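{- Let $n$ be even and $d$ a positive integer, and let $H \sim \mathcal{G}_{\mathrm{reg}}(n,d)$, with every edge of $H$ given weight $(n-1)/d$. Then with probability $1-o_n(1)$, $H$ is an $\epsilon$ cut sparsifier of the (unweighted) complete graph $K_n$ on the same vertex set, with \[ \epsilon \le \frac{2\sqrt{2/\pi} + o_{n,d}(1)}{\sqrt d}, \qquad 2\sqrt{2/\pi} = 1.595\ldots \]
   Context: $\mathcal{G}_{\mathrm{reg}}(n,d)$ ($n$ even) is the distribution of the $d$-regular multigraph on vertex set $[n]$ obtained as the disjoint union of $d$ independent uniformly random perfect matchings of $[n]$. For a weighted graph $G=(V,E,w)$ and $S\subseteq V$, $\mathrm{cut}_G(S)$ is the total weight of edges with exactly one endpoint in $S$. A weighted graph $H$ on $V$ is an $\epsilon$ cut sparsifier of $G$ if for all $S\subseteq V$: $(1-\epsilon)\mathrm{cut}_G(S)\le \mathrm{cut}_H(S)\le(1+\epsilon)\mathrm{cut}_G(S)$. The notation $o_{n,d}(1)$ denotes an error term such that after taking the limit $n\to\infty$ one obtains an expression depending only on $d$, which tends to $0$ as $d\to\infty$. -}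

module Defs where

open import Data.Bool using (Bool; true; false; _∧_; not; if_then_else_)
open import Data.Nat as ℕ using (ℕ; zero; suc)
open import Data.Integer using (ℤ; +_; -[1+_])
open import Data.Fin using (Fin; _≟_)
open import Data.Fin.Subset using (Subset)
open import Data.Vec using (Vec; []; _∷_; lookup)
open import Data.List using (List; []; _∷_; concatMap; map; length; filterᵇ; allFin; foldr; upTo)
open import Relation.Nullary.Decidable using (⌊_⌋; does)
open import Data.Rational using (ℚ; 0ℚ; _+_; _*_; _-_; _/_; _≤ᵇ_)

vecsOver : {A : Set} → List A → (k : ℕ) → List (Vec A k)
vecsOver xs zero    = [] ∷ []
vecsOver xs (suc k) = concatMap (λ x → map (x ∷_) (vecsOver xs k)) xs

allB : {A : Set} → (A → Bool) → List A → Bool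
allB p = foldr (λ x b → p x ∧ b) true

countB : {A : Set} → (A → Bool) → List A → ℕ
countB p xs = length (filterᵇ p xs)

sumℚ : List ℚ → ℚ
sumℚ = foldr _+_ 0ℚ

ℕtoℚ : ℕ → ℚ
ℕtoℚ m = (+ m) / 1

-- Perfect matchings of [n] = Fin n, as fixed-point-free involutions
-- (represented by their table Vec (Fin n) n).

Matching : ℕ → Set
Matching n = Vec (Fin n) n

isPerfectMatching : {n : ℕ} → Matching n → Bool
isPerfectMatching {n} m =
  allB (λ i → ⌊ lookup m (lookup m i) ≟ i ⌋ ∧ not ⌊ lookup m i ≟ i ⌋) (allFin n)

perfectMatchings : (n : ℕ) → List (Matching n)
perfectMatchings n = filterᵇ isPerfectMatching (vecsOver (allFin n) n)

-- sample space of G_reg(n,d): d-tuples of independent uniform perfect matchings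
-- (uniform measure on this list)
regSamples : (n d : ℕ) → List (Vec (Matching n) d)
regSamples n d = vecsOver (perfectMatchings n) d

-- probability of a (decidable) event under the uniform measure on a finite list
-- (defined as 0 on an empty sample space, which does not occur for n even)
probability : {A : Set} → (A → Bool) → List A → ℚ
probability {A} p xs = go (countB p xs) (length xs)
  where
  go : ℕ → ℕ → ℚ
  go good zero      = 0ℚ
  go good (suc tot) = (+ good) / suc tot

allSubsets : (n : ℕ) → List (Subset n)
allSubsets n = vecsOver (true ∷ false ∷ []) n

crosses : {n : ℕ} → Subset n → Fin n → Fin n → Bool
crosses S i j = lookup S i ∧ not (lookup S j)

indℚ : Bool → ℚ
indℚ b = if b then ℕtoℚ 1 else 0ℚ

-- cut of the unweighted complete graph K_n: edges {i,j} with exactly one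
-- endpoint in S, each counted once via its endpoint in S
cutK : (n : ℕ) → Subset n → ℚ
cutK n S = sumℚ (map (λ i → sumℚ (map (λ j → indℚ (crosses S i j)) (allFin n))) (allFin n))

-- cut of the multigraph H = union of the matchings in M, every edge of weight w;
-- the edge {i, m i} of matching m crosses iff exactly one endpoint is in S,
-- counted once via its endpoint in S (parallel edges counted with multiplicity)
cutH : {n d : ℕ} → ℚ → Vec (Matching n) d → Subset n → ℚ
cutH {n} {d} w M S =
  w * sumℚ (map (λ k → let m = lookup M k in
                   sumℚ (map (λ i → indℚ (crosses S i (lookup m i))) (allFin n)))
                (allFin d))

edgeWeight : (n d : ℕ) → .{{_ : ℕ.NonZero d}} → ℚ
edgeWeight n d = (+ (n ℕ.∸ 1)) / d

-- "H is an ε cut sparsifier of K_n" for ε = q / √d (q ≥ 0), i.e.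
--   ∀ S, (1-ε) cutK S ≤ cutH S ≤ (1+ε) cutK S
--   ⇔ ∀ S, |cutH S - cutK S| ≤ (q/√d) cutK S
--   ⇔ ∀ S, d (cutH S - cutK S)² ≤ q² (cutK S)²     (both sides ≥ 0)
-- The squared form avoids the irrational √d.
isSparsifierScaledB : (n d : ℕ) → .{{_ : ℕ.NonZero d}} → (q : ℚ) → Vec (Matching n) d → Bool
isSparsifierScaledB n d q M =
  allB (λ S → let δ = cutH (edgeWeight n d) M S - cutK n S in
              (ℕtoℚ d * (δ * δ)) ≤ᵇ (q * q * (cutK n S * cutK n S)))
       (allSubsets n)

-- π via Leibniz series.  leibnizLower k = 4 Σ_{i<2k} (-1)^i/(2i+1);
-- these are strictly increasing lower bounds converging to π, hence for
-- rational x:  x < π  ⇔  ∃ k, x < leibnizLower k.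

leibnizTerm : ℕ → ℚ
leibnizTerm i = (+ 1) / (1 ℕ.+ 2 ℕ.* (2 ℕ.* i)) - (+ 1) / (3 ℕ.+ 2 ℕ.* (2 ℕ.* i))

leibnizLower : ℕ → ℚ
leibnizLower k = ℕtoℚ 4 * sumℚ (map leibnizTerm (upTo k))

-- Suppose some cut of H deviates too much and take an extremal one. It is locally
-- optimal: moving a single vertex across does not increase the deviation, so the
-- number of crossing edges at every vertex obeys a one-sided bound. The expected
-- number of cuts that are both bad and locally optimal is then estimated: tilting the
-- matchings exponentially towards the deviation decouples the vertices into
-- independent binomial rows, and the local constraint gains a fixed factor in every
-- row, which together with the tilt beats the number of subsets. The tilted count of
-- matchings with prescribed types is dominated by a finite grid of product weights.
-- Densities are treated in windows; very small sets are excluded by bounding the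
-- exponential moment of the number of edges inside the set.
{-# OPTIONS --safe #-}
module Submission where

-- A plain union bound over cuts stops at 2√(ln 2) = 1.665..., above the target 1.5957...; the
-- factor gained in the rows has to close this gap. It does so with something to spare: everything
-- runs with the single value 1.595 < 2√(2/π), so the error term is absorbed by the difference and
-- the bound on d does not depend on q. Numerically, at balanced cuts a row contributes 0.8464 to
-- the squared probability and the tilt about exp(-1.2285); the product lies just below 1/4, the
-- square of one over the two choices per vertex. Squares appear because the number of matchings
-- with a prescribed crossing pattern is bounded by the square root of a product measure. Square
-- roots of Bernoulli weights are cosines and sines of an angle, and a discrete rotation supplies
-- such points without irrational numbers. In the same spirit powers of 1 + 1/M replace the
-- exponential function, and integer tables evaluated during type checking replace the normal
-- distribution function.

open import Data.Nat as ℕ using (ℕ; zero; suc)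
import Data.Nat.Properties as ℕP
open import Data.Integer as ℤ using (ℤ)
import Data.Integer.Properties as ℤP
open import Data.Rational as ℚ using (ℚ; 0ℚ; 1ℚ; _+_; _*_; _-_; -_; _≤_; _<_; _/_; NonNegative; nonNegative; Positive; positive; ↥_; ↧_)
import Data.Rational.Properties as ℚP
import Data.Rational.Unnormalised as ℚᵘ
import Data.Rational.Unnormalised.Properties as ℚᵘP
open import Data.List using (List; []; _∷_; map; foldr; _++_; concatMap; length; filterᵇ)
open import Data.Bool using (Bool; true; false; if_then_else_; _∧_; not; T)
open import Data.Product using (_×_; _,_; Σ; ∃; ∃-syntax)
open import Data.Sum using (_⊎_; inj₁; inj₂)
open import Data.Empty using (⊥; ⊥-elim)
open import Data.Unit using (⊤; tt)
open import Relation.Nullary using (¬_; Dec; yes; no)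
open import Relation.Nullary.Decidable using (toWitness; True)
open import Relation.Binary.PropositionalEquality using (_≡_; _≢_; refl; sym; trans; cong; cong₂; subst; subst₂; module ≡-Reasoning)
open import Defs
import Data.Nat.DivMod as ℕD
open import Data.Fin using (Fin)
import Data.Fin as Fin
import Data.Fin.Properties as FinP
open import Data.Vec as Vec using (Vec; []; _∷_; lookup)
import Data.Vec.Properties as VecP
open import Data.List using (allFin; upTo; tabulate)
open import Data.List.Membership.Propositional using (_∈_; _∉_)
import Data.List.Membership.Propositional.Properties as ∈P
open import Data.List.Relation.Unary.Any using (here; there)
open import Data.List.Relation.Unary.All as All using (All; []; _∷_)
import Data.List.Relation.Unary.All.Properties as AllP
open import Data.List.Relation.Unary.Unique.Propositional using (Unique)
open import Data.List.Relation.Unary.AllPairs using ([]; _∷_)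
import Data.List.Relation.Unary.Unique.Propositional.Properties as UniqueP
open import Relation.Nullary.Decidable using (⌊_⌋)
open import Function using (_∘_)
import Data.List.Properties as LP
open ℚP using () renaming (*-identityʳ to *-1ʳ; *-identityˡ to *-1ˡ; +-monoʳ-≤ to +-≤ʳ; +-monoˡ-≤ to +-≤ˡ; <-≤-trans to <-≤; +-identityʳ to +-0ʳ; +-identityˡ to +-0ˡ; *-assoc to *-as; *-comm to *-cm; +-comm to +-cm; +-assoc to +-as; positive⁻¹ to >0; *-zeroˡ to *-0ˡ; *-zeroʳ to *-0ʳ; ≤-total to ≤-tot; +-inverseʳ to +-inv)
open ℚP using (≰⇒>)
open ℕP using () renaming (≤-trans to ≤≤; ≤-reflexive to ≤≡; <⇒≤ to <≤; n≤1+n to n≤sn; ≤-refl to ≤r; +-identityʳ to n+0; *-comm to *-cmℕ; +-comm to +-cmℕ; m+[n∸m]≡n to m+[n∸m]; +-monoʳ-≤ to +-≤ℕ; m≤n⇒m≤1+n to ≤⇒≤s)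
open ℕP using (+-suc; m≤m+n; ≤-pred; m≤n+m)
open import Data.Rational using () renaming (1ℚ to 1q; 0ℚ to 0q)
open import Data.Nat using () renaming (_*_ to _*'_; _+_ to _+'_; _≤_ to _<=_; _<_ to _≺_)
open import Data.Fin using () renaming (zero to fz; suc to fs)
open ℚP using () renaming (neg-antimono-≤ to neg≤)
open ℕP using () renaming (suc-injective to suc-inj)
open import Relation.Binary.PropositionalEquality using () renaming (cong₂ to ap₂)
open import Relation.Binary.PropositionalEquality using () renaming (cong to ap)
open import Data.Product using () renaming (proj₁ to fst)
open import Data.Product using () renaming (proj₂ to snd)

-- A normalisation-based decision procedure for polynomial identities over ℚ.
infixl 6 _:+_ _:-_
infixl 7 _:*_ _:/_
infix 8 :-_
data Expr : Set where
 con : ℚ -> Expr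
 var : ℕ -> Expr
 _:+_ _:*_ _:-_ : Expr -> Expr -> Expr
 :-_ : Expr -> Expr

_:/_ : ℕ -> (b : ℕ) -> .{{_ : ℕ.NonZero b}} -> Expr
a :/ b = con ((ℤ.+ a) / b)

:0 :1 :2 :3 :4 :8 :16 :½ v0 v1 v2 v3 v4 v5 v6 v7 v8 v9 v10 v11 : Expr
:0 = con 0q
:1 = con 1q
:2 = 2 :/ 1
:3 = 3 :/ 1
:4 = 4 :/ 1
:8 = 8 :/ 1
:16 = 16 :/ 1
:½ = 1 :/ 2
v0 = var 0
v1 = var 1
v2 = var 2
v3 = var 3
v4 = var 4
v5 = var 5
v6 = var 6
v7 = var 7
v8 = var 8
v9 = var 9
v10 = var 10
v11 = var 11

look : ∀ {n} -> ℕ -> Vec ℚ n -> ℚ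
look k [] = 0q
look zero (x ∷ ρ) = x
look (suc k) (x ∷ ρ) = look k ρ

⟦_⟧ : Expr -> ∀ {n} -> Vec ℚ n -> ℚ
⟦ con c ⟧ ρ = c
⟦ var k ⟧ ρ = look k ρ
⟦ a :+ b ⟧ ρ = ⟦ a ⟧ ρ + ⟦ b ⟧ ρ
⟦ a :* b ⟧ ρ = ⟦ a ⟧ ρ * ⟦ b ⟧ ρ
⟦ a :- b ⟧ ρ = ⟦ a ⟧ ρ - ⟦ b ⟧ ρ
⟦ :- a ⟧ ρ = - ⟦ a ⟧ ρ

-- Horner form: coefficients are polynomials in the remaining variables.
Poly : ℕ -> Set
Poly zero = ℚ
Poly (suc n) = List (Poly n)

ev : ∀ n -> Poly n -> Vec ℚ n -> ℚ
ev zero c ρ = c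
ev (suc n) [] ρ = 0q
ev (suc n) (p ∷ ps) (x ∷ ρ) = ev n p ρ + x * ev (suc n) ps (x ∷ ρ)

conP : ∀ n -> ℚ -> Poly n
conP zero c = c
conP (suc n) c = conP n c ∷ []

varP : ∀ n -> ℕ -> Poly n
varP zero k = 0q
varP (suc n) zero = conP n 0q ∷ conP n 1q ∷ []
varP (suc n) (suc k) = varP n k ∷ []

addP mulP : ∀ n -> Poly n -> Poly n -> Poly n
addP zero a b = a + b
addP (suc n) [] qs = qs
addP (suc n) (p ∷ ps) [] = p ∷ ps
addP (suc n) (p ∷ ps) (q ∷ qs) = addP n p q ∷ addP (suc n) ps qs

scaleP : ∀ n -> Poly n -> Poly (suc n) -> Poly (suc n)
scaleP n p [] = []
scaleP n p (q ∷ qs) = mulP n p q ∷ scaleP n p qs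
mulP zero a b = a * b
mulP (suc n) [] qs = []
mulP (suc n) (p ∷ ps) qs = addP (suc n) (scaleP n p qs) (conP n 0q ∷ mulP (suc n) ps qs)

nf : ∀ n -> Expr -> Poly n
nf n (con c) = conP n c
nf n (var k) = varP n k
nf n (a :+ b) = addP n (nf n a) (nf n b)
nf n (a :* b) = mulP n (nf n a) (nf n b)
nf n (a :- b) = addP n (nf n a) (mulP n (conP n (- 1q)) (nf n b))
nf n (:- a) = mulP n (conP n (- 1q)) (nf n a)

zP : ∀ n -> Poly n -> Bool
zP zero c = ⌊ c ℚ.≟ 0q ⌋
zP (suc n) [] = true
zP (suc n) (p ∷ ps) = zP n p ∧ zP (suc n) ps

private
 infixr 2 _>>_
 _>>_ : ∀ {A : Set} {a b c : A} -> a ≡ b -> b ≡ c -> a ≡ c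
 _>>_ = trans
 interchange : ∀ a b c e -> a + b + (c + e) ≡ a + c + (b + e)
 interchange a b c e = +-as a b (c + e) >> ap (a +_) (sym (+-as b c e) >> ap (_+ e) (+-cm b c) >> +-as c b e) >> sym (+-as a c (b + e))

 eh : ∀ n c ρ -> ev n (conP n c) ρ ≡ c
 eh zero c ρ = refl
 eh (suc n) c (x ∷ ρ) = ap₂ _+_ (eh n c ρ) (*-0ʳ x) >> +-0ʳ c

 ev-var : ∀ n k ρ -> ev n (varP n k) ρ ≡ look k ρ
 ev-var zero k [] = refl
 ev-var (suc n) zero (x ∷ ρ) = ap₂ (\ a b -> a + x * b) (eh n 0q ρ) (ap₂ _+_ (eh n 1q ρ) (*-0ʳ x) >> +-0ʳ 1q) >> +-0ˡ (x * 1q) >> *-1ʳ x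
 ev-var (suc n) (suc k) (x ∷ ρ) = ap₂ _+_ (ev-var n k ρ) (*-0ʳ x) >> +-0ʳ (look k ρ)

 eg : ∀ n p q ρ -> ev n (addP n p q) ρ ≡ ev n p ρ + ev n q ρ
 eg zero p q ρ = refl
 eg (suc n) [] q ρ = sym (+-0ˡ (ev (suc n) q ρ))
 eg (suc n) (p ∷ ps) [] ρ = sym (+-0ʳ (ev (suc n) (p ∷ ps) ρ))
 eg (suc n) (p ∷ ps) (q ∷ qs) (x ∷ ρ) = ap₂ (\ a b -> a + x * b) (eg n p q ρ) (eg (suc n) ps qs (x ∷ ρ))
  >> ap (ev n p ρ + ev n q ρ +_) (ℚP.*-distribˡ-+ x (ev (suc n) ps (x ∷ ρ)) (ev (suc n) qs (x ∷ ρ))) >> interchange (ev n p ρ) (ev n q ρ) (x * ev (suc n) ps (x ∷ ρ)) (x * ev (suc n) qs (x ∷ ρ))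

 ev-mul : ∀ n p q ρ -> ev n (mulP n p q) ρ ≡ ev n p ρ * ev n q ρ
 ev-scale : ∀ n p qs x ρ -> ev (suc n) (scaleP n p qs) (x ∷ ρ) ≡ ev n p ρ * ev (suc n) qs (x ∷ ρ)
 ev-scale n p [] x ρ = sym (*-0ʳ (ev n p ρ))
 ev-scale n p (q ∷ qs) x ρ = ap₂ (\ a b -> a + x * b) (ev-mul n p q ρ) (ev-scale n p qs x ρ)
  >> ap (P * ev n q ρ +_) (sym (*-as x P Q) >> ap (_* Q) (*-cm x P) >> *-as P x Q) >> sym (ℚP.*-distribˡ-+ P (ev n q ρ) (x * Q))
  where
  P = ev n p ρ
  Q = ev (suc n) qs (x ∷ ρ)
 ev-mul zero p q ρ = refl
 ev-mul (suc n) [] q (x ∷ ρ) = sym (*-0ˡ (ev (suc n) q (x ∷ ρ)))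
 ev-mul (suc n) (p ∷ ps) q (x ∷ ρ) = eg (suc n) (scaleP n p q) (conP n 0q ∷ mulP (suc n) ps q) (x ∷ ρ)
  >> ap₂ _+_ (ev-scale n p q x ρ) (ap₂ (\ a b -> a + x * b) (eh n 0q ρ) (ev-mul (suc n) ps q (x ∷ ρ)) >> +-0ˡ (x * (PS * Q)) >> sym (*-as x PS Q))
  >> sym (ℚP.*-distribʳ-+ Q (ev n p ρ) (x * PS))
  where
  PS = ev (suc n) ps (x ∷ ρ)
  Q = ev (suc n) q (x ∷ ρ)

 ef : ∀ n e ρ -> ev n (nf n e) ρ ≡ ⟦ e ⟧ ρ
 ev-neg : ∀ n e ρ -> ev n (mulP n (conP n (- 1q)) (nf n e)) ρ ≡ - ⟦ e ⟧ ρ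
 ef n (con c) ρ = eh n c ρ
 ef n (var k) ρ = ev-var n k ρ
 ef n (a :+ b) ρ = eg n (nf n a) (nf n b) ρ >> ap₂ _+_ (ef n a ρ) (ef n b ρ)
 ef n (a :* b) ρ = ev-mul n (nf n a) (nf n b) ρ >> ap₂ _*_ (ef n a ρ) (ef n b ρ)
 ef n (a :- b) ρ = eg n (nf n a) (mulP n (conP n (- 1q)) (nf n b)) ρ >> ap₂ _+_ (ef n a ρ) (ev-neg n b ρ)
 ef n (:- a) ρ = ev-neg n a ρ
 ev-neg n e ρ = ev-mul n (conP n (- 1q)) (nf n e) ρ >> ap₂ _*_ (eh n (- 1q) ρ) (ef n e ρ) >> sym (ℚP.neg-distribˡ-* 1q (⟦ e ⟧ ρ)) >> ap -_ (*-1ˡ (⟦ e ⟧ ρ))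

 ev-zero : ∀ n p ρ -> zP n p ≡ true -> ev n p ρ ≡ 0q
 ev-zero zero p ρ h with p ℚ.≟ 0q
 ... | yes e = e
 ev-zero (suc n) [] ρ h = refl
 ev-zero (suc n) (p ∷ ps) (x ∷ ρ) h with zP n p in ep
 ... | true = ap₂ (\ a b -> a + x * b) (ev-zero n p ρ ep) (ev-zero (suc n) ps (x ∷ ρ) h) >> +-0ˡ (x * 0q) >> *-0ʳ x

pM : ∀ n (a b : Expr) -> zP n (nf n (a :- b)) ≡ true -> ∀ (ρ : Vec ℚ n) -> ⟦ a ⟧ ρ ≡ ⟦ b ⟧ ρ
pM n a b h ρ = sym (+-0ʳ (⟦ a ⟧ ρ)) >> ap (⟦ a ⟧ ρ +_) (sym (ℚP.+-inverseˡ (⟦ b ⟧ ρ))) >> sym (+-as (⟦ a ⟧ ρ) (- ⟦ b ⟧ ρ) (⟦ b ⟧ ρ))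
 >> ap (_+ ⟦ b ⟧ ρ) (sym (ef n (a :- b) ρ) >> ev-zero n (nf n (a :- b)) ρ h) >> +-0ˡ (⟦ b ⟧ ρ)

Tr : ∀ {b} -> T b -> b ≡ true
Tr {true} _ = refl

r1 : ∀ a b {_ : T (zP 1 (nf 1 (a :- b)))} x0 -> ⟦ a ⟧ (x0 ∷ []) ≡ ⟦ b ⟧ (x0 ∷ [])
r1 a b {t} x0 = pM 1 a b (Tr t) (x0 ∷ [])
r2 : ∀ a b {_ : T (zP 2 (nf 2 (a :- b)))} x0 x1 -> ⟦ a ⟧ (x0 ∷ x1 ∷ []) ≡ ⟦ b ⟧ (x0 ∷ x1 ∷ [])
r2 a b {t} x0 x1 = pM 2 a b (Tr t) (x0 ∷ x1 ∷ [])
r3 : ∀ a b {_ : T (zP 3 (nf 3 (a :- b)))} x0 x1 x2 -> ⟦ a ⟧ (x0 ∷ x1 ∷ x2 ∷ []) ≡ ⟦ b ⟧ (x0 ∷ x1 ∷ x2 ∷ [])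
r3 a b {t} x0 x1 x2 = pM 3 a b (Tr t) (x0 ∷ x1 ∷ x2 ∷ [])
r4 : ∀ a b {_ : T (zP 4 (nf 4 (a :- b)))} x0 x1 x2 x3 -> ⟦ a ⟧ (x0 ∷ x1 ∷ x2 ∷ x3 ∷ []) ≡ ⟦ b ⟧ (x0 ∷ x1 ∷ x2 ∷ x3 ∷ [])
r4 a b {t} x0 x1 x2 x3 = pM 4 a b (Tr t) (x0 ∷ x1 ∷ x2 ∷ x3 ∷ [])
r5 : ∀ a b {_ : T (zP 5 (nf 5 (a :- b)))} x0 x1 x2 x3 x4 -> ⟦ a ⟧ (x0 ∷ x1 ∷ x2 ∷ x3 ∷ x4 ∷ []) ≡ ⟦ b ⟧ (x0 ∷ x1 ∷ x2 ∷ x3 ∷ x4 ∷ [])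
r5 a b {t} x0 x1 x2 x3 x4 = pM 5 a b (Tr t) (x0 ∷ x1 ∷ x2 ∷ x3 ∷ x4 ∷ [])
r6 : ∀ a b {_ : T (zP 6 (nf 6 (a :- b)))} x0 x1 x2 x3 x4 x5 -> ⟦ a ⟧ (x0 ∷ x1 ∷ x2 ∷ x3 ∷ x4 ∷ x5 ∷ []) ≡ ⟦ b ⟧ (x0 ∷ x1 ∷ x2 ∷ x3 ∷ x4 ∷ x5 ∷ [])
r6 a b {t} x0 x1 x2 x3 x4 x5 = pM 6 a b (Tr t) (x0 ∷ x1 ∷ x2 ∷ x3 ∷ x4 ∷ x5 ∷ [])
r7 : ∀ a b {_ : T (zP 7 (nf 7 (a :- b)))} x0 x1 x2 x3 x4 x5 x6 -> ⟦ a ⟧ (x0 ∷ x1 ∷ x2 ∷ x3 ∷ x4 ∷ x5 ∷ x6 ∷ []) ≡ ⟦ b ⟧ (x0 ∷ x1 ∷ x2 ∷ x3 ∷ x4 ∷ x5 ∷ x6 ∷ [])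
r7 a b {t} x0 x1 x2 x3 x4 x5 x6 = pM 7 a b (Tr t) (x0 ∷ x1 ∷ x2 ∷ x3 ∷ x4 ∷ x5 ∷ x6 ∷ [])
r8 : ∀ a b {_ : T (zP 8 (nf 8 (a :- b)))} x0 x1 x2 x3 x4 x5 x6 x7 -> ⟦ a ⟧ (x0 ∷ x1 ∷ x2 ∷ x3 ∷ x4 ∷ x5 ∷ x6 ∷ x7 ∷ []) ≡ ⟦ b ⟧ (x0 ∷ x1 ∷ x2 ∷ x3 ∷ x4 ∷ x5 ∷ x6 ∷ x7 ∷ [])
r8 a b {t} x0 x1 x2 x3 x4 x5 x6 x7 = pM 8 a b (Tr t) (x0 ∷ x1 ∷ x2 ∷ x3 ∷ x4 ∷ x5 ∷ x6 ∷ x7 ∷ [])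
r9 : ∀ a b {_ : T (zP 9 (nf 9 (a :- b)))} x0 x1 x2 x3 x4 x5 x6 x7 x8 -> ⟦ a ⟧ (x0 ∷ x1 ∷ x2 ∷ x3 ∷ x4 ∷ x5 ∷ x6 ∷ x7 ∷ x8 ∷ []) ≡ ⟦ b ⟧ (x0 ∷ x1 ∷ x2 ∷ x3 ∷ x4 ∷ x5 ∷ x6 ∷ x7 ∷ x8 ∷ [])
r9 a b {t} x0 x1 x2 x3 x4 x5 x6 x7 x8 = pM 9 a b (Tr t) (x0 ∷ x1 ∷ x2 ∷ x3 ∷ x4 ∷ x5 ∷ x6 ∷ x7 ∷ x8 ∷ [])
r10 : ∀ a b {_ : T (zP 10 (nf 10 (a :- b)))} x0 x1 x2 x3 x4 x5 x6 x7 x8 x9 -> ⟦ a ⟧ (x0 ∷ x1 ∷ x2 ∷ x3 ∷ x4 ∷ x5 ∷ x6 ∷ x7 ∷ x8 ∷ x9 ∷ []) ≡ ⟦ b ⟧ (x0 ∷ x1 ∷ x2 ∷ x3 ∷ x4 ∷ x5 ∷ x6 ∷ x7 ∷ x8 ∷ x9 ∷ [])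
r10 a b {t} x0 x1 x2 x3 x4 x5 x6 x7 x8 x9 = pM 10 a b (Tr t) (x0 ∷ x1 ∷ x2 ∷ x3 ∷ x4 ∷ x5 ∷ x6 ∷ x7 ∷ x8 ∷ x9 ∷ [])
r11 : ∀ a b {_ : T (zP 11 (nf 11 (a :- b)))} x0 x1 x2 x3 x4 x5 x6 x7 x8 x9 x10 -> ⟦ a ⟧ (x0 ∷ x1 ∷ x2 ∷ x3 ∷ x4 ∷ x5 ∷ x6 ∷ x7 ∷ x8 ∷ x9 ∷ x10 ∷ []) ≡ ⟦ b ⟧ (x0 ∷ x1 ∷ x2 ∷ x3 ∷ x4 ∷ x5 ∷ x6 ∷ x7 ∷ x8 ∷ x9 ∷ x10 ∷ [])
r11 a b {t} x0 x1 x2 x3 x4 x5 x6 x7 x8 x9 x10 = pM 11 a b (Tr t) (x0 ∷ x1 ∷ x2 ∷ x3 ∷ x4 ∷ x5 ∷ x6 ∷ x7 ∷ x8 ∷ x9 ∷ x10 ∷ [])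
r12 : ∀ a b {_ : T (zP 12 (nf 12 (a :- b)))} x0 x1 x2 x3 x4 x5 x6 x7 x8 x9 x10 x11 -> ⟦ a ⟧ (x0 ∷ x1 ∷ x2 ∷ x3 ∷ x4 ∷ x5 ∷ x6 ∷ x7 ∷ x8 ∷ x9 ∷ x10 ∷ x11 ∷ []) ≡ ⟦ b ⟧ (x0 ∷ x1 ∷ x2 ∷ x3 ∷ x4 ∷ x5 ∷ x6 ∷ x7 ∷ x8 ∷ x9 ∷ x10 ∷ x11 ∷ [])
r12 a b {t} x0 x1 x2 x3 x4 x5 x6 x7 x8 x9 x10 x11 = pM 12 a b (Tr t) (x0 ∷ x1 ∷ x2 ∷ x3 ∷ x4 ∷ x5 ∷ x6 ∷ x7 ∷ x8 ∷ x9 ∷ x10 ∷ x11 ∷ [])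

-- Naturals as rationals, and ordered-field arithmetic.

infixl 7 _//_
_//_ : ℕ -> (b : ℕ) -> .{{_ : ℕ.NonZero b}} -> ℚ
a // b = (ℤ.+ a) / b

-- Opaque, so that conversion checking does not unfold `ι` of a numeral into a normalised fraction;
-- the arithmetic facts that follow serve as its interface.
opaque
 ι : ℕ -> ℚ
 ι = ℕtoℚ

 ι-def : ∀ m -> ι m ≡ ℕtoℚ m
 ι-def m = refl

 ta : ∀ m -> ℚ.toℚᵘ (ι m) ℚᵘ.≃ ℚᵘ.mkℚᵘ (ℤ.+ m) 0
 ta m = ℚP.toℚᵘ-fromℚᵘ (ℚᵘ.mkℚᵘ (ℤ.+ m) 0)

ι0 : ι 0 ≡ 0q
ι0 = ι-def 0

ι1 : ι 1 ≡ 1q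
ι1 = ι-def 1

zq : ∀ m n -> ι (m +' n) ≡ ι m + ι n
zq m n = ℚP.toℚᵘ-injective (begin
 ℚ.toℚᵘ (ι (m +' n))                           ≈⟨ ta (m +' n) ⟩
 ℚᵘ.mkℚᵘ (ℤ.+ (m +' n)) 0                          ≈⟨ ℚᵘ.*≡* (ap (ℤ._* ℤ.+ 1) (ℤP.pos-+ m n >> sym (ap₂ ℤ._+_ (ℤP.*-identityʳ (ℤ.+ m)) (ℤP.*-identityʳ (ℤ.+ n))))) ⟩
 ℚᵘ.mkℚᵘ (ℤ.+ m) 0 ℚᵘ.+ ℚᵘ.mkℚᵘ (ℤ.+ n) 0             ≈⟨ ℚᵘP.+-cong (ta m) (ta n) ⟨
 ℚ.toℚᵘ (ι m) ℚᵘ.+ ℚ.toℚᵘ (ι n)                   ≈⟨ ℚP.toℚᵘ-homo-+ (ι m) (ι n) ⟨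
 ℚ.toℚᵘ (ι m + ι n)                               ∎)
 where open ℚᵘP.≃-Reasoning

zn : ∀ m n -> ι (m *' n) ≡ ι m * ι n
zn m n = ℚP.toℚᵘ-injective (begin
 ℚ.toℚᵘ (ι (m *' n))                           ≈⟨ ta (m *' n) ⟩
 ℚᵘ.mkℚᵘ (ℤ.+ (m *' n)) 0                          ≈⟨ ℚᵘ.*≡* (ap (ℤ._* ℤ.+ 1) (ℤP.pos-* m n)) ⟩
 ℚᵘ.mkℚᵘ (ℤ.+ m) 0 ℚᵘ.* ℚᵘ.mkℚᵘ (ℤ.+ n) 0             ≈⟨ ℚᵘP.*-cong (ta m) (ta n) ⟨
 ℚ.toℚᵘ (ι m) ℚᵘ.* ℚ.toℚᵘ (ι n)                   ≈⟨ ℚP.toℚᵘ-homo-* (ι m) (ι n) ⟨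
 ℚ.toℚᵘ (ι m * ι n)                               ∎)
 where open ℚᵘP.≃-Reasoning

mn : ∀ {m n} -> m <= n -> ι m ≤ ι n
mn {m} {n} p = ℚP.toℚᵘ-cancel-≤ (ℚᵘP.≤-respʳ-≃ (ℚᵘP.≃-sym (ta n)) (ℚᵘP.≤-respˡ-≃ (ℚᵘP.≃-sym (ta m))
 (ℚᵘ.*≤* (ℤP.*-monoʳ-≤-nonNeg (ℤ.+ 1) (ℤ.+≤+ p)))))

cf : ∀ {m n} -> ι m ≤ ι n -> m <= n
cf {m} {n} p with ℚᵘP.≤-respʳ-≃ (ta n) (ℚᵘP.≤-respˡ-≃ (ta m) (ℚP.toℚᵘ-mono-≤ p))
... | ℚᵘ.*≤* q with subst₂' (ℤP.*-identityʳ (ℤ.+ m)) (ℤP.*-identityʳ (ℤ.+ n)) q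
 where
 subst₂' : ∀ {a b c e : ℤ} -> a ≡ b -> c ≡ e -> a ℤ.≤ c -> b ℤ.≤ e
 subst₂' refl refl x = x
... | ℤ.+≤+ r = r

≤ι : {m n : ℕ} {{_ : True (m ℕ.≤? n)}} -> ι m ≤ ι n
≤ι {{t}} = mn (toWitness t)

zx : ∀ m -> 1q ≤ ι (suc m)
zx m = subst (_≤ ι (suc m)) ι1 (mn {1} {suc m} (ℕ.s≤s ℕ.z≤n))

su : ∀ m -> ι (suc m) ≡ 1q + ι m
su m = trans (zq 1 m) (ap (_+ ι m) ι1)

zd : ∀ m -> 0q ≤ ι m
zd m = subst (_≤ ι m) ι0 (mn {0} {m} ℕ.z≤n)

by : ∀ {p q : ℚ} {t : T (p ℚ.≤ᵇ q)} -> p ≤ q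
by {t = t} = ℚP.≤ᵇ⇒≤ t

≤-refl : ∀ {a} -> a ≤ a
≤-refl = ℚP.≤-refl

EQ : ∀ {a b : ℚ} -> a ≡ b -> a ≤ b
EQ refl = ℚP.≤-refl

infixr 4 _~_
_~_ : ∀ {a b c} -> a ≤ b -> b ≤ c -> a ≤ c
_~_ = ℚP.≤-trans

mb : ∀ {a b c e} -> a ≤ b -> c ≤ e -> a + c ≤ b + e
mb = ℚP.+-mono-≤

nh : ∀ {a b} -> 0q ≤ a -> 0q ≤ b -> 0q ≤ a + b
nh = ℚP.+-mono-≤

za : ∀ {a b c} -> 0q ≤ c -> a ≤ b -> c * a ≤ c * b
za {c = c} p q = ℚP.*-monoˡ-≤-nonNeg c {{nonNegative p}} q

zb : ∀ {a b c} -> 0q ≤ c -> a ≤ b -> a * c ≤ b * c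
zb {c = c} p q = ℚP.*-monoʳ-≤-nonNeg c {{nonNegative p}} q

nc : ∀ {a b} -> 0q ≤ a -> 0q ≤ b -> 0q ≤ a * b
nc {a} {b} p q = EQ (sym (*-0ˡ b)) ~ zb q p

ma : ∀ {a b c e} -> 0q ≤ a -> 0q ≤ c -> a ≤ b -> c ≤ e -> a * c ≤ b * e
ma pa pc p q = zb pc p ~ za (pa ~ p) q

ba : ∀ {a b c} -> 0q ≤ c -> b ≡ a + c -> a ≤ b
ba {a} {b} {c} p refl = EQ (sym (+-0ʳ a)) ~ +-≤ʳ a p

df : ∀ {a b} -> a ≤ b -> 0q ≤ b - a
df {a} {b} p = EQ (sym (+-inv a)) ~ +-≤ˡ (- a) p

nj : ∀ {a b} -> 0q ≤ b - a -> a ≤ b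
nj {a} {b} p = ba p (lem a b)
 where lem = r2 v1 (v0 :+ (v1 :- v0))

sn : ∀ a -> 0q ≤ a * a
sn a with ≤-tot 0q a
... | inj₁ p = nc p p
... | inj₂ p = nc (neg p) (neg p) ~ EQ (lem a)
 where
 neg : ∀ {a} -> a ≤ 0q -> 0q ≤ - a
 neg {a} q = df q ~ EQ (+-0ˡ (- a))
 lem = r1 ((:- v0) :* (:- v0)) (v0 :* v0)

infixr 8 _^_
_^_ : ℚ -> ℕ -> ℚ
x ^ zero = 1q
x ^ suc n = x * x ^ n

ze : 0q ≤ 1q
ze = by

ng : ∀ {x} n -> 0q ≤ x -> 0q ≤ x ^ n
ng zero p = ze
ng (suc n) p = nc p (ng n p)

mc : ∀ {x y} n -> 0q ≤ x -> x ≤ y -> x ^ n ≤ y ^ n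
mc zero p q = ≤-refl
mc (suc n) p q = ma p (ng n p) q (mc n p q)

zr : ∀ x m n -> x ^ (m +' n) ≡ x ^ m * x ^ n
zr x zero n = sym (*-1ˡ _)
zr x (suc m) n = trans (ap (x *_) (zr x m n)) (sym (*-as x (x ^ m) (x ^ n)))

zi : ∀ x y n -> (x * y) ^ n ≡ x ^ n * y ^ n
zi x y zero = refl
zi x y (suc n) = trans (ap ((x * y) *_) (zi x y n)) (lem x y (x ^ n) (y ^ n))
 where lem = r4 ((v0 :* v1) :* (v2 :* v3)) ((v0 :* v2) :* (v1 :* v3))

zC : ∀ n -> 1q ^ n ≡ 1q
zC zero = refl
zC (suc n) = trans (*-1ˡ _) (zC n)

zp : ∀ x m n -> x ^ (m *' n) ≡ (x ^ m) ^ n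
zp x zero n = sym (zC n)
zp x (suc m) n = trans (zr x n (m *' n)) (ap (x ^ n *_) (zp x m n) >> sym (zi x (x ^ m) n))

zt : ∀ {x} n -> 1q ≤ x -> 1q ≤ x ^ n
zt n p = EQ (sym (zC n)) ~ mc n ze p

zy : ∀ {x} n -> 0q ≤ x -> x ≤ 1q -> x ^ n ≤ 1q
zy n p q = mc n p q ~ EQ (zC n)

em : ∀ {x m n} -> 1q ≤ x -> m <= n -> x ^ m ≤ x ^ n
em {x} {m} {n} p q = subst (\ k -> x ^ m ≤ x ^ k) (m+[n∸m] q)
 (EQ (sym (*-1ʳ _)) ~ za (ng m (ze ~ p)) (zt (n ℕ.∸ m) p) ~ EQ (sym (zr x m (n ℕ.∸ m))))

ι-↑ : ∀ m n -> ι (m ℕ.^ n) ≡ ι m ^ n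
ι-↑ m zero = ι1
ι-↑ m (suc n) = trans (zn m (m ℕ.^ n)) (ap (ι m *_) (ι-↑ m n))

<⇒≱ : ∀ {a b : ℚ} -> a < b -> ¬ (b ≤ a)
<⇒≱ p q = ℚP.<-irrefl refl (<-≤ p q)

qa : ∀ {a b : ℚ} -> a < b -> a ≤ b
qa = ℚP.<⇒≤

pos-* : ∀ {a b} -> 0q < a -> 0q < b -> 0q < a * b
pos-* {a} {b} p q = subst (_< a * b) (*-0ˡ b) (ℚP.*-monoˡ-<-pos b {{positive q}} p)

po : ∀ {a} n -> 0q < a -> 0q < a ^ n
po zero p = >0 1q
po (suc n) p = pos-* p (po n p)

zj : ∀ m -> 0q < ι (suc m)
zj m = <-≤ (>0 1q) (zx m)

ca : ∀ {a b c} -> 0q < c -> a * c ≤ b * c -> a ≤ b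
ca {c = c} p q = ℚP.*-cancelʳ-≤-pos c {{positive p}} q

-- Total inverse: 0 is sent to 0.
opaque
 ig : ℚ -> ℚ
 ig x with x ℚ.≟ 0q
 ... | yes _ = 0q
 ... | no x≢0 = (ℚ.1/ x) {{ℚ.≢-nonZero x≢0}}

 ic : ∀ {x} -> 0q < x -> x * ig x ≡ 1q
 ic {x} p with x ℚ.≟ 0q
 ... | yes refl = ⊥-elim (ℚP.<-irrefl refl p)
 ... | no x≢0 = ℚP.*-inverseʳ x {{ℚ.≢-nonZero x≢0}}

io : ∀ {x} -> 0q < x -> 0q < ig x
io {x} p = ≰⇒> \ q -> <⇒≱ (>0 1q)
 (EQ (sym (ic p)) ~ za (qa p) q ~ EQ (*-0ʳ x))

ie : ∀ {x} -> 0q < x -> 0q ≤ ig x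
ie p = qa (io p)

≤-div : ∀ {a b c} -> 0q < c -> a * c ≤ b -> a ≤ b * ig c
≤-div {a} {b} {c} p q = EQ (sym (*-1ʳ a) >> ap (a *_) (sym (ic p)) >> sym (*-as a c (ig c))) ~ zb (ie p) q

di : ∀ {a b c} -> 0q < c -> b ≤ a * c -> b * ig c ≤ a
di {a} {b} {c} p q = zb (ie p) q ~ EQ (*-as a c (ig c) >> ap (a *_) (ic p) >> *-1ʳ a)

sr : ∀ {a b} -> 0q ≤ b -> a * a ≤ b * b -> a ≤ b
sr {a} {b} pb q with ≤-tot a b
... | inj₁ r = r
... | inj₂ r with a ℚ.≤? b
...   | yes s = s
...   | no s = ⊥-elim (<⇒≱ (ℚP.≤-<-trans (za pb r) (ℚP.*-monoˡ-<-pos a {{positive (ℚP.≤-<-trans pb (≰⇒> s))}} (≰⇒> s))) q)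

-- Bernoulli's inequality. In the absence of an exponential function most bounds on powers below,
-- including weighted AM-GM, descend from it.
bo : ∀ {x} n -> 0q ≤ 1q + x -> 1q + ι n * x ≤ (1q + x) ^ n
bo {x} zero p = EQ (ap (\ t -> 1q + t * x) ι0 >> ap (1q +_) (*-0ˡ x) >> +-0ʳ 1q)
bo {x} (suc n) p = ba (nc (zd n) (sn x)) (lem (ι n) x >> ap (\ k -> (1q + k * x) + ι n * (x * x)) (sym (su n)))
 ~ za p (bo n p)
 where lem = r2 ((:1 :+ v1) :* (:1 :+ v0 :* v1)) ((:1 :+ (:1 :+ v0) :* v1) :+ v0 :* (v1 :* v1))

-- Finite sums, and discrete exponentials over one cell of steps.

sm : (ℕ -> ℚ) -> ℕ -> ℚ
sm a zero = 0q
sm a (suc m) = sm a m + a m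

sg : ∀ {a b} m -> (∀ j -> j ≺ m -> a j ≤ b j) -> sm a m ≤ sm b m
sg zero h = ≤-refl
sg (suc m) h = mb (sg m (\ j p -> h j (ℕP.m<n⇒m<1+n p))) (h m ≤r)

sk : ∀ {a} m -> (∀ j -> 0q ≤ a j) -> 0q ≤ sm a m
sk zero h = ≤-refl
sk (suc m) h = nh (sk m h) (h m)

sx : ∀ a m n -> sm a (m +' n) ≡ sm a m + sm (\ j -> a (m +' j)) n
sx a m zero = trans (ap (sm a) (n+0 m)) (sym (+-0ʳ _))
sx a m (suc n) = trans (ap (sm a) (+-suc m n)) (ap (_+ a (m +' n)) (sx a m n) >> +-as (sm a m) (sm (\ j -> a (m +' j)) n) (a (m +' n)))

sT : ∀ c m -> sm (\ _ -> c) m ≡ ι m * c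
sT c zero = sym (ap (_* c) ι0 >> *-0ˡ c)
sT c (suc m) = trans (ap (_+ c) (sT c m)) (lem (ι m) c >> ap (_* c) (sym (su m)))
 where lem = r2 (v0 :* v1 :+ v1) ((:1 :+ v0) :* v1)

-- With x = (1 - c)/ℓ Bernoulli gives c ≤ (1 - x)^ℓ, and (1 + x)(1 - x) ≤ 1 turns this into an upper
-- bound for (1 + x)^ℓ. The sign of x is left open, so growing and shrinking cells are treated
-- alike.
pow-up : ∀ {c} ℓ -> 0q ≤ c -> 0q ≤ 1q + (1q - c) * ig (ι (suc ℓ)) -> (1q + (1q - c) * ig (ι (suc ℓ))) ^ suc ℓ * c ≤ 1q
pow-up {c} ℓ pc pr = za (ng (suc ℓ) pr) bern
 ~ EQ (sym (zi (1q + x) (1q - x) (suc ℓ))) ~ zy (suc ℓ) (nc pr p1) (ba (sn x) (lem x))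
 where
 i = ig (ι (suc ℓ))
 x = (1q - c) * i
 ii : ι (suc ℓ) * i ≡ 1q
 ii = ic (zj ℓ)
 ipos : 0q ≤ i
 ipos = ie (zj ℓ)
 i1 : i ≤ 1q
 i1 = EQ (sym (*-1ˡ i)) ~ zb ipos (zx ℓ) ~ EQ ii
 lem = r1 :1 ((:1 :+ v0) :* (:1 :- v0) :+ v0 :* v0)
 p1 : 0q ≤ 1q - x
 p1 = nh (df i1) (nc pc ipos) ~ EQ (l c i)
  where l = r2 ((:1 :- v1) :+ v0 :* v1) (:1 :- (:1 :- v0) :* v1)
 bern : c ≤ (1q - x) ^ suc ℓ
 bern = EQ (trans (l1 c) (ap (\ k -> 1q + - ((1q - c) * k)) (sym ii)) ) ~ EQ (l2 c (ι (suc ℓ)) i) ~ bo {x = - x} (suc ℓ) p1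
  where
  l1 = r1 v0 (:1 :+ :- ((:1 :- v0) :* :1))
  l2 = r3 (:1 :+ :- ((:1 :- v0) :* (v1 :* v2))) (:1 :+ v1 :* (:- ((:1 :- v0) :* v2)))

-- For i ≤ ℓ and c ≤ 1 one has c ≤ 1 - i(1 - c)/ℓ, and Bernoulli does the rest.
pow-lo : ∀ {c} ℓ i -> i <= suc ℓ -> 0q ≤ c -> c ≤ 1q -> c ≤ (1q - (1q - c) * ig (ι (suc ℓ))) ^ i
pow-lo {c} ℓ i i≤ pc c1 = ba (nc (df i1) (df c1)) (l1 c (ι i * k)) ~ EQ (l2 c (ι i) k) ~ bo {x = - ((1q - c) * k)} i p1
 where
 k = ig (ι (suc ℓ))
 ii : ι (suc ℓ) * k ≡ 1q
 ii = ic (zj ℓ)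
 kpos : 0q ≤ k
 kpos = ie (zj ℓ)
 i1 : ι i * k ≤ 1q
 i1 = zb kpos (mn i≤) ~ EQ ii
 k≤1 : k ≤ 1q
 k≤1 = EQ (sym (*-1ˡ k)) ~ zb kpos (zx ℓ) ~ EQ ii
 l1 = r2 (:1 :+ :- ((:1 :- v0) :* v1)) (v0 :+ (:1 :- v1) :* (:1 :- v0))
 l2 = r3 (:1 :+ :- ((:1 :- v0) :* (v1 :* v2))) (:1 :+ v1 :* (:- ((:1 :- v0) :* v2)))
 p1 : 0q ≤ 1q + - ((1q - c) * k)
 p1 = nh (df k≤1) (nc pc kpos) ~ EQ (l c k)
  where l = r2 ((:1 :- v1) :+ v0 :* v1) (:1 :+ :- ((:1 :- v0) :* v1))

geo-up : ∀ (a : ℕ -> ℚ) {r} m -> 0q ≤ r -> (∀ j -> j ≺ m -> a (suc j) ≤ r * a j) -> ∀ i -> i <= m -> a i ≤ r ^ i * a 0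
geo-up a m pr h zero p = EQ (sym (*-1ˡ _))
geo-up a {r} m pr h (suc i) p = h i p ~ za pr (geo-up a m pr h i (<≤ p)) ~ EQ (sym (*-as r _ _))

geo-lo : ∀ (a : ℕ -> ℚ) {r} m -> 0q ≤ r -> (∀ j -> j ≺ m -> r * a j ≤ a (suc j)) -> ∀ i -> i <= m -> r ^ i * a 0 ≤ a i
geo-lo a m pr h zero p = EQ (*-1ˡ _)
geo-lo a {r} m pr h (suc i) p = EQ (*-as r _ _) ~ za pr (geo-lo a m pr h i (<≤ p)) ~ h i p

-- one cell of length ℓ = suc ℓ' with ratios ≤ 1 + (1-c)/ℓ: values bounded by G0 ⊔ G1, end by G1
cell-up : ∀ (a : ℕ -> ℚ) {c} zh (A G0 G1 : ℚ) -> 0q ≤ A -> 0q < c -> c ≤ 1q + 1q ->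
 (∀ j -> 0q ≤ a j) ->
 (∀ j -> j ≺ suc zh -> a (suc j) ≤ (1q + (1q - c) * ig (ι (suc zh))) * a j) ->
 a 0 ≤ G0 * A -> G0 ≤ G1 * c -> 0q ≤ G1 ->
 a (suc zh) ≤ G1 * A × (∀ i -> i <= suc zh -> a i ≤ (G0 ℚ.⊔ G1) * A)
cell-up a {c} zh A G0 G1 pA pc c2 nn h h0 g pG1 = end , all
 where
 i0 = ig (ι (suc zh))
 r = 1q + (1q - c) * i0
 ipos = ie (zj zh)
 i1 : i0 ≤ 1q
 i1 = EQ (sym (*-1ˡ i0)) ~ zb ipos (zx zh) ~ EQ (ic (zj zh))
 pr : 0q ≤ r
 pr = nh (df i1) (nc (df c2) ipos) ~ EQ (l c i0)
  where l = r2 ((:1 :- v1) :+ (:1 :+ :1 :- v0) :* v1) (:1 :+ (:1 :- v0) :* v1)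
 full : r ^ suc zh * a 0 ≤ G1 * A
 full = ca pc (EQ (l1 (r ^ suc zh) (a 0) c) ~ zb (nn 0) (pow-up zh (qa pc) pr) ~ EQ (*-1ˡ _) ~ h0 ~ zb pA g ~ EQ (l2 G1 c A))
  where
  l1 = r3 (v0 :* v1 :* v2) (v0 :* v2 :* v1)
  l2 = r3 (v0 :* v1 :* v2) (v0 :* v2 :* v1)
 end = geo-up a (suc zh) pr h (suc zh) ≤r ~ full
 all : ∀ i -> i <= suc zh -> a i ≤ (G0 ℚ.⊔ G1) * A
 -- According to whether r is below or above 1, the geometric bound is largest at the start or at
 -- the end of the cell; hence the maximum of `G0` and `G1`.
 all i p with ≤-tot r 1q
 ... | inj₁ r1 = geo-up a (suc zh) pr h i p ~ zb (nn 0) (zy i pr r1) ~ EQ (*-1ˡ _) ~ h0 ~ zb pA (ℚP.p≤p⊔q G0 G1)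
 ... | inj₂ r1 = geo-up a (suc zh) pr h i p ~ zb (nn 0) (em r1 p) ~ full ~ zb pA (ℚP.p≤q⊔p G0 G1)

cell-lo : ∀ (a : ℕ -> ℚ) {c} zh (A H0 H1 : ℚ) -> 0q ≤ A -> 0q ≤ c -> c ≤ 1q ->
 (∀ j -> 0q ≤ a j) ->
 (∀ j -> j ≺ suc zh -> (1q - (1q - c) * ig (ι (suc zh))) * a j ≤ a (suc j)) ->
 H0 * A ≤ a 0 -> H1 ≤ H0 * c ->
 ∀ i -> i <= suc zh -> H1 * A ≤ a i
cell-lo a {c} zh A H0 H1 pA pc c1 nn h h0 g i p =
 zb pA g ~ EQ (l H0 c A) ~ za pc h0 ~ zb (nn 0) (pow-lo zh i p pc c1) ~ geo-lo a (suc zh) pr h i p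
 where
 l = r3 (v0 :* v1 :* v2) (v1 :* (v0 :* v2))
 i0 = ig (ι (suc zh))
 ipos = ie (zj zh)
 i1 : i0 ≤ 1q
 i1 = EQ (sym (*-1ˡ i0)) ~ zb ipos (zx zh) ~ EQ (ic (zj zh))
 pr : 0q ≤ 1q - (1q - c) * i0
 pr = nh (df i1) (nc pc ipos) ~ EQ (l' c i0)
  where l' = r2 ((:1 :- v1) :+ v0 :* v1) (:1 :- (:1 :- v0) :* v1)

-- Integer tables bounding sums over many cells.

div-up : ∀ a b -> a <= suc (a ℕ./ suc b) *' suc b
div-up a b = ≤≤ (≤≡ (ℕD.m≡m%n+[m/n]*n a (suc b))) (ℕP.+-monoˡ-≤ ((a ℕ./ suc b) *' suc b) (<≤ (ℕD.m%n<n a (suc b))))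

ι≤* : ∀ {a b c} -> a <= b *' c -> ι a ≤ ι b * ι c
ι≤* {a} {b} {c} p = mn p ~ EQ (zn b c)

ι-⊔ : ∀ a b -> ι a ℚ.⊔ ι b ≤ ι (a ℕ.⊔ b)
ι-⊔ a b = ℚP.⊔-lub (mn (ℕP.m≤m⊔n a b)) (mn (ℕP.m≤n⊔m a b))

-- A cell of ℓ steps changes the sequence at most by the factor 1/c upwards, c = `un`/`cm`, and at
-- least by c downwards, c = `loDen`/`cm`. Values relative to the starting term are kept as integers
-- in units of 1/`cd`, rounded up in `uG` and down in `loH`; `ub` and `lA` add up the cells. These
-- recursions are opaque, so that proofs use them symbolically while `upEval` and `loEval` do the
-- computing.
module Cells (num' scale' : ℕ) (ud ld : ℕ -> ℕ -> ℕ) (lo≤ : ∀ B k -> ld B k <= suc num') where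

 cm cd : ℕ
 cm = suc num'
 cd = suc scale'

 un loDen : ℕ -> ℕ -> ℕ
 un B k = suc (ud B k)
 loDen = ld

 -- the same recursions with accumulators, for evaluation
 upRun : ℕ -> ℕ -> ℕ -> ℕ -> ℕ -> ℕ × ℕ
 upRun B zero k G acc = G , acc
 upRun B (suc f) k G acc with suc (G *' cm ℕ./ un B k)
 ... | G' = upRun B f (suc k) G' (acc +' (G ℕ.⊔′ G'))

 loRun : ℕ -> ℕ -> ℕ -> ℕ -> ℕ -> ℕ
 loRun B zero k H acc = acc
 loRun B (suc f) k H acc with H *' loDen B k ℕ./ cm
 ... | H' = loRun B f (suc k) H' (acc +' H')

 endOf : ℕ -> ℕ -> ℕ -> ℕ
 endOf B K G = suc (G *' cm ℕ./ suc (ℕ.pred (un B K ℕ.∸ cm)))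

 upFin : ℕ -> ℕ -> ℕ × ℕ -> ℕ
 upFin B K (G , acc) = acc +' endOf B K G

 upEval loEval : ℕ -> ℕ -> ℕ
 upEval B K = upFin B K (upRun B K 0 cd 0)
 loEval B K = loRun B K 0 cd 0

 opaque
  uG : ℕ -> ℕ -> ℕ
  uG B zero = cd
  uG B (suc k) = suc (uG B k *' cm ℕ./ un B k)

  ub : ℕ -> ℕ -> ℕ
  ub B zero = 0
  ub B (suc k) = ub B k +' (uG B k ℕ.⊔ uG B (suc k))

  ua : ℕ -> ℕ -> ℕ
  ua B K = ub B K +' suc (uG B K *' cm ℕ./ suc (ℕ.pred (un B K ℕ.∸ cm)))

  loH : ℕ -> ℕ -> ℕ
  loH B zero = cd
  loH B (suc k) = loH B k *' loDen B k ℕ./ cm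

  lA : ℕ -> ℕ -> ℕ
  lA B zero = 0
  lA B (suc k) = lA B k +' loH B (suc k)

  us : ∀ B f k -> upRun B f k (uG B k) (ub B k) ≡ (uG B (f +' k) , ub B (f +' k))
  us B zero k = refl
  us B (suc f) k = trans (ap (\ m -> upRun B f (suc k) (uG B (suc k)) (ub B k +' m)) (sym (ℕP.⊔≡⊔′ (uG B k) (uG B (suc k))))) (us B f (suc k) >> ap (\ m -> uG B m , ub B m) (+-suc f k))

  lp : ∀ B f k -> loRun B f k (loH B k) (lA B k) ≡ lA B (f +' k)
  lp B zero k = refl
  lp B (suc f) k = trans (lp B f (suc k)) (ap (lA B) (+-suc f k))

  upG-zero : ∀ B -> uG B zero ≡ cd
  upG-zero B = refl
  loH-zero : ∀ B -> loH B zero ≡ cd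
  loH-zero B = refl
  upAcc-zero : ∀ B -> ub B zero ≡ 0
  upAcc-zero B = refl
  loAcc-zero : ∀ B -> lA B zero ≡ 0
  loAcc-zero B = refl
  upAcc-suc : ∀ B k -> ub B (suc k) ≡ ub B k +' (uG B k ℕ.⊔ uG B (suc k))
  upAcc-suc B k = refl
  loAcc-suc : ∀ B k -> lA B (suc k) ≡ lA B k +' loH B (suc k)
  loAcc-suc B k = refl
  upG-suc : ∀ B k -> uG B k *' cm <= uG B (suc k) *' un B k
  upG-suc B k = div-up (uG B k *' cm) _
  loH-suc : ∀ B k -> loH B (suc k) *' cm <= loH B k *' loDen B k
  loH-suc B k = ℕD.m/n*n≤m (loH B k *' loDen B k) cm
  upEnd : ℕ -> ℕ -> ℕ
  upEnd B K = suc (uG B K *' cm ℕ./ suc (ℕ.pred (un B K ℕ.∸ cm)))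
  upEnd-spec : ∀ B K -> uG B K *' cm <= upEnd B K *' suc (ℕ.pred (un B K ℕ.∸ cm))
  upEnd-spec B K = div-up (uG B K *' cm) _
  upTotal-pos : ∀ B K -> 1 <= ua B K
  upTotal-pos B K = ≤≤ (ℕ.s≤s ℕ.z≤n) (m≤n+m (endOf B K (uG B K)) (ub B K))
  upTotal-eval : ∀ B K -> ua B K ≡ upEval B K
  upTotal-eval B K = sym (ap (upFin B K) (us B K 0) >> ap (\ m -> ub B m +' endOf B K (uG B m)) (n+0 K))
  loAcc-eval : ∀ B K -> lA B K ≡ loEval B K
  loAcc-eval B K = sym (lp B K 0 >> ap (lA B) (n+0 K))
  upTotal-def : ∀ B K -> ua B K ≡ ub B K +' upEnd B K
  upTotal-def B K = refl

 sl : 0q < ι cm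
 sl = zj num'

 upC : ℕ -> ℕ -> ℚ
 upC B k = ι (un B k) * ig (ι cm)

 upC-pos : ∀ B k -> 0q < upC B k
 upC-pos B k = pos-* (zj _) (io sl)

 upG-step : ∀ B k -> ι (uG B k) ≤ ι (uG B (suc k)) * upC B k
 upG-step B k = ≤-div sl (EQ (sym (zn (uG B k) cm)) ~ ι≤* {b = uG B (suc k)} (upG-suc B k)) ~ EQ (*-as (ι (uG B (suc k))) (ι (un B k)) (ig (ι cm)))

 module UpTail (a : ℕ -> ℚ) (nn : ∀ j -> 0q ≤ a j) (zh B K : ℕ)
  (c2 : ∀ k -> k ≺ K -> upC B k ≤ 1q + 1q)
  (h : ∀ k i -> k ≺ K -> i ≺ suc zh -> a (suc (k *' suc zh +' i)) ≤ (1q + (1q - upC B k) * ig (ι (suc zh))) * a (k *' suc zh +' i))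
  (h∞ : ∀ i -> a (suc (K *' suc zh +' i)) ≤ (1q + (1q - upC B K) * ig (ι (suc zh))) * a (K *' suc zh +' i))
  (big : suc cm <= un B K) where

  ℓ = suc zh
  A = a 0 * ig (ι cd)
  pA : 0q ≤ A
  pA = nc (nn 0) (ie (zj scale'))

  cell : ∀ k -> k ≺ K -> a (k *' ℓ) ≤ ι (uG B k) * A ->
   a (suc k *' ℓ) ≤ ι (uG B (suc k)) * A × sm (\ i -> a (k *' ℓ +' i)) ℓ ≤ ι ℓ * (ι (uG B k ℕ.⊔ uG B (suc k)) * A)
  cell k p h0 = fin (cell-up (\ i -> a (k *' ℓ +' i)) {upC B k} zh A (ι (uG B k)) (ι (uG B (suc k))) pA (upC-pos B k) (c2 k p) (\ j -> nn (k *' ℓ +' j))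
   (\ j q -> subst (\ t -> a t ≤ (1q + (1q - upC B k) * ig (ι (suc zh))) * a (k *' suc zh +' j)) (sym (+-suc (k *' ℓ) j)) (h k j p q))
   (subst (\ t -> a t ≤ ι (uG B k) * A) (sym (n+0 (k *' ℓ))) h0) (upG-step B k) (zd (uG B (suc k))))
   where
   fin : a (k *' ℓ +' suc zh) ≤ ι (uG B (suc k)) * A × (∀ i -> i <= suc zh -> a (k *' ℓ +' i) ≤ (ι (uG B k) ℚ.⊔ ι (uG B (suc k))) * A) ->
    a (suc k *' ℓ) ≤ ι (uG B (suc k)) * A × sm (\ i -> a (k *' ℓ +' i)) ℓ ≤ ι ℓ * (ι (uG B k ℕ.⊔ uG B (suc k)) * A)
   fin (e , al) = subst (\ t -> a t ≤ ι (uG B (suc k)) * A) (+-cmℕ (k *' ℓ) ℓ) e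
    , (sg {\ i -> a (k *' ℓ +' i)} {\ _ -> ι (uG B k ℕ.⊔ uG B (suc k)) * A} ℓ (\ j q -> al j (<≤ q) ~ zb pA (ι-⊔ (uG B k) (uG B (suc k)))) ~ EQ (sT (ι (uG B k ℕ.⊔ uG B (suc k)) * A) ℓ))

  ij : ∀ k -> k <= K -> a (k *' ℓ) ≤ ι (uG B k) * A × sm a (k *' ℓ) ≤ ι ℓ * (ι (ub B k) * A)
  ij zero p = (EQ (sym (*-1ʳ (a 0)) >> ap (a 0 *_) (sym (ic (zj scale'))) >> l (a 0) (ι cd) (ig (ι cd)) >> ap (\ g -> ι g * A) (sym (upG-zero B))))
   , nc (zd ℓ) (nc (zd (ub B 0)) pA)
   where l = r3 (v0 :* (v1 :* v2)) (v1 :* (v0 :* v2))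
  ij (suc k) p = fst ce , (EQ (ap (sm a) (+-cmℕ ℓ (k *' ℓ)) >> sx a (k *' ℓ) ℓ) ~ mb (snd st) (snd ce)
   ~ EQ (l (ι ℓ) (ι (ub B k)) (ι (uG B k ℕ.⊔ uG B (suc k))) A >> ap (\ t -> ι ℓ * (t * A)) (sym (ap ι (upAcc-suc B k) >> zq (ub B k) (uG B k ℕ.⊔ uG B (suc k))))))
   where
   st = ij k (<≤ p)
   ce = cell k p (fst st)
   l = r4 (v0 :* (v1 :* v3) :+ v0 :* (v2 :* v3)) (v0 :* ((v1 :+ v2) :* v3))

  t : ℚ
  t = (upC B K - 1q) * ig (ι ℓ)
  -- Beyond cell K each step multiplies by at most 1 - t, so t times a term is at most the drop to
  -- the next term and the sum telescopes. The bound on the remaining tail is therefore independent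
  -- of its length.
  geo : ∀ m -> t * sm (\ i -> a (K *' ℓ +' i)) m + a (K *' ℓ +' m) ≤ a (K *' ℓ)
  geo zero = EQ (ap₂ _+_ (*-0ʳ t) (ap a (n+0 _)) >> (+-0ˡ _))
  geo (suc m) = +-≤ʳ (t * sm (\ i -> a (K *' ℓ +' i)) (suc m)) (subst (\ u -> a u ≤ (1q + (1q - upC B K) * ig (ι ℓ)) * a (K *' ℓ +' m)) (sym (+-suc (K *' ℓ) m)) (h∞ m))
   ~ EQ (l (upC B K) (ig (ι ℓ)) (sm (\ i -> a (K *' ℓ +' i)) m) (a (K *' ℓ +' m))) ~ geo m
   where l = r4 ((v0 :- :1) :* v1 :* (v2 :+ v3) :+ (:1 :+ (:1 :- v0) :* v1) :* v3) ((v0 :- :1) :* v1 :* v2 :+ v3)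

  w : ℕ
  w = suc (ℕ.pred (un B K ℕ.∸ cm))
  w≡ : w ≡ un B K ℕ.∸ cm
  w≡ = ℕP.suc-pred (un B K ℕ.∸ cm) {{ℕ.>-nonZero (ℕP.m<n⇒0<n∸m big)}}
  t≡ : t * (ι cm * ι ℓ) ≡ ι w
  t≡ = trans (l (ι (un B K)) (ig (ι cm)) (ι cm) (ig (ι ℓ)) (ι ℓ)) (trans (ap₂ (\ x y -> (ι (un B K) * x - ι cm) * y) (ic sl) (ic (zj zh)))
   (l2 (ι (un B K)) (ι cm) >> ap (\ u -> u - ι cm) (ap ι (sym (ap (cm ℕ.+_) w≡ >> m+[n∸m] (<≤ big))) >> zq cm w) >> l3 (ι cm) (ι w)))
   where
   l = r5 ((v0 :* v1 :- :1) :* v3 :* (v2 :* v4)) ((v0 :* (v2 :* v1) :- v2) :* (v4 :* v3))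
   l2 = r2 ((v0 :* :1 :- v1) :* :1) (v0 :- v1)
   l3 = r2 (v0 :+ v1 :- v0) v1
  g∞ : ℕ
  g∞ = upEnd B K
  tail : ∀ m -> sm (\ i -> a (K *' ℓ +' i)) m ≤ ι ℓ * (ι g∞ * A)
  tail m = ca (zj (ℕ.pred (un B K ℕ.∸ cm))) (EQ (ap (s *_) (sym t≡) >> l s t (ι cm) (ι ℓ)) ~ zb (nc (zd cm) (zd ℓ)) ts
   ~ zb (nc (zd cm) (zd ℓ)) (fst (ij K ≤r)) ~ EQ (l2 (ι (uG B K)) A (ι cm) (ι ℓ))
   ~ za (nc (zd ℓ) pA) (EQ (sym (zn (uG B K) cm)) ~ ι≤* {b = g∞} (upEnd-spec B K)) ~ EQ (l3 (ι ℓ) A (ι g∞) (ι w)))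
   where
   s = sm (\ i -> a (K *' ℓ +' i)) m
   ts : t * s ≤ a (K *' ℓ)
   ts = ba (nn (K *' ℓ +' m)) refl ~ geo m
   l = r4 (v0 :* (v1 :* (v2 :* v3))) (v1 :* v0 :* (v2 :* v3))
   l2 = r4 (v0 :* v1 :* (v2 :* v3)) (v3 :* v1 :* (v0 :* v2))
   l3 = r4 (v0 :* v1 :* (v2 :* v3)) (v0 :* (v2 :* v1) :* v3)

  up-bound : ∀ m -> sm a m ≤ ι ℓ * (ι (ua B K) * A)
  up-bound m = ba (sk (K *' ℓ) (\ j -> nn (m +' j))) (sx a m (K *' ℓ)) ~ EQ (ap (sm a) (+-cmℕ m (K *' ℓ)) >> sx a (K *' ℓ) m)
   ~ mb (snd (ij K ≤r)) (tail m) ~ EQ (l (ι ℓ) (ι (ub B K)) (ι g∞) A >> ap (\ u -> ι ℓ * (u * A)) (sym (ap ι (upTotal-def B K) >> zq (ub B K) g∞)))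
   where l = r4 (v0 :* (v1 :* v3) :+ v0 :* (v2 :* v3)) (v0 :* ((v1 :+ v2) :* v3))

 loC : ℕ -> ℕ -> ℚ
 loC B k = ι (loDen B k) * ig (ι cm)

 module LoTail (a : ℕ -> ℚ) (nn : ∀ j -> 0q ≤ a j) (zh B K : ℕ)
  (h : ∀ k i -> k ≺ K -> i ≺ suc zh -> (1q - (1q - loC B k) * ig (ι (suc zh))) * a (k *' suc zh +' i) ≤ a (suc (k *' suc zh +' i))) where

  ℓ = suc zh
  A = a 0 * ig (ι cd)
  pA : 0q ≤ A
  pA = nc (nn 0) (ie (zj scale'))

  loC1 : ∀ k -> loC B k ≤ 1q
  loC1 k = zb (ie sl) (mn (lo≤ B k)) ~ EQ (ic sl)

  loH-step : ∀ k -> ι (loH B (suc k)) ≤ ι (loH B k) * loC B k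
  loH-step k = ≤-div sl (EQ (sym (zn (loH B (suc k)) cm)) ~ mn (loH-suc B k) ~ EQ (zn (loH B k) (loDen B k)))
   ~ EQ (*-as (ι (loH B k)) (ι (loDen B k)) (ig (ι cm)))

  cell : ∀ k -> k ≺ K -> ι (loH B k) * A ≤ a (k *' ℓ) -> ∀ i -> i <= ℓ -> ι (loH B (suc k)) * A ≤ a (k *' ℓ +' i)
  cell k p h0 = cell-lo (\ i -> a (k *' ℓ +' i)) {loC B k} zh A (ι (loH B k)) (ι (loH B (suc k))) pA (nc (zd (loDen B k)) (ie sl)) (loC1 k) (\ j -> nn (k *' ℓ +' j))
   (\ j q -> subst (\ t -> (1q - (1q - loC B k) * ig (ι (suc zh))) * a (k *' suc zh +' j) ≤ a t) (sym (+-suc (k *' ℓ) j)) (h k j p q))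
   (subst (\ t -> ι (loH B k) * A ≤ a t) (sym (n+0 (k *' ℓ))) h0) (loH-step k)

  ij : ∀ k -> k <= K -> ι (loH B k) * A ≤ a (k *' ℓ) × ι ℓ * (ι (lA B k) * A) ≤ sm (\ j -> a (suc j)) (k *' ℓ)
  ij zero p = (EQ (ap (\ g -> ι g * A) (loH-zero B) >> l (a 0) (ι cd) (ig (ι cd)) >> ap (a 0 *_) (ic (zj scale')) >> *-1ʳ (a 0)))
   , EQ (ap (\ z -> ι ℓ * (z * A)) (ap ι (loAcc-zero B) >> ι0) >> l0 (ι ℓ) A)
   where
   l = r3 (v1 :* (v0 :* v2)) (v0 :* (v1 :* v2))
   l0 = r2 (v0 :* (:0 :* v1)) :0
  ij (suc k) p = subst (\ t -> ι (loH B (suc k)) * A ≤ a t) (+-cmℕ (k *' ℓ) ℓ) (cell k p (fst st) ℓ ≤r)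
   , (EQ (ap (\ u -> ι ℓ * (u * A)) (ap ι (loAcc-suc B k) >> zq (lA B k) (loH B (suc k))) >> l (ι ℓ) (ι (lA B k)) (ι (loH B (suc k))) A)
    ~ mb (snd st) (EQ (sym (sT (ι (loH B (suc k)) * A) ℓ)) ~ sg ℓ (\ j q -> cell k p (fst st) (suc j) q ~ EQ (ap a (+-suc (k *' ℓ) j))))
    ~ EQ (sym (ap (sm (\ j -> a (suc j))) (+-cmℕ ℓ (k *' ℓ)) >> sx (\ j -> a (suc j)) (k *' ℓ) ℓ)))
   where
   st = ij k (<≤ p)
   l = r4 (v0 :* ((v1 :+ v2) :* v3)) (v0 :* (v1 :* v3) :+ v0 :* (v2 :* v3))

  lo-bound : ι ℓ * (ι (lA B K) * A) ≤ sm (\ j -> a (suc j)) (K *' ℓ)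
  lo-bound = snd (ij K ≤r)

-- Binomial weights and their tails.

bd : ℚ -> ℚ -> ℕ -> ℕ -> ℚ
bd v U zero zero = 1q
bd v U zero (suc r) = 0q
bd v U (suc d) zero = v * bd v U d zero
bd v U (suc d) (suc r) = v * bd v U d (suc r) + U * bd v U d r

bg : ∀ {v U} d r -> 0q ≤ v -> 0q ≤ U -> 0q ≤ bd v U d r
bg zero zero pv pU = ze
bg zero (suc r) pv pU = ≤-refl
bg (suc d) zero pv pU = nc pv (bg d zero pv pU)
bg (suc d) (suc r) pv pU = nh (nc pv (bg d (suc r) pv pU)) (nc pU (bg d r pv pU))

-- `bd v U d r` is C(d,r) U^r v^(d-r), not normalised. This is the ratio of successive terms, (r +
-- 1) v b(r+1) = (d - r) U b(r), with the subtracted part moved to the left so that no truncated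
-- subtraction occurs.
br : ∀ v U d r -> ι (suc r) * (v * bd v U d (suc r)) + ι r * (U * bd v U d r) ≡ ι d * (U * bd v U d r)
br v U zero zero = trans (ap₂ (\ a b -> a * (v * 0q) + b * (U * 1q)) ι1 ι0) (l v U >> ap (_* (U * 1q)) (sym ι0))
 where l = r2 (:1 :* (v0 :* :0) :+ :0 :* (v1 :* :1)) (:0 :* (v1 :* :1))
br v U zero (suc r) = l v U (ι (suc (suc r))) (ι (suc r)) (ι 0)
 where l = r5 (v2 :* (v0 :* :0) :+ v3 :* (v1 :* :0)) (v4 :* (v1 :* :0))
br v U (suc d) zero =
 trans (ap₂ (\ a b -> a * (v * (v * x1 + U * x0)) + b * (U * (v * x0))) ι1 ι0) (trans (l v U x0 x1)
  (trans (ap (\ t -> v * t + U * (v * x0)) (sym (ap₂ (\ a b -> a * (v * x1) + b * (U * x0)) ι1 ι0)))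
  (ap (\ t -> v * t + U * (v * x0)) (br v U d zero) >> l2 v U x0 (ι d) >> ap (_* (U * (v * x0))) (sym (su d)))))
 where
 x0 = bd v U d zero
 x1 = bd v U d (suc zero)
 l = r4 (:1 :* (v0 :* (v0 :* v3 :+ v1 :* v2)) :+ :0 :* (v1 :* (v0 :* v2))) (v0 :* (:1 :* (v0 :* v3) :+ :0 :* (v1 :* v2)) :+ v1 :* (v0 :* v2))
 l2 = r4 (v0 :* (v3 :* (v1 :* v2)) :+ v1 :* (v0 :* v2)) ((:1 :+ v3) :* (v1 :* (v0 :* v2)))
br v U (suc d) (suc r) =
 trans (ap₂ (\ a b -> a * (v * (v * x2 + U * x1)) + b * (U * (v * x1 + U * x0))) (su (suc r)) (su r))
  (trans (l v U x0 x1 x2 (ι r) (ι (suc r)) )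
  (trans (ap₂ (\ s t -> v * s + U * t + c) e1 e2)
  (l2 v U x0 x1 (ι d) (ι r) (ι (suc r)) (ap (\ z -> z) (su r)) >> ap (_* (U * (v * x1 + U * x0))) (sym (su d)))))
 where
 x0 = bd v U d r
 x1 = bd v U d (suc r)
 x2 = bd v U d (suc (suc r))
 c = (1q + ι (suc r)) * (v * (U * x1)) - ι (suc r) * (v * (U * x1)) + ((1q + ι r) * (U * (v * x1)) - ι (suc r) * (v * (U * x1))) + ((1q + ι r) - ι r) * (U * (U * x0))
 e1 = trans (ap (\ a -> a * (v * x2) + ι (suc r) * (U * x1)) (sym (su (suc r)))) (br v U d (suc r))
 e2 = br v U d r
 l = r7 ((:1 :+ v6) :* (v0 :* (v0 :* v4 :+ v1 :* v3)) :+ (:1 :+ v5) :* (v1 :* (v0 :* v3 :+ v1 :* v2))) (v0 :* ((:1 :+ v6) :* (v0 :* v4) :+ v6 :* (v1 :* v3)) :+ v1 :* (v6 :* (v0 :* v3) :+ v5 :* (v1 :* v2)) :+ ((:1 :+ v6) :* (v0 :* (v1 :* v3)) :- v6 :* (v0 :* (v1 :* v3)) :+ ((:1 :+ v5) :* (v1 :* (v0 :* v3)) :- v6 :* (v0 :* (v1 :* v3))) :+ ((:1 :+ v5) :- v5) :* (v1 :* (v1 :* v2))))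
 l2 : ∀ v U x0 x1 d r r1 -> r1 ≡ 1q + r -> v * (d * (U * x1)) + U * (d * (U * x0)) + ((1q + r1) * (v * (U * x1)) - r1 * (v * (U * x1)) + ((1q + r) * (U * (v * x1)) - r1 * (v * (U * x1))) + ((1q + r) - r) * (U * (U * x0)))
  ≡ (1q + d) * (U * (v * x1 + U * x0))
 l2 v U x0 x1 d r .(1q + r) refl = l3 v U x0 x1 d r
  where l3 = r6 (v0 :* (v4 :* (v1 :* v3)) :+ v1 :* (v4 :* (v1 :* v2)) :+ ((:1 :+ (:1 :+ v5)) :* (v0 :* (v1 :* v3)) :- (:1 :+ v5) :* (v0 :* (v1 :* v3)) :+ ((:1 :+ v5) :* (v1 :* (v0 :* v3)) :- (:1 :+ v5) :* (v0 :* (v1 :* v3))) :+ ((:1 :+ v5) :- v5) :* (v1 :* (v1 :* v2)))) ((:1 :+ v4) :* (v1 :* (v0 :* v3 :+ v1 :* v2)))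

bz : ∀ v U d r -> d ≺ r -> bd v U d r ≡ 0q
bz v U zero (suc r) p = refl
bz v U (suc d) (suc r) (ℕ.s≤s p) = trans (ap₂ (\ a b -> v * a + U * b) (bz v U d (suc r) (ℕP.m<n⇒m<1+n p)) (bz v U d r p)) (l v U)
 where l = r2 (v0 :* :0 :+ v1 :* :0) :0

-- Each entry is an independent label with weight v for absent and U for present; the value is the
-- total weight of at least T present labels. That `ℕ.pred` fixes 0 is intended, since a threshold
-- once met stays met.
ro : List (ℚ × ℚ) -> ℕ -> ℚ
ro [] zero = 1q
ro [] (suc T) = 0q
ro ((v , U) ∷ l) T = v * ro l T + U * ro l (ℕ.pred T)

rep : {A : Set} -> ℕ -> A -> List A
rep zero x = []
rep (suc n) x = x ∷ rep n x

rh : ∀ v U d T -> ro (rep d (v , U)) T + sm (bd v U d) T ≡ (v + U) ^ d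
rh v U zero zero = +-0ʳ 1q
rh v U zero (suc T) = trans (+-0ˡ (sm (bd v U zero) (suc T))) (s T)
 where
 s : ∀ T -> sm (bd v U zero) (suc T) ≡ 1q
 s zero = refl
 s (suc T) = trans (+-0ʳ (sm (bd v U zero) (suc T))) (s T)
rh v U (suc d) T = trans (ap (\ t -> (v * ro l T + U * ro l (ℕ.pred T)) + t) (bs T))
 (trans (lem v U (ro l T) (ro l (ℕ.pred T)) (sm (bd v U d) T) (sm (bd v U d) (ℕ.pred T)))
  (ap₂ (\ a b -> v * a + U * b) (rh v U d T) (rh v U d (ℕ.pred T)) >> lem2 v U ((v + U) ^ d)))
 where
 l = rep d (v , U)
 lem = r6 (v0 :* v2 :+ v1 :* v3 :+ (v0 :* v4 :+ v1 :* v5)) (v0 :* (v2 :+ v4) :+ v1 :* (v3 :+ v5))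
 lem2 = r3 (v0 :* v2 :+ v1 :* v2) ((v0 :+ v1) :* v2)
 bs : ∀ T -> sm (bd v U (suc d)) T ≡ v * sm (bd v U d) T + U * sm (bd v U d) (ℕ.pred T)
 bs zero = z v U
  where z = r2 :0 (v0 :* :0 :+ v1 :* :0)
 bs (suc zero) = z v U (bd v U d zero)
  where z = r3 (:0 :+ v0 :* v2) (v0 :* (:0 :+ v2) :+ v1 :* :0)
 bs (suc (suc T)) = trans (ap (_+ (v * bd v U d (suc T) + U * bd v U d T)) (bs (suc T))) (z v U (sm (bd v U d) (suc T)) (sm (bd v U d) T) (bd v U d (suc T)) (bd v U d T))
  where z = r6 (v0 :* v2 :+ v1 :* v3 :+ (v0 :* v4 :+ v1 :* v5)) (v0 :* (v2 :+ v4) :+ v1 :* (v3 :+ v5))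

sE : ∀ a m -> (∀ j -> a j ≡ 0q) -> sm a m ≡ 0q
sE a zero h = refl
sE a (suc m) h = trans (ap₂ _+_ (sE a m h) (h m)) (+-0ʳ 0q)

+-cancelr : ∀ c a b -> a + c ≡ b + c -> a ≡ b
+-cancelr c a b e = trans (lem a c) (ap (_- c) e >> sym (lem b c))
 where lem = r2 v0 (v0 :+ v1 :- v1)

rowGE-up : ∀ v U d T -> ro (rep d (v , U)) T ≡ sm (\ j -> bd v U d (T +' j)) (suc d)
rowGE-up v U d T = +-cancelr (sm (bd v U d) T) (ro (rep d (v , U)) T) (sm (\ j -> bd v U d (T +' j)) (suc d))
 (rh v U d T >> sym tot >> sym z2 >> ap (sm (bd v U d)) (+-cmℕ (suc d) T) >> sx (bd v U d) T (suc d) >> +-cm (sm (bd v U d) T) (sm (\ j -> bd v U d (T +' j)) (suc d)))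
 where
 gz : ∀ d T -> d ≺ T -> ro (rep d (v , U)) T ≡ 0q
 gz zero (suc T) p = refl
 gz (suc d) (suc T) (ℕ.s≤s p) = trans (ap₂ (\ a b -> v * a + U * b) (gz d (suc T) (ℕP.m<n⇒m<1+n p)) (gz d T p)) (l v U)
  where l = r2 (v0 :* :0 :+ v1 :* :0) :0
 tot : sm (bd v U d) (suc d) ≡ (v + U) ^ d
 tot = trans (sym (ap (_+ sm (bd v U d) (suc d)) (gz d (suc d) ≤r) >> +-0ˡ (sm (bd v U d) (suc d)))) (rh v U d (suc d))
 z2 : sm (bd v U d) (suc d +' T) ≡ sm (bd v U d) (suc d)
 z2 = trans (sx (bd v U d) (suc d) T) (ap (sm (bd v U d) (suc d) +_) (sE (\ j -> bd v U d (suc d +' j)) T (\ j -> bz v U d (suc d +' j) (m≤m+n (suc d) j))) >> +-0ʳ (sm (bd v U d) (suc d)))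

sumTo-rev : ∀ (b : ℕ -> ℚ) T m -> m <= T -> sm (\ j -> b (T ℕ.∸ suc j)) m + sm b (T ℕ.∸ m) ≡ sm b T
sumTo-rev b T zero p = +-0ˡ (sm b T)
sumTo-rev b T (suc m) p = trans (lem (sm (\ j -> b (T ℕ.∸ suc j)) m) (b (T ℕ.∸ suc m)) (sm b (T ℕ.∸ suc m)))
 (ap (\ k -> sm (\ j -> b (T ℕ.∸ suc j)) m + sm b k) (sym (ℕP.+-∸-assoc 1 p)) >> sumTo-rev b T m (<≤ p))
 where lem = r3 (v0 :+ v1 :+ v2) (v0 :+ (v2 :+ v1))

-- successive ratios of the binomial weights, without truncated subtraction
bq : ∀ {v U} d r {ρ} -> 0q ≤ v -> 0q ≤ U -> 0q < v -> ι d * U ≤ ρ * (ι (suc r) * v) + ι r * U -> bd v U d (suc r) ≤ ρ * bd v U d r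
bq {v} {U} d r {ρ} pv pU v+ h = ca (pos-* (zj r) v+)
 (ba (nc (df h) (bg d r pv pU)) (trans (l ρ (ι (suc r)) v (bd v U d r) (ι r) U (ι d))
  (ap (_+ (ρ * (ι (suc r) * v) + ι r * U - ι d * U) * bd v U d r) (ap (\ z -> z - ι r * (U * bd v U d r)) (sym (br v U d r)) >> l2 (ι (suc r)) v (bd v U d (suc r)) (ι r * (U * bd v U d r))))))
 where
 l = r7 (v0 :* v3 :* (v1 :* v2)) ((v6 :* (v5 :* v3) :- v4 :* (v5 :* v3)) :+ (v0 :* (v1 :* v2) :+ v4 :* v5 :- v6 :* v5) :* v3)
 l2 = r4 (v0 :* (v1 :* v2) :+ v3 :- v3) (v2 :* (v0 :* v1))

bin-step-lo : ∀ {v U} d r {ρ} -> 0q ≤ v -> 0q ≤ U -> 0q < U -> 0q < ι d - ι r -> ρ * (ι d * U) ≤ ι (suc r) * v + ρ * (ι r * U) -> ρ * bd v U d (suc r) ≤ bd v U d r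
bin-step-lo {v} {U} d r {ρ} pv pU U+ dr h = ca (pos-* dr U+)
 (ba (nc (df h) (bg d (suc r) pv pU)) (trans (l (bd v U d r) (ι d) (ι r) U) (trans (ap (\ z -> z - ι r * (U * bd v U d r)) (sym (br v U d r)))
  (l2 ρ (ι (suc r)) v (bd v U d (suc r)) (ι r * (U * bd v U d r)) (ι d) (ι r) U))))
 where
 l = r4 (v0 :* ((v1 :- v2) :* v3)) (v1 :* (v3 :* v0) :- v2 :* (v3 :* v0))
 l2 = r8 (v1 :* (v2 :* v3) :+ v4 :- v4) (v0 :* v3 :* ((v5 :- v6) :* v7) :+ (v1 :* v2 :+ v0 :* (v6 :* v7) :- v0 :* (v5 :* v7)) :* v3)

module RowTail (num' scale' : ℕ) (ud ld : ℕ -> ℕ -> ℕ) (lo≤ : ∀ B k -> ld B k <= suc num') where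
 open Cells num' scale' ud ld lo≤ public

 module _ (v U : ℚ) (d T zh B K K' : ℕ) (v+ : 0q < v) (U+ : 0q < U)
  (c2 : ∀ k -> k <= K -> upC B k ≤ 1q + 1q)
  (Hu : ∀ k -> k <= K -> ι d * U ≤ (1q + (1q - upC B k) * ig (ι (suc zh))) * (ι (T +' k *' suc zh) * v) + ι (T +' k *' suc zh) * U)
  (big : suc cm <= un B K)
  (fit : K' *' suc zh <= T) (fit' : T <= d)
  (Hl : ∀ k -> k ≺ K' -> (1q - (1q - loC B k) * ig (ι (suc zh))) * (ι d * U) ≤ ι (T ℕ.∸ suc k *' suc zh) * v + (1q - (1q - loC B k) * ig (ι (suc zh))) * (ι (T ℕ.∸ suc (suc k *' suc zh)) * U)) where

  private
   ℓ = suc zh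
   pv = qa v+
   pU = qa U+
   au : ℕ -> ℚ
   au j = bd v U d (T +' j)
   al : ℕ -> ℚ
   al j = bd v U d (T ℕ.∸ j)
   i0 = ig (ι ℓ)
   ipos : 0q ≤ i0
   ipos = ie (zj zh)
   i1 : i0 ≤ 1q
   i1 = EQ (sym (*-1ˡ i0)) ~ zb ipos (zx zh) ~ EQ (ic (zj zh))
   ρu : ℕ -> ℚ
   ρu k = 1q + (1q - upC B k) * i0
   ρu-nn : ∀ k -> k <= K -> 0q ≤ ρu k
   ρu-nn k p = nh (df i1) (nc (df (c2 k p)) ipos) ~ EQ (l (upC B k) i0)
    where l = r2 ((:1 :- v1) :+ (:1 :+ :1 :- v0) :* v1) (:1 :+ (:1 :- v0) :* v1)
   ups : ∀ k i -> k <= K -> au (suc (k *' ℓ +' i)) ≤ ρu k * au (k *' ℓ +' i)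
   ups k i p = subst (\ t -> bd v U d t ≤ ρu k * au (k *' ℓ +' i)) (sym (+-suc T (k *' ℓ +' i)))
    (bq d (T +' (k *' ℓ +' i)) {ρu k} pv pU v+
     (Hu k p ~ mb (za (ρu-nn k p) (zb pv (mn (≤⇒≤s le)))) (zb pU (mn le))))
    where
    le : T +' k *' ℓ <= T +' (k *' ℓ +' i)
    le = +-≤ℕ T (m≤m+n (k *' ℓ) i)
   module UT = UpTail au (\ j -> bg d (T +' j) pv pU) zh B K (\ k p -> c2 k (<≤ p)) (\ k i p _ -> ups k i (<≤ p)) (\ i -> ups K i ≤r) big
   ρl : ℕ -> ℚ
   ρl k = 1q - (1q - loC B k) * i0
   ρl-nn : ∀ k -> 0q ≤ ρl k
   ρl-nn k = nh (df i1) (nc (nc (zd (loDen B k)) (ie sl)) ipos) ~ EQ (l (loC B k) i0)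
    where l = r2 ((:1 :- v1) :+ v0 :* v1) (:1 :- (:1 :- v0) :* v1)
   los : ∀ k i -> k ≺ K' -> i ≺ ℓ -> ρl k * al (k *' ℓ +' i) ≤ al (suc (k *' ℓ +' i))
   los k i p q = subst (\ t -> ρl k * bd v U d t ≤ bd v U d r) (sym e)
    (bin-step-lo d r {ρl k} pv pU U+ drp (Hl k p ~ mb (zb pv (mn le1)) (za (ρl-nn k) (zb pU (mn le2)))))
    where
    j = k *' ℓ +' i
    r = T ℕ.∸ suc j
    j< : suc j <= suc k *' ℓ
    j< = ≤≤ (≤≡ (sym (+-suc (k *' ℓ) i))) (≤≤ (+-≤ℕ (k *' ℓ) q) (≤≡ (+-cmℕ (k *' ℓ) ℓ)))
    j<T : suc j <= T
    j<T = ≤≤ j< (≤≤ (ℕP.*-monoˡ-≤ ℓ p) fit)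
    e : T ℕ.∸ j ≡ suc r
    e = ℕP.+-∸-assoc 1 j<T
    le1 : T ℕ.∸ suc k *' ℓ <= suc r
    le1 = ≤⇒≤s (ℕP.∸-monoʳ-≤ T j<)
    le2 : T ℕ.∸ suc (suc k *' ℓ) <= r
    le2 = ℕP.∸-monoʳ-≤ T (≤⇒≤s j<)
    drp : 0q < ι d - ι r
    drp = <-≤ (>0 1q) (EQ (l (ι r)) ~ +-≤ˡ (- ι r) (EQ (sym (su r)) ~ mn (≤≤ (≤≡ (sym e)) (≤≤ (ℕP.m∸n≤m T j) fit'))))
     where l = r1 :1 (:1 :+ v0 :- v0)
   module LT = LoTail al (\ j -> bg d (T ℕ.∸ j) pv pU) zh B K' los

  -- Both sums are compared with the single weight at T: ℓ times `ua` in units of 1/`cd` bounds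
  -- everything from T upwards, ℓ times `lA` in the same unit is reached by the cells below T alone.
  row-tail : ι (lA B K') * ro (rep d (v , U)) T ≤ ι (ua B K) * sm (bd v U d) T
  row-tail = za (zd (lA B K')) (EQ (rowGE-up v U d T) ~ UT.up-bound (suc d) ~ EQ (ap (\ z -> ι ℓ * (ι (ua B K) * (bd v U d z * ig (ι cd)))) (n+0 T)))
   ~ EQ (l (ι (lA B K')) (ι ℓ) (ι (ua B K)) (bd v U d T * ig (ι cd)))
   ~ za (zd (ua B K)) (LT.lo-bound ~ ba (sk (T ℕ.∸ K' *' ℓ) (\ j -> bg d j pv pU)) (sym (sumTo-rev (bd v U d) T (K' *' ℓ) fit)))
   where l = r4 (v0 :* (v1 :* (v2 :* v3))) (v2 :* (v1 :* (v0 :* v3)))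

-- Ratios of tilted binomial weights near the threshold.

pT : ∀ {p q} -> p + q ≡ 1q -> p ≡ 1q - q
pT {p} {q} e = trans (l p q) (ap (_- q) e)
 where l = r2 v0 (v0 :+ v1 :- v1)

-- At X = dp(1 + ωq) the ratio (d - X)U/(Xv) is at most g(1 - ωp)/(1 + ωq). Because (1 - ωp)(1 + ω)
-- = 1 + ωq - ω²p ≤ 1 + ωq this is at most g/(1 + ω), so that p and q disappear from the scalar
-- condition that remains.
ratio-core-up : ∀ {p q d v U X g ρ ω} -> 0q < p -> 0q < q -> p + q ≡ 1q -> 0q ≤ d -> 0q ≤ v -> 0q ≤ U -> 0q ≤ ρ -> 0q ≤ 1q - ω * p ->
 d * p * (1q + ω * q) ≤ X -> U * q ≤ p * g * v -> g ≤ ρ * (1q + ω) -> d * U ≤ ρ * (X * v) + X * U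
ratio-core-up {p} {q} {d} {v} {U} {X} {g} {ρ} {ω} p+ q+ pq pd pv pU pρ pω hX hw hg = ca q+ (
 ba (nh (nc (nc (df hX) q≥) (nh (nc pρ pv) pU))
  (nh (nc (nc pd (nc q≥ pω)) (df hw)) (nh (nc (nc (nc (nc pd p≥) q≥) pv) (nc pω (df hg))) (nc (nc (nc (nc pd p≥) q≥) pv) (nc pρ (nc (sn ω) p≥))))))
  (subst (\ p -> (ρ * (X * v) + X * U) * q ≡ d * U * q + ((X - d * p * (1q + ω * q)) * q * (ρ * v + U) + (d * (q * (1q - ω * p)) * (p * g * v - U * q) + (d * p * q * v * ((1q - ω * p) * (ρ * (1q + ω) - g)) + d * p * q * v * (ρ * (ω * ω * p)))))) (sym (pT pq)) (l q d v U X g ρ ω)))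
 where
 p≥ = qa p+
 q≥ = qa q+
 l = r8 ((v6 :* (v4 :* v2) :+ v4 :* v3) :* v0) (v1 :* v3 :* v0 :+ ((v4 :- v1 :* (:1 :- v0) :* (:1 :+ v7 :* v0)) :* v0 :* (v6 :* v2 :+ v3) :+ (v1 :* (v0 :* (:1 :- v7 :* (:1 :- v0))) :* ((:1 :- v0) :* v5 :* v2 :- v3 :* v0) :+ (v1 :* (:1 :- v0) :* v0 :* v2 :* ((:1 :- v7 :* (:1 :- v0)) :* (v6 :* (:1 :+ v7) :- v5)) :+ v1 :* (:1 :- v0) :* v0 :* v2 :* (v6 :* (v7 :* v7 :* (:1 :- v0)))))))

ratio-core-lo : ∀ {p q d v U X g ρ ω} -> 0q < p -> 0q < q -> p + q ≡ 1q -> 0q ≤ d -> 0q ≤ v -> 0q ≤ U -> 0q ≤ ρ -> 0q ≤ 1q - ω * p ->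
 d * p * (1q + ω * q) ≤ X -> U * q ≤ p * g * v -> ρ * g ≤ 1q + ω -> ρ * (d * U) ≤ X * v + ρ * (X * U)
ratio-core-lo {p} {q} {d} {v} {U} {X} {g} {ρ} {ω} p+ q+ pq pd pv pU pρ pω hX hw hg = ca q+ (
 ba (nh (nc (nc (df hX) q≥) (nh pv (nc pρ pU)))
  (nh (nc (nc (nc pρ pd) (nc q≥ pω)) (df hw)) (nh (nc (nc (nc (nc pd p≥) q≥) pv) (nc pω (df hg))) (nc (nc (nc (nc pd p≥) q≥) pv) (nc (sn ω) p≥)))))
  (subst (\ p -> (X * v + ρ * (X * U)) * q ≡ ρ * (d * U) * q + ((X - d * p * (1q + ω * q)) * q * (v + ρ * U) + (ρ * d * (q * (1q - ω * p)) * (p * g * v - U * q) + (d * p * q * v * ((1q - ω * p) * (1q + ω - ρ * g)) + d * p * q * v * (ω * ω * p))))) (sym (pT pq)) (l q d v U X g ρ ω)))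
 where
 p≥ = qa p+
 q≥ = qa q+
 l = r8 ((v4 :* v2 :+ v6 :* (v4 :* v3)) :* v0) (v6 :* (v1 :* v3) :* v0 :+ ((v4 :- v1 :* (:1 :- v0) :* (:1 :+ v7 :* v0)) :* v0 :* (v2 :+ v6 :* v3) :+ (v6 :* v1 :* (v0 :* (:1 :- v7 :* (:1 :- v0))) :* ((:1 :- v0) :* v5 :* v2 :- v3 :* v0) :+ (v1 :* (:1 :- v0) :* v0 :* v2 :* ((:1 :- v7 :* (:1 :- v0)) :* (:1 :+ v7 :- v6 :* v5)) :+ v1 :* (:1 :- v0) :* v0 :* v2 :* (v7 :* v7 :* (:1 :- v0))))))

md : ∀ {a b A B} -> - A ≤ a -> a ≤ A -> - B ≤ b -> b ≤ B -> a * b ≤ A * B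
md {a} {b} {A} {B} a1 a2 b1 b2 = nj (EQ (sym (*-0ʳ (1 // 2))) ~ za by (nh (nc (df a2) (df b1)) (nc (df a1) (df b2))) ~ EQ (l a b A B))
 where
  l = r4 (:½ :* ((v2 :- v0) :* (v1 :- (:- v3)) :+ (v0 :- (:- v2)) :* (v3 :- v1))) (v2 :* v3 :- v0 :* v1)

c1000 c2000 : ℚ
c1000 = 1 // 1000
c2000 = 2000 // 1

-- To first order in the small unit `zk` the two sides differ by b - β - e, which is at least
-- 1/1000. The second-order terms have a coefficient of at most 2000, and 2·10⁶ · `zk` ≤ 1 lets the
-- slack pay for them.
scalar-up : ∀ {zk β e b ρ x} -> 0q ≤ zk -> (2000000 // 1) * zk ≤ 1q -> β + e + c1000 ≤ b -> 0q ≤ e -> e ≤ 1 // 2 -> 0q ≤ β -> β ≤ 2 // 1 -> b ≤ 2 // 1 -> - (4 // 1) ≤ ρ -> ρ ≤ 4 // 1 -> 0q ≤ x -> x ≤ 6 // 1 ->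
 (1q + (β * zk + ρ * zk)) * (1q + e * zk) ≤ (1q + (b - x) * zk) * (1q + (ρ * zk + x * zk - (1545 // 1) * (zk * zk)))
scalar-up {m} {β} {e} {b} {ρ} {x} pm hm hb pe e2 pβ β2 b2 ρ1 ρ2 px x6 =
 ba (nc pm (nh (df hb) (df hQ))) (l m β e b ρ x)
 where
 b0 : 0q ≤ b
 b0 = nh (nh pβ pe) by ~ hb
 bx1 : - (6 // 1) ≤ b - x
 bx1 = mb b0 (neg≤ x6) 
 bx2 : b - x ≤ 6 // 1
 bx2 = mb b2 (neg≤ px) ~ by
 xb1 : - (6 // 1) ≤ x - b
 xb1 = by ~ mb px (neg≤ b2)
 xb2 : x - b ≤ 6 // 1
 xb2 = mb x6 (neg≤ b0)
 m1 : m ≤ 1q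
 m1 = EQ (sym (*-1ˡ m)) ~ zb {1q} {2000000 // 1} pm by ~ hm
 Q = (1545 // 1) + ((β + ρ) * e + ((x - b) * (ρ + x) + (1545 // 1) * ((b - x) * m)))
 Qb : Q ≤ c2000
 Qb = mb (≤-refl {1545 // 1}) (mb (md {A = 6 // 1} {B = 1 // 2} (by ~ mb pβ ρ1) (mb β2 ρ2) (by ~ pe) e2)
  (mb (md {A = 6 // 1} {B = 10 // 1} xb1 xb2 (by ~ mb ρ1 px) (mb ρ2 x6))
   (EQ (l3 b x m) ~ md {A = 6 // 1} {B = 1 // 100} bx1 bx2 (by ~ nc {1545 // 1} by pm) mm))) ~ by
  where
  mm : (1545 // 1) * m ≤ 1 // 100
  mm = EQ (l2 m) ~ za {c = 1545 // 2000000} by hm ~ by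
   where l2 = r1 ((1545 :/ 1) :* v0) ((1545 :/ 2000000) :* ((2000000 :/ 1) :* v0))
  l3 = r3 ((1545 :/ 1) :* ((v0 :- v1) :* v2)) ((v0 :- v1) :* ((1545 :/ 1) :* v2))
 hQ : m * Q ≤ c1000
 hQ = za pm Qb ~ EQ (l2 m) ~ za {c = 1 // 1000} by hm ~ by
  where l2 = r1 (v0 :* (2000 :/ 1)) ((1 :/ 1000) :* ((2000000 :/ 1) :* v0))
 l = r6 ((:1 :+ (v3 :- v5) :* v0) :* (:1 :+ (v4 :* v0 :+ v5 :* v0 :- (1545 :/ 1) :* (v0 :* v0)))) ((:1 :+ (v1 :* v0 :+ v4 :* v0)) :* (:1 :+ v2 :* v0) :+ v0 :* ((v3 :- (v1 :+ v2 :+ (1 :/ 1000))) :+ ((1 :/ 1000) :- v0 :* ((1545 :/ 1) :+ ((v1 :+ v4) :* v2 :+ ((v5 :- v3) :* (v4 :+ v5) :+ (1545 :/ 1) :* ((v3 :- v5) :* v0)))))))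

scalar-lo : ∀ {zk β e b ρ x} -> 0q ≤ zk -> (2000000 // 1) * zk ≤ 1q -> β + e + c1000 ≤ b -> 0q ≤ e -> e ≤ 1 // 2 -> 0q ≤ β -> β ≤ 2 // 1 -> b ≤ 2 // 1 -> - (4 // 1) ≤ ρ -> ρ ≤ 4 // 1 -> 0q ≤ x -> x ≤ 6 // 1 ->
 (1q - (b + x) * zk) * ((1q + (β * zk + ρ * zk)) * (1q + e * zk)) ≤ 1q + (ρ * zk - x * zk - (4 // 1) * (zk * zk))
scalar-lo {m} {β} {e} {b} {ρ} {x} pm hm hb pe e2 pβ β2 b2 ρ1 ρ2 px x6 =
 ba (nc pm (nh (df hb) (df hQ))) (l m β e b ρ x)
 where
 b0 : 0q ≤ b
 b0 = nh (nh pβ pe) by ~ hb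
 m1 : m ≤ 1q
 m1 = EQ (sym (*-1ˡ m)) ~ zb {1q} {2000000 // 1} pm by ~ hm
 W = (β + ρ + e) + (β + ρ) * e * m
 br1 : - (6 // 1) ≤ β + ρ
 br1 = by ~ mb pβ ρ1
 br2 : β + ρ ≤ 6 // 1
 br2 = mb β2 ρ2
 be2 : (β + ρ) * e ≤ 3 // 1
 be2 = md {A = 6 // 1} {B = 1 // 2} br1 br2 (by ~ pe) e2
 be1 : - ((β + ρ) * e) ≤ 3 // 1
 be1 = EQ (ll (β + ρ) e) ~ md {A = 6 // 1} {B = 1 // 2} (neg≤ br2) (neg≤ br1) (by ~ pe) e2
  where ll = r2 (:- (v0 :* v1)) ((:- v0) :* v1)
 W1 : - W ≤ 12 // 1
 W1 = EQ (ll (β + ρ) e m) ~ mb (mb (neg≤ br1) (neg≤ pe)) (zb pm be1 ~ za (by {0q} {3 // 1}) m1) ~ by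
  where ll = r3 (:- ((v0 :+ v1) :+ v0 :* v1 :* v2)) ((:- v0) :+ (:- v1) :+ (:- (v0 :* v1)) :* v2)
 Q = (4 // 1) + ((β + ρ) * e + (b + x) * (- W))
 Qb : Q ≤ c2000
 Qb = mb (≤-refl {4 // 1}) (mb be2 (za (nh b0 px) W1 ~ zb (by {0q} {12 // 1}) (mb b2 x6))) ~ by
 hQ : m * Q ≤ c1000
 hQ = za pm Qb ~ EQ (l2 m) ~ za {c = 1 // 1000} by hm ~ by
  where l2 = r1 (v0 :* (2000 :/ 1)) ((1 :/ 1000) :* ((2000000 :/ 1) :* v0))
 l = r6 (:1 :+ (v4 :* v0 :- v5 :* v0 :- :4 :* (v0 :* v0))) ((:1 :- (v3 :+ v5) :* v0) :* ((:1 :+ (v1 :* v0 :+ v4 :* v0)) :* (:1 :+ v2 :* v0)) :+ v0 :* ((v3 :- (v1 :+ v2 :+ (1 :/ 1000))) :+ ((1 :/ 1000) :- v0 :* (:4 :+ ((v1 :+ v4) :* v2 :+ (v3 :+ v5) :* (:- ((v1 :+ v4 :+ v2) :+ (v1 :+ v4) :* v2 :* v0)))))))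

inv-unique : ∀ {x y} -> 0q < x -> x * y ≡ 1q -> ig x ≡ y
inv-unique {x} {y} p e = trans (sym (*-1ʳ (ig x))) (ap (ig x *_) (sym e) >> l (ig x) x y >> ap (_* y) (ic p) >> *-1ˡ y)
 where l = r3 (v0 :* (v1 :* v2)) (v1 :* v0 :* v2)

-- `suc nB` is 128 · 128 · 1000: cells are 1/128 of a standard deviation wide and slopes are given
-- in thousandths, so 1 - c = (B/1000 - k/128)/128 has exactly this denominator. `suc nScale` = 10⁹
-- is the resolution of the tables.
opaque
 nB nScale : ℕ
 nB = 16383999
 nScale = 999999999

 nBig≡ : suc nB ≡ 16384000
 nBig≡ = refl
 nBig≡′ : nB ≡ 16383999
 nBig≡′ = refl
 nScale≡ : nScale ≡ 999999999
 nScale≡ = refl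

-- At distance x standard deviations from the threshold the logarithm of a tilted Gaussian has slope
-- b - x. Upper bounds take the slope at the start of cell k, lower bounds at its far end, hence
-- `suc k` in `ldn`.
udn ldn : ℕ -> ℕ -> ℕ -> ℕ
udn n B k = (n +' 1000 *' k) ℕ.∸ 128 *' B
ldn n B k = suc n ℕ.∸ (128 *' B +' 1000 *' suc k)

lj : ∀ n B k -> ldn n B k <= suc n
lj n B k = ℕP.m∸n≤m (suc n) (128 *' B +' 1000 *' suc k)

ud0 ld0 : ℕ -> ℕ -> ℕ
ud0 = udn nB
ld0 = ldn nB

open RowTail nB nScale ud0 ld0 (lj nB) public

wo : ℕ -> ℕ -> ℕ -> ℕ -> ℕ -> ℕ -> ℕ -> Bool
wo A B C D e0 u l = (u *' u *' A) ℕ.≤ᵇ (B *' ((u +' l) *' (u +' l)) *' (C +' D *' (e0 *' e0)))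

wn : ∀ A B C D e0 u l -> T (wo A B C D e0 u l) -> ι u * ι u * ι A ≤ ι B * ((ι u + ι l) * (ι u + ι l)) * (ι C + ι D * (ι e0 * ι e0))
wn A B C D e0 u l t = EQ (sym (zn (u *' u) A >> ap (_* ι A) (zn u u)))
 ~ mn (ℕP.≤ᵇ⇒≤ (u *' u *' A) (B *' ((u +' l) *' (u +' l)) *' (C +' D *' (e0 *' e0))) t)
 ~ EQ (trans (zn (B *' ((u +' l) *' (u +' l))) (C +' D *' (e0 *' e0))) (ap₂ _*_ (zn B ((u +' l) *' (u +' l)) >> ap (ι B *_) (zn (u +' l) (u +' l) >> ap₂ _*_ (zq u l) (zq u l)))
  (zq C (D *' (e0 *' e0)) >> ap (ι C +_) (zn D (e0 *' e0) >> ap (ι D *_) (zn e0 e0)))))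

wi : ℕ -> ℕ -> ℕ -> Bool
wi = wo 100000000000000 8464 10000000000 9999

li : ∀ m -> ι m ≡ m // 1
li m = ι-def m

zg : ℚ
zg = 13 // 10

cN : ι (suc nB) ≡ 16384000 // 1
cN = trans (ap ι nBig≡) (li 16384000)

invNum : ig (ι (suc nB)) ≡ 1 // 16384000
invNum = inv-unique (zj nB) (ap (_* (1 // 16384000)) cN)

upC≡ : ∀ B k -> 128 *' B <= nB -> 1q - upC B k ≡ (ι B * (1 // 1000) - ι k * (1 // 128)) * (1 // 128)
upC≡ B k h = trans (ap₂ (\ a b -> 1q - a * b) e invNum) (l (ι B) (ι k))
 where
 e0 : suc (ud0 B k) +' 128 *' B ≡ suc nB +' 1000 *' k
 e0 = ap suc (ℕP.m∸n+n≡m (≤≤ h (m≤m+n nB (1000 *' k))))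
 e : ι (suc (ud0 B k)) ≡ (16384000 // 1) + (1000 // 1) * ι k - (128 // 1) * ι B
 e = trans (l0 (ι (suc (ud0 B k))) (ι (128 *' B))) (ap₂ _-_ (sym (zq (suc (ud0 B k)) (128 *' B)) >> ap ι e0 >> zq (suc nB) (1000 *' k) >> ap₂ _+_ cN (zn 1000 k >> ap (_* ι k) (li 1000)))
  (zn 128 B >> ap (_* ι B) (li 128)))
  where l0 = r2 v0 (v0 :+ v1 :- v1)
 l = r2 (:1 :- ((16384000 :/ 1) :+ (1000 :/ 1) :* v1 :- (128 :/ 1) :* v0) :* (1 :/ 16384000)) ((v0 :* (1 :/ 1000) :- v1 :* (1 :/ 128)) :* (1 :/ 128))

loC≡ : ∀ B k -> 128 *' B +' 1000 *' suc k <= suc nB -> 1q - loC B k ≡ (ι B * (1 // 1000) + ι (suc k) * (1 // 128)) * (1 // 128)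
loC≡ B k h = trans (ap₂ (\ a b -> 1q - a * b) e invNum) (l (ι B) (ι (suc k)))
 where
 e : ι (ld0 B k) ≡ (16384000 // 1) - ((128 // 1) * ι B + (1000 // 1) * ι (suc k))
 e = trans (l0 (ι (ld0 B k)) (ι (128 *' B +' 1000 *' suc k))) (ap₂ _-_ (sym (zq (ld0 B k) (128 *' B +' 1000 *' suc k)) >> ap ι (ℕP.m∸n+n≡m h) >> cN)
  (zq (128 *' B) (1000 *' suc k) >> ap₂ _+_ (zn 128 B >> ap (_* ι B) (li 128)) (zn 1000 (suc k) >> ap (_* ι (suc k)) (li 1000))))
  where l0 = r2 v0 (v0 :+ v1 :- v1)
 l = r2 (:1 :- ((16384000 :/ 1) :- ((128 :/ 1) :* v0 :+ (1000 :/ 1) :* v1)) :* (1 :/ 16384000)) ((v0 :* (1 :/ 1000) :+ v1 :* (1 :/ 128)) :* (1 :/ 128))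

-- Lengths are measured in standard deviations: Λ = 128ℓ is about √(dpq), `zk` is 1/Λ, and T lies at
-- least about ρ standard deviations above the untilted mean dp. The odds U/v are tilted by at most
-- about (1.3 + ρ + e) `zk`, so the log-weight has slope at most about 1.3 + e at T; b exceeds this
-- by 1/1000.
module Window (p q : ℚ) (p+ : 0q < p) (q+ : 0q < q) (pq : p + q ≡ 1q) (d T zh : ℕ) (ρ : ℚ) (ρ1 : - (4 // 1) ≤ ρ) (ρ2 : ρ ≤ 4 // 1)
 (small : (2000000 // 1) * ((1 // 128) * ig (ι (suc zh))) ≤ 1q)
 (Δlo : ((128 // 1) * ι (suc zh)) * ((128 // 1) * ι (suc zh)) ≤ ι d * (p * q))
 (Δhi : ι d * (p * q) ≤ ((128 // 1) * ι (suc zh) + (128 // 1)) * ((128 // 1) * ι (suc zh) + (128 // 1)))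
 (hT : ι d * p + ρ * ((1 // 128) * ig (ι (suc zh))) * (ι d * (p * q)) ≤ ι T + (3 // 1))
 (T≤d : T <= d) (fit : suc (512 *' suc zh) <= T) where

 iℓ zk Λ Δ : ℚ
 iℓ = ig (ι (suc zh))
 zk = (1 // 128) * iℓ
 Λ = (128 // 1) * ι (suc zh)
 Δ = ι d * (p * q)

 Λλ : Λ * zk ≡ 1q
 Λλ = trans (l (ι (suc zh)) iℓ) (ic (zj zh))
  where l = r2 (((128 :/ 1) :* v0) :* ((1 :/ 128) :* v1)) (v0 :* v1)
 λ+ : 0q < zk
 λ+ = pos-* (>0 (1 // 128)) (io (zj zh))
 p6 : 0q ≤ zk
 p6 = qa λ+
 p1 : p ≤ 1q
 p1 = ba (qa q+) (sym pq)
 pΔ : 0q ≤ Δ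
 pΔ = nc (zd d) (nc (qa p+) (qa q+))

 λΔ : Λ ≤ zk * Δ
 λΔ = EQ (sym (*-1ˡ Λ) >> ap (_* Λ) (sym Λλ) >> l Λ zk) ~ za p6 Δlo
  where l = r2 (v0 :* v1 :* v0) (v1 :* (v0 :* v0))
 λλΔ : 1q ≤ zk * zk * Δ
 λλΔ = EQ (sym Λλ >> *-cm Λ zk) ~ za p6 λΔ ~ EQ (sym (*-as zk zk Δ))

 private
  sy : ∀ c -> 0q ≤ c -> c ≤ 2000000 // 1 -> c * zk ≤ 1q
  sy c pc hc = zb p6 hc ~ small

  xΔ : ∀ x -> 0q ≤ x -> x ≤ 6 // 1 -> x * zk * Δ ≤ x * Λ + (1542 // 1)
  xΔ x px x6 = za (nc px p6) Δhi ~ EQ (l x zk Λ >> ap₂ (\ s t -> x * s * Λ + x * ((256 // 1) * t) + x * ((16384 // 1) * zk)) (*-cm zk Λ >> Λλ) (*-cm zk Λ >> Λλ))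
   ~ ℚP.≤-trans (mb (mb (EQ (l2 x Λ)) (zb {x} {6 // 1} by x6)) (ma px (nc {16384 // 1} by p6) x6 (sy (16384 // 1) by by))) (EQ (l3 x Λ))
   where
   l = r3 (v0 :* v1 :* ((v2 :+ (128 :/ 1)) :* (v2 :+ (128 :/ 1)))) (v0 :* (v1 :* v2) :* v2 :+ v0 :* ((256 :/ 1) :* (v1 :* v2)) :+ v0 :* ((16384 :/ 1) :* v1))
   l2 = r2 (v0 :* :1 :* v1) (v0 :* v1)
   l3 = r2 (v0 :* v1 :+ (6 :/ 1) :* ((256 :/ 1) :* :1) :+ (6 :/ 1) :* :1) (v0 :* v1 :+ (1542 :/ 1))

  ω-ok : ∀ ω -> ω ≤ 1q -> 0q ≤ 1q - ω * p
  ω-ok ω h = df (zb (qa p+) h ~ EQ (*-1ˡ p) ~ p1)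

  kx : ∀ k -> k <= 768 -> ι k * (1 // 128) ≤ 6 // 1
  kx k h = zb {c = 1 // 128} by (mn h ~ EQ (li 768)) ~ by

  kℓ : ∀ k -> ι (k *' suc zh) ≡ (ι k * (1 // 128)) * Λ
  kℓ k = trans (zn k (suc zh)) (l (ι k) (ι (suc zh)))
   where l = r2 (v0 :* v1) ((v0 :* (1 :/ 128)) :* ((128 :/ 1) :* v1))

 module _ (e1 : ℕ) (he1 : e1 <= 428) (v U : ℚ) (v+ : 0q < v) (U+ : 0q < U) where
  e b : ℚ
  e = ι e1 * (1 // 1000)
  B : ℕ
  B = 1301 +' e1
  b = ι B * (1 // 1000)
  g : ℚ
  g = (1q + (zg * zk + ρ * zk)) * (1q + e * zk)
  private
   b≡ : b ≡ zg + e + c1000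
   b≡ = trans (ap (_* (1 // 1000)) (zq 1301 e1 >> ap (_+ ι e1) (li 1301))) (l (ι e1))
    where l = r1 (((1301 :/ 1) :+ v0) :* (1 :/ 1000)) ((13 :/ 10) :+ v0 :* (1 :/ 1000) :+ (1 :/ 1000))
   hb : zg + e + c1000 ≤ b
   hb = EQ (sym b≡)
   pe : 0q ≤ e
   pe = nc (zd e1) by
   e2 : e ≤ 1 // 2
   e2 = zb {c = 1 // 1000} by (mn he1 ~ EQ (li 428)) ~ by
   b2 : b ≤ 2 // 1
   b2 = EQ b≡ ~ mb (mb (≤-refl {zg}) e2) (≤-refl {c1000}) ~ by
   B≤ : B <= 1729
   B≤ = +-≤ℕ 1301 he1
   BB : 128 *' B <= 221312
   BB = ℕP.*-monoʳ-≤ 128 B≤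
   BB1 : 128 *' B <= nB
   BB1 = ≤-pred (≤≤ (ℕ.s≤s BB) (≤≤ (toWitness {a? = 221313 ℕ.≤? 16384000} tt) (≤≡ (sym nBig≡))))

  ww : U * q ≤ p * g * v -> ι (lA B 512) * ro (rep d (v , U)) T ≤ ι (ua B 768) * sm (bd v U d) T
  -- 768 cells reach six standard deviations above the threshold, 512 cells four below it.
  ww hw = row-tail v U d T zh B 768 512 v+ U+ c2 Hu big (<≤ fit) T≤d Hl
   where
   ρu : ∀ k -> 1q + (1q - upC B k) * iℓ ≡ 1q + (b - ι k * (1 // 128)) * zk
   ρu k = trans (ap (\ t -> 1q + t * iℓ) (upC≡ B k BB1)) (l b (ι k * (1 // 128)) iℓ)
    where l = r3 (:1 :+ (v0 :- v1) :* (1 :/ 128) :* v2) (:1 :+ (v0 :- v1) :* ((1 :/ 128) :* v2))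
   b0 : 0q ≤ b
   b0 = nh (nh (by {0q} {zg}) pe) (by {0q} {c1000}) ~ hb
   bx : ∀ k -> k <= 768 -> - (6 // 1) ≤ b - ι k * (1 // 128)
   bx k hk = mb b0 (neg≤ (kx k hk))
   c2 : ∀ k -> k <= 768 -> upC B k ≤ 1q + 1q
   c2 k hk = nj ((by {0q} {1q + (- (6 // 1)) * (1 // 128)}) ~ +-≤ʳ 1q (zb {c = 1 // 128} by (bx k hk) ~ EQ (sym (upC≡ B k BB1))) ~ EQ (l (upC B k)))
    where l = r1 (:1 :+ (:1 :- v0)) (:1 :+ :1 :- v0)
   big : suc (suc nB) <= suc (ud0 B 768)
   big = ℕ.s≤s (ℕP.m+n≤o⇒m≤o∸n (suc nB) (≤≤ (≤≡ (sym (+-suc nB (128 *' B)))) (+-≤ℕ nB (≤≤ (ℕ.s≤s BB) (toWitness {a? = 221313 ℕ.≤? 768000} tt)))))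
   Hu : ∀ k -> k <= 768 -> ι d * U ≤ (1q + (1q - upC B k) * ig (ι (suc zh))) * (ι (T +' k *' suc zh) * v) + ι (T +' k *' suc zh) * U
   Hu k hk = subst (\ z -> ι d * U ≤ z * (ι (T +' k *' suc zh) * v) + ι (T +' k *' suc zh) * U) (sym (ρu k))
    (ratio-core-up {p} {q} {ι d} {v} {U} {ι (T +' k *' suc zh)} {g} {1q + (b - x) * zk} {ω} p+ q+ pq (zd d) (qa v+) (qa U+) pρ (ω-ok ω ω1) hX hw
     (scalar-up {zk} {zg} {e} {b} {ρ} {x} p6 small hb pe e2 (by {0q} {zg}) (by {zg} {2 // 1}) b2 ρ1 ρ2 px (kx k hk)))
    where
    x = ι k * (1 // 128)
    px : 0q ≤ x
    px = nc (zd k) by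
    -- 1545 = 1542 + 3: the error of replacing Δ by Λ² in `xΔ`, and the rounding of T granted by
    -- `hT`. Subtracting 1545 `zk`² suffices since `zk`²Δ ≥ 1.
    ω = ρ * zk + x * zk - (1545 // 1) * (zk * zk)
    pρ : 0q ≤ 1q + (b - x) * zk
    pρ = df (sy (6 // 1) by by) ~ EQ (l zk) ~ +-≤ʳ 1q (zb p6 (bx k hk))
     where l = r1 (:1 :- (6 :/ 1) :* v0) (:1 :+ (:- (6 :/ 1)) :* v0)
    ω1 : ω ≤ 1q
    ω1 = ba (nc {1545 // 1} by (nc p6 p6)) (l (ρ * zk + x * zk) ((1545 // 1) * (zk * zk))) ~ mb (zb p6 ρ2) (zb p6 (kx k hk)) ~ EQ (l2 zk) ~ sy (10 // 1) by by
     where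
     l = r2 v0 ((v0 :- v1) :+ v1)
     l2 = r1 (:4 :* v0 :+ (6 :/ 1) :* v0) ((10 :/ 1) :* v0)
    hX : ι d * p * (1q + ω * q) ≤ ι (T +' k *' suc zh)
    hX = EQ (l (ι d) p q (ρ * zk) (x * zk) (zk * zk))
     ~ mb (mb hT (xΔ x px (kx k hk))) (neg≤ (za {c = 1545 // 1} by λλΔ)) ~ EQ (l2 (ι T) (x * Λ)) ~ EQ (sym (zq T (k *' suc zh) >> ap (ι T +_) (kℓ k)))
     where
     l = r6 (v0 :* v1 :* (:1 :+ (v3 :+ v4 :- (1545 :/ 1) :* v5) :* v2)) (v0 :* v1 :+ v3 :* (v0 :* (v1 :* v2)) :+ v4 :* (v0 :* (v1 :* v2)) :+ :- ((1545 :/ 1) :* (v5 :* (v0 :* (v1 :* v2)))))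
     l2 = r2 (v0 :+ :3 :+ (v1 :+ (1542 :/ 1)) :+ :- ((1545 :/ 1) :* :1)) (v0 :+ v1)
   Hl : ∀ k -> k ≺ 512 -> (1q - (1q - loC B k) * ig (ι (suc zh))) * (ι d * U) ≤ ι (T ℕ.∸ suc k *' suc zh) * v + (1q - (1q - loC B k) * ig (ι (suc zh))) * (ι (T ℕ.∸ suc (suc k *' suc zh)) * U)
   Hl k hk = subst (\ z -> z * (ι d * U) ≤ ι (T ℕ.∸ m) * v + z * (X * U)) (sym ρl)
    (ratio-core-lo {p} {q} {ι d} {v} {U} {X} {g} {ρ'} {ω} p+ q+ pq (zd d) (qa v+) (qa U+) pρ (ω-ok ω ω1) hX hw
     (scalar-lo {zk} {zg} {e} {b} {ρ} {x} p6 small hb pe e2 (by {0q} {zg}) (by {zg} {2 // 1}) b2 ρ1 ρ2 px x6)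
     ~ +-≤ˡ (ρ' * (X * U)) (zb (qa v+) (mn (ℕP.∸-monoʳ-≤ T (n≤sn m)))))
    where
    m = suc k *' suc zh
    X = ι (T ℕ.∸ suc m)
    x = ι (suc k) * (1 // 128)
    px : 0q ≤ x
    px = nc (zd (suc k)) by
    x6 = kx (suc k) (≤≤ hk (toWitness {a? = 512 ℕ.≤? 768} tt))
    ρ' = 1q - (b + x) * zk
    -- 4 = 3 + 1: the rounding of T granted by `hT`, and the `suc` in the position X = T - `suc m`.
    ω = ρ * zk - x * zk - (4 // 1) * (zk * zk)
    ρl : 1q - (1q - loC B k) * ig (ι (suc zh)) ≡ ρ'
    ρl = trans (ap (\ t -> 1q - t * iℓ) (loC≡ B k (≤≤ (ℕP.+-mono-≤ BB (ℕP.*-monoʳ-≤ 1000 hk)) (≤≤ (toWitness {a? = (221312 +' 512000) ℕ.≤? 16384000} tt) (≤≡ (sym nBig≡)))))) (l b x iℓ)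
     where l = r3 (:1 :- (v0 :+ v1) :* (1 :/ 128) :* v2) (:1 :- (v0 :+ v1) :* ((1 :/ 128) :* v2))
    pρ : 0q ≤ ρ'
    pρ = df (zb p6 (mb b2 x6) ~ sy ((2 // 1) + (6 // 1)) by by)
    ω1 : ω ≤ 1q
    ω1 = ba (nh (nc px p6) (nc {4 // 1} by (nc p6 p6))) (l (ρ * zk) (x * zk) ((4 // 1) * (zk * zk))) ~ zb p6 ρ2 ~ sy (4 // 1) by by
     where l = r3 v0 ((v0 :- v1 :- v2) :+ (v1 :+ v2))
    m≤ : suc m <= T
    m≤ = ≤≤ (ℕ.s≤s (ℕP.*-monoˡ-≤ (suc zh) hk)) fit
    Xe : X ≡ ι T - (1q + x * Λ)
    Xe = trans (l X (1q + x * Λ)) (ap (_- (1q + x * Λ)) (ap (X +_) (ap (1q +_) (sym (kℓ (suc k))) >> sym (su m)) >> sym (zq (T ℕ.∸ suc m) (suc m)) >> ap ι (ℕP.m∸n+n≡m m≤)))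
     where l = r2 v0 (v0 :+ v1 :- v1)
    hX : ι d * p * (1q + ω * q) ≤ X
    hX = EQ (l (ι d) p q (ρ * zk) x zk)
     ~ mb (mb hT (neg≤ (za px λΔ))) (neg≤ (za {c = 4 // 1} by λλΔ)) ~ EQ (l2 (ι T) (x * Λ) >> sym Xe)
     where
     l = r6 (v0 :* v1 :* (:1 :+ (v3 :- v4 :* v5 :- :4 :* (v5 :* v5)) :* v2)) (v0 :* v1 :+ v3 :* (v0 :* (v1 :* v2)) :+ :- (v4 :* (v5 :* (v0 :* (v1 :* v2)))) :+ :- (:4 :* (v5 :* v5 :* (v0 :* (v1 :* v2)))))
     l2 = r2 (v0 :+ :3 :+ :- v1 :+ :- (:4 :* :1)) (v0 :- (:1 :+ v1))

-- Matching on the two equations swaps the opaque constants for literals, after which the tables are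
-- evaluated by built-in arithmetic on naturals.
upEval-lit : ∀ n s -> n ≡ 16383999 -> s ≡ 999999999 -> ∀ B K -> Cells.upEval n s (udn n) (ldn n) (lj n) B K ≡ Cells.upEval 16383999 999999999 (udn 16383999) (ldn 16383999) (lj 16383999) B K
upEval-lit n s refl refl B K = refl

loEval-lit : ∀ n s -> n ≡ 16383999 -> s ≡ 999999999 -> ∀ B K -> Cells.loEval n s (udn n) (ldn n) (lj n) B K ≡ Cells.loEval 16383999 999999999 (udn 16383999) (ldn 16383999) (lj 16383999) B K
loEval-lit n s refl refl B K = refl

litUp litLo : ℕ -> ℕ -> ℕ
litUp = Cells.upEval 16383999 999999999 (udn 16383999) (ldn 16383999) (lj 16383999)
litLo = Cells.loEval 16383999 999999999 (udn 16383999) (ldn 16383999) (lj 16383999)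

upTotal-lit : ∀ B K -> ua B K ≡ litUp B K
upTotal-lit B K = trans (upTotal-eval B K) (upEval-lit nB nScale nBig≡′ nScale≡ B K)

loAcc-lit : ∀ B K -> lA B K ≡ litLo B K
loAcc-lit B K = trans (loAcc-eval B K) (loEval-lit nB nScale nBig≡′ nScale≡ B K)

-- u/(u + l) bounds the fraction of a row above its threshold. It is computed at the right end e1,
-- where the weights are tilted most, and may exceed 0.92 by the penalty factor belonging to the
-- left end e0: (u/(u + l))² ≤ 0.8464 (1 + 0.9999 (e0/1000)²).
Wd : ℕ -> ℕ -> Set
Wd e0 e1 = ∃[ u ] ∃[ l ] (ua (1301 +' e1) 768 ≡ u × lA (1301 +' e1) 512 ≡ l × T (wi e0 u l))

wd : ∀ e0 e1 u l -> litUp (1301 +' e1) 768 ≡ u -> litLo (1301 +' e1) 512 ≡ l -> T (wi e0 u l) -> Wd e0 e1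
wd e0 e1 u l hu hl t = u , l , trans (upTotal-lit (1301 +' e1) 768) hu , trans (loAcc-lit (1301 +' e1) 512) hl , t

w01 : Wd 0 60
w01 = wd 0 60 749419457431 69241963208 refl refl tt
w02 : Wd 60 100
w02 = wd 60 100 797639715422 67970676619 refl refl tt
w03 : Wd 100 120
w03 = wd 100 120 823274424583 67350173676 refl refl tt
w04 : Wd 120 135
w04 = wd 120 135 843208534307 66891241891 refl refl tt
w05 : Wd 135 147
w05 = wd 135 147 859609643079 66528007594 refl refl tt
w06 : Wd 147 159
w06 = wd 147 159 876427046368 66168202177 refl refl tt
w07 : Wd 159 171
w07 = wd 159 171 893673121594 65811779112 refl refl tt
w08 : Wd 171 183
w08 = wd 171 183 911360582022 65458696835 refl refl tt
w09 : Wd 183 198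
w09 = wd 183 198 934110780510 65021977927 refl refl tt
w10 : Wd 198 218
w10 = wd 198 218 965595676161 64447560663 refl refl tt
w11 : Wd 218 248
w11 = wd 218 248 1015426416905 63602428136 refl refl tt
w12 : Wd 248 308
w12 = wd 248 308 1125367097622 61969295970 refl refl tt
w13 : Wd 308 368
w13 = wd 308 368 1250872610862 60408489277 refl refl tt
w14 : Wd 368 428
w14 = wd 368 428 1394533362230 58915682306 refl refl tt

-- The row factor 0.92.

ec : ℕ -> ℚ
ec e0 = (9999 // 10000) * ((ι e0 * (1 // 1000)) * (ι e0 * (1 // 1000)))

ee : ∀ e0 -> 0q ≤ ec e0
ee e0 = nc {9999 // 10000} by (sn (ι e0 * (1 // 1000)))

wT : ∀ e0 u l -> T (wi e0 u l) -> ι u * ι u * (10000 // 1) ≤ (8464 // 1) * ((ι u + ι l) * (ι u + ι l)) * (1q + ec e0)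
wT e0 u l t = ca {c = 10000000000 // 1} (>0 (10000000000 // 1)) (EQ (l1 (ι u) >> ap (ι u * ι u *_) (sym (li 100000000000000)))
 ~ wn 100000000000000 8464 10000000000 9999 e0 u l t
 ~ EQ (ap₂ (\ b c -> b * ((ι u + ι l) * (ι u + ι l)) * c) (li 8464) (ap₂ (\ c d -> c + d * (ι e0 * ι e0)) (li 10000000000) (li 9999)) >> l2 ((ι u + ι l) * (ι u + ι l)) (ι e0)))
 where
 l1 = r1 (v0 :* v0 :* (10000 :/ 1) :* (10000000000 :/ 1)) (v0 :* v0 :* (100000000000000 :/ 1))
 l2 = r2 ((8464 :/ 1) :* v0 :* ((10000000000 :/ 1) :+ (9999 :/ 1) :* (v1 :* v1))) ((8464 :/ 1) :* v0 :* (:1 :+ (9999 :/ 10000) :* ((v1 :* (1 :/ 1000)) :* (v1 :* (1 :/ 1000)))) :* (10000000000 :/ 1))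

pow-excess : ∀ c d -> 0q ≤ c -> c ≤ 1q -> (1q - c * ig (ι (suc d))) ^ suc d * (1q + c) ≤ 1q
pow-excess c d pc c1 = za (ng (suc d) px) (EQ (ap (1q +_) (sym (*-1ʳ c) >> ap (c *_) (sym (ic (zj d))) >> l2 c (ι (suc d)) (ig (ι (suc d))))) ~ bo (suc d) (nh ze (nc pc ip)))
 ~ EQ (sym (zi (1q - x) (1q + x) (suc d))) ~ zy (suc d) (nc px (nh ze (nc pc ip))) (ba (sn x) (l x))
 where
 ip = ie (zj d)
 x = c * ig (ι (suc d))
 i1 : ig (ι (suc d)) ≤ 1q
 i1 = EQ (sym (*-1ˡ (ig (ι (suc d))))) ~ zb ip (zx d) ~ EQ (ic (zj d))
 px : 0q ≤ 1q - x
 px = df (ma pc ip c1 i1 ~ EQ (*-1ˡ 1q))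
 l = r1 :1 ((:1 :- v0) :* (:1 :+ v0) :+ v0 :* v0)
 l2 = r3 (v0 :* (v1 :* v2)) (v1 :* (v0 :* v2))

z8 : ∀ {m} {t : T (m ℕ.≤ᵇ 428)} -> m <= 428
z8 {m} {t} = ℕP.≤ᵇ⇒≤ m 428 t

-- The pair (v, U) is arbitrary, whereas the tilt fixes Y. At U = Yv Cauchy-Schwarz for (v + U)² is
-- sharp and the fraction above the threshold is about Φ(1.3) = 0.903 < 0.92. A larger U/v raises
-- that fraction, but Cauchy-Schwarz then loses a definite factor; the windows follow this
-- trade-off.
module Kappa (p q : ℚ) (p+ : 0q < p) (q+ : 0q < q) (pq : p + q ≡ 1q) (d' T zh : ℕ) (ρ : ℚ) (ρ0 : 0q ≤ zg + ρ) (ρ2 : ρ ≤ 4 // 1)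
 (small : (2000000 // 1) * ((1 // 128) * ig (ι (suc zh))) ≤ 1q)
 (Δlo : ((128 // 1) * ι (suc zh)) * ((128 // 1) * ι (suc zh)) ≤ ι (suc d') * (p * q))
 (Δhi : ι (suc d') * (p * q) ≤ ((128 // 1) * ι (suc zh) + (128 // 1)) * ((128 // 1) * ι (suc zh) + (128 // 1)))
 (hT : ι (suc d') * p + ρ * ((1 // 128) * ig (ι (suc zh))) * (ι (suc d') * (p * q)) ≤ ι T + (3 // 1))
 (T≤d : T <= suc d') (fit : suc (512 *' suc zh) <= T)
 (Y : ℚ) (Y+ : 0q < Y) (hY : Y * q ≡ p * (1q + (zg * ((1 // 128) * ig (ι (suc zh))) + ρ * ((1 // 128) * ig (ι (suc zh)))))) where

 ρ1 : - (4 // 1) ≤ ρ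
 ρ1 = (by { - (4 // 1)} { - zg}) ~ nj (ρ0 ~ EQ (l ρ))
  where l = r1 ((13 :/ 10) :+ v0) (v0 :- (:- (13 :/ 10)))
 open Window p q p+ q+ pq (suc d') T zh ρ ρ1 ρ2 small Δlo Δhi hT T≤d fit
 d = suc d'
 iY φ : ℚ
 iY = ig Y
 φ = zg * zk + ρ * zk
 pφ : 0q ≤ φ
 pφ = nc ρ0 p6 ~ EQ (ℚP.*-distribʳ-+ zk zg ρ)
 pY = qa Y+
 piY : 0q ≤ iY
 piY = ie Y+

 module _ (v U : ℚ) (v+ : 0q < v) (U+ : 0q < U) where
  Qf : ℚ
  Qf = v * v + U * U * iY
  low : ℕ -> Set
  low zero = ⊤
  low (suc e0) = Y * (1q + ι (suc e0) * (1 // 1000) * zk) * v ≤ U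

  pen0 : (v + U) * (v + U) ≤ (1q + Y) * Qf
  pen0 = ba (nc (sn (U - Y * v)) piY) (trans (l v U Y iY) (ap (\ t -> (v + U) * (v + U) + (U - Y * v) * (U - Y * v) * iY + (t - 1q) * (U * U + v * U + v * U - Y * v * v) ) (ic Y+)) >> l2 v U Y iY)
   where
   l = r4 ((:1 :+ v2) :* (v0 :* v0 :+ v1 :* v1 :* v3)) ((v0 :+ v1) :* (v0 :+ v1) :+ (v1 :- v2 :* v0) :* (v1 :- v2 :* v0) :* v3 :+ (v2 :* v3 :- :1) :* (v1 :* v1 :+ v0 :* v1 :+ v0 :* v1 :- v2 :* v0 :* v0))
   l2 = r4 ((v0 :+ v1) :* (v0 :+ v1) :+ (v1 :- v2 :* v0) :* (v1 :- v2 :* v0) :* v3 :+ (:1 :- :1) :* (v1 :* v1 :+ v0 :* v1 :+ v0 :* v1 :- v2 :* v0 :* v0)) ((v0 :+ v1) :* (v0 :+ v1) :+ (v1 :- v2 :* v0) :* (v1 :- v2 :* v0) :* v3)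

  private
   w : ℚ
   w = U * iY - v
   Uw : U ≡ Y * (w + v)
   Uw = trans (sym (*-1ʳ U)) (ap (U *_) (sym (ic Y+)) >> l U Y iY v)
    where l = r4 (v0 :* (v1 :* v2)) (v1 :* (v0 :* v2 :- v3 :+ v3))
   Qw : Qf ≡ v * v + Y * ((w + v) * (w + v))
   Qw = ap (v * v +_) (ap (\ z -> U * z * iY) Uw >> l U Y (w + v) iY >> ap (\ z -> z * (U * iY) * Y) (sym (l2 U iY v)) >> l3 U iY Y v)
    where
    l = r4 (v0 :* (v1 :* v2) :* v3) (v2 :* (v0 :* v3) :* v1)
    l2 = r3 (v0 :* v1) (v0 :* v1 :- v2 :+ v2)
    l3 = r4 ((v0 :* v1) :* (v0 :* v1) :* v2) (v2 :* ((v0 :* v1 :- v3 :+ v3) :* (v0 :* v1 :- v3 :+ v3)))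
   Qpos : 0q ≤ (1q + Y) * Qf
   Qpos = nc (nh ze pY) (nh (nc (qa v+) (qa v+)) (nc (nc (qa U+) (qa U+)) piY))
   id : ℚ
   id = ig (ι d)
   pid : 0q ≤ id
   pid = ie (zj d')

  -- `pen0` discards (U - Yv)²/Y. Once U/v exceeds Y(1 + ε `zk`), this square is a proportion of at
  -- least 0.9999 ε²/d of the product, because `zk`²pq ≥ 1/d; the d-th power makes it the factor 1 +
  -- 0.9999 ε² in `total-sq`.
  pen : ∀ e0 -> 1 <= e0 -> e0 <= 428 -> Y * (1q + ι e0 * (1 // 1000) * zk) * v ≤ U -> (v + U) * (v + U) ≤ (1q + Y) * Qf * (1q - ec e0 * id)
  pen e0 e≥1 e≤ lo = ba (df main) (l0 ((1q + Y) * Qf) κ >> ap (\ z -> (1q + Y) * z - κ * ((1q + Y) * Qf)) Qw >> l1 v w Y (κ * ((1q + Y) * Qf)) >> ap (\ z -> (v + z) * (v + z) + (Y * (w * w) - κ * ((1q + Y) * Qf))) (sym Uw))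
   where
   ε ξ κ : ℚ
   ε = ι e0 * (1 // 1000)
   ξ = ε * zk
   κ = ec e0 * id
   l0 = r2 (v0 :* (:1 :- v1)) (v0 :- v1 :* v0)
   l1 = r4 ((:1 :+ v2) :* (v0 :* v0 :+ v2 :* ((v1 :+ v0) :* (v1 :+ v0))) :- v3) ((v0 :+ v2 :* (v1 :+ v0)) :* (v0 :+ v2 :* (v1 :+ v0)) :+ (v2 :* (v1 :* v1) :- v3))
   ε+ : 0q < ε
   ε+ = pos-* (<-≤ (zj 0) (mn e≥1)) (>0 (1 // 1000))
   ξ+ : 0q < ξ
   ξ+ = pos-* ε+ λ+
   pξ = qa ξ+
   pκ : 0q ≤ κ
   pκ = nc (ee e0) pid
   ξvw : ξ * v ≤ w
   ξvw = EQ (l ξ v) ~ +-≤ˡ (- v) (EQ (sym (*-1ˡ ((1q + ξ) * v)) >> ap (_* ((1q + ξ) * v)) (sym (ic Y+)) >> l2 Y iY ξ v) ~ zb piY lo)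
    where
    l = r2 (v0 :* v1) ((:1 :+ v0) :* v1 :+ :- v1)
    l2 = r4 (v0 :* v1 :* ((:1 :+ v2) :* v3)) (v0 :* (:1 :+ v2) :* v3 :* v1)
   pw : 0q ≤ w
   pw = nc pξ (qa v+) ~ ξvw
   A = p * (1q + φ)
   λs : (2000000 // 1) * zk ≤ 1q
   λs = small
   sml : ∀ c -> 0q ≤ c -> c * zk ≤ c * (1 // 2000000)
   sml c pc = za pc (EQ (ll zk) ~ za {c = 1 // 2000000} by λs ~ by)
    where ll = r1 v0 ((1 :/ 2000000) :* ((2000000 :/ 1) :* v0))
   φs : φ ≤ 3 // 1000000
   φs = EQ (sym (ℚP.*-distribʳ-+ zk zg ρ)) ~ zb p6 (+-≤ʳ zg ρ2) ~ zb p6 (by {zg + (4 // 1)} {6 // 1}) ~ sml (6 // 1) by ~ by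
   ε1 : ε ≤ 1q
   ε1 = zb {c = 1 // 1000} by (mn e≤ ~ EQ (li 428)) ~ by
   ξs : ξ ≤ 1 // 1000000
   ξs = zb p6 ε1 ~ sml 1q by ~ by
   -- κ (1+Y)(1+Y(1+ξ)²) ≤ Y ξ² after multiplication by q²
   C : κ * ((1q + Y) * (1q + Y * ((1q + ξ) * (1q + ξ)))) ≤ Y * (ξ * ξ)
   C = ca (pos-* q+ q+) (EQ (l κ Y q ξ) ~ EQ (ap (\ z -> κ * ((q + z) * (q + z * ((1q + ξ) * (1q + ξ))))) hY)
    ~ za pκ (ma (nh (qa q+) pA) (nh (qa q+) (nc pA (nc 1ξ 1ξ))) s1 s2)
    ~ EQ (l3 (ε * ε) id φ ξ) ~ za (nc (nc (nc (qa ε+) (qa ε+)) pid) (nh ze pφ)) s3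
    ~ EQ (l4 (ε * ε) id φ) ~ zb (nh ze pφ) (za (nc (qa ε+) (qa ε+)) s4)
    ~ EQ (l5 ε zk p q φ) ~ EQ (ap (\ z -> z * q * (ξ * ξ)) (sym hY)) ~ EQ (l6 Y q ξ))
    where
    1ξ : 0q ≤ 1q + ξ
    1ξ = nh ze pξ
    pA : 0q ≤ A
    pA = nc (qa p+) (nh ze pφ)
    s1 : q + A ≤ 1q + φ
    s1 = EQ (la p q φ >> ap (_+ p * φ) pq) ~ +-≤ʳ 1q (zb pφ p1 ~ EQ (*-1ˡ φ))
     where la = r3 (v1 :+ v0 :* (:1 :+ v2)) (v0 :+ v1 :+ v0 :* v2)
    s2 : q + A * ((1q + ξ) * (1q + ξ)) ≤ (1q + φ) * ((1q + ξ) * (1q + ξ))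
    s2 = +-≤ˡ (A * ((1q + ξ) * (1q + ξ))) (ba {q} {q * ((1q + ξ) * (1q + ξ))} {q * (ξ + (ξ + ξ * ξ))} (nc (qa q+) (nh pξ (nh pξ (sn ξ)))) (lb q ξ)) ~ EQ (lc q A ((1q + ξ) * (1q + ξ))) ~ zb (nc 1ξ 1ξ) s1
     where
     lb = r2 (v0 :* ((:1 :+ v1) :* (:1 :+ v1))) (v0 :+ v0 :* (v1 :+ (v1 :+ v1 :* v1)))
     lc = r3 (v0 :* v2 :+ v1 :* v2) ((v0 :+ v1) :* v2)
    s3 : (9999 // 10000) * ((1q + φ) * ((1q + ξ) * (1q + ξ))) ≤ 1q
    s3 = za {c = 9999 // 10000} by (ma (nh ze pφ) (nc 1ξ 1ξ) (+-≤ʳ 1q φs) (ma 1ξ 1ξ (+-≤ʳ 1q ξs) (+-≤ʳ 1q ξs))) ~ by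
    s4 : id ≤ zk * zk * (p * q)
    s4 = EQ (sym (*-1ʳ id)) ~ za pid λλΔ ~ EQ (ld id zk (ι d) (p * q) >> ap (_* (zk * zk * (p * q))) (ic (zj d')) >> *-1ˡ (zk * zk * (p * q)))
     where ld = r4 (v0 :* (v1 :* v1 :* (v2 :* v3))) ((v2 :* v0) :* (v1 :* v1 :* v3))
    l = r4 (v0 :* ((:1 :+ v1) :* (:1 :+ v1 :* ((:1 :+ v3) :* (:1 :+ v3)))) :* (v2 :* v2)) (v0 :* ((v2 :+ v1 :* v2) :* (v2 :+ v1 :* v2 :* ((:1 :+ v3) :* (:1 :+ v3)))))
    l3 = r4 ((9999 :/ 10000) :* v0 :* v1 :* ((:1 :+ v2) :* ((:1 :+ v2) :* ((:1 :+ v3) :* (:1 :+ v3))))) (v0 :* v1 :* (:1 :+ v2) :* ((9999 :/ 10000) :* ((:1 :+ v2) :* ((:1 :+ v3) :* (:1 :+ v3)))))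
    l4 = r3 (v0 :* v1 :* (:1 :+ v2) :* :1) (v0 :* v1 :* (:1 :+ v2))
    l5 = r5 (v0 :* v0 :* (v1 :* v1 :* (v2 :* v3)) :* (:1 :+ v4)) (v2 :* (:1 :+ v4) :* v3 :* ((v0 :* v1) :* (v0 :* v1)))
    l6 = r3 (v0 :* v1 :* v1 :* (v2 :* v2)) (v0 :* (v2 :* v2) :* (v1 :* v1))
   main : κ * ((1q + Y) * Qf) ≤ Y * (w * w)
   main = ca (pos-* ξ+ ξ+) (EQ (ap (\ z -> κ * ((1q + Y) * z) * (ξ * ξ)) Qw >> la κ Y v w ξ)
    ~ za (nc pκ (nh ze pY)) (mb (ma ξv0 ξv0 ξvw ξvw) (za pY (ma (nh (nc pξ pw) ξv0) (nh (nc pξ pw) ξv0) (+-≤ʳ (ξ * w) ξvw) (+-≤ʳ (ξ * w) ξvw))))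
    ~ EQ (lb κ Y w ξ) ~ zb (sn w) C ~ EQ (lc Y ξ w))
    where
    ξv0 : 0q ≤ ξ * v
    ξv0 = nc pξ (qa v+)
    la = r5 (v0 :* ((:1 :+ v1) :* (v2 :* v2 :+ v1 :* ((v3 :+ v2) :* (v3 :+ v2)))) :* (v4 :* v4)) (v0 :* (:1 :+ v1) :* (v4 :* v2 :* (v4 :* v2) :+ v1 :* ((v4 :* v3 :+ v4 :* v2) :* (v4 :* v3 :+ v4 :* v2))))
    lb = r4 (v0 :* (:1 :+ v1) :* (v2 :* v2 :+ v1 :* ((v3 :* v2 :+ v2) :* (v3 :* v2 :+ v2)))) (v0 :* ((:1 :+ v1) :* (:1 :+ v1 :* ((:1 :+ v3) :* (:1 :+ v3)))) :* (v2 :* v2))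
    lc = r3 (v0 :* (v1 :* v1) :* (v2 :* v2)) (v0 :* (v2 :* v2) :* (v1 :* v1))

  Rg Z : ℚ
  Rg = ro (rep d (v , U)) T
  Z = ((1q + Y) * Qf) ^ d

  Result : Set
  Result = Rg * Rg * (10000 // 1) ≤ (8464 // 1) * Z

  total-sq : ∀ e0 -> e0 <= 428 -> low e0 -> (v + U) ^ d * (v + U) ^ d * (1q + ec e0) ≤ Z
  total-sq zero e≤ lo = EQ (ap₂ _*_ (sym (zi (v + U) (v + U) d)) (ap (\ z -> 1q + (9999 // 10000) * ((z * (1 // 1000)) * (z * (1 // 1000)))) ι0 >> refl) >> (*-1ʳ _)) ~ mc d (sn (v + U)) pen0
  total-sq (suc e) e≤ lo = zb (nh ze (ee (suc e))) (EQ (sym (zi (v + U) (v + U) d)) ~ mc d (sn (v + U)) (pen (suc e) (ℕ.s≤s ℕ.z≤n) e≤ lo) ~ EQ (zi ((1q + Y) * Qf) (1q - ec (suc e) * id) d))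
   ~ EQ (*-as Z ((1q - ec (suc e) * id) ^ d) (1q + ec (suc e))) ~ za (ng d Qpos) (pow-excess (ec (suc e)) d' (ee (suc e)) ex1) ~ EQ (*-1ʳ Z)
   where
   ε1 : ι (suc e) * (1 // 1000) ≤ 1q
   ε1 = zb {c = 1 // 1000} by (mn e≤ ~ EQ (li 428)) ~ by
   ε0 : 0q ≤ ι (suc e) * (1 // 1000)
   ε0 = nc (zd (suc e)) by
   ex1 : ec (suc e) ≤ 1q
   ex1 = za {c = 9999 // 10000} by (ma ε0 ε0 ε1 ε1) ~ by

  Rg-nn : 0q ≤ Rg
  Rg-nn = subst (0q ≤_) (sym (rowGE-up v U d T)) (sk (suc d) (\ j -> bg d (T +' j) (qa v+) (qa U+)))

  in-window : ∀ e0 e1 -> e0 <= 428 -> e1 <= 428 -> Wd e0 e1 -> low e0 -> U ≤ Y * (1q + ι e1 * (1 // 1000) * zk) * v -> Result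
  in-window e0 e1 e0≤ e1≤ (u , l , hu , hl , t) lo hi = ca (pos-* (pos-* s+ s+) (<-≤ (>0 1q) (ba (ee e0) refl)))
   (EQ (la Rg s (1q + ec e0)) ~ za {c = 10000 // 1} by (zb (nh ze (ee e0)) (ma (nc s0 Rg-nn) (nc s0 Rg-nn) sR sR))
    ~ EQ (lb (ι u) P (1q + ec e0)) ~ ma (nc (nc (zd u) (zd u)) by) (nc (nc P0 P0) (nh ze (ee e0))) (wT e0 u l t) (total-sq e0 e0≤ lo)
    ~ EQ (lc Z s (1q + ec e0)))
   where
   s = ι u + ι l
   P = (v + U) ^ d
   P0 : 0q ≤ P
   P0 = ng d (nh (qa v+) (qa U+))
   s0 : 0q ≤ s
   s0 = nh (zd u) (zd l)
   s+ : 0q < s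
   s+ = <-≤ (zj 0) (mn (subst (1 ℕ.≤_) hu (upTotal-pos (1301 +' e1) 768)) ~ ba (zd l) refl)
   hw : U * q ≤ p * ((1q + (zg * zk + ρ * zk)) * (1q + ι e1 * (1 // 1000) * zk)) * v
   hw = zb (qa q+) hi ~ EQ (l1 Y (1q + ι e1 * (1 // 1000) * zk) v q >> ap (\ z -> z * (1q + ι e1 * (1 // 1000) * zk) * v) hY >> ap (_* v) (*-as p (1q + (zg * zk + ρ * zk)) (1q + ι e1 * (1 // 1000) * zk)))
    where l1 = r4 (v0 :* v1 :* v2 :* v3) (v0 :* v3 :* v1 :* v2)
   tail : ι l * Rg ≤ ι u * sm (bd v U d) T
   tail = subst₂ (\ a b -> ι a * Rg ≤ ι b * sm (bd v U d) T) hl hu (ww e1 e1≤ v U v+ U+ hw)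
   sR : s * Rg ≤ ι u * P
   sR = EQ (ℚP.*-distribʳ-+ Rg (ι u) (ι l)) ~ +-≤ʳ (ι u * Rg) tail ~ EQ (sym (ℚP.*-distribˡ-+ (ι u) Rg (sm (bd v U d) T)) >> ap (ι u *_) (rh v U d T))
   la = r3 (v0 :* v0 :* (10000 :/ 1) :* (v1 :* v1 :* v2)) ((10000 :/ 1) :* (v1 :* v0 :* (v1 :* v0) :* v2))
   lb = r3 ((10000 :/ 1) :* (v0 :* v1 :* (v0 :* v1) :* v2)) (v0 :* v0 :* (10000 :/ 1) :* (v1 :* v1 :* v2))
   lc = r3 ((8464 :/ 1) :* (v1 :* v1) :* v2 :* v0) ((8464 :/ 1) :* v0 :* (v1 :* v1 :* v2))

  -- From here on the penalty is enough without any tail estimate: 0.8464 (1 + 0.9999 · 0.428²) > 1.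
  last-window : low 428 -> Result
  last-window lo = EQ (*-cm (Rg * Rg) (10000 // 1)) ~ zb (nc Rg-nn Rg-nn) (by {10000 // 1} {(8464 // 1) * (1q + (9999 // 10000) * ((428 // 1) * (1 // 1000) * ((428 // 1) * (1 // 1000))))} ~ EQ (ap (\ z -> (8464 // 1) * (1q + (9999 // 10000) * (z * (1 // 1000) * (z * (1 // 1000))))) (sym (li 428))))
   ~ EQ (ll (1q + ec 428) (Rg * Rg)) ~ za {c = 8464 // 1} by (zb (nh ze (ee 428)) (ma Rg-nn Rg-nn RP RP) ~ total-sq 428 ≤r lo)
   where
   ll = r2 ((8464 :/ 1) :* v0 :* v1) ((8464 :/ 1) :* (v1 :* v0))
   RP : Rg ≤ (v + U) ^ d
   RP = ba (sk T (\ j -> bg d j (qa v+) (qa U+))) (sym (rh v U d T))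

  sC : ∀ e0 e1 -> e0 <= 428 -> suc e1 <= 428 -> Wd e0 (suc e1) -> (low (suc e1) -> Result) -> low e0 -> Result
  sC e0 e1 e0≤ e1≤ ok next lo = go (≤-tot U (Y * (1q + ι (suc e1) * (1 // 1000) * zk) * v))
   where
   go : U ≤ Y * (1q + ι (suc e1) * (1 // 1000) * zk) * v ⊎ Y * (1q + ι (suc e1) * (1 // 1000) * zk) * v ≤ U -> Result
   go (inj₁ hi) = in-window e0 (suc e1) e0≤ e1≤ ok lo hi
   go (inj₂ lo') = next lo'

  row-bound : Result
  row-bound = sC 0 59 z8 z8 w01 (sC 60 99 z8 z8 w02 (sC 100 119 z8 z8 w03 (sC 120 134 z8 z8 w04 (sC 135 146 z8 z8 w05
   (sC 147 158 z8 z8 w06 (sC 159 170 z8 z8 w07 (sC 171 182 z8 z8 w08 (sC 183 197 z8 z8 w09 (sC 198 217 z8 z8 w10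
   (sC 218 247 z8 z8 w11 (sC 248 307 z8 z8 w12 (sC 308 367 z8 z8 w13 (sC 368 427 z8 z8 w14 last-window))))))))))))) tt

-- Discrete rotations, and balancing of angles.

module Rotation (Y δ : ℚ) (pY : 0q ≤ Y) (pδ : 0q ≤ δ) where

 -- One step multiplies v + iU/√Y by 1 + iδ√Y. Up to a radius that grows with the index, v is the
 -- cosine and U is √Y times the sine of an angle, with no root ever taken.
 vU : ℕ -> ℚ × ℚ
 vU zero = 1q , 0q
 vU (suc j) = fst (vU j) - δ * snd (vU j) , snd (vU j) + δ * Y * fst (vU j)

 vv UU : ℕ -> ℚ
 vv j = fst (vU j)
 UU j = snd (vU j)

 module Bal (J : ℕ) (vnn : ∀ j -> j <= J -> 0q ≤ vv j) where

  Unn : ∀ j -> j <= J -> 0q ≤ UU j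
  Unn zero p = ≤-refl
  Unn (suc j) p = nh (Unn j (<≤ p)) (nc (nc pδ pY) (vnn j (<≤ p)))

  -- The sine of the angle between the points n and n + i, up to positive factors; it stays
  -- nonnegative as long as v does, that is within a quarter turn.
  wa : ∀ n i -> n +' i <= J -> 0q ≤ UU (n +' i) * vv n - vv (n +' i) * UU n
  wa n zero p = EQ (l (UU n) (vv n) >> ap (\ k -> UU k * vv n - vv k * UU n) (sym (n+0 n)))
   where l = r2 :0 (v0 :* v1 :- v1 :* v0)
  wa n (suc i) p = nh (wa n i p') (nc pδ (nh (nc pY (nc (vnn m p') (vnn n n≤))) (nc (Unn m p') (Unn n n≤))))
   ~ EQ (l (UU m) (vv m) (UU n) (vv n) δ Y >> ap (\ k -> UU k * vv n - vv k * UU n) (sym (+-suc n i)))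
   where
   m = n +' i
   p' : m <= J
   p' = ≤≤ (+-≤ℕ n (n≤sn i)) p
   n≤ : n <= J
   n≤ = ≤≤ (m≤m+n n i) p'
   l = r6 ((v0 :* v3 :- v1 :* v2) :+ v4 :* (v5 :* (v1 :* v3) :+ v0 :* v2)) ((v0 :+ v4 :* v5 :* v1) :* v3 :- (v1 :- v4 :* v0) :* v2)

  RL : List ℕ -> ℕ -> ℚ
  RL l T = ro (map vU l) T

  Al : List ℕ -> Set
  Al [] = ⊤
  Al (j ∷ l) = j <= J × Al l

  RL-nn : ∀ l T -> Al l -> 0q ≤ RL l T
  RL-nn [] zero a = ze
  RL-nn [] (suc T) a = ≤-refl
  RL-nn (j ∷ l) T (p , a) = nh (nc (vnn j p) (RL-nn l T a)) (nc (Unn j p) (RL-nn l (ℕ.pred T) a))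

  RL-cons : ∀ j {l l'} -> j <= J -> (∀ T -> RL l T ≤ RL l' T) -> ∀ T -> RL (j ∷ l) T ≤ RL (j ∷ l') T
  RL-cons j p h T = mb (za (vnn j p) (h T)) (za (Unn j p) (h (ℕ.pred T)))

  RL-swap : ∀ i j l T -> RL (i ∷ j ∷ l) T ≡ RL (j ∷ i ∷ l) T
  RL-swap i j l T = s (vv i) (UU i) (vv j) (UU j) (RL l T) (RL l (ℕ.pred T)) (RL l (ℕ.pred (ℕ.pred T)))
   where s = r7 (v0 :* (v2 :* v4 :+ v3 :* v5) :+ v1 :* (v2 :* v5 :+ v3 :* v6)) (v2 :* (v0 :* v4 :+ v1 :* v5) :+ v3 :* (v0 :* v5 :+ v1 :* v6))

  -- With the sum of two indices fixed, the mixed coefficient vU' + Uv' does not change, while vv'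
  -- and UU' both grow as the angles approach each other: each is half a difference or sum involving
  -- cos of the difference. The exact gain is the sine from `wa` times δ.
  closer1 : ∀ n i l -> suc (n +' i) <= J -> Al l -> ∀ T -> RL (n ∷ suc (n +' i) ∷ l) T ≤ RL (suc n ∷ n +' i ∷ l) T
  closer1 n i l p al T = ba (nc (nc pδ (wa n i (<≤ p))) (nh (RL-nn l T al) (nc pY (RL-nn l (ℕ.pred (ℕ.pred T)) al))))
   (s (vv n) (UU n) (vv (n +' i)) (UU (n +' i)) δ Y (RL l T) (RL l (ℕ.pred T)) (RL l (ℕ.pred (ℕ.pred T))))
   where s = r9 ((v0 :- v4 :* v1) :* (v2 :* v6 :+ v3 :* v7) :+ (v1 :+ v4 :* v5 :* v0) :* (v2 :* v7 :+ v3 :* v8)) ((v0 :* ((v2 :- v4 :* v3) :* v6 :+ (v3 :+ v4 :* v5 :* v2) :* v7) :+ v1 :* ((v2 :- v4 :* v3) :* v7 :+ (v3 :+ v4 :* v5 :* v2) :* v8)) :+ v4 :* (v3 :* v0 :- v2 :* v1) :* (v6 :+ v5 :* v8))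

  closer : ∀ i n b l -> n <= b -> b +' i <= J -> Al l -> ∀ T -> RL (n ∷ b +' i ∷ l) T ≤ RL (n +' i ∷ b ∷ l) T
  closer zero n b l n≤b p al T = EQ (ap₂ (\ x y -> RL (x ∷ y ∷ l) T) (sym (n+0 n)) (n+0 b))
  closer (suc i) n b l n≤b p al T = go (ℕP.m≤n⇒m<n∨m≡n n≤b)
   where
   p' : suc (b +' i) <= J
   p' = ≤≤ (≤≡ (sym (+-suc b i))) p
   go : n ≺ b ⊎ n ≡ b -> RL (n ∷ b +' suc i ∷ l) T ≤ RL (n +' suc i ∷ b ∷ l) T
   go (inj₂ refl) = EQ (RL-swap n (n +' suc i) l T)
   go (inj₁ n<b) = EQ (ap (\ k -> RL (n ∷ k ∷ l) T) (+-suc b i >> ap suc (sym e)))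
    ~ closer1 n k l (≤≤ (≤≡ (ap suc e)) p') al T
    ~ EQ (ap (\ k -> RL (suc n ∷ k ∷ l) T) e)
    ~ closer i (suc n) b l n<b (<≤ p') al T ~ EQ (ap (\ k -> RL (k ∷ b ∷ l) T) (sym (+-suc n i)))
    where
    k = (b +' i) ℕ.∸ n
    e : n +' k ≡ b +' i
    e = m+[n∸m] (≤≤ n≤b (m≤m+n b i))

  meet : ∀ j h a c l -> j <= a -> a <= h -> a +' c ≡ j +' h -> h <= J -> Al l -> ∀ T -> RL (j ∷ h ∷ l) T ≤ RL (a ∷ c ∷ l) T
  meet j h a c l ja ah e hJ al T = EQ (ap (\ k -> RL (j ∷ k ∷ l) T) (sym ch)) ~ closer i j c l jc (≤≤ (≤≡ ch) hJ) al T ~ EQ (ap (\ k -> RL (k ∷ c ∷ l) T) ji)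
   where
   i = a ℕ.∸ j
   ji : j +' i ≡ a
   ji = m+[n∸m] ja
   ch : c +' i ≡ h
   ch = ℕP.+-cancelˡ-≡ j (c +' i) h (ap (j ℕ.+_) (+-cmℕ c i) >> sym (ℕP.+-assoc j i c) >> ap (ℕ._+ c) ji >> e)
   jc : j <= c
   jc = ℕP.+-cancelʳ-≤ h j c (≤≤ (≤≡ (sym e >> +-cmℕ a c)) (+-≤ℕ c ah))

  sL : List ℕ -> ℕ
  sL [] = 0
  sL (j ∷ l) = j +' sL l

  -- The smoothing step of `balance`: the head is replaced by the prescribed index a at the expense
  -- of another entry, so the induction can peel off an entry equal to the mean.
  record Pulled (a j : ℕ) (l : List ℕ) : Set where
   field
    l' : List ℕ
    len : length l' ≡ length l
    tot : a +' sL l' ≡ j +' sL l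
    al' : Al l'
    le : ∀ T -> RL (j ∷ l) T ≤ RL (a ∷ l') T

  cz : ∀ {a j} h {t} -> a <= J -> h <= J -> Pulled a j t -> Pulled a j (h ∷ t)
  cz {a} {j} h {t} aJ hJ P = record
   { l' = h ∷ l' ; len = ap suc len
   ; tot = trans (xz a h (sL l')) (ap (h ℕ.+_) tot >> sym (xz j h (sL t)))
   ; al' = hJ , al'
   ; le = \ T -> EQ (RL-swap j h t T) ~ RL-cons h {j ∷ t} {a ∷ l'} hJ le T ~ EQ (RL-swap h a l' T) }
   where
   open Pulled P
   xz : ∀ x y z -> x +' (y +' z) ≡ y +' (x +' z)
   xz x y z = trans (sym (ℕP.+-assoc x y z)) (ap (ℕ._+ z) (+-cmℕ x y) >> ℕP.+-assoc y x z)

  ha : ∀ {a j} h {t} c -> Al t -> c <= J -> a +' c ≡ j +' h -> (∀ T -> RL (j ∷ h ∷ t) T ≤ RL (a ∷ c ∷ t) T) -> Pulled a j (h ∷ t)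
  ha {a} {j} h {t} c al cJ e le = record { l' = c ∷ t ; len = refl ; tot = trans (sym (ℕP.+-assoc a c (sL t))) (ap (ℕ._+ sL t) e >> ℕP.+-assoc j h (sL t)) ; al' = cJ , al ; le = le }

  pull-up : ∀ a j l -> j <= a -> a <= J -> Al l -> a *' length l ≺ sL l -> Pulled a j l
  pull-up a j [] ja aJ al h = ⊥-elim (ℕP.n≮0 h)
  pull-up a j (x ∷ t) ja aJ (xJ , al) h = go (ℕP.≤-total a x)
   where
   go : a <= x ⊎ x <= a -> Pulled a j (x ∷ t)
   go (inj₁ ax) = ha x c al (≤≤ c≤ xJ) e (meet j x a c t ja ax e xJ al)
    where
    c = (j +' x) ℕ.∸ a
    e : a +' c ≡ j +' x
    e = m+[n∸m] (≤≤ ax (m≤n+m x j))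
    c≤ : c <= x
    c≤ = ℕP.+-cancelˡ-≤ a c x (≤≤ (≤≡ e) (ℕP.+-monoˡ-≤ x ja))
   go (inj₂ xa) = cz x aJ xJ (pull-up a j t ja aJ al (ℕP.+-cancelˡ-< a _ _ (ℕP.<-≤-trans (ℕP.≤-<-trans (≤≡ (sym (ℕP.*-suc a (length t)))) h) (ℕP.+-monoˡ-≤ (sL t) xa))))

  pull-down : ∀ a j l -> a <= j -> j <= J -> Al l -> sL l ≺ a *' length l -> Pulled a j l
  pull-down a j [] aj jJ al h = ⊥-elim (ℕP.n≮0 (ℕP.<-≤-trans h (≤≡ (ℕP.*-zeroʳ a))))
  pull-down a j (x ∷ t) aj jJ (xJ , al) h = go (ℕP.≤-total x a)
   where
   go : x <= a ⊎ a <= x -> Pulled a j (x ∷ t)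
   go (inj₁ xa) = ha x c al (≤≤ c≤ jJ) e (\ T -> EQ (RL-swap j x t T) ~ meet x j a c t xa aj (e >> +-cmℕ j x) jJ al T)
    where
    c = (j +' x) ℕ.∸ a
    e : a +' c ≡ j +' x
    e = m+[n∸m] (≤≤ aj (m≤m+n j x))
    c≤ : c <= j
    c≤ = ℕP.+-cancelˡ-≤ a c j (≤≤ (≤≡ e) (≤≤ (+-≤ℕ j xa) (≤≡ (+-cmℕ j a))))
   go (inj₂ ax) = cz x (≤≤ aj jJ) xJ (pull-down a j t aj jJ al (ℕP.+-cancelˡ-< a _ _ (ℕP.≤-<-trans (ℕP.+-monoˡ-≤ (sL t) ax) (ℕP.<-≤-trans h (≤≡ (ℕP.*-suc a (length t)))))))

  -- Smoothing in the manner of Schur concavity. If the head lies below the mean a, the rest has an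
  -- entry above the mean, and moving the two towards each other makes one of them exactly a;
  -- symmetrically above. Rows whose columns use different angles are thereby reduced to identical
  -- columns.
  balance : ∀ n a l -> length l ≡ n -> a <= J -> Al l -> sL l ≡ a *' n -> ∀ T -> RL l T ≤ RL (rep n a) T
  balance zero a [] e aJ al s T = ≤-refl
  balance (suc n) a (j ∷ l) e aJ (jJ , al) s T = go (ℕP.<-cmp j a)
   where
   open import Relation.Binary.Definitions using (Tri; tri<; tri≈; tri>)
   en : length l ≡ n
   en = suc-inj e
   s' : j +' sL l ≡ a +' a *' n
   s' = trans s (ℕP.*-suc a n)
   fin : Pulled a j l -> RL (j ∷ l) T ≤ RL (rep (suc n) a) T
   fin P = le T ~ RL-cons a {l'} {rep n a} aJ (balance n a l' (len >> en) aJ al' (ℕP.+-cancelˡ-≡ a _ _ (tot >> s'))) T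
    where open Pulled P
   go : Tri (j ≺ a) (j ≡ a) (a ≺ j) -> RL (j ∷ l) T ≤ RL (rep (suc n) a) T
   go (tri< j<a _ _) = fin (pull-up a j l (<≤ j<a) aJ al (subst (\ k -> a *' k ≺ sL l) (sym en) (ℕP.+-cancelˡ-< a _ _ (ℕP.≤-<-trans (≤≡ (sym s')) (ℕP.+-monoˡ-< (sL l) j<a)))))
   go (tri≈ _ refl _) = RL-cons j {l} {rep n j} jJ (balance n j l en jJ al (ℕP.+-cancelˡ-≡ j _ _ s')) T
   go (tri> _ _ a<j) = fin (pull-down a j l (<≤ a<j) jJ al (subst (\ k -> sL l ≺ a *' k) (sym en) (ℕP.+-cancelˡ-< a _ _ (ℕP.<-≤-trans (ℕP.+-monoˡ-< (sL l) a<j) (≤≡ s')))))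

-- Weighted AM-GM and entropy bounds.

amgm-aux : ∀ {h} x y -> 0q ≤ h -> 0q ≤ 1q - ι x * h -> (1q + ι y * h) ^ x * (1q - ι x * h) ^ y ≤ 1q
amgm-aux {h} x y ph pb = ma (ng x (nh ze (nc (zd y) ph))) (ng y pb) (mc x (nh ze (nc (zd y) ph)) (bo y (nh ze ph))) (mc y pb s1)
 ~ EQ (ap₂ _*_ (sym (zp (1q + h) y x) >> ap ((1q + h) ^_) (*-cmℕ y x)) (sym (zp k x y)) >> sym (zi (1q + h) k (x *' y)) >> ap (_^ (x *' y)) (ic 1h+) >> zC (x *' y))
 where
 1h+ : 0q < 1q + h
 1h+ = <-≤ (>0 1q) (ba ph refl)
 k = ig (1q + h)
 pk : 0q ≤ k
 pk = ie 1h+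
 k1 : k ≤ 1q
 k1 = EQ (sym (*-1ˡ k)) ~ zb pk (ba {1q} {1q + h} {h} ph refl) ~ EQ (ic 1h+)
 ke : k ≡ 1q + - (h * k)
 ke = trans (l h k) (ap (\ z -> z + - (h * k)) (ic 1h+))
  where l = r2 v1 ((:1 :+ v0) :* v1 :+ :- (v0 :* v1))
 hk : h * k ≤ h
 hk = za ph k1 ~ EQ (*-1ʳ h)
 s1 : 1q - ι x * h ≤ k ^ x
 s1 = +-≤ʳ 1q (neg≤ (za (zd x) hk)) ~ EQ (l (ι x) (h * k)) ~ bo x (subst (0q ≤_) ke pk) ~ EQ (ap (_^ x) (sym ke))
  where l = r2 (:1 :+ :- (v0 :* v1)) (:1 :+ v0 :* (:- v1))

-- Relative to their mean, A and B are 1 + yh and 1 - xh. `amgm-aux` bounds these by (1 + h)^y and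
-- (1 + h)^(-x), both by Bernoulli, and the powers cancel.
amgm≥ : ∀ {A B} x y -> 0q ≤ B -> B ≤ A -> 0q < ι x * A + ι y * B -> A ^ x * B ^ y * (ι (x +' y)) ^ (x +' y) ≤ (ι x * A + ι y * B) ^ (x +' y)
amgm≥ {A} {B} x y pB BA M+ = EQ (ap₂ (\ a b -> a * b * S ^ (x +' y)) (ap (_^ x) A≡ >> zi (M * iS) (1q + ι y * h) x) (ap (_^ y) B≡ >> zi (M * iS) (1q - ι x * h) y))
 ~ EQ (trans (l1 ((M * iS) ^ x) ((1q + ι y * h) ^ x) ((M * iS) ^ y) ((1q - ι x * h) ^ y) (S ^ (x +' y)))
  (ap (\ z -> (z * S ^ (x +' y)) * ((1q + ι y * h) ^ x * (1q - ι x * h) ^ y)) (sym (zr (M * iS) x y))))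
 ~ za (nc (ng (x +' y) (nc (qa M+) piS)) (ng (x +' y) (zd (x +' y)))) (amgm-aux x y ph pb)
 ~ EQ (*-1ʳ ((M * iS) ^ (x +' y) * S ^ (x +' y)) >> sym (zi (M * iS) S (x +' y)) >> ap (_^ (x +' y)) (l2 M iS S >> ap (M *_) (ic S+) >> *-1ʳ M))
 where
 S = ι (x +' y)
 M = ι x * A + ι y * B
 S≡ : S ≡ ι x + ι y
 S≡ = zq x y
 S+ : 0q < S
 S+ = ≰⇒> \ q -> <⇒≱ M+ (mb (z x (m≤m+n x y) A q) (z y (m≤n+m y x) B q) ~ EQ (+-0ʳ 0q))
  where
  z : ∀ x' -> x' <= x +' y -> ∀ A -> S ≤ 0q -> ι x' * A ≤ 0q
  z x' p A q = EQ (ap (_* A) (ℚP.≤-antisym (mn p ~ q) (zd x')) >> *-0ˡ A)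
 iS = ig S
 piS = ie S+
 iM = ig M
 h = (A - B) * iM
 ph : 0q ≤ h
 ph = nc (df BA) (ie M+)
 l1 = r5 (v0 :* v1 :* (v2 :* v3) :* v4) ((v0 :* v2 :* v4) :* (v1 :* v3))
 l2 = r3 (v0 :* v1 :* v2) (v0 :* (v2 :* v1))
 A≡ : A ≡ (M * iS) * (1q + ι y * h)
 A≡ = sym (la M iS (ι y) (A - B) iM >> ap (\ z -> iS * (M + ι y * (A - B) * z)) (ic M+) >> ap (iS *_) (lb (ι x) (ι y) A B) >> ap (\ z -> iS * (z * A)) (sym S≡) >> lc iS S A >> ap (_* A) (ic S+) >> *-1ˡ A)
  where
  la = r5 (v0 :* v1 :* (:1 :+ v2 :* (v3 :* v4))) (v1 :* (v0 :+ v2 :* v3 :* (v0 :* v4)))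
  lb = r4 (v0 :* v2 :+ v1 :* v3 :+ v1 :* (v2 :- v3) :* :1) ((v0 :+ v1) :* v2)
  lc = r3 (v0 :* (v1 :* v2)) (v1 :* v0 :* v2)
 B≡ : B ≡ (M * iS) * (1q - ι x * h)
 B≡ = sym (la M iS (ι x) (A - B) iM >> ap (\ z -> iS * (M - ι x * (A - B) * z)) (ic M+) >> ap (iS *_) (lb (ι x) (ι y) A B) >> ap (\ z -> iS * (z * B)) (sym S≡) >> lc iS S B >> ap (_* B) (ic S+) >> *-1ˡ B)
  where
  la = r5 (v0 :* v1 :* (:1 :- v2 :* (v3 :* v4))) (v1 :* (v0 :- v2 :* v3 :* (v0 :* v4)))
  lb = r4 (v0 :* v2 :+ v1 :* v3 :- v0 :* (v2 :- v3) :* :1) ((v0 :+ v1) :* v3)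
  lc = r3 (v0 :* (v1 :* v2)) (v1 :* v0 :* v2)
 pb : 0q ≤ 1q - ι x * h
 pb = ca (pos-* M+ (io S+)) (EQ (*-0ˡ (M * iS)) ~ pB ~ EQ (B≡ >> *-cm (M * iS) (1q - ι x * h)))

amgm : ∀ {A B} x y -> 0q ≤ A -> 0q ≤ B -> 0q < ι x * A + ι y * B -> A ^ x * B ^ y * (ι (x +' y)) ^ (x +' y) ≤ (ι x * A + ι y * B) ^ (x +' y)
amgm {A} {B} x y pA pB M+ = go (≤-tot B A)
 where
 go : B ≤ A ⊎ A ≤ B -> A ^ x * B ^ y * (ι (x +' y)) ^ (x +' y) ≤ (ι x * A + ι y * B) ^ (x +' y)
 go (inj₁ BA) = amgm≥ x y pB BA M+
 go (inj₂ AB) = EQ (ap₂ (\ a b -> a * (ι b) ^ b) (*-cm (A ^ x) (B ^ y)) (+-cmℕ x y)) ~ amgm≥ y x pA AB (subst (0q <_) (+-cm (ι x * A) (ι y * B)) M+)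
  ~ EQ (ap₂ _^_ (+-cm (ι y * B) (ι x * A)) (+-cmℕ y x))

-- AM-GM for x/a and y/b with multiplicities x and y says that relative entropy is at most ln(1 +
-- χ²); the last hypothesis states χ² ≤ η with denominators cleared.
gibbs : ∀ {a b η} x y -> 0q < a -> 0q < b -> a + b ≡ 1q -> 0q ≤ η -> 1 <= x +' y ->
 (ι x * b - ι y * a) * (ι x * b - ι y * a) ≤ η * (a * b) * (ι (x +' y) * ι (x +' y)) ->
 ι x ^ x * ι y ^ y ≤ (ι (x +' y) * (1q + η)) ^ (x +' y) * (a ^ x * b ^ y)
gibbs {a} {b} {η} x y a+ b+ ab pη sc h = ca (po (x +' y) S+)
 (EQ (ap (_* S ^ (x +' y)) (ap₂ _*_ (ap (_^ x) eA >> zi A a x) (ap (_^ y) eB >> zi B b y)))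
  ~ EQ (l1 (A ^ x) (a ^ x) (B ^ y) (b ^ y) (S ^ (x +' y)))
  ~ zb (nc (ng x (qa a+)) (ng y (qa b+))) (amgm {A} {B} x y (nc (zd x) (ie a+)) (nc (zd y) (ie b+)) M+ ~ mc (x +' y) (qa M+) Mle)
  ~ EQ (ap (_* (a ^ x * b ^ y)) (zi (S * (1q + η)) S (x +' y)) >> l2 ((S * (1q + η)) ^ (x +' y)) (S ^ (x +' y)) (a ^ x * b ^ y)))
 where
 S = ι (x +' y)
 S+ : 0q < S
 S+ = <-≤ (zj 0) (mn sc)
 ia = ig a
 ib = ig b
 A = ι x * ia
 B = ι y * ib
 eA : ι x ≡ A * a
 eA = sym (lz (ι x) ia a >> ap (ι x *_) (ic a+) >> *-1ʳ (ι x))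
  where lz = r3 (v0 :* v1 :* v2) (v0 :* (v2 :* v1))
 eB : ι y ≡ B * b
 eB = sym (lz (ι y) ib b >> ap (ι y *_) (ic b+) >> *-1ʳ (ι y))
  where lz = r3 (v0 :* v1 :* v2) (v0 :* (v2 :* v1))
 l1 = r5 (v0 :* v1 :* (v2 :* v3) :* v4) (v0 :* v2 :* v4 :* (v1 :* v3))
 l2 = r3 (v0 :* v1 :* v2) (v0 :* v2 :* v1)
 M = ι x * A + ι y * B
 Mab : M * (a * b) ≡ ι x * ι x * b + ι y * ι y * a
 Mab = trans (lz (ι x) (ι y) ia ib a b) (ap₂ (\ s t -> ι x * ι x * b * s + ι y * ι y * a * t) (ic a+) (ic b+)) >> lw (ι x) (ι y) a b
  where
  lz = r6 ((v0 :* (v0 :* v2) :+ v1 :* (v1 :* v3)) :* (v4 :* v5)) (v0 :* v0 :* v5 :* (v4 :* v2) :+ v1 :* v1 :* v4 :* (v5 :* v3))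
  lw = r4 (v0 :* v0 :* v3 :* :1 :+ v1 :* v1 :* v2 :* :1) (v0 :* v0 :* v3 :+ v1 :* v1 :* v2)
 key : ι x * ι x * b + ι y * ι y * a ≡ (ι x * b - ι y * a) * (ι x * b - ι y * a) + a * b * (S * S)
 key = trans (ap (\ b -> ι x * ι x * b + ι y * ι y * a) be) (lk (ι x) (ι y) a >> ap₂ (\ b s -> (ι x * b - ι y * a) * (ι x * b - ι y * a) + a * b * (s * s)) (sym be) (sym (zq x y)))
  where
  be : b ≡ 1q - a
  be = pT (+-cm b a >> ab)
  lk = r3 (v0 :* v0 :* (:1 :- v2) :+ v1 :* v1 :* v2) ((v0 :* (:1 :- v2) :- v1 :* v2) :* (v0 :* (:1 :- v2) :- v1 :* v2) :+ v2 :* (:1 :- v2) :* ((v0 :+ v1) :* (v0 :+ v1)))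
 Mle : M ≤ S * (1q + η) * S
 Mle = ca (pos-* a+ b+) (EQ (Mab >> key) ~ +-≤ˡ (a * b * (S * S)) h ~ EQ (lm η (a * b) S))
  where lm = r3 (v0 :* v1 :* (v2 :* v2) :+ v1 :* (v2 :* v2)) (v2 :* (:1 :+ v0) :* v2 :* v1)
 M+ : 0q < M
 M+ = ≰⇒> \ q -> <⇒≱ (pos-* (pos-* a+ b+) (pos-* S+ S+)) (ba (sn (ι x * b - ι y * a)) (key >> +-cm ((ι x * b - ι y * a) * (ι x * b - ι y * a)) (a * b * (S * S))) ~ EQ (sym Mab) ~ zb (qa (pos-* a+ b+)) q ~ EQ (*-0ˡ (a * b)))

bC : ℕ -> ℕ -> ℚ
bC = bd 1q 1q

binC-nn : ∀ d r -> 0q ≤ bC d r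
binC-nn d r = bg d r ze ze

bf : ∀ v U d r t -> r +' t ≡ d -> bd v U d r ≡ bC d r * (U ^ r * v ^ t)
bf v U zero zero zero e = refl
bf v U (suc d) zero (suc t) e = trans (ap (v *_) (bf v U d zero t (suc-inj e))) (l v (bC d zero) (v ^ t))
 where l = r3 (v0 :* (v1 :* (:1 :* v2))) (:1 :* v1 :* (:1 :* (v0 :* v2)))
bf v U (suc d) (suc r) zero e = trans (ap₂ (\ a b -> v * a + U * b) (bz v U d (suc r) rd) (bf v U d r zero e'))
 (l v U (bC d r) (U ^ r) >> ap (\ z -> (1q * z + 1q * bC d r) * (U * U ^ r * 1q)) (sym (bz 1q 1q d (suc r) rd)))
 where
 e' = suc-inj e
 rd : d ≺ suc r
 rd = ℕ.s≤s (≤≡ (sym e' >> n+0 r))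
 l = r4 (v0 :* :0 :+ v1 :* (v2 :* (v3 :* :1))) ((:1 :* :0 :+ :1 :* v2) :* (v1 :* v3 :* :1))
bf v U (suc d) (suc r) (suc t) e = trans (ap₂ (\ a b -> v * a + U * b) (bf v U d (suc r) t (sym (+-suc r t) >> suc-inj e)) (bf v U d r (suc t) (suc-inj e)))
 (l v U (bC d (suc r)) (bC d r) (U ^ r) (v ^ t))
 where l = r6 (v0 :* (v2 :* (v1 :* v4 :* v5)) :+ v1 :* (v3 :* (v4 :* (v0 :* v5)))) ((:1 :* v2 :+ :1 :* v3) :* (v1 :* v4 :* (v0 :* v5)))

bin-total : ∀ v U d -> sm (bd v U d) (suc d) ≡ (v + U) ^ d
bin-total v U d = trans (sym (rowGE-up v U d 0)) (sym (+-0ʳ (ro (rep d (v , U)) 0)) >> rh v U d 0)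

sB : ∀ (a : ℕ -> ℚ) m r -> r ≺ m -> (∀ j -> 0q ≤ a j) -> a r ≤ sm a m
sB a (suc m) r p nn = go (ℕP.m≤n⇒m<n∨m≡n (≤-pred p))
 where
 go : r ≺ m ⊎ r ≡ m -> a r ≤ sm a (suc m)
 go (inj₁ q) = sB a m r q nn ~ ba (nn m) refl
 go (inj₂ refl) = ba (sk m nn) (+-cm (sm a m) (a m))

binC-upper : ∀ {Y} x y -> 0q ≤ Y -> bC (x +' y) x * Y ^ x ≤ (1q + Y) ^ (x +' y)
binC-upper {Y} x y pY = EQ (sym (bf 1q Y (x +' y) x y refl >> ap (bC (x +' y) x *_) (ap (Y ^ x *_) (zC y) >> *-1ʳ (Y ^ x))))
 ~ sB (bd 1q Y (x +' y)) (suc (x +' y)) x (ℕ.s≤s (m≤m+n x y)) (\ j -> bg (x +' y) j ze pY) ~ EQ (bin-total 1q Y (x +' y))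

-- In the expansion of (x + y)^(x+y) with these two summands as weights, the term of index x is the
-- largest of the `suc (x +' y)` terms.
binC-lower : ∀ x y -> ι (x +' y) ^ (x +' y) ≤ ι (suc (x +' y)) * (bC (x +' y) x * (ι x ^ x * ι y ^ y))
binC-lower x y = EQ (ap (_^ d) (zq x y >> +-cm (ι x) (ι y)) >> sym (bin-total (ι y) (ι x) d))
 ~ sg (suc d) (\ j p -> mode j (≤-pred p)) ~ EQ (sT (b x) (suc d) >> ap (ι (suc d) *_) (bf (ι y) (ι x) d x y refl))
 where
 d = x +' y
 b = bd (ι y) (ι x) d
 py = zd y
 px = zd x
 up1 : ∀ i -> x +' i ≺ d -> b (suc (x +' i)) ≤ b (x +' i)
 up1 i p = bq d (x +' i) {1q} py px y+ (EQ (ap (_* ι x) (zq x y)) ~ EQ (l1 (ι x) (ι y)) ~ mb (zb py (mn (≤≤ (m≤m+n x i) (n≤sn (x +' i))))) (zb px (mn (m≤m+n x i)))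
  ~ EQ (ap (_+ ι (x +' i) * ι x) (sym (*-1ˡ (ι (suc (x +' i)) * ι y))))) ~ EQ (*-1ˡ (b (x +' i)))
  where
  y+ : 0q < ι y
  y+ = <-≤ (zj 0) (mn (≤≤ (ℕ.s≤s ℕ.z≤n) (ℕP.+-cancelˡ-< x i y p)))
  l1 = r2 ((v0 :+ v1) :* v0) (v0 :* v1 :+ v0 :* v0)
 lo1 : ∀ r -> r ≺ x -> b r ≤ b (suc r)
 lo1 r p = go (y ℕ.≟ 0)
  where
  go : Dec (y ≡ 0) -> b r ≤ b (suc r)
  go (yes refl) = (EQ (bf (ι 0) (ι x) d r (d ℕ.∸ r) (m+[n∸m] (≤≤ (<≤ p) (m≤m+n x 0))) >> ap (\ z -> bC d r * (ι x ^ r * z)) (z0 (d ℕ.∸ r) (ℕP.m<n⇒0<n∸m (ℕP.<-≤-trans p (m≤m+n x 0)))) >> lz (bC d r) (ι x ^ r)) ~ bg d (suc r) py px)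
   where
   z0 : ∀ m -> 0 ≺ m -> ι 0 ^ m ≡ 0q
   z0 (suc m) q = trans (ap (_* ι 0 ^ m) ι0) (*-0ˡ (ι 0 ^ m))
   lz = r2 (v0 :* (v1 :* :0)) :0
  go (no y≢0) = (ca {b r} {b (suc r)} (pos-* (zj r) y+) (ba (nc (bg d r py px) (df k)) (e1 (b (suc r)) (ι (suc r)) (ι y) (ι r * (ι x * b r)) >> ap (\ z -> z - ι r * (ι x * b r)) (br (ι y) (ι x) d r) >> e2 (ι d) (ι x) (b r) (ι r) (ι (suc r)) (ι y))))
   where
   y+ : 0q < ι y
   y+ = <-≤ (zj 0) (mn (ℕP.n≢0⇒n>0 y≢0))
   k : ι (suc r) * ι y + ι r * ι x ≤ ι d * ι x
   k = mb (zb py (mn p)) (zb px (mn (<≤ p))) ~ EQ (l3 (ι x) (ι y) >> ap (_* ι x) (sym (zq x y)))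
    where l3 = r2 (v0 :* v1 :+ v0 :* v0) ((v0 :+ v1) :* v0)
   e1 = r4 (v0 :* (v1 :* v2)) (v1 :* (v2 :* v0) :+ v3 :- v3)
   e2 = r6 (v0 :* (v1 :* v2) :- v3 :* (v1 :* v2)) (v2 :* (v4 :* v5) :+ v2 :* (v0 :* v1 :- (v4 :* v5 :+ v3 :* v1)))
 upm : ∀ i -> x +' i <= d -> b (x +' i) ≤ b x
 upm zero p = EQ (ap b (n+0 x))
 upm (suc i) p = EQ (ap b (+-suc x i)) ~ up1 i p' ~ upm i (<≤ p')
  where
  p' : x +' i ≺ d
  p' = ≤≤ (≤≡ (sym (+-suc x i))) p
 lom : ∀ i r -> r +' i ≡ x -> b r ≤ b x
 lom zero r e = EQ (ap b (sym (n+0 r) >> e))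
 lom (suc i) r e = lo1 r (≤≤ (m≤m+n (suc r) i) (≤≡ (sym (+-suc r i) >> e))) ~ lom i (suc r) (sym (+-suc r i) >> e)
 mode : ∀ j -> j <= d -> b j ≤ b x
 mode j p = go (ℕP.≤-total j x)
  where
  go : j <= x ⊎ x <= j -> b j ≤ b x
  go (inj₁ q) = lom (x ℕ.∸ j) j (m+[n∸m] q)
  go (inj₂ q) = subst (\ k -> b k ≤ b x) (m+[n∸m] q) (upm (j ℕ.∸ x) (≤≤ (≤≡ (m+[n∸m] q)) p))

-- A finite grid of angles covering all frequencies.

module Cover (Y δ : ℚ) (Y+ : 0q < Y) (zB : 0q < δ) where
 private
  pY = qa Y+
  pδ = qa zB
 open Rotation Y δ pY pδ public
 iY : ℚ
 iY = ig Y
 piY : 0q ≤ iY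
 piY = ie Y+

 -- The addition theorem of the cosine, and next to it that of the sine.
 add-v : ∀ n m -> vv (n +' m) ≡ vv n * vv m - UU n * UU m * iY
 add-U : ∀ n m -> UU (n +' m) ≡ UU n * vv m + vv n * UU m
 add-v n zero = trans (ap vv (n+0 n)) (l (vv n) (UU n) iY)
  where l = r3 v0 (v0 :* :1 :- v1 :* :0 :* v2)
 add-v n (suc m) = trans (ap vv (+-suc n m)) (ap₂ (\ a b -> a - δ * b) (add-v n m) (add-U n m) >> l (vv n) (UU n) (vv m) (UU m) δ iY >> ap (\ z -> vv n * (vv m - δ * UU m) - UU n * UU m * iY - δ * UU n * vv m * z) (sym (ic Y+)) >> l2 (vv n) (UU n) (vv m) (UU m) δ iY Y)
  where
  l = r6 (v0 :* v2 :- v1 :* v3 :* v5 :- v4 :* (v1 :* v2 :+ v0 :* v3)) (v0 :* (v2 :- v4 :* v3) :- v1 :* v3 :* v5 :- v4 :* v1 :* v2 :* :1)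
  l2 = r7 (v0 :* (v2 :- v4 :* v3) :- v1 :* v3 :* v5 :- v4 :* v1 :* v2 :* (v6 :* v5)) (v0 :* (v2 :- v4 :* v3) :- v1 :* (v3 :+ v4 :* v6 :* v2) :* v5)
 add-U n zero = trans (ap UU (n+0 n)) (l (vv n) (UU n))
  where l = r2 v1 (v1 :* :1 :+ v0 :* :0)
 add-U n (suc m) = trans (ap UU (+-suc n m)) (ap₂ (\ a b -> b + δ * Y * a) (add-v n m) (add-U n m) >> l (vv n) (UU n) (vv m) (UU m) δ iY Y >> ap (\ z -> UU n * vv m + vv n * UU m + δ * Y * (vv n * vv m) - δ * UU n * UU m * z) (ic Y+) >> l2 (vv n) (UU n) (vv m) (UU m) δ Y)
  where
  l = r7 ((v1 :* v2 :+ v0 :* v3) :+ v4 :* v6 :* (v0 :* v2 :- v1 :* v3 :* v5)) (v1 :* v2 :+ v0 :* v3 :+ v4 :* v6 :* (v0 :* v2) :- v4 :* v1 :* v3 :* (v6 :* v5))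
  l2 = r6 (v1 :* v2 :+ v0 :* v3 :+ v4 :* v5 :* (v0 :* v2) :- v4 :* v1 :* v3 :* :1) (v1 :* (v2 :- v4 :* v3) :+ v0 :* (v3 :+ v4 :* v5 :* v2))

 qq : ℕ -> ℚ
 qq n = vv n * vv n + UU n * UU n * iY

 qq-suc : ∀ n -> qq (suc n) ≡ (1q + δ * δ * Y) * qq n
 qq-suc n = trans (l (vv n) (UU n) δ Y iY) (ap (\ z -> vv n * vv n + UU n * UU n * iY + δ * δ * (U * U) + (δ + δ) * (U * vv n) * (z - 1q) + δ * δ * Y * (vv n * vv n) * z ) (ic Y+) >> l2 (vv n) (UU n) δ Y iY >> ap (\ z -> (1q + δ * δ * Y) * (vv n * vv n) + UU n * UU n * iY + δ * δ * (U * U) * z) (sym (ic Y+)) >> l3 (vv n) (UU n) δ Y iY)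
  where
  U = UU n
  l = r5 ((v0 :- v2 :* v1) :* (v0 :- v2 :* v1) :+ (v1 :+ v2 :* v3 :* v0) :* (v1 :+ v2 :* v3 :* v0) :* v4) (v0 :* v0 :+ v1 :* v1 :* v4 :+ v2 :* v2 :* (v1 :* v1) :+ (v2 :+ v2) :* (v1 :* v0) :* (v3 :* v4 :- :1) :+ v2 :* v2 :* v3 :* (v0 :* v0) :* (v3 :* v4))
  l2 = r5 (v0 :* v0 :+ v1 :* v1 :* v4 :+ v2 :* v2 :* (v1 :* v1) :+ (v2 :+ v2) :* (v1 :* v0) :* (:1 :- :1) :+ v2 :* v2 :* v3 :* (v0 :* v0) :* :1) ((:1 :+ v2 :* v2 :* v3) :* (v0 :* v0) :+ v1 :* v1 :* v4 :+ v2 :* v2 :* (v1 :* v1) :* :1)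
  l3 = r5 ((:1 :+ v2 :* v2 :* v3) :* (v0 :* v0) :+ v1 :* v1 :* v4 :+ v2 :* v2 :* (v1 :* v1) :* (v3 :* v4)) ((:1 :+ v2 :* v2 :* v3) :* (v0 :* v0 :+ v1 :* v1 :* v4))

 qo : ∀ n -> qq n ≡ (1q + δ * δ * Y) ^ n
 qo zero = l iY
  where l = r1 (:1 :* :1 :+ :0 :* :0 :* v0) :1
 qo (suc n) = trans (qq-suc n) (ap ((1q + δ * δ * Y) *_) (qo n))

 1≤qq : ∀ n -> 1q ≤ qq n
 1≤qq n = zt n (ba (nc (nc pδ pδ) pY) refl) ~ EQ (sym (qo n))

 record End (F : ℕ) : Set where
  field
   J : ℕ
   J≤ : J <= F
   vpos : ∀ j -> j <= J -> 0q < vv j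
   vend : vv (suc J) ≤ 0q

 search : ∀ f -> End f ⊎ (∀ j -> j <= f -> 0q < vv j)
 search zero = inj₂ (\ { zero p -> >0 1q })
 search (suc f) = go (search f)
  where
  go : End f ⊎ (∀ j -> j <= f -> 0q < vv j) -> End (suc f) ⊎ (∀ j -> j <= suc f -> 0q < vv j)
  go (inj₁ e) = inj₁ record { J = End.J e ; J≤ = ≤⇒≤s (End.J≤ e) ; vpos = End.vpos e ; vend = End.vend e }
  go (inj₂ h) = ga (vv (suc f) ℚ.≤? 0q)
   where
   ga : Dec (vv (suc f) ≤ 0q) -> End (suc f) ⊎ (∀ j -> j <= suc f -> 0q < vv j)
   ga (yes q) = inj₁ record { J = f ; J≤ = n≤sn f ; vpos = h ; vend = q }
   ga (no q) = inj₂ (\ j p -> go3 j (ℕP.m≤n⇒m<n∨m≡n p))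
    where
    go3 : ∀ j -> j ≺ suc f ⊎ j ≡ suc f -> 0q < vv j
    go3 j (inj₁ p) = h j (≤-pred p)
    go3 j (inj₂ refl) = ≰⇒> q

 -- After the first step U is at least δY, so each later step lowers v by at least δ²Y; F such steps
 -- use up the initial value 1. This bounds the number of steps in a quarter turn.
 ed : ∀ F -> 1q ≤ ι F * (δ * δ * Y) -> End (suc F)
 ed F hF = go (search (suc F))
  where
  go : End (suc F) ⊎ (∀ j -> j <= suc F -> 0q < vv j) -> End (suc F)
  go (inj₁ e) = e
  go (inj₂ h) = ⊥-elim (<⇒≱ (h (suc F) ≤r) (dec F ≤r ~ nonpos))
   where
   open Bal (suc F) (\ j p -> qa (h j p)) using (Unn)
   Ulow : ∀ j -> suc j <= suc F -> δ * Y ≤ UU (suc j)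
   Ulow zero p = EQ (l δ Y)
    where l = r2 (v0 :* v1) (:0 :+ v0 :* v1 :* :1)
   Ulow (suc j) p = Ulow j (<≤ p) ~ ba (nc (nc pδ pY) (qa (h (suc j) (<≤ p)))) refl
   dec : ∀ j -> suc j <= suc F -> vv (suc j) ≤ 1q - ι j * (δ * δ * Y)
   dec zero p = EQ (l δ Y >> ap (\ z -> 1q - z * (δ * δ * Y)) (sym ι0))
    where l = r2 (:1 :- v0 :* :0) (:1 :- :0 :* (v0 :* v0 :* v1))
   dec (suc j) p = mb (dec j (<≤ p)) (neg≤ (za pδ (Ulow j (<≤ p)))) ~ EQ (l (ι j) δ Y >> ap (\ z -> 1q - z * (δ * δ * Y)) (sym (su j)))
    where l = r3 (:1 :- v0 :* (v1 :* v1 :* v2) :- v1 :* (v1 :* v2)) (:1 :- (:1 :+ v0) :* (v1 :* v1 :* v2))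
   nonpos : 1q - ι F * (δ * δ * Y) ≤ 0q
   nonpos = +-≤ʳ 1q (neg≤ hF) ~ EQ (+-inv 1q)

 -- Only multiples of d serve as grid indices, since the mean of d of them must be an integer for
 -- `balance`. In return a grid step consists of d rotations, and `ht` asks that the square of its
 -- angle, about d²δ²Y, be at most η/40.
 module Grid (F d' : ℕ) (E : End F) (η : ℚ) (η1 : η ≤ 1q)
  (ht : (40 // 1) * (ι (suc d') * ι (suc d') * (δ * δ) * Y) ≤ η) where
  open End E public
  d = suc d'
  open Bal J (\ j p -> qa (vpos j p)) public

  t : ℚ
  t = ι d * ι d * (δ * δ) * Y
  pt : 0q ≤ t
  pt = nc (nc (nc (zd d) (zd d)) (nc pδ pδ)) pY
  pη : 0q ≤ η
  pη = nc {40 // 1} by pt ~ ht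
  t40 : t ≤ 1 // 40
  t40 = ca {c = 40 // 1} (>0 (40 // 1)) (EQ (*-cm t (40 // 1)) ~ ht ~ η1 ~ by)

  v≤1 : ∀ j -> j <= suc J -> vv j ≤ 1q
  v≤1 zero p = ≤-refl
  v≤1 (suc j) p = ba (nc pδ (Unn j (≤-pred p))) (l (vv j) (δ * UU j)) ~ v≤1 j (<≤ p)
   where l = r2 v0 ((v0 :- v1) :+ v1)
  U≤ : ∀ j -> j <= suc J -> UU j ≤ ι j * (δ * Y)
  U≤ zero p = nc (zd 0) (nc pδ pY)
  U≤ (suc j) p = mb (U≤ j (<≤ p)) (za (nc pδ pY) (v≤1 j (<≤ p))) ~ EQ (l (ι j) (δ * Y) >> ap (_* (δ * Y)) (sym (su j)))
   where l = r2 (v0 :* v1 :+ v1 :* :1) ((:1 :+ v0) :* v1)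
  v≥ : ∀ j -> j <= d -> j <= suc J -> 1q - ι j * (ι d * (δ * δ * Y)) ≤ vv j
  v≥ zero p q = ba (nc (zd 0) (nc (zd d) (nc (nc pδ pδ) pY))) (l (ι 0 * (ι d * (δ * δ * Y))))
   where l = r1 :1 ((:1 :- v0) :+ v0)
  v≥ (suc j) p q = EQ (ap (\ z -> 1q - z * (ι d * (δ * δ * Y))) (su j) >> l (ι j) (ι d) δ Y) ~ mb (v≥ j (<≤ p) (<≤ q)) (neg≤ (za pδ (U≤ j (<≤ q) ~ zb (nc pδ pY) (mn (<≤ p)))))
   where l = r4 (:1 :- (:1 :+ v0) :* (v1 :* (v2 :* v2 :* v3))) ((:1 :- v0 :* (v1 :* (v2 :* v2 :* v3))) :+ :- (v2 :* (v1 :* (v2 :* v3))))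
  dJ : d <= J
  dJ = ℕP.≮⇒≥ \ lt -> <⇒≱ (<-≤ (>0 (39 // 40)) (by {39 // 40} {1q - (1 // 40)} ~ +-≤ʳ 1q (neg≤ (zb (nc (zd d) (nc (nc pδ pδ) pY)) (mn lt) ~ EQ (l (ι d) δ Y) ~ t40)) ~ v≥ (suc J) lt ≤r)) vend
   where l = r3 (v0 :* (v0 :* (v1 :* v1 :* v2))) (v0 :* v0 :* (v1 :* v1) :* v2)
  vd≥ : 39 // 40 ≤ vv d
  vd≥ = by {39 // 40} {1q - (1 // 40)} ~ +-≤ʳ 1q (neg≤ (EQ (l (ι d) δ Y) ~ t40)) ~ v≥ d ≤r (≤⇒≤s dJ)
   where l = r3 (v0 :* (v0 :* (v1 :* v1 :* v2))) (v0 :* v0 :* (v1 :* v1) :* v2)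
  Ud2 : UU d * UU d * iY ≤ t
  Ud2 = zb piY (ma (Unn d dJ) (Unn d dJ) (U≤ d (≤⇒≤s dJ)) (U≤ d (≤⇒≤s dJ))) ~ EQ (l (ι d) δ Y iY >> ap (\ z -> ι d * ι d * (δ * δ) * Y * z) (ic Y+) >> *-1ʳ t)
   where l = r4 (v0 :* (v1 :* v2) :* (v0 :* (v1 :* v2)) :* v3) (v0 :* v0 :* (v1 :* v1) :* v2 :* (v2 :* v3))
  -- The squared tangent of a grid step is at most η/9; the 9 is the square of the factor 3 lost in
  -- `middle`.
  small-step : (9 // 1) * (UU d * UU d * iY) ≤ η * (vv d * vv d)
  small-step = za {c = 9 // 1} by Ud2 ~ EQ (l t) ~ za {c = 9 // 40} by ht ~ zb pη (by {9 // 40} {(39 // 40) * (39 // 40)}) ~ EQ (*-cm ((39 // 40) * (39 // 40)) η) ~ za pη (ma (by {0q} {39 // 40}) (by {0q} {39 // 40}) vd≥ vd≥)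
   where l = r1 ((9 :/ 1) :* v0) ((9 :/ 40) :* ((40 :/ 1) :* v0))
  sF : UU d * UU d * iY ≤ η * (vv d * vv d)
  sF = EQ (sym (*-1ˡ (UU d * UU d * iY))) ~ zb (nc (nc (Unn d dJ) (Unn d dJ)) piY) (by {1q} {9 // 1}) ~ small-step

  U+ : ∀ j -> 1 <= j -> j <= J -> 0q < UU j
  U+ (suc j) p q = <-≤ (pos-* (pos-* zB Y+) (vpos j (<≤ q))) (ba (Unn j (<≤ q)) (+-cm (UU j) (δ * Y * vv j)))

  qq+ : ∀ n -> 0q < qq n
  qq+ n = <-≤ (>0 1q) (1≤qq n)

  aa bb : ℕ -> ℚ
  aa n = UU n * UU n * iY * ig (qq n)
  bb n = vv n * vv n * ig (qq n)

  K : ℕ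
  K = J ℕ./ d
  dK≤ : ∀ k -> k <= K -> d *' k <= J
  dK≤ k p = ≤≤ (ℕP.*-monoʳ-≤ d p) (≤≤ (≤≡ (*-cmℕ d K)) (ℕD.m/n*n≤m J d))
  J<dK : J ≺ d *' K +' d
  J<dK = ℕP.≤-<-trans (≤≡ (ℕD.m≡m%n+[m/n]*n J d >> +-cmℕ (J ℕ.% d) (K *' d) >> ap (ℕ._+ J ℕ.% d) (*-cmℕ K d))) (ℕP.+-monoʳ-< (d *' K) (ℕD.m%n<n J d))
  1≤K : 1 <= K
  1≤K = ≤≤ (≤≡ (sym (ℕD.n/n≡1 d))) (ℕD./-monoˡ-≤ d dJ)

  module _ (x y : ℕ) (sc : 1 <= x +' y) where
   private
    s = x +' y
    S = ι s
    pS = zd s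
    N α zF : ℕ -> ℚ
    N = qq
    α n = UU n * UU n * iY
    zF n = vv n * vv n
    Be : ℕ -> Set
    Be k = S * α (d *' k) ≤ ι x * N (d *' k)
    -- `Be k` says that sin² of the k-th grid angle is at most the target frequency x/(x + y). The
    -- search stops where this fails next, or at the end of the grid.
    pick : ∀ K -> ∃[ k ] (k <= K × Be k × (k ≡ K ⊎ ¬ Be (suc k)))
    pick zero = 0 , ℕ.z≤n , (EQ (ap (\ n -> S * α n) (ℕP.*-zeroʳ d) >> l S iY) ~ nc (zd x) (qa (qq+ (d *' 0)))) , inj₁ refl
     where l = r2 (v0 :* (:0 :* :0 :* v1)) :0
    pick (suc K) = go (pick K)
     where
     go : ∃[ k ] (k <= K × Be k × (k ≡ K ⊎ ¬ Be (suc k))) -> ∃[ k ] (k <= suc K × Be k × (k ≡ suc K ⊎ ¬ Be (suc k)))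
     go (k , p , b , inj₂ nb) = k , ≤⇒≤s p , b , inj₂ nb
     go (k , p , b , inj₁ refl) = ga (S * α (d *' suc k) ℚ.≤? ι x * N (d *' suc k))
      where
      ga : Dec (Be (suc k)) -> ∃[ k' ] (k' <= suc k × Be k' × (k' ≡ suc k ⊎ ¬ Be (suc k')))
      ga (yes b') = suc k , ≤r , b' , inj₁ refl
      ga (no nb) = k , n≤sn k , b , inj₂ nb

    Gd : ℕ -> Set
    Gd n = (ι x * N n - S * α n) * (ι x * N n - S * α n) ≤ η * (α n * zF n) * (S * S)

    αnn : ∀ n -> n <= J -> 0q ≤ α n
    αnn n p = nc (nc (Unn n p) (Unn n p)) piY
    βnn : ∀ n -> 0q ≤ zF n
    βnn n = sn (vv n)

    first : ¬ Be 1 -> Gd d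
    first nb = EQ (l1 (ι x * N d) (S * α d)) ~ ma nn1 nn1 le1 le1 ~ EQ (l2 S (α d)) ~ za (nc (αnn d dJ) (nc pS pS)) sF ~ EQ (l3 η (α d) (zF d) S)
     where
     lt : ι x * N d ≤ S * α d
     lt = qa (≰⇒> (\ h -> nb (subst (\ k -> S * α k ≤ ι x * N k) (sym (ℕP.*-identityʳ d)) h)))
     nn1 : 0q ≤ S * α d - ι x * N d
     nn1 = df lt
     le1 : S * α d - ι x * N d ≤ S * α d
     le1 = ba (nc (zd x) (qa (qq+ d))) (l (S * α d) (ι x * N d))
      where l = r2 v0 ((v0 :- v1) :+ v1)
     l1 = r2 ((v0 :- v1) :* (v0 :- v1)) ((v1 :- v0) :* (v1 :- v0))
     l2 = r2 (v0 :* v1 :* (v0 :* v1)) (v1 :* (v0 :* v0) :* v1)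
     l3 = r4 (v1 :* (v3 :* v3) :* (v0 :* v2)) (v0 :* (v1 :* v2) :* (v3 :* v3))

    -- From the last grid point less than one grid step remains to the quarter turn, so cos² is at
    -- most η sin² there, and the target lies between sin² and 1.
    final : Be K -> Gd (d *' K)
    final bl = ma (df bl) (df bl) le1 le1 ~ EQ (l2 S (zF n)) ~ za (nc (βnn n) (nc pS pS)) bα ~ EQ (l3 η (α n) (zF n) S)
     where
     n = d *' K
     nJ : n <= J
     nJ = dK≤ K ≤r
     le1 : ι x * N n - S * α n ≤ S * zF n
     le1 = +-≤ˡ (- (S * α n)) (zb (qa (qq+ n)) (mn (m≤m+n x y))) ~ EQ (l S (zF n) (α n))
      where l = r3 (v0 :* (v1 :+ v2) :- v0 :* v2) (v0 :* v1)
     i = suc J ℕ.∸ n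
     ni : n +' i ≡ suc J
     ni = m+[n∸m] (≤⇒≤s nJ)
     i≤d : i <= d
     i≤d = ℕP.+-cancelˡ-≤ n i d (≤≤ (≤≡ ni) J<dK)
     vn = vv n
     Un = UU n
     e1 : vn * vv i ≤ Un * UU i * iY
     e1 = nj (df vend ~ EQ (ap (\ k -> 0q - vv k) (sym ni) >> ap (\ z -> 0q - z) (add-v n i) >> l (vn * vv i) (Un * UU i * iY)))
      where l = r2 (:0 :- (v0 :- v1)) (v1 :- v0)
     e2 : UU i * vv d ≤ UU d * vv i
     e2 = nj (subst (\ k -> 0q ≤ UU k * vv i - vv k * UU i) id≡ (wa i (d ℕ.∸ i) (≤≤ (≤≡ id≡) dJ)) ~ EQ (l (UU d) (vv i) (vv d) (UU i)))
      where
      id≡ : i +' (d ℕ.∸ i) ≡ d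
      id≡ = m+[n∸m] i≤d
      l = r4 (v0 :* v1 :- v2 :* v3) (v0 :* v1 :- v3 :* v2)
     e3 : vn * vv d ≤ Un * (UU d * iY)
     e3 = ca (vpos i (≤≤ i≤d dJ)) (EQ (l (vn) (vv d) (vv i)) ~ zb (qa (vpos d dJ)) e1 ~ EQ (l' Un (UU i) iY (vv d)) ~ za (nc (Unn n nJ) piY) e2 ~ EQ (l'' Un iY (UU d) (vv i)))
      where
      l = r3 (v0 :* v1 :* v2) (v0 :* v2 :* v1)
      l' = r4 (v0 :* v1 :* v2 :* v3) (v0 :* v2 :* (v1 :* v3))
      l'' = r4 (v0 :* v1 :* (v2 :* v3)) (v0 :* (v2 :* v1) :* v3)
     bα : zF n ≤ η * α n
     bα = ca (pos-* (vpos d dJ) (vpos d dJ)) (EQ (l vn (vv d)) ~ ma (nc (qa (vpos n nJ)) (qa (vpos d dJ))) (nc (qa (vpos n nJ)) (qa (vpos d dJ))) e3 e3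
      ~ EQ (l' Un (UU d) iY) ~ za (αnn n nJ) sF ~ EQ (l'' η (α n) (zF d)))
      where
      l = r2 (v0 :* v0 :* (v1 :* v1)) (v0 :* v1 :* (v0 :* v1))
      l' = r3 (v0 :* (v1 :* v2) :* (v0 :* (v1 :* v2))) (v0 :* v0 :* v2 :* (v1 :* v1 :* v2))
      l'' = r3 (v1 :* (v0 :* v2)) (v0 :* v1 :* v2)
     l2 = r2 (v0 :* v1 :* (v0 :* v1)) (v1 :* (v0 :* v0) :* v1)
     l3 = r4 (v2 :* (v3 :* v3) :* (v0 :* v1)) (v0 :* (v1 :* v2) :* (v3 :* v3))

    -- The target lies between sin²α and sin²(α + β), with β one grid step. Expanding the difference
    -- gives 2 sin α cos α sin β cos β plus at most sin²β cos²α, and β ≤ α bounds the latter by a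
    -- third copy of the same product.
    middle : ∀ k -> 1 <= k -> suc k <= K -> Be k -> ¬ Be (suc k) -> Gd (d *' k)
    middle k k1 kK bl nb = ca (pos-* (qq+ d) (qq+ d)) (EQ (l0 (ι x * N n - S * α n) (N d)) ~ ma g0 g0 g1 g1 ~ EQ (l1 S Un vn (vv d) (UU d) iY) ~ za (nc (nc (αnn n nJ) (βnn n)) (nc pS pS)) g2 ~ EQ (l2 η (α n) (zF n) S (N d)))
     where
     n = d *' k
     m = n +' d
     nJ : n <= J
     nJ = dK≤ k (<≤ kK)
     m≡ : d *' suc k ≡ m
     m≡ = trans (ℕP.*-suc d k) (+-cmℕ d n)
     mJ : m <= J
     mJ = ≤≤ (≤≡ (sym m≡)) (dK≤ (suc k) kK)
     vn = vv n
     Un = UU n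
     lt : ι x * (N n * N d) ≤ S * α m
     lt = EQ (ap (ι x *_) (ap₂ _*_ (qo n) (qo d) >> sym (zr (1q + δ * δ * Y) n d) >> sym (qo m))) ~ qa (≰⇒> (\ h -> nb (subst (\ k -> S * α k ≤ ι x * N k) (sym m≡) h)))
     g0 : 0q ≤ (ι x * N n - S * α n) * N d
     g0 = nc (df bl) (qa (qq+ d))
     dn : d <= n
     dn = ≤≤ (≤≡ (sym (ℕP.*-identityʳ d))) (ℕP.*-monoʳ-≤ d k1)
     wr : UU d * vn ≤ vv d * Un
     wr = nj (subst (\ k -> 0q ≤ UU k * vv d - vv k * UU d) dn≡ (wa d (n ℕ.∸ d) (≤≤ (≤≡ dn≡) nJ)) ~ EQ (l Un (vv d) vn (UU d)))
      where
      dn≡ : d +' (n ℕ.∸ d) ≡ n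
      dn≡ = m+[n∸m] dn
      l = r4 (v0 :* v1 :- v2 :* v3) (v1 :* v0 :- v3 :* v2)
     g1 : (ι x * N n - S * α n) * N d ≤ S * ((3 // 1) * (Un * vn * (vv d * UU d * iY)))
     g1 = EQ (la (ι x) (N n) S (α n) (N d)) ~ +-≤ˡ (- (S * (α n * N d))) lt ~ EQ (ap (\ z -> S * (z * z * iY) - S * (α n * N d)) (add-U n d)) ~ EQ (lb S Un vn (UU d) (vv d) iY)
      ~ za pS (ba (nc (nc (Unn d dJ) (Unn d dJ)) (nc piY (αnn n nJ))) (lc (Un * vn * (vv d * UU d * iY)) (UU d) iY (vn * vn) (α n)) ~ +-≤ʳ ((2 // 1) * (Un * vn * (vv d * UU d * iY))) (EQ (le (UU d) iY vn) ~ za (nc (nc (Unn d dJ) piY) (qa (vpos n nJ))) wr) ~ EQ (lf (UU d) iY vn (vv d) Un))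
      where
      la = r5 ((v0 :* v1 :- v2 :* v3) :* v4) (v0 :* (v1 :* v4) :+ :- (v2 :* (v3 :* v4)))
      lb = r6 (v0 :* ((v1 :* v4 :+ v2 :* v3) :* (v1 :* v4 :+ v2 :* v3) :* v5) :- v0 :* (v1 :* v1 :* v5 :* (v4 :* v4 :+ v3 :* v3 :* v5))) (v0 :* (:2 :* (v1 :* v2 :* (v4 :* v3 :* v5)) :+ v3 :* v3 :* v5 :* (v2 :* v2) :- v3 :* v3 :* (v5 :* (v1 :* v1 :* v5))))
      lc = r5 (:2 :* v0 :+ v1 :* v1 :* v2 :* v3) ((:2 :* v0 :+ v1 :* v1 :* v2 :* v3 :- v1 :* v1 :* (v2 :* v4)) :+ v1 :* v1 :* (v2 :* v4))
      le = r3 (v0 :* v0 :* v1 :* (v2 :* v2)) (v0 :* v1 :* v2 :* (v0 :* v2))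
      lf = r5 (:2 :* (v4 :* v2 :* (v3 :* v0 :* v1)) :+ v0 :* v1 :* v2 :* (v3 :* v4)) (:3 :* (v4 :* v2 :* (v3 :* v0 :* v1)))
     g2 : (9 // 1) * (UU d * UU d * iY) * (vv d * vv d) ≤ η * (N d * N d)
     g2 = zb (βnn d) small-step ~ EQ (*-as η (zF d) (zF d)) ~ za pη (ma (βnn d) (βnn d) βN βN)
      where
      βN : zF d ≤ N d
      βN = ba (αnn d dJ) refl
     l0 = r2 (v0 :* v0 :* (v1 :* v1)) (v0 :* v1 :* (v0 :* v1))
     l1 = r6 (v0 :* (:3 :* (v1 :* v2 :* (v3 :* v4 :* v5))) :* (v0 :* (:3 :* (v1 :* v2 :* (v3 :* v4 :* v5))))) (v1 :* v1 :* v5 :* (v2 :* v2) :* (v0 :* v0) :* ((9 :/ 1) :* (v4 :* v4 :* v5) :* (v3 :* v3)))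
     l2 = r5 (v1 :* v2 :* (v3 :* v3) :* (v0 :* (v4 :* v4))) (v0 :* (v1 :* v2) :* (v3 :* v3) :* (v4 :* v4))

    good : ∃[ k ] (1 <= k × k <= K × Gd (d *' k))
    good = go (pick K)
     where
     go : ∃[ k ] (k <= K × Be k × (k ≡ K ⊎ ¬ Be (suc k))) -> ∃[ k ] (1 <= k × k <= K × Gd (d *' k))
     go (k , p , b , inj₁ e) = K , 1≤K , ≤r , final (subst Be e b)
     go (zero , p , b , inj₂ nb) = 1 , ≤r , 1≤K , subst Gd (sym (ℕP.*-identityʳ d)) (first nb)
     go (suc k , p , b , inj₂ nb) = ga (ℕP.m≤n⇒m<n∨m≡n p)
      where
      ga : suc k ≺ K ⊎ suc k ≡ K -> ∃[ k ] (1 <= k × k <= K × Gd (d *' k))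
      ga (inj₁ q) = suc k , ℕ.s≤s ℕ.z≤n , p , middle (suc k) (ℕ.s≤s ℕ.z≤n) q b nb
      ga (inj₂ e) = K , 1≤K , ≤r , final (subst Be e b)

   cover : ∃[ k ] (1 <= k × k <= K × ι x ^ x * ι y ^ y ≤ (ι (x +' y) * (1q + η)) ^ (x +' y) * (aa (d *' k) ^ x * bb (d *' k) ^ y))
   cover = fin good
    where
    fin : ∃[ k ] (1 <= k × k <= K × Gd (d *' k)) -> _
    fin (k , k1 , kK , g) = k , k1 , kK , gibbs {aa n} {bb n} {η} x y (pos-* (pos-* (pos-* Un+ Un+) (io Y+)) iN+) (pos-* (pos-* vn+ vn+) iN+) ab pη sc
     (EQ (ap (\ z -> z * z) (l1 (ι x) (ι y) (α n) (zF n) iN) >> l2 (ι x * zF n - ι y * α n) iN >> ap (\ z -> z * z * (iN * iN)) (l3 (ι x) (ι y) (α n) (zF n) >> ap (\ z -> ι x * N n - z * α n) (sym (zq x y))))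
      ~ zb (nc (qa iN+) (qa iN+)) g ~ EQ (l4 η (α n) (zF n) S iN))
     where
     n = d *' k
     nJ = dK≤ k kK
     Un+ = U+ n (≤≤ k1 (m≤m+n k (d' *' k))) nJ
     vn+ = vpos n nJ
     iN = ig (qq n)
     iN+ = io (qq+ n)
     ab : aa n + bb n ≡ 1q
     ab = trans (l (α n) (zF n) iN) (ic (qq+ n))
      where l = r3 (v0 :* v2 :+ v1 :* v2) ((v1 :+ v0) :* v2)
     l1 = r5 (v0 :* (v3 :* v4) :- v1 :* (v2 :* v4)) ((v0 :* v3 :- v1 :* v2) :* v4)
     l2 = r2 (v0 :* v1 :* (v0 :* v1)) (v0 :* v0 :* (v1 :* v1))
     l3 = r4 (v0 :* v3 :- v1 :* v2) (v0 :* (v3 :+ v2) :- (v0 :+ v1) :* v2)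
     l4 = r5 (v0 :* (v1 :* v2) :* (v3 :* v3) :* (v4 :* v4)) (v0 :* (v1 :* v4 :* (v2 :* v4)) :* (v3 :* v3))

-- Sums over lists.

S : {A : Set} -> (A -> ℚ) -> List A -> ℚ
S f [] = 0q
S f (x ∷ xs) = f x + S f xs

S-nn : ∀ {A : Set} {f : A -> ℚ} xs -> (∀ x -> 0q ≤ f x) -> 0q ≤ S f xs
S-nn [] h = ≤-refl
S-nn (x ∷ xs) h = nh (h x) (S-nn xs h)

Sm : ∀ {A : Set} {f g : A -> ℚ} xs -> (∀ x -> x ∈ xs -> f x ≤ g x) -> S f xs ≤ S g xs
Sm [] h = ≤-refl
Sm (x ∷ xs) h = mb (h x (here refl)) (Sm xs (\ y p -> h y (there p)))

Sc : ∀ {A : Set} {f g : A -> ℚ} xs -> (∀ x -> x ∈ xs -> f x ≡ g x) -> S f xs ≡ S g xs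
Sc [] h = refl
Sc (x ∷ xs) h = ap₂ _+_ (h x (here refl)) (Sc xs (\ y p -> h y (there p)))

S-++ : ∀ {A : Set} (f : A -> ℚ) xs ys -> S f (xs ++ ys) ≡ S f xs + S f ys
S-++ f [] ys = sym (+-0ˡ (S f ys))
S-++ f (x ∷ xs) ys = trans (ap (f x +_) (S-++ f xs ys)) (sym (+-as (f x) (S f xs) (S f ys)))

S-map : ∀ {A B : Set} (f : B -> ℚ) (g : A -> B) xs -> S f (map g xs) ≡ S (f ∘ g) xs
S-map f g [] = refl
S-map f g (x ∷ xs) = ap (f (g x) +_) (S-map f g xs)

So : ∀ {A B : Set} (f : B -> ℚ) (g : A -> List B) xs -> S f (concatMap g xs) ≡ S (\ x -> S f (g x)) xs
So f g [] = refl
So f g (x ∷ xs) = trans (S-++ f (g x) (concatMap g xs)) (ap (S f (g x) +_) (So f g xs))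

Sa : ∀ {A : Set} c (f : A -> ℚ) xs -> S (\ x -> c * f x) xs ≡ c * S f xs
Sa c f [] = sym (*-0ʳ c)
Sa c f (x ∷ xs) = trans (ap (c * f x +_) (Sa c f xs)) (sym (ℚP.*-distribˡ-+ c (f x) (S f xs)))

S-+ : ∀ {A : Set} (f g : A -> ℚ) xs -> S (\ x -> f x + g x) xs ≡ S f xs + S g xs
S-+ f g [] = refl
S-+ f g (x ∷ xs) = trans (ap (f x + g x +_) (S-+ f g xs)) (l (f x) (g x) (S f xs) (S g xs))
 where l = r4 (v0 :+ v1 :+ (v2 :+ v3)) (v0 :+ v2 :+ (v1 :+ v3))

S-zero : ∀ {A : Set} (xs : List A) -> S (\ _ -> 0q) xs ≡ 0q
S-zero [] = refl
S-zero (x ∷ xs) = trans (+-0ˡ (S (\ _ -> 0q) xs)) (S-zero xs)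

Ss : ∀ {A B : Set} (f : A -> B -> ℚ) xs ys -> S (\ x -> S (f x) ys) xs ≡ S (\ y -> S (\ x -> f x y) xs) ys
Ss f [] ys = sym (S-zero ys)
Ss f (x ∷ xs) ys = trans (ap (S (f x) ys +_) (Ss f xs ys)) (sym (S-+ (f x) (\ y -> S (\ x -> f x y) xs) ys))

Sn : ∀ {A : Set} c (xs : List A) -> S (\ _ -> c) xs ≡ ι (length xs) * c
Sn c [] = sym (ap (_* c) ι0 >> *-0ˡ c)
Sn c (x ∷ xs) = trans (ap (c +_) (Sn c xs)) (l c (ι (length xs)) >> ap (_* c) (sym (su (length xs))))
 where l = r2 (v0 :+ v1 :* v0) ((:1 :+ v1) :* v0)

S-term : ∀ {A : Set} {f : A -> ℚ} {x} xs -> x ∈ xs -> (∀ x -> 0q ≤ f x) -> f x ≤ S f xs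
S-term (x ∷ xs) (here refl) h = ba (S-nn xs h) refl
S-term {f = f} (y ∷ xs) (there p) h = S-term xs p h ~ ba (h y) (+-cm (f y) (S f xs))

Sg : ∀ {A : Set} (xs : List A) k (f : Vec A (suc k) -> ℚ) -> S f (vecsOver xs (suc k)) ≡ S (\ x -> S (\ v -> f (x ∷ v)) (vecsOver xs k)) xs
Sg xs k f = trans (So f (\ x -> map (x ∷_) (vecsOver xs k)) xs) (Sc xs (\ x _ -> S-map f (x ∷_) (vecsOver xs k)))

-- After multiplying out, each product of two terms is compared by taking the root of the product of
-- two hypotheses. It lets one sum square roots of weights while only the squares are available as
-- rationals.
sq-sum : ∀ {A : Set} {a b : A -> ℚ} {σ} xs -> 0q ≤ σ -> (∀ x -> 0q ≤ a x) -> (∀ x -> 0q ≤ b x) -> (∀ x -> x ∈ xs -> a x * a x ≤ σ * (b x * b x)) -> S a xs * S a xs ≤ σ * (S b xs * S b xs)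
sq-sum {a = a} {b} {σ} xs pσ na nb h = EQ (ex a) ~ Sm xs (\ x p -> Sm xs (\ y q -> sr (nc pσ (nc (nb x) (nb y))) (pq x y p q))) ~ EQ (sym (ap (σ *_) (ex b) >> sym (Sc xs (\ x _ -> Sa σ (\ y -> b x * b y) xs) >> Sa σ (\ x -> S (\ y -> b x * b y) xs) xs)))
 where
 ex : ∀ c -> S c xs * S c xs ≡ S (\ x -> S (\ y -> c x * c y) xs) xs
 ex c = trans (sym (Sa (S c xs) c xs)) (Sc xs (\ x _ -> trans (*-cm (S c xs) (c x)) (sym (Sa (c x) c xs))))
 pq : ∀ x y -> x ∈ xs -> y ∈ xs -> a x * a y * (a x * a y) ≤ σ * (b x * b y) * (σ * (b x * b y))
 pq x y p q = EQ (l1 (a x) (a y)) ~ ma (sn (a x)) (sn (a y)) (h x p) (h y q) ~ EQ (l2 σ (b x) (b y))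
  where
  l1 = r2 (v0 :* v1 :* (v0 :* v1)) (v0 :* v0 :* (v1 :* v1))
  l2 = r3 (v0 :* (v1 :* v1) :* (v0 :* (v2 :* v2))) (v0 :* (v1 :* v2) :* (v0 :* (v1 :* v2)))

𝟙 : Bool -> ℚ
𝟙 true = 1q
𝟙 false = 0q

nk : ∀ b -> 0q ≤ 𝟙 b
nk true = ze
nk false = ≤-refl

zG : ∀ b -> 𝟙 b ≤ 1q
zG true = ≤-refl
zG false = ze

cB : ∀ {A : Set} (p : A -> Bool) xs -> ι (countB p xs) ≡ S (\ x -> 𝟙 (p x)) xs
cB p [] = ι0
cB p (x ∷ xs) = go (p x) refl
 where
 go : ∀ b -> p x ≡ b -> ι (countB p (x ∷ xs)) ≡ 𝟙 (p x) + S (\ x -> 𝟙 (p x)) xs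
 go true e rewrite e = trans (su (countB p xs)) (ap (1q +_) (cB p xs))
 go false e rewrite e = trans (cB p xs) (sym (+-0ˡ (S (\ x -> 𝟙 (p x)) xs)))

remove : ∀ {A : Set} {x : A} (xs : List A) -> x ∈ xs -> List A
remove (x ∷ xs) (here _) = xs
remove (x ∷ xs) (there p) = x ∷ remove xs p

S-remove : ∀ {A : Set} (f : A -> ℚ) {x} xs (p : x ∈ xs) -> S f xs ≡ f x + S f (remove xs p)
S-remove f (x ∷ xs) (here refl) = refl
S-remove f {x} (y ∷ xs) (there p) = trans (ap (f y +_) (S-remove f xs p)) (l (f y) (f x) (S f (remove xs p)))
 where l = r3 (v0 :+ (v1 :+ v2)) (v1 :+ (v0 :+ v2))

rm : ∀ {A : Set} {x y : A} xs (p : x ∈ xs) -> y ∈ xs -> y ≢ x -> y ∈ remove xs p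
rm (x ∷ xs) (here refl) (here refl) ne = ⊥-elim (ne refl)
rm (x ∷ xs) (here refl) (there q) ne = q
rm (x ∷ xs) (there p) (here refl) ne = here refl
rm (x ∷ xs) (there p) (there q) ne = there (rm xs p q ne)

S-⊆ : ∀ {A : Set} {f : A -> ℚ} xs ys -> Unique xs -> (∀ x -> x ∈ xs -> x ∈ ys) -> (∀ x -> 0q ≤ f x) -> S f xs ≤ S f ys
S-⊆ [] ys u h nn = S-nn ys nn
S-⊆ {f = f} (x ∷ xs) ys (nx ∷ u) h nn = +-≤ʳ (f x) (S-⊆ xs (remove ys p) u (\ y q -> rm ys p (h y (there q)) (\ e -> All.lookup nx q (sym e))) nn) ~ EQ (sym (S-remove f ys p))
 where p = h x (here refl)

fi : ∀ {A : Set} (p : A -> Bool) {x} xs -> x ∈ filterᵇ p xs -> x ∈ xs × p x ≡ true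
fi p (y ∷ ys) q with p y in e
fi p (y ∷ ys) (here refl) | true = here refl , e
fi p (y ∷ ys) (there q) | true = there (fst (fi p ys q)) , snd (fi p ys q)
fi p (y ∷ ys) q | false = there (fst (fi p ys q)) , snd (fi p ys q)

fr : ∀ {A : Set} (p : A -> Bool) {x} xs -> x ∈ xs -> p x ≡ true -> x ∈ filterᵇ p xs
fr p (y ∷ ys) (here refl) e rewrite e = here refl
fr p (y ∷ ys) (there q) e with p y
... | true = there (fr p ys q e)
... | false = fr p ys q e

uf : ∀ {A : Set} (p : A -> Bool) {xs} -> Unique xs -> Unique (filterᵇ p xs)
uf p [] = []
uf p {x ∷ xs} (nx ∷ u) with p x
... | true = All.tabulate (\ {y} q -> All.lookup nx (fst (fi p xs q))) ∷ uf p u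
... | false = uf p u

vc : ∀ {A : Set} (xs : List A) {k} (v : Vec A k) -> (∀ i -> lookup v i ∈ xs) -> v ∈ vecsOver xs k
vc xs [] h = here refl
vc xs (x ∷ v) h = ∈P.∈-concatMap⁺ (\ x -> map (x ∷_) (vecsOver xs _)) {xs = xs} (∈→Any xs (h fz) (∈P.∈-map⁺ (x ∷_) (vc xs v (\ i -> h (fs i)))))
 where
 open import Data.List.Relation.Unary.Any using (Any)
 ∈→Any : ∀ ys {w} -> x ∈ ys -> w ∈ map (x ∷_) (vecsOver xs _) -> Any (\ y -> w ∈ map (y ∷_) (vecsOver xs _)) ys
 ∈→Any (y ∷ ys) (here refl) q = here q
 ∈→Any (y ∷ ys) (there p) q = there (∈→Any ys p q)

uc : ∀ {A : Set} (xs : List A) k -> Unique xs -> Unique (vecsOver xs k)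
uc xs zero u = [] ∷ []
uc {A} xs (suc k) u = go xs u
 where
 uk = uc xs k u
 go : ∀ ys -> Unique ys -> Unique (concatMap (\ x -> map (x ∷_) (vecsOver xs k)) ys)
 go [] _ = []
 go (y ∷ ys) (ny ∷ uy) = UniqueP.++⁺ (UniqueP.map⁺ (\ e -> snd (VecP.∷-injective e)) uk) (go ys uy)
  (\ {v} (p , q) -> dis v p (hd ys q))
  where
  hd : ∀ zs {v} -> v ∈ concatMap (\ x -> map (x ∷_) (vecsOver xs k)) zs -> Vec.head v ∈ zs
  hd (z ∷ zs) p with ∈P.∈-++⁻ (map (z ∷_) (vecsOver xs k)) p
  ... | inj₁ q with ∈P.∈-map⁻ (z ∷_) q
  ...   | (w , _ , refl) = here refl
  hd (z ∷ zs) p | inj₂ q = there (hd zs q)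
  dis : ∀ v -> v ∈ map (y ∷_) (vecsOver xs k) -> Vec.head v ∈ ys -> ⊥
  dis v p q with ∈P.∈-map⁻ (y ∷_) p
  ... | (w , _ , refl) = All.lookup ny q refl

-- Recursive enumeration of perfect matchings.

pi : {A : Set} -> List A -> List (A × List A)
pi [] = []
pi (x ∷ xs) = (x , xs) ∷ map (\ wy -> fst wy , x ∷ snd wy) (pi xs)

pf : ∀ {A : Set} (xs : List A) {w ws} -> (w , ws) ∈ pi xs -> w ∈ xs × (∀ x -> x ∈ ws -> x ∈ xs) × (∀ x -> x ∈ xs -> x ≡ w ⊎ x ∈ ws) × length xs ≡ suc (length ws)
pf (x ∷ xs) (here refl) = here refl , (\ _ q -> there q) , (\ { _ (here e) -> inj₁ e ; _ (there q) -> inj₂ q }) , refl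
pf (x ∷ xs) (there p) with ∈P.∈-map⁻ (\ wy -> fst wy , x ∷ snd wy) p
... | ((w , ws) , q , refl) with pf xs q
... | (a , b , c , e) = there a , (\ { _ (here r) -> here r ; y (there r) -> there (b y r) }) , (\ { _ (here r) -> inj₂ (here r) ; y (there r) -> (case' (c y r)) }) , ap suc e
 where
 case' : ∀ {y} -> y ≡ w ⊎ y ∈ ws -> y ≡ w ⊎ y ∈ (x ∷ ws)
 case' (inj₁ r) = inj₁ r
 case' (inj₂ r) = inj₂ (there r)

pn : ∀ {A : Set} (xs : List A) {w ws} -> Unique xs -> (w , ws) ∈ pi xs -> w ∉ ws × Unique ws
pn (x ∷ xs) (nx ∷ u) (here refl) = (\ q -> All.lookup nx q refl) , u
pn (x ∷ xs) (nx ∷ u) (there p) with ∈P.∈-map⁻ (\ wy -> fst wy , x ∷ snd wy) p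
... | ((w , ws) , q , refl) with pn xs u q | pf xs q
... | (a , b) | (c , e , _) = (\ { (here r) -> All.lookup nx c (sym r) ; (there r) -> a r }) , All.tabulate (\ {y} r -> All.lookup nx (e y r)) ∷ b

p3 : ∀ {A : Set} (xs : List A) {w} -> w ∈ xs -> ∃[ ws ] ((w , ws) ∈ pi xs)
p3 (x ∷ xs) (here refl) = xs , here refl
p3 (x ∷ xs) (there p) = x ∷ fst r , there (∈P.∈-map⁺ (\ wy -> fst wy , x ∷ snd wy) (snd r))
 where r = p3 xs p

pL : ∀ {A : Set} (xs : List A) -> map fst (pi xs) ≡ xs
pL [] = refl
pL (x ∷ xs) = ap (x ∷_) (sym (LP.map-∘ (pi xs)) >> pL xs)

upd : ∀ {n} -> Vec (Fin n) n -> Fin n -> Fin n -> Vec (Fin n) n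
upd bc v w = (bc Vec.[ v ]≔ w) Vec.[ w ]≔ v

-- Exposes a matching by giving the first remaining vertex every possible partner; f counts the
-- pairs still to be chosen and `bc` records those already fixed. Unlike a filter over all tables
-- this supports induction on the exposed vertices, in any chosen order.
PL : ∀ {n} -> ℕ -> List (Fin n) -> Vec (Fin n) n -> List (Vec (Fin n) n)
PL zero re bc = bc ∷ []
PL (suc f) [] bc = bc ∷ []
PL (suc f) (v ∷ vs) bc = concatMap (\ wy -> PL f (snd wy) (upd bc v (fst wy))) (pi vs)

S-PL : ∀ {n} (g : Vec (Fin n) n -> ℚ) f v vs bc -> S g (PL (suc f) (v ∷ vs) bc) ≡ S (\ wy -> S g (PL f (snd wy) (upd bc v (fst wy)))) (pi vs)
S-PL g f v vs bc = So g (\ wy -> PL f (snd wy) (upd bc v (fst wy))) (pi vs)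

upd-v : ∀ {n} (bc : Vec (Fin n) n) {v w} -> v ≢ w -> lookup (upd bc v w) v ≡ w
upd-v bc {v} {w} ne = trans (VecP.lookup∘updateAt′ v w ne (bc Vec.[ v ]≔ w)) (VecP.lookup∘updateAt v bc)

upd-w : ∀ {n} (bc : Vec (Fin n) n) v w -> lookup (upd bc v w) w ≡ v
upd-w bc v w = VecP.lookup∘updateAt w (bc Vec.[ v ]≔ w)

upd-o : ∀ {n} (bc : Vec (Fin n) n) {v w i} -> i ≢ v -> i ≢ w -> lookup (upd bc v w) i ≡ lookup bc i
upd-o bc {v} {w} {i} iv iw = trans (VecP.lookup∘updateAt′ i w iw (bc Vec.[ v ]≔ w)) (VecP.lookup∘updateAt′ i v iv bc)

co : ∀ {A B : Set} (g : A -> List B) xs {y} -> y ∈ concatMap g xs -> ∃[ x ] (x ∈ xs × y ∈ g x)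
co g (x ∷ xs) p with ∈P.∈-++⁻ (g x) p
... | inj₁ q = x , here refl , q
... | inj₂ q = fst r , there (fst (snd r)) , snd (snd r)
 where r = co g xs q

cp : ∀ {A B : Set} (g : A -> List B) xs {x y} -> x ∈ xs -> y ∈ g x -> y ∈ concatMap g xs
cp g (x ∷ xs) (here refl) q = ∈P.∈-++⁺ˡ q
cp g (x ∷ xs) (there p) q = ∈P.∈-++⁺ʳ (g x) (cp g xs p q)

Pa : ∀ {n} f (re : List (Fin n)) bc {m} -> Unique re -> m ∈ PL f re bc -> ∀ i -> i ∉ re -> lookup m i ≡ lookup bc i
Pa zero re bc u (here refl) i ni = refl
Pa (suc f) [] bc u (here refl) i ni = refl
Pa (suc f) (v ∷ vs) bc {m} (nv ∷ u) p i ni with co (\ wy -> PL f (snd wy) (upd bc v (fst wy))) (pi vs) p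
... | ((w , ws) , q , r) = trans (Pa f ws (upd bc v w) (snd (pn vs u q)) r i (\ z -> ni (there (fst (snd pk) i z)))) (upd-o bc (\ e -> ni (here e)) (\ e -> ni (there (subst (_∈ vs) (sym e) (fst pk)))))
 where pk = pf vs q

PL-head : ∀ {n} f v (vs : List (Fin n)) bc {w ws m} -> Unique (v ∷ vs) -> (w , ws) ∈ pi vs -> m ∈ PL f ws (upd bc v w) -> lookup m v ≡ w × lookup m w ≡ v
PL-head f v vs bc {w} {ws} {m} (nv ∷ u) q r = trans (Pa f ws (upd bc v w) uw r v (\ z -> All.lookup nv (fst (snd pk) v z) refl)) (upd-v bc (All.lookup nv (fst pk)))
 , trans (Pa f ws (upd bc v w) uw r w (fst (pn vs u q))) (upd-w bc v w)
 where
 pk = pf vs q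
 uw = snd (pn vs u q)

Is : ∀ {n} -> Vec (Fin n) n -> Set
Is {n} m = (∀ i -> lookup m (lookup m i) ≡ i) × (∀ i -> lookup m i ≢ i)

vec-ext : ∀ {A : Set} {n} (v w : Vec A n) -> (∀ i -> lookup v i ≡ lookup w i) -> v ≡ w
vec-ext [] [] h = refl
vec-ext (x ∷ v) (y ∷ w) h = ap₂ _∷_ (h fz) (vec-ext v w (\ i -> h (fs i)))

-- Invariant: m agrees with `bc` off the remaining vertices and maps these among themselves. Hence
-- the partner of the first one occurs among the picks, and removing the pair preserves the
-- invariant.
Pc : ∀ {n} f (re : List (Fin n)) bc m -> Is m -> Unique re -> length re <= f +' f -> (∀ i -> i ∉ re -> lookup m i ≡ lookup bc i) -> (∀ i -> i ∈ re -> lookup m i ∈ re) -> m ∈ PL f re bc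
Pc zero [] bc m pm u l ag cl = here (vec-ext m bc (\ i -> ag i (\ ())))
Pc (suc f) [] bc m pm u l ag cl = here (vec-ext m bc (\ i -> ag i (\ ())))
Pc (suc f) (v ∷ vs) bc m (inv' , nf) (nv ∷ u) l ag cl = cp (\ wy -> PL f (snd wy) (upd bc v (fst wy))) (pi vs) q
 (Pc f ws (upd bc v w) m (inv' , nf) (snd pu) len ag' cl')
 where
 w = lookup m v
 wv : w ∈ vs
 wv with cl v (here refl)
 ... | here e = ⊥-elim (nf v e)
 ... | there z = z
 ws = fst (p3 vs wv)
 q = snd (p3 vs wv)
 pk = pf vs q
 pu = pn vs u q
 mw : lookup m w ≡ v
 mw = inv' v
 len : length ws <= f +' f
 len = ≤-pred (≤-pred (≤≤ (≤≡ (ap suc (sym (snd (snd (snd pk)))))) (≤≤ l (≤≡ (ap suc (+-suc f f))))))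
 v∉ws : v ∉ ws
 v∉ws z = All.lookup nv (fst (snd pk) v z) refl
 ag' : ∀ i -> i ∉ ws -> lookup m i ≡ lookup (upd bc v w) i
 ag' i ni with i Fin.≟ v | i Fin.≟ w
 ... | yes refl | _ = sym (upd-v bc (\ e -> nf v (sym e)))
 ... | no _ | yes refl = trans mw (sym (upd-w bc v w))
 ... | no iv | no iw = trans (ag i nr) (sym (upd-o bc iv iw))
  where
  nr : i ∉ (v ∷ vs)
  nr (here e) = iv e
  nr (there z) with fst (snd (snd pk)) i z
  ... | inj₁ e = iw e
  ... | inj₂ z' = ni z'
 cl' : ∀ i -> i ∈ ws -> lookup m i ∈ ws
 cl' i z with cl i (there (fst (snd pk) i z))
 ... | here e = ⊥-elim (fst pu (subst (_∈ ws) (sym (inv' i) >> ap (lookup m) e) z))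
 ... | there z' with fst (snd (snd pk)) (lookup m i) z'
 ...   | inj₁ e = ⊥-elim (v∉ws (subst (_∈ ws) (sym (inv' i) >> ap (lookup m) e >> mw) z))
 ...   | inj₂ z'' = z''

PL-sound : ∀ {n} f (re : List (Fin n)) bc -> Unique re -> length re ≡ f +' f -> (∀ i -> i ∉ re -> lookup bc (lookup bc i) ≡ i × lookup bc i ≢ i × lookup bc i ∉ re) -> ∀ {m} -> m ∈ PL f re bc -> Is m
PL-sound zero [] bc u l h (here refl) = (\ i -> fst (h i (\ ()))) , (\ i -> fst (snd (h i (\ ()))))
PL-sound (suc f) (v ∷ vs) bc (nv ∷ u) l h p with co (\ wy -> PL f (snd wy) (upd bc v (fst wy))) (pi vs) p
... | ((w , ws) , q , r) = PL-sound f ws (upd bc v w) (snd pu) len h' r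
 where
 pk = pf vs q
 pu = pn vs u q
 vw : v ≢ w
 vw = All.lookup nv (fst pk)
 v∉ws : v ∉ ws
 v∉ws z = All.lookup nv (fst (snd pk) v z) refl
 len : length ws ≡ f +' f
 len = suc-inj (suc-inj (ap suc (sym (snd (snd (snd pk)))) >> l >> ap suc (+-suc f f)))
 b' = upd bc v w
 h' : ∀ i -> i ∉ ws -> lookup b' (lookup b' i) ≡ i × lookup b' i ≢ i × lookup b' i ∉ ws
 h' i ni with i Fin.≟ v | i Fin.≟ w
 ... | yes refl | _ = trans (ap (lookup b') (upd-v bc vw)) (upd-w bc v w) , (\ e -> vw (sym e >> upd-v bc vw)) , (\ z -> fst pu (subst (_∈ ws) (upd-v bc vw) z))
 ... | no _ | yes refl = trans (ap (lookup b') (upd-w bc v w)) (upd-v bc vw) , (\ e -> vw (sym (upd-w bc v w) >> e)) , (\ z -> v∉ws (subst (_∈ ws) (upd-w bc v w) z))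
 ... | no iv | no iw = trans (ap (lookup b') bi) (upd-o bc (\ e -> bn (here e)) (\ e -> bn (there (subst (_∈ vs) (sym e) (fst pk)))) >> fst hi) , (\ e -> fst (snd hi) (sym bi >> e)) , (\ z -> bn (there (fst (snd pk) _ (subst (_∈ ws) bi z))))
  where
  nr : i ∉ (v ∷ vs)
  nr (here e) = iv e
  nr (there z) with fst (snd (snd pk)) i z
  ... | inj₁ e = iw e
  ... | inj₂ z' = ni z'
  hi = h i nr
  bi = upd-o bc iv iw
  bn : lookup bc i ∉ (v ∷ vs)
  bn = snd (snd hi)

Pe : ∀ {n} f (re : List (Fin n)) bc -> Unique re -> Unique (PL f re bc)
Pe zero re bc u = [] ∷ []
Pe (suc f) [] bc u = [] ∷ []
Pe {n} (suc f) (v ∷ vs) bc u@(nv ∷ uv) = go (pi vs) (\ _ p -> p) (subst Unique (sym (pL vs)) uv)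
 where
 g : Fin n × List (Fin n) -> List (Vec (Fin n) n)
 g wy = PL f (snd wy) (upd bc v (fst wy))
 go : ∀ ps -> (∀ x -> x ∈ ps -> x ∈ pi vs) -> Unique (map fst ps) -> Unique (concatMap g ps)
 go [] s um = []
 go ((w , ws) ∷ ps) s (nw ∷ um) = UniqueP.++⁺ (Pe f ws (upd bc v w) (snd (pn vs uv (s _ (here refl))))) (go ps (\ x p -> s x (there p)) um) dis
  where
  dis : ∀ {m} -> m ∈ PL f ws (upd bc v w) × m ∈ concatMap g ps -> ⊥
  dis (p , q) with co g ps q
  ... | ((w' , ws') , a , b) = All.lookup nw (∈P.∈-map⁺ fst a) (sym (fst (PL-head f v vs bc u (s _ (here refl)) p)) >> fst (PL-head f v vs bc u (s _ (there a)) b))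

-- dd f = (2f-1)!!
dd : ℕ -> ℕ
dd zero = 1
dd (suc f) = suc (f +' f) *' dd f

picks-length : ∀ {A : Set} (xs : List A) -> length (pi xs) ≡ length xs
picks-length xs = trans (sym (LP.length-map fst (pi xs))) (ap length (pL xs))

Pn : ∀ {n} f (re : List (Fin n)) bc -> length re ≡ f +' f -> S (\ _ -> 1q) (PL f re bc) ≡ ι (dd f)
Pn zero re bc l = trans (+-0ʳ 1q) (sym ι1)
Pn (suc f) (v ∷ vs) bc l = trans (S-PL (\ _ -> 1q) f v vs bc) (Sc (pi vs) (\ wy q -> Pn f (snd wy) (upd bc v (fst wy)) (len wy q)) >> Sn (ι (dd f)) (pi vs) >> ap (\ k -> ι k * ι (dd f)) (picks-length vs >> lv) >> sym (zn (suc (f +' f)) (dd f)))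
 where
 lv : length vs ≡ suc (f +' f)
 lv = trans (suc-inj l) (+-suc f f)
 len : ∀ wy -> wy ∈ pi vs -> length (snd wy) ≡ f +' f
 len wy q = suc-inj (sym (snd (snd (snd (pf vs q)))) >> lv)

ao : ∀ {A : Set} (p : A -> Bool) xs -> allB p xs ≡ true -> ∀ x -> x ∈ xs -> p x ≡ true
ao p (y ∷ ys) e x q with p y in ey
ao p (y ∷ ys) e x (here refl) | true = ey
ao p (y ∷ ys) e x (there q) | true = ao p ys e x q

ac : ∀ {A : Set} (p : A -> Bool) xs -> (∀ x -> x ∈ xs -> p x ≡ true) -> allB p xs ≡ true
ac p [] h = refl
ac p (y ∷ ys) h rewrite h y (here refl) = ac p ys (\ x q -> h x (there q))

isPM-sound : ∀ {n} (m : Vec (Fin n) n) -> isPerfectMatching m ≡ true -> Is m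
isPM-sound {n} m e = (\ i -> fst (at i)) , (\ i -> snd (at i))
 where
 at : ∀ i -> lookup m (lookup m i) ≡ i × lookup m i ≢ i
 at i with lookup m (lookup m i) Fin.≟ i | lookup m i Fin.≟ i | ao (\ i -> ⌊ lookup m (lookup m i) Fin.≟ i ⌋ ∧ not ⌊ lookup m i Fin.≟ i ⌋) (allFin n) e i (∈P.∈-allFin i)
 ... | yes p | no q | _ = p , q

isPM-complete : ∀ {n} (m : Vec (Fin n) n) -> Is m -> isPerfectMatching m ≡ true
isPM-complete {n} m (a , b) = ac _ (allFin n) (\ i _ -> at i)
 where
 at : ∀ i -> (⌊ lookup m (lookup m i) Fin.≟ i ⌋ ∧ not ⌊ lookup m i Fin.≟ i ⌋) ≡ true
 at i with lookup m (lookup m i) Fin.≟ i | lookup m i Fin.≟ i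
 ... | yes p | no q = refl
 ... | yes p | yes q = ⊥-elim (b i q)
 ... | no p | _ = ⊥-elim (p (a i))

bk : ∀ n -> Vec (Fin n) n
bk n = Vec.tabulate (\ i -> i)

allPL : ∀ f -> List (Vec (Fin (f +' f)) (f +' f))
allPL f = PL f (allFin (f +' f)) (bk (f +' f))

lF : ∀ n -> length (allFin n) ≡ n
lF n = LP.length-tabulate (\ i -> i)

PM-unique : ∀ n -> Unique (perfectMatchings n)
PM-unique n = uf isPerfectMatching (uc (allFin n) n (UniqueP.allFin⁺ n))

PM-≤ : ∀ f {g : Vec (Fin (f +' f)) (f +' f) -> ℚ} -> (∀ m -> 0q ≤ g m) -> S g (perfectMatchings (f +' f)) ≤ S g (allPL f)
PM-≤ f {g} nn = S-⊆ (perfectMatchings n) (allPL f) (PM-unique n)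
 (\ m p -> Pc f (allFin n) (bk n) m (isPM-sound m (snd (fi isPerfectMatching (vecsOver (allFin n) n) p))) (UniqueP.allFin⁺ n) (≤≡ (lF n)) (\ i ni -> ⊥-elim (ni (∈P.∈-allFin i))) (\ i _ -> ∈P.∈-allFin (lookup m i))) nn
 where n = f +' f

Pl : ∀ f -> ι (dd f) ≤ ι (length (perfectMatchings (f +' f)))
Pl f = EQ (sym (Pn f (allFin n) (bk n) (lF n))) ~ S-⊆ (allPL f) (perfectMatchings n) (Pe f (allFin n) (bk n) (UniqueP.allFin⁺ n))
 (\ m p -> fr isPerfectMatching (vecsOver (allFin n) n) (vc (allFin n) m (\ i -> ∈P.∈-allFin (lookup m i))) (isPM-complete m (PL-sound f (allFin n) (bk n) (UniqueP.allFin⁺ n) (lF n) (\ i ni -> ⊥-elim (ni (∈P.∈-allFin i))) p)))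
 (\ _ -> ze) ~ EQ (Sn 1q (perfectMatchings n) >> (*-1ʳ _))
 where n = f +' f

-- number of perfect matchings between classes of sizes a , b, and inside a class of size g
Φ : ℕ -> ℕ -> ℕ
Φ zero zero = 1
Φ zero (suc b) = 0
Φ (suc a) zero = 0
Φ (suc a) (suc b) = suc a *' Φ a b

DD : ℕ -> ℕ
DD zero = 1
DD (suc zero) = 0
DD (suc (suc g)) = suc g *' DD g

db : ∀ a b -> a ≡ b ⊎ Φ a b ≡ 0
db zero zero = inj₁ refl
db zero (suc b) = inj₂ refl
db (suc a) zero = inj₂ refl
db (suc a) (suc b) with db a b
... | inj₁ e = inj₁ (ap suc e)
... | inj₂ e = inj₂ (ap (suc a ℕ.*_) e >> ℕP.*-zeroʳ (suc a))

Φ-sym : ∀ a b -> suc b *' Φ a b <= suc a *' Φ a b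
Φ-sym a b with db a b
... | inj₁ refl = ≤r
... | inj₂ e = ≤≤ (≤≡ (ap (suc b ℕ.*_) e >> ℕP.*-zeroʳ (suc b))) ℕ.z≤n

xo : Bool -> Bool -> Bool
xo true b = not b
xo false b = b

ea : Bool -> Bool -> Bool
ea true b = b
ea false b = not b

zv : ∀ a b -> 0q * ι a ≤ ι b * 0q
zv a b = EQ (*-0ˡ (ι a) >> sym (*-0ʳ (ι b)))

oe : ∀ a -> 1q * ι a ≤ ι a * 1q
oe a = EQ (*-cm 1q (ι a))

-- Matchings with prescribed crossing types.

module Typed {n : ℕ} (Sv xv : Fin n -> Bool) where

 oa : Fin n -> Fin n -> Bool
 oa v w = ea (xo (Sv v) (Sv w)) (xv v) ∧ ea (xo (Sv w) (Sv v)) (xv w)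

 cT : Bool -> Bool -> List (Fin n) -> ℕ
 cT s x [] = 0
 cT s x (i ∷ l) = (if ea (Sv i) s ∧ ea (xv i) x then 1 else 0) +' cT s x l

 -- A crossing vertex needs a crossing partner on the other side, a non-crossing one a non-crossing
 -- partner on its own side. The three groups are matched independently: one bijection and two
 -- matchings inside a side.
 Wt : List (Fin n) -> ℕ
 Wt l = Φ (cT true true l) (cT false true l) *' (DD (cT true false l) *' DD (cT false false l))

 me : List (Fin n) -> Vec (Fin n) n -> ℚ
 me [] m = 1q
 me (i ∷ l) m = 𝟙 (ea (xo (Sv i) (Sv (lookup m i))) (xv i)) * me l m

 mt : ∀ l m -> 0q ≤ me l m
 mt [] m = ze
 mt (i ∷ l) m = nc (nk (ea (xo (Sv i) (Sv (lookup m i))) (xv i))) (mt l m)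

 mh : ∀ vs {w ws} m -> (w , ws) ∈ pi vs -> me vs m ≡ 𝟙 (ea (xo (Sv w) (Sv (lookup m w))) (xv w)) * me ws m
 mh (x ∷ xs) m (here refl) = refl
 mh (x ∷ xs) m (there p) with ∈P.∈-map⁻ (\ wy -> fst wy , x ∷ snd wy) p
 ... | ((w , ws) , q , refl) = trans (ap (𝟙 (ea (xo (Sv x) (Sv (lookup m x))) (xv x)) *_) (mh xs m q)) (l (𝟙 (ea (xo (Sv x) (Sv (lookup m x))) (xv x))) (𝟙 (ea (xo (Sv w) (Sv (lookup m w))) (xv w))) (me ws m))
  where l = r3 (v0 :* (v1 :* v2)) (v1 :* (v0 :* v2))

 ci : ∀ s x vs {w ws} -> (w , ws) ∈ pi vs -> cT s x vs ≡ cT s x (w ∷ ws)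
 ci s x (y ∷ ys) (here refl) = refl
 ci s x (y ∷ ys) (there p) with ∈P.∈-map⁻ (\ wy -> fst wy , y ∷ snd wy) p
 ... | ((w , ws) , q , refl) = trans (ap (i y ℕ.+_) (ci s x ys q)) (sym (ℕP.+-assoc (i y) (i w) (cT s x ws)) >> ap (ℕ._+ cT s x ws) (+-cmℕ (i y) (i w)) >> ℕP.+-assoc (i w) (i y) (cT s x ws))
  where
  i : Fin n -> ℕ
  i z = if ea (Sv z) s ∧ ea (xv z) x then 1 else 0

 S-type : ∀ s x vs -> S (\ wy -> 𝟙 (ea (Sv (fst wy)) s ∧ ea (xv (fst wy)) x)) (pi vs) ≡ ι (cT s x vs)
 S-type s x vs = trans (sym (S-map (\ w -> 𝟙 (ea (Sv w) s ∧ ea (xv w) x)) fst (pi vs))) (ap (S (\ w -> 𝟙 (ea (Sv w) s ∧ ea (xv w) x))) (pL vs) >> go vs)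
  where
  go : ∀ vs -> S (\ w -> 𝟙 (ea (Sv w) s ∧ ea (xv w) x)) vs ≡ ι (cT s x vs)
  go [] = sym ι0
  go (v ∷ vs) with ea (Sv v) s ∧ ea (xv v) x
  ... | true = trans (ap (1q +_) (go vs)) (sym (su (cT s x vs)))
  ... | false = trans (+-0ˡ (S (\ w -> 𝟙 (ea (Sv w) s ∧ ea (xv w) x)) vs)) (go vs)

 -- The type of v leaves a single class of admissible partners, and every choice in it leaves the
 -- same weight. The sum is thus a class size times that weight, the first-vertex recursion of `Φ`
 -- or `DD`.
 partner-step : ∀ v vs -> S (\ wy -> 𝟙 (oa v (fst wy)) * ι (Wt (snd wy))) (pi vs) ≤ ι (Wt (v ∷ vs))
 partner-step v vs = go (Sv v) (xv v) refl refl
  where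
  c11 = cT true true vs
  c01 = cT false true vs
  c10 = cT true false vs
  c00 = cT false false vs
  fin : ∀ s x (W' : ℕ) -> (∀ wy -> wy ∈ pi vs -> 𝟙 (oa v (fst wy)) * ι (Wt (snd wy)) ≤ ι W' * 𝟙 (ea (Sv (fst wy)) s ∧ ea (xv (fst wy)) x)) -> cT s x vs *' W' <= Wt (v ∷ vs) ->
   S (\ wy -> 𝟙 (oa v (fst wy)) * ι (Wt (snd wy))) (pi vs) ≤ ι (Wt (v ∷ vs))
  fin s x W' h k = Sm (pi vs) h ~ EQ (Sa (ι W') _ (pi vs) >> ap (ι W' *_) (S-type s x vs) >> *-cm (ι W') (ι (cT s x vs)) >> sym (zn (cT s x vs) W')) ~ mn k
  pr : ℕ -> ℕ
  pr = ℕ.pred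
  go : ∀ s x -> Sv v ≡ s -> xv v ≡ x -> S (\ wy -> 𝟙 (oa v (fst wy)) * ι (Wt (snd wy))) (pi vs) ≤ ι (Wt (v ∷ vs))
  go true true es ex = fin false true (Φ c11 (pr c01) *' (DD c10 *' DD c00)) h k
   where
   k : c01 *' (Φ c11 (pr c01) *' (DD c10 *' DD c00)) <= Wt (v ∷ vs)
   k rewrite es | ex with c01
   ... | zero = ℕ.z≤n
   ... | suc b = ≤≤ (≤≡ (sym (ℕP.*-assoc (suc b) (Φ c11 b) (DD c10 *' DD c00)))) (ℕP.*-monoˡ-≤ (DD c10 *' DD c00) (Φ-sym c11 b))
   h : ∀ wy -> wy ∈ pi vs -> 𝟙 (oa v (fst wy)) * ι (Wt (snd wy)) ≤ ι (Φ c11 (pr c01) *' (DD c10 *' DD c00)) * 𝟙 (ea (Sv (fst wy)) false ∧ ea (xv (fst wy)) true)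
   h (w , ws) q rewrite es | ex | ci true true vs q | ci false true vs q | ci true false vs q | ci false false vs q with Sv w | xv w
   ... | true | _ = zv _ _
   ... | false | true = oe _
   ... | false | false = zv _ _
  go false true es ex = fin true true (Φ (pr c11) c01 *' (DD c10 *' DD c00)) h k
   where
   k : c11 *' (Φ (pr c11) c01 *' (DD c10 *' DD c00)) <= Wt (v ∷ vs)
   k rewrite es | ex with c11
   ... | zero = ℕ.z≤n
   ... | suc b = ≤≡ (sym (ℕP.*-assoc (suc b) (Φ b c01) (DD c10 *' DD c00)))
   h : ∀ wy -> wy ∈ pi vs -> 𝟙 (oa v (fst wy)) * ι (Wt (snd wy)) ≤ ι (Φ (pr c11) c01 *' (DD c10 *' DD c00)) * 𝟙 (ea (Sv (fst wy)) true ∧ ea (xv (fst wy)) true)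
   h (w , ws) q rewrite es | ex | ci true true vs q | ci false true vs q | ci true false vs q | ci false false vs q with Sv w | xv w
   ... | false | _ = zv _ _
   ... | true | true = oe _
   ... | true | false = zv _ _
  go true false es ex = fin true false (Φ c11 c01 *' (DD (pr c10) *' DD c00)) h k
   where
   k : c10 *' (Φ c11 c01 *' (DD (pr c10) *' DD c00)) <= Wt (v ∷ vs)
   k rewrite es | ex with c10
   ... | zero = ℕ.z≤n
   ... | suc b = ≤≡ (xz (suc b) (Φ c11 c01) (DD b *' DD c00) >> ap (Φ c11 c01 ℕ.*_) (sym (ℕP.*-assoc (suc b) (DD b) (DD c00))))
    where
    xz : ∀ x y z -> x *' (y *' z) ≡ y *' (x *' z)
    xz x y z = trans (sym (ℕP.*-assoc x y z)) (ap (ℕ._* z) (*-cmℕ x y) >> ℕP.*-assoc y x z)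
   h : ∀ wy -> wy ∈ pi vs -> 𝟙 (oa v (fst wy)) * ι (Wt (snd wy)) ≤ ι (Φ c11 c01 *' (DD (pr c10) *' DD c00)) * 𝟙 (ea (Sv (fst wy)) true ∧ ea (xv (fst wy)) false)
   h (w , ws) q rewrite es | ex | ci true true vs q | ci false true vs q | ci true false vs q | ci false false vs q with Sv w | xv w
   ... | false | _ = zv _ _
   ... | true | false = oe _
   ... | true | true = zv _ _
  go false false es ex = fin false false (Φ c11 c01 *' (DD c10 *' DD (pr c00))) h k
   where
   k : c00 *' (Φ c11 c01 *' (DD c10 *' DD (pr c00))) <= Wt (v ∷ vs)
   k rewrite es | ex with c00
   ... | zero = ℕ.z≤n
   ... | suc b = ≤≡ (xz (suc b) (Φ c11 c01) (DD c10 *' DD b) >> ap (Φ c11 c01 ℕ.*_) (xz (suc b) (DD c10) (DD b)))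
    where
    xz : ∀ x y z -> x *' (y *' z) ≡ y *' (x *' z)
    xz x y z = trans (sym (ℕP.*-assoc x y z)) (ap (ℕ._* z) (*-cmℕ x y) >> ℕP.*-assoc y x z)
   h : ∀ wy -> wy ∈ pi vs -> 𝟙 (oa v (fst wy)) * ι (Wt (snd wy)) ≤ ι (Φ c11 c01 *' (DD c10 *' DD (pr c00))) * 𝟙 (ea (Sv (fst wy)) false ∧ ea (xv (fst wy)) false)
   h (w , ws) q rewrite es | ex | ci true true vs q | ci false true vs q | ci true false vs q | ci false false vs q with Sv w | xv w
   ... | true | _ = zv _ _
   ... | false | false = oe _
   ... | false | true = zv _ _

 tb : ∀ f re bc -> Unique re -> length re ≡ f +' f -> S (me re) (PL f re bc) ≤ ι (Wt re)
 tb zero [] bc u l = EQ (+-0ʳ 1q >> sym ι1)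
 tb (suc f) (v ∷ vs) bc u@(nv ∷ uv) l = EQ (S-PL (me (v ∷ vs)) f v vs bc) ~ Sm (pi vs) each ~ partner-step v vs
  where
  lv : length vs ≡ suc (f +' f)
  lv = trans (suc-inj l) (+-suc f f)
  each : ∀ wy -> wy ∈ pi vs -> S (me (v ∷ vs)) (PL f (snd wy) (upd bc v (fst wy))) ≤ 𝟙 (oa v (fst wy)) * ι (Wt (snd wy))
  each (w , ws) q = EQ (Sc (PL f ws (upd bc v w)) (\ m r -> eq m r) >> Sa (𝟙 (oa v w)) (me ws) (PL f ws (upd bc v w)))
   ~ za (nk (oa v w)) (tb f ws (upd bc v w) (snd (pn vs uv q)) (suc-inj (sym (snd (snd (snd (pf vs q)))) >> lv)))
   where
   eq : ∀ m -> m ∈ PL f ws (upd bc v w) -> me (v ∷ vs) m ≡ 𝟙 (oa v w) * me ws m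
   eq m r = trans (ap (𝟙 (ea (xo (Sv v) (Sv (lookup m v))) (xv v)) *_) (mh vs m q)) (ap₂ (\ a b -> 𝟙 (ea (xo (Sv v) (Sv a)) (xv v)) * (𝟙 (ea (xo (Sv w) (Sv b)) (xv w)) * me ws m)) (fst hd) (snd hd) >> a (ea (xo (Sv v) (Sv w)) (xv v)) (ea (xo (Sv w) (Sv v)) (xv w)) (me ws m))
    where
    hd = PL-head f v vs bc u q r
    a : ∀ p q c -> 𝟙 p * (𝟙 q * c) ≡ 𝟙 (p ∧ q) * c
    a true q c = *-1ˡ (𝟙 q * c)
    a false q c = trans (*-0ˡ (𝟙 q * c)) (sym (*-0ˡ c))

bj : List Bool
bj = true ∷ false ∷ []

pF : ∀ {n} -> (Fin n -> ℚ) -> ℚ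
pF {zero} g = 1q
pF {suc n} g = g fz * pF (\ i -> g (fs i))

pH : ∀ {n} {g : Fin n -> ℚ} -> (∀ i -> 0q ≤ g i) -> 0q ≤ pF g
pH {zero} h = ze
pH {suc n} h = nc (h fz) (pH (\ i -> h (fs i)))

p5 : ∀ {n} {g h : Fin n -> ℚ} -> (∀ i -> 0q ≤ g i) -> (∀ i -> g i ≤ h i) -> pF g ≤ pF h
p5 {zero} p q = ≤-refl
p5 {suc n} p q = ma (p fz) (pH (\ i -> p (fs i))) (q fz) (p5 (\ i -> p (fs i)) (\ i -> q (fs i)))

pG : ∀ {n} {g h : Fin n -> ℚ} -> (∀ i -> g i ≡ h i) -> pF g ≡ pF h
pG {zero} e = refl
pG {suc n} e = ap₂ _*_ (e fz) (pG (\ i -> e (fs i)))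

pP : ∀ {n} (g h : Fin n -> ℚ) -> pF (\ i -> g i * h i) ≡ pF g * pF h
pP {zero} g h = refl
pP {suc n} g h = trans (ap (g fz * h fz *_) (pP (\ i -> g (fs i)) (\ i -> h (fs i)))) (l (g fz) (h fz) (pF (\ i -> g (fs i))) (pF (\ i -> h (fs i))))
 where l = r4 (v0 :* v1 :* (v2 :* v3)) (v0 :* v2 :* (v1 :* v3))

S-bools : ∀ n (f : Vec Bool (suc n) -> ℚ) -> S f (vecsOver bj (suc n)) ≡ S (\ c -> f (true ∷ c)) (vecsOver bj n) + S (\ c -> f (false ∷ c)) (vecsOver bj n)
S-bools n f = trans (Sg bj n f) (ap (S (\ c -> f (true ∷ c)) (vecsOver bj n) +_) (+-0ʳ _))

p7 : ∀ n (g : Fin n -> Bool -> ℚ) -> S (\ c -> pF (\ i -> g i (lookup c i))) (vecsOver bj n) ≡ pF (\ i -> g i true + g i false)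
p7 zero g = +-0ʳ 1q
p7 (suc n) g = trans (S-bools n (\ c -> pF (\ i -> g i (lookup c i)))) (trans (ap₂ _+_ (Sa (g fz true) (\ c -> pF (\ i -> g (fs i) (lookup c i))) (vecsOver bj n)) (Sa (g fz false) (\ c -> pF (\ i -> g (fs i) (lookup c i))) (vecsOver bj n)))
 (ap₂ (\ a b -> g fz true * a + g fz false * b) ih ih >> sym (ℚP.*-distribʳ-+ (pF (\ i -> g (fs i) true + g (fs i) false)) (g fz true) (g fz false))))
 where ih = p7 n (\ i -> g (fs i))

-- Inserts a sum over all label vectors, of which the indicators keep exactly one. This is what
-- exchanges matchings for label vectors in `bp`.
select : ∀ n (b : Fin n -> Bool) (F : Vec Bool n -> ℚ) -> F (Vec.tabulate b) ≡ S (\ c -> pF (\ i -> 𝟙 (ea (b i) (lookup c i))) * F c) (vecsOver bj n)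
select zero b F = sym (+-0ʳ (1q * F []) >> *-1ˡ (F []))
select (suc n) b F = trans (go (b fz) refl) (sym (S-bools n (\ c -> pF (\ i -> 𝟙 (ea (b i) (lookup c i))) * F c)))
 where
 P : Vec Bool n -> ℚ
 P c = pF (\ i -> 𝟙 (ea (b (fs i)) (lookup c i)))
 one : ∀ x -> S (\ c -> 1q * P c * F (x ∷ c)) (vecsOver bj n) ≡ F (x ∷ Vec.tabulate (\ i -> b (fs i)))
 one x = trans (Sc (vecsOver bj n) (\ c _ -> ap (_* F (x ∷ c)) (*-1ˡ (P c)))) (sym (select n (\ i -> b (fs i)) (\ c -> F (x ∷ c))))
 nul : ∀ x -> S (\ c -> 0q * P c * F (x ∷ c)) (vecsOver bj n) ≡ 0q
 nul x = trans (Sc (vecsOver bj n) (\ c _ -> trans (ap (_* F (x ∷ c)) (*-0ˡ (P c))) (*-0ˡ (F (x ∷ c))))) (S-zero (vecsOver bj n))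
 go : ∀ b0 -> b fz ≡ b0 -> F (Vec.tabulate b) ≡ S (\ c -> 𝟙 (ea (b fz) true) * P c * F (true ∷ c)) (vecsOver bj n) + S (\ c -> 𝟙 (ea (b fz) false) * P c * F (false ∷ c)) (vecsOver bj n)
 go true e rewrite e = sym (ap₂ _+_ (one true) (nul false) >> (+-0ʳ _))
 go false e rewrite e = sym (ap₂ _+_ (nul true) (one false) >> (+-0ˡ _))

kF : ∀ {n} -> (Fin n -> Bool) -> (Fin n -> Bool) -> Bool -> Bool -> ℕ
kF {zero} s c a b = 0
kF {suc n} s c a b = (if ea (s fz) a ∧ ea (c fz) b then 1 else 0) +' kF (\ i -> s (fs i)) (\ i -> c (fs i)) a b

pV : ∀ {n} (s c : Fin n -> Bool) (h : Bool -> Bool -> ℚ) -> pF (\ i -> h (s i) (c i)) ≡ h true true ^ kF s c true true * h true false ^ kF s c true false * (h false true ^ kF s c false true * h false false ^ kF s c false false)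
pV {zero} s c h = refl
pV {suc n} s c h = trans (ap (h (s fz) (c fz) *_) (pV (\ i -> s (fs i)) (\ i -> c (fs i)) h)) (go (s fz) (c fz) refl refl)
 where
 k : Bool -> Bool -> ℕ
 k = kF (\ i -> s (fs i)) (\ i -> c (fs i))
 go : ∀ a b -> s fz ≡ a -> c fz ≡ b -> h (s fz) (c fz) * (h true true ^ k true true * h true false ^ k true false * (h false true ^ k false true * h false false ^ k false false)) ≡ h true true ^ kF s c true true * h true false ^ kF s c true false * (h false true ^ kF s c false true * h false false ^ kF s c false false)
 go true true e1 e2 rewrite e1 | e2 = l (h true true) (h true true ^ k true true) (h true false ^ k true false) (h false true ^ k false true) (h false false ^ k false false)
  where l = r5 (v0 :* (v1 :* v2 :* (v3 :* v4))) (v0 :* v1 :* v2 :* (v3 :* v4))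
 go true false e1 e2 rewrite e1 | e2 = l (h true false) (h true true ^ k true true) (h true false ^ k true false) (h false true ^ k false true) (h false false ^ k false false)
  where l = r5 (v0 :* (v1 :* v2 :* (v3 :* v4))) (v1 :* (v0 :* v2) :* (v3 :* v4))
 go false true e1 e2 rewrite e1 | e2 = l (h false true) (h true true ^ k true true) (h true false ^ k true false) (h false true ^ k false true) (h false false ^ k false false)
  where l = r5 (v0 :* (v1 :* v2 :* (v3 :* v4))) (v1 :* v2 :* (v0 :* v3 :* v4))
 go false false e1 e2 rewrite e1 | e2 = l (h false false) (h true true ^ k true true) (h true false ^ k true false) (h false true ^ k false true) (h false false ^ k false false)
  where l = r5 (v0 :* (v1 :* v2 :* (v3 :* v4))) (v1 :* v2 :* (v3 :* (v0 :* v4)))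

cn : ∀ {n} -> (Fin n -> Bool) -> Bool -> ℕ
cn {zero} s a = 0
cn {suc n} s a = (if ea (s fz) a then 1 else 0) +' cn (\ i -> s (fs i)) a

km : ∀ {n} (s c : Fin n -> Bool) a -> kF s c a true +' kF s c a false ≡ cn s a
km {zero} s c a = refl
km {suc n} s c a with ea (s fz) a | c fz | km (\ i -> s (fs i)) (\ i -> c (fs i)) a
... | false | _ | ih = ih
... | true | true | ih = ap suc ih
... | true | false | ih = trans (+-suc _ _) (ap suc ih)

cu : ∀ {n} (s : Fin n -> Bool) -> cn s true +' cn s false ≡ n
cu {zero} s = refl
cu {suc n} s with s fz | cu (\ i -> s (fs i))
... | true | ih = ap suc ih
... | false | ih = trans (+-suc _ _) (ap suc ih)

pJ : ∀ {n} (s : Fin n -> Bool) (h : Bool -> ℚ) -> pF (\ i -> h (s i)) ≡ h true ^ cn s true * h false ^ cn s false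
pJ {zero} s h = refl
pJ {suc n} s h = trans (ap (h (s fz) *_) (pJ (\ i -> s (fs i)) h)) (go (s fz) refl)
 where
 k : Bool -> ℕ
 k = cn (\ i -> s (fs i))
 go : ∀ a -> s fz ≡ a -> h (s fz) * (h true ^ k true * h false ^ k false) ≡ h true ^ cn s true * h false ^ cn s false
 go true e rewrite e = sym (*-as (h true) (h true ^ k true) (h false ^ k false))
 go false e rewrite e = l (h false) (h true ^ k true) (h false ^ k false)
  where l = r3 (v0 :* (v1 :* v2)) (v1 :* (v0 :* v2))

fa : ℕ -> ℕ
fa zero = 1
fa (suc n) = suc n *' fa n

bt : ∀ x y -> bC (x +' y) x * (ι (fa x) * ι (fa y)) ≡ ι (fa (x +' y))
bt zero y = trans (ap₂ (\ a b -> a * (b * ι (fa y))) (c0 y) ι1) (l (ι (fa y)))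
 where
 c0 : ∀ y -> bC y 0 ≡ 1q
 c0 zero = refl
 c0 (suc y) = trans (*-1ˡ (bC y 0)) (c0 y)
 l = r1 (:1 :* (:1 :* v0)) v0
bt (suc x) y = trans (ap (\ z -> bC (suc x +' y) (suc x) * (z * ι (fa y))) (zn (suc x) (fa x))) (l1 (bC d (suc x)) (ι (suc x)) (ι (fa x)) (ι (fa y)) >> ap (_* (ι (fa x) * ι (fa y))) key >> l2 (ι (suc y)) (bC d x) (ι (fa x)) (ι (fa y)) >> ap (\ z -> bC d x * (ι (fa x) * z)) (sym (zn (suc y) (fa y))) >> ap (\ z -> bC z x * (ι (fa x) * ι (fa (suc y)))) (sym (+-suc x y)) >> bt x (suc y) >> ap (\ z -> ι (fa z)) (+-suc x y))
 where
 d = suc (x +' y)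
 key : ι (suc x) * bC d (suc x) ≡ ι (suc y) * bC d x
 key = trans (k1 (ι (suc x)) (bC d (suc x)) (ι x) (bC d x)) (ap (\ z -> z - ι x * bC d x) (ap₂ _+_ (ap (ι (suc x) *_) (sym (*-1ˡ (bC d (suc x))))) (ap (ι x *_) (sym (*-1ˡ (bC d x)))) >> br 1q 1q d x) >> k2 (ι d) (bC d x) (ι x) >> ap (_* bC d x) (ap (_- ι x) (ap ι (sym (+-suc x y)) >> zq x (suc y)) >> k3 (ι x) (ι (suc y))))
  where
  k1 = r4 (v0 :* v1) (v0 :* v1 :+ v2 :* v3 :- v2 :* v3)
  k2 = r3 (v0 :* (:1 :* v1) :- v2 :* v1) ((v0 :- v2) :* v1)
  k3 = r2 (v0 :+ v1 :- v0) v1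
 l1 = r4 (v0 :* (v1 :* v2 :* v3)) (v1 :* v0 :* (v2 :* v3))
 l2 = r4 (v0 :* v1 :* (v2 :* v3)) (v1 :* (v2 :* (v0 :* v3)))

-- (g - 1)!! is at most g!!, and their product is g!. Squared counts of matchings thereby become
-- factorials, ready to form binomial coefficients.
DD-sq : ∀ g -> DD g *' DD g <= fa g
DD-sq zero = ≤r
DD-sq (suc zero) = ℕ.z≤n
DD-sq (suc (suc g)) = ≤≤ (≤≡ (m4 (suc g) (DD g))) (≤≤ (ℕP.*-mono-≤ (ℕP.*-monoˡ-≤ (suc g) (n≤sn (suc g))) (DD-sq g)) (≤≡ (ℕP.*-assoc (suc (suc g)) (suc g) (fa g))))
 where
 m4 : ∀ a b -> a *' b *' (a *' b) ≡ a *' a *' (b *' b)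
 m4 a b = trans (ℕP.*-assoc a b (a *' b)) (ap (a ℕ.*_) (sym (ℕP.*-assoc b a b) >> ap (ℕ._* b) (*-cmℕ b a) >> ℕP.*-assoc a b b) >> sym (ℕP.*-assoc a a (b *' b)))

Φ-sq : ∀ a b -> Φ a b *' Φ a b <= fa a *' fa b
Φ-sq a b with db a b
... | inj₁ refl = ≤≡ (ap₂ ℕ._*_ (dg a) (dg a))
 where
 dg : ∀ a -> Φ a a ≡ fa a
 dg zero = refl
 dg (suc a) = ap (suc a ℕ.*_) (dg a)
... | inj₂ e = ≤≤ (≤≡ (ap (ℕ._* Φ a b) e)) ℕ.z≤n

fact-dd : ∀ f -> fa (f +' f) <= suc (f +' f) *' (dd f *' dd f)
fact-dd zero = ≤r
fact-dd (suc f) = ≤≤ (≤≡ (ap (\ k -> suc k *' fa k) (+-suc f f)))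
 (≤≤ (ℕP.*-monoʳ-≤ (suc (suc n)) (ℕP.*-monoʳ-≤ (suc n) (fact-dd f))) (≤≤ (≤≡ (r (suc (suc n)) (suc n) (dd f))) (≤≤ (ℕP.*-monoˡ-≤ (suc n *' dd f *' (suc n *' dd f)) (n≤sn (suc (suc n)))) (≤≡ (ap (\ k -> suc (suc k) *' (suc n *' dd f *' (suc n *' dd f))) (sym (+-suc f f)))))))
 where
 n = f +' f
 open import Data.Nat.Tactic.RingSolver using () renaming (solve-∀ to solveℕ)
 r : ∀ a b c -> a *' (b *' (b *' (c *' c))) ≡ a *' (b *' c *' (b *' c))
 r = solveℕ

-- Label patterns of random matchings.

module Pattern (f : ℕ) (Sb : Vec Bool (f +' f)) (up : Bool) where
 n = f +' f
 PM : List (Vec (Fin n) n)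
 PM = perfectMatchings n
 tot : ℚ
 tot = ι (length PM)
 AC : List (Vec Bool n)
 AC = vecsOver bj n
 sb : Fin n -> Bool
 sb i = lookup Sb i
 -- The label marks the favoured event: crossing when an excess is studied (`up`), not crossing for
 -- a deficit. Both directions then require many labels, so all thresholds are lower bounds.
 bit : Vec (Fin n) n -> Fin n -> Bool
 bit m i = ea up (xo (sb i) (sb (lookup m i)))
 lab : Vec (Fin n) n -> Vec Bool n
 lab m = Vec.tabulate (bit m)
 lg : ∀ {d} -> Vec (Vec (Fin n) n) d -> Vec (Vec Bool n) d
 lg ms = Vec.map lab ms

 Ac : Vec Bool n -> ℚ
 Ac c = S (\ m -> pF (\ i -> 𝟙 (ea (bit m i) (lookup c i)))) PM

 An : ∀ c -> 0q ≤ Ac c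
 An c = S-nn PM (\ m -> pH (\ i -> nk (ea (bit m i) (lookup c i))))

 pl : ∀ {d} -> Vec (Vec Bool n) d -> ℚ
 pl [] = 1q
 pl (c ∷ cs) = Ac c * pl cs

 pI : ∀ {d} (cs : Vec (Vec Bool n) d) -> 0q ≤ pl cs
 pI [] = ze
 pI (c ∷ cs) = nc (An c) (pI cs)

 -- The law of the label matrix: columns come from independent matchings, so the weight of a matrix
 -- is the product of the column counts `Ac`.
 bp : ∀ d (F : Vec (Vec Bool n) d -> ℚ) -> S (\ ms -> F (lg ms)) (vecsOver PM d) ≡ S (\ cs -> pl cs * F cs) (vecsOver AC d)
 bp zero F = ap (_+ 0q) (sym (*-1ˡ (F [])))
 bp (suc d) F = trans (Sg PM d (\ ms -> F (lg ms)))
  (trans (Sc PM (\ m _ -> trans (bp d (\ cs -> F (lab m ∷ cs))) (select n (bit m) G)))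
  (trans (Ss (\ m c -> pF (\ i -> 𝟙 (ea (bit m i) (lookup c i))) * G c) PM AC)
  (trans (Sc AC (\ c _ -> trans (Sc PM (\ m _ -> *-cm (pF (\ i -> 𝟙 (ea (bit m i) (lookup c i)))) (G c))) (Sa (G c) (\ m -> pF (\ i -> 𝟙 (ea (bit m i) (lookup c i)))) PM >> *-cm (G c) (Ac c) >> sym (Sa (Ac c) (\ cs -> pl cs * F (c ∷ cs)) (vecsOver AC d)) >> Sc (vecsOver AC d) (\ cs _ -> sym (*-as (Ac c) (pl cs) (F (c ∷ cs)))))))
  (sym (Sg AC d (\ cs -> pl cs * F cs))))))
  where
  G : Vec Bool n -> ℚ
  G c = S (\ cs -> pl cs * F (c ∷ cs)) (vecsOver AC d)

 module _ (c : Vec Bool n) where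
  cb : Fin n -> Bool
  cb i = lookup c i
  xb : Fin n -> Bool
  xb i = ea up (cb i)
  open Typed sb xb
  k11 k10 k01 k00 : ℕ
  k11 = kF sb cb true true
  k10 = kF sb cb true false
  k01 = kF sb cb false true
  k00 = kF sb cb false false

  private
   eq-flip : ∀ u x c -> ea (ea u x) c ≡ ea x (ea u c)
   eq-flip true x c = refl
   eq-flip false true c = refl
   eq-flip false false true = refl
   eq-flip false false false = refl

   mo : ∀ k (h : Fin k -> Fin n) m -> me (tabulate h) m ≡ pF (\ i -> 𝟙 (ea (xo (sb (h i)) (sb (lookup m (h i)))) (xb (h i))))
   mo zero h m = refl
   mo (suc k) h m = ap (𝟙 (ea (xo (sb (h fz)) (sb (lookup m (h fz)))) (xb (h fz))) *_) (mo k (\ i -> h (fs i)) m)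

   ct : ∀ k (h : Fin k -> Fin n) a b -> cT a b (tabulate h) ≡ kF (\ i -> sb (h i)) (\ i -> xb (h i)) a b
   ct zero h a b = refl
   ct (suc k) h a b = ap ((if ea (sb (h fz)) a ∧ ea (xb (h fz)) b then 1 else 0) ℕ.+_) (ct k (\ i -> h (fs i)) a b)

   A≤W : Ac c ≤ ι (Wt (allFin n))
   A≤W = EQ (Sc PM (\ m _ -> trans (pG (\ i -> ap 𝟙 (eq-flip up (xo (sb i) (sb (lookup m i))) (cb i)))) (sym (mo n (\ i -> i) m)))) ~ PM-≤ f (mt (allFin n)) ~ tb f (allFin n) (bk n) (UniqueP.allFin⁺ n) (lF n)

   kn : ∀ {k} (s c : Fin k -> Bool) a b -> kF s (\ i -> not (c i)) a b ≡ kF s c a (not b)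
   kn {zero} s c a b = refl
   kn {suc k} s c a b = ap₂ (\ z w -> (if ea (s fz) a ∧ z then 1 else 0) +' w) (e (c fz) b) (kn (\ i -> s (fs i)) (\ i -> c (fs i)) a b)
    where
    e : ∀ x b -> ea (not x) b ≡ ea x (not b)
    e true b = refl
    e false true = refl
    e false false = refl

   Wfact : Wt (allFin n) *' Wt (allFin n) <= fa k11 *' fa k10 *' (fa k01 *' fa k00)
   Wfact = ≤≤ (≤≡ (ap (\ w -> w *' w) We)) (≤≤ (≤≡ (sq4 (Φ x11 x01) (DD x10) (DD x00))) (≤≤ (ℕP.*-mono-≤ (Φ-sq x11 x01) (ℕP.*-mono-≤ (DD-sq x10) (DD-sq x00))) (≤≡ (perm up refl))))
    where
    x : Bool -> Bool -> ℕ
    x = kF sb xb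
    x11 = x true true
    x10 = x true false
    x01 = x false true
    x00 = x false false
    We : Wt (allFin n) ≡ Φ x11 x01 *' (DD x10 *' DD x00)
    We = ap₂ ℕ._*_ (ap₂ Φ (ct n (\ i -> i) true true) (ct n (\ i -> i) false true)) (ap₂ (\ a b -> DD a *' DD b) (ct n (\ i -> i) true false) (ct n (\ i -> i) false false))
    open import Data.Nat.Tactic.RingSolver using () renaming (solve-∀ to solveℕ)
    sq4 : ∀ a b c -> a *' (b *' c) *' (a *' (b *' c)) ≡ a *' a *' (b *' b *' (c *' c))
    sq4 = solveℕ
    p1 : ∀ a b c e -> a *' b *' (c *' e) ≡ a *' c *' (b *' e)
    p1 = solveℕ
    p2 : ∀ a b c e -> a *' b *' (c *' e) ≡ c *' a *' (e *' b)
    p2 = solveℕ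
    perm : ∀ u -> up ≡ u -> fa x11 *' fa x01 *' (fa x10 *' fa x00) ≡ fa k11 *' fa k10 *' (fa k01 *' fa k00)
    perm true e rewrite e = p1 (fa k11) (fa k01) (fa k10) (fa k00)
    perm false e rewrite e | kn sb cb true true | kn sb cb true false | kn sb cb false true | kn sb cb false false = p2 (fa k10) (fa k00) (fa k11) (fa k01)

  ks : k11 +' k10 ≡ cn sb true
  ks = km sb cb true
  ks' : k01 +' k00 ≡ cn sb false
  ks' = km sb cb false

  -- The squared count is at most a product of four factorials. The three binomial coefficients
  -- complete it to n!, which exceeds ((n - 1)!!)² by a factor of at most n + 1, and (n - 1)!! is at
  -- most the number of perfect matchings.
  pattern-bound : Ac c * Ac c * (bC n (cn sb true) * (bC (cn sb true) k11 * bC (cn sb false) k01)) ≤ ι (suc n) * (tot * tot)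
  pattern-bound = zb (nc (binC-nn n s) (nc (binC-nn s k11) (binC-nn s' k01))) (ma (An c) (An c) A≤W A≤W ~ EQ (sym (zn (Wt (allFin n)) (Wt (allFin n)))) ~ mn Wfact ~ EQ fe)
   ~ EQ (l (ι (fa k11) * ι (fa k10)) (ι (fa k01) * ι (fa k00)) (bC n s) (bC s k11) (bC s' k01) >> ap₂ (\ a b -> bC n s * (a * b)) f1 f2 >> f3)
   ~ mn (fact-dd f) ~ EQ (zn (suc n) (dd f *' dd f) >> ap (ι (suc n) *_) (zn (dd f) (dd f))) ~ za (zd (suc n)) (ma (zd (dd f)) (zd (dd f)) (Pl f) (Pl f))
   where
   s = cn sb true
   s' = cn sb false
   fe : ι (fa k11 *' fa k10 *' (fa k01 *' fa k00)) ≡ ι (fa k11) * ι (fa k10) * (ι (fa k01) * ι (fa k00))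
   fe = trans (zn (fa k11 *' fa k10) (fa k01 *' fa k00)) (ap₂ _*_ (zn (fa k11) (fa k10)) (zn (fa k01) (fa k00)))
   l = r5 (v0 :* v1 :* (v2 :* (v3 :* v4))) (v2 :* (v3 :* v0 :* (v4 :* v1)))
   f1 : bC s k11 * (ι (fa k11) * ι (fa k10)) ≡ ι (fa s)
   f1 = subst (\ z -> bC z k11 * (ι (fa k11) * ι (fa k10)) ≡ ι (fa z)) ks (bt k11 k10)
   f2 : bC s' k01 * (ι (fa k01) * ι (fa k00)) ≡ ι (fa s')
   f2 = subst (\ z -> bC z k01 * (ι (fa k01) * ι (fa k00)) ≡ ι (fa z)) ks' (bt k01 k00)
   f3 : bC n s * (ι (fa s) * ι (fa s')) ≡ ι (fa n)
   f3 = subst (\ z -> bC z s * (ι (fa s) * ι (fa s')) ≡ ι (fa z)) (cu sb) (bt s s')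

-- Summation of label matrices against grid weights.

module Master (f : ℕ) (Sb : Vec Bool (f +' f)) (up : Bool)
 (sc : 1 <= cn (lookup Sb) true) (sd : 1 <= cn (lookup Sb) false)
 (d' F : ℕ) (η : ℚ) (η1 : η ≤ 1q)
 (Y δ Y' δ' : ℚ) (Y+ : 0q < Y) (zB : 0q < δ) (Y'+ : 0q < Y') (δ'+ : 0q < δ')
 (E : Cover.End Y δ Y+ zB F) (E' : Cover.End Y' δ' Y'+ δ'+ F)
 (ht : (40 // 1) * (ι (suc d') * ι (suc d') * (δ * δ) * Y) ≤ η)
 (ht' : (40 // 1) * (ι (suc d') * ι (suc d') * (δ' * δ') * Y') ≤ η) where

 open Pattern f Sb up public
 d = suc d'
 private
  module C1 = Cover Y δ Y+ zB
  module C2 = Cover Y' δ' Y'+ δ'+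
 module G1 = C1.Grid F d' E η η1 ht
 module G2 = C2.Grid F d' E' η η1 ht'
 s s' : ℕ
 s = cn sb true
 s' = cn sb false
 n≡ : s +' s' ≡ n
 n≡ = cu sb
 n+ : 0q < ι n
 n+ = <-≤ (zj 0) (mn (≤≤ sc (≤≤ (m≤m+n s s') (≤≡ n≡))))
 θ zm : ℚ
 θ = ι s * ig (ι n)
 zm = ι s' * ig (ι n)
 pη : 0q ≤ η
 pη = G1.pη

 Ix : Set
 Ix = ℕ × ℕ
 GP : List Ix
 GP = concatMap (\ k -> map (k ,_) (upTo (suc G2.K))) (upTo (suc G1.K))

 Id : Ix -> Set
 Id κ = fst κ <= G1.K × snd κ <= G2.K

 GP⁺ : ∀ κ -> Id κ -> κ ∈ GP
 GP⁺ (k , k') (p , q) = cp (\ k -> map (k ,_) (upTo (suc G2.K))) (upTo (suc G1.K)) (∈P.∈-upTo⁺ (ℕ.s≤s p)) (∈P.∈-map⁺ (k ,_) (∈P.∈-upTo⁺ (ℕ.s≤s q)))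

 GP⁻ : ∀ κ -> κ ∈ GP -> Id κ
 GP⁻ κ p with co (\ k -> map (k ,_) (upTo (suc G2.K))) (upTo (suc G1.K)) p
 ... | (k , a , b) with ∈P.∈-map⁻ (k ,_) b
 ... | (k' , c , refl) = ≤-pred (∈P.∈-upTo⁻ a) , ≤-pred (∈P.∈-upTo⁻ c)

 wt : Ix -> Bool -> Bool -> ℚ
 wt κ true true = C1.UU (d *' fst κ)
 wt κ true false = C1.vv (d *' fst κ)
 wt κ false true = C2.UU (d *' snd κ)
 wt κ false false = C2.vv (d *' snd κ)

 en : Bool -> Bool -> ℚ
 en true true = C1.iY
 en false true = C2.iY
 en _ false = 1q

 iq : Ix -> Bool -> ℚ
 iq κ true = ig (C1.qq (d *' fst κ))
 iq κ false = ig (C2.qq (d *' snd κ))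

 qn : Ix -> Bool -> ℚ
 qn κ true = C1.qq (d *' fst κ)
 qn κ false = C2.qq (d *' snd κ)

 q*iq : ∀ κ b -> qn κ b * iq κ b ≡ 1q
 q*iq κ true = ic (G1.qq+ (d *' fst κ))
 q*iq κ false = ic (G2.qq+ (d *' snd κ))

 iq-nn : ∀ κ b -> 0q ≤ iq κ b
 iq-nn κ true = ie (G1.qq+ (d *' fst κ))
 iq-nn κ false = ie (G2.qq+ (d *' snd κ))

 en-nn : ∀ a b -> 0q ≤ en a b
 en-nn true true = C1.piY
 en-nn false true = C2.piY
 en-nn true false = ze
 en-nn false false = ze

 wt-nn : ∀ κ -> Id κ -> ∀ a b -> 0q ≤ wt κ a b
 wt-nn κ (p , q) true true = G1.Unn (d *' fst κ) (G1.dK≤ (fst κ) p)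
 wt-nn κ (p , q) true false = qa (G1.vpos (d *' fst κ) (G1.dK≤ (fst κ) p))
 wt-nn κ (p , q) false true = G2.Unn (d *' snd κ) (G2.dK≤ (snd κ) q)
 wt-nn κ (p , q) false false = qa (G2.vpos (d *' snd κ) (G2.dK≤ (snd κ) q))

 -- The Bernoulli weights sin² and cos² of a grid angle. The row sums use `wt`, which is their
 -- square root apart from the radius (`iq`) and a factor 1/Y per label (`en`); both of these are
 -- collected over the whole matrix.
 w2 : Ix -> Bool -> Bool -> ℚ
 w2 κ a b = wt κ a b * wt κ a b * en a b * iq κ a

 wP : Ix -> Vec Bool n -> ℚ
 wP κ c = pF (\ i -> wt κ (sb i) (lookup c i))
 eP : Vec Bool n -> ℚ
 eP c = pF (\ i -> en (sb i) (lookup c i))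
 iP : Ix -> ℚ
 iP κ = pF (\ i -> iq κ (sb i))
 w2P : Ix -> Vec Bool n -> ℚ
 w2P κ c = pF (\ i -> w2 κ (sb i) (lookup c i))

 w2P≡ : ∀ κ c -> w2P κ c ≡ wP κ c * wP κ c * eP c * iP κ
 w2P≡ κ c = trans (pP (\ i -> wt κ (sb i) (lookup c i) * wt κ (sb i) (lookup c i) * en (sb i) (lookup c i)) (\ i -> iq κ (sb i))) (ap (_* iP κ) (pP (\ i -> wt κ (sb i) (lookup c i) * wt κ (sb i) (lookup c i)) (\ i -> en (sb i) (lookup c i)) >> ap (_* eP c) (pP (\ i -> wt κ (sb i) (lookup c i)) (\ i -> wt κ (sb i) (lookup c i)))))

 -- One factor n + 1 comes from `pattern-bound`, the other three from replacing each of its binomial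
 -- coefficients by an entropy.
 C0 : ℚ
 C0 = ι (suc n) ^ 4 * (tot * tot) * (θ ^ s * zm ^ s') * (1q + η) ^ n

 private
  pθ : 0q ≤ θ
  pθ = nc (zd s) (ie n+)
  pθ' : 0q ≤ zm
  pθ' = nc (zd s') (ie n+)
 C0-nn : 0q ≤ C0
 C0-nn = nc (nc (nc (ng 4 (zd (suc n))) (nc (zd (length PM)) (zd (length PM)))) (nc (ng s pθ) (ng s' pθ'))) (ng n (nh ze pη))

 private
  oc : ∀ x y a b -> 1 <= x +' y -> 0q ≤ a -> 0q ≤ b -> ι x ^ x * ι y ^ y ≤ (ι (x +' y) * (1q + η)) ^ (x +' y) * (a ^ x * b ^ y) -> 1q ≤ ι (suc (x +' y)) * bC (x +' y) x * (1q + η) ^ (x +' y) * (a ^ x * b ^ y)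
  oc x y a b p pa pb h = ca (po (x +' y) (<-≤ (zj 0) (mn p))) (EQ (*-1ˡ (ι (x +' y) ^ (x +' y))) ~ binC-lower x y ~ za (zd (suc (x +' y))) (za (binC-nn (x +' y) x) (h ~ EQ (ap (_* (a ^ x * b ^ y)) (zi (ι (x +' y)) (1q + η) (x +' y))))) ~ EQ (l (ι (suc (x +' y))) (bC (x +' y) x) (ι (x +' y) ^ (x +' y)) ((1q + η) ^ (x +' y)) (a ^ x * b ^ y)))
   where l = r5 (v0 :* (v1 :* (v2 :* v3 :* v4))) (v0 :* v1 :* v3 :* v4 :* v2)
  one-θ : 1q ≤ ι (suc n) * bC n s * (θ ^ s * zm ^ s')
  one-θ = ca (po n n+) (EQ (*-1ˡ (ι n ^ n)) ~ subst (\ m -> ι m ^ m ≤ ι (suc m) * (bC m s * (ι s ^ s * ι s' ^ s'))) n≡ (binC-lower s s') ~ EQ (ap₂ (\ a b -> ι (suc n) * (bC n s * (a * b))) (e s) (e s') >> l (ι (suc n)) (bC n s) (θ ^ s) (ι n ^ s) (zm ^ s') (ι n ^ s') >> ap (ι (suc n) * bC n s * (θ ^ s * zm ^ s') *_) (sym (zr (ι n) s s') >> ap (ι n ^_) n≡)))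
   where
   e : ∀ t -> ι t ^ t ≡ (ι t * ig (ι n)) ^ t * ι n ^ t
   e t = trans (ap (_^ t) (sym (*-1ʳ (ι t)) >> ap (ι t *_) (sym (ic n+)) >> e' (ι t) (ι n) (ig (ι n)))) (zi (ι t * ig (ι n)) (ι n) t)
    where e' = r3 (v0 :* (v1 :* v2)) (v0 :* v2 :* v1)
   l = r6 (v0 :* (v1 :* (v2 :* v3 :* (v4 :* v5)))) (v0 :* v1 :* (v2 :* v4) :* (v3 :* v5))

 -- `binC-lower` makes each of the three binomial coefficients, times the matching product weight
 -- and the polynomial factor, at least 1. Multiplying by these three quantities brings the left
 -- side into the form of `pattern-bound`.
 pattern-grid : ∀ c -> ∃[ κ ] (Id κ × Ac c * Ac c ≤ C0 * w2P κ c)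
 pattern-grid c = fin (G1.cover a b (≤≤ sc (≤≡ (sym (ks c))))) (G2.cover a' b' (≤≤ sd (≤≡ (sym (ks' c)))))
  where
  a = k11 c
  b = k10 c
  a' = k01 c
  b' = k00 c
  fin : ∃[ k ] (1 <= k × k <= G1.K × ι a ^ a * ι b ^ b ≤ (ι (a +' b) * (1q + η)) ^ (a +' b) * (G1.aa (d *' k) ^ a * G1.bb (d *' k) ^ b)) ->
   ∃[ k ] (1 <= k × k <= G2.K × ι a' ^ a' * ι b' ^ b' ≤ (ι (a' +' b') * (1q + η)) ^ (a' +' b') * (G2.aa (d *' k) ^ a' * G2.bb (d *' k) ^ b')) ->
   ∃[ κ ] (Id κ × Ac c * Ac c ≤ C0 * w2P κ c)
  fin (k , _ , kK , h) (k' , _ , kK' , h') = (k , k') , (kK , kK') ,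
   (EQ (sym (*-1ʳ (A * A))) ~ za (nc (An c) (An c)) (EQ refl ~ ma ze (nc ze ze) one-θ (ma ze ze o1 o2))
   ~ EQ (l (A * A) (ι (suc n)) (bC n s) (θ ^ s * zm ^ s') (ι (suc s)) (bC s a) ((1q + η) ^ s) W1 (ι (suc s')) (bC s' a') ((1q + η) ^ s') W2)
   ~ zb rest-nn (pattern-bound c)
   ~ za (nc (zd (suc n)) (nc (zd (length PM)) (zd (length PM)))) (zb (nc (nc (ng s pθ) (ng s' pθ')) (nc (nc (ng s 1η) (ng s' 1η)) (nc W1-nn W2-nn))) (ma (zd (suc n)) (nc (zd (suc s)) (zd (suc s'))) (≤-refl {ι (suc n)}) (ma (zd (suc s)) (zd (suc s')) (mn (ℕ.s≤s s≤n)) (mn (ℕ.s≤s s'≤n)))))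
   ~ EQ (l2 (ι (suc n)) (tot * tot) (θ ^ s * zm ^ s') ((1q + η) ^ s) ((1q + η) ^ s') W1 W2 >> ap₂ (\ x y -> ι (suc n) ^ 4 * (tot * tot) * (θ ^ s * zm ^ s') * x * y) (sym (zr (1q + η) s s') >> ap ((1q + η) ^_) n≡) W≡))
   where
   A = Ac c
   n1 = d *' k
   n2 = d *' k'
   W1 = G1.aa n1 ^ a * G1.bb n1 ^ b
   W2 = G2.aa n2 ^ a' * G2.bb n2 ^ b'
   1η : 0q ≤ 1q + η
   1η = nh ze pη
   aa-nn : 0q ≤ G1.aa n1
   aa-nn = nc (nc (sn (C1.UU n1)) C1.piY) (ie (G1.qq+ n1))
   bb-nn : 0q ≤ G1.bb n1
   bb-nn = nc (sn (C1.vv n1)) (ie (G1.qq+ n1))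
   aa-nn' : 0q ≤ G2.aa n2
   aa-nn' = nc (nc (sn (C2.UU n2)) C2.piY) (ie (G2.qq+ n2))
   bb-nn' : 0q ≤ G2.bb n2
   bb-nn' = nc (sn (C2.vv n2)) (ie (G2.qq+ n2))
   W1-nn : 0q ≤ W1
   W1-nn = nc (ng a aa-nn) (ng b bb-nn)
   W2-nn : 0q ≤ W2
   W2-nn = nc (ng a' aa-nn') (ng b' bb-nn')
   o1 : 1q ≤ ι (suc s) * bC s a * (1q + η) ^ s * W1
   o1 = subst (\ z -> 1q ≤ ι (suc z) * bC z a * (1q + η) ^ z * W1) (ks c) (oc a b (G1.aa n1) (G1.bb n1) (≤≤ sc (≤≡ (sym (ks c)))) aa-nn bb-nn h)
   o2 : 1q ≤ ι (suc s') * bC s' a' * (1q + η) ^ s' * W2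
   o2 = subst (\ z -> 1q ≤ ι (suc z) * bC z a' * (1q + η) ^ z * W2) (ks' c) (oc a' b' (G2.aa n2) (G2.bb n2) (≤≤ sd (≤≡ (sym (ks' c)))) aa-nn' bb-nn' h')
   s≤n : s <= n
   s≤n = ≤≤ (m≤m+n s s') (≤≡ n≡)
   s'≤n : s' <= n
   s'≤n = ≤≤ (m≤n+m s' s) (≤≡ n≡)
   rest-nn : 0q ≤ ι (suc n) * (ι (suc s) * ι (suc s')) * (θ ^ s * zm ^ s' * ((1q + η) ^ s * (1q + η) ^ s' * (W1 * W2)))
   rest-nn = nc (nc (zd (suc n)) (nc (zd (suc s)) (zd (suc s')))) (nc (nc (ng s pθ) (ng s' pθ')) (nc (nc (ng s 1η) (ng s' 1η)) (nc W1-nn W2-nn)))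
   l = r12 (v0 :* (v1 :* v2 :* v3 :* (v4 :* v5 :* v6 :* v7 :* (v8 :* v9 :* v10 :* v11)))) (v0 :* (v2 :* (v5 :* v9)) :* (v1 :* (v4 :* v8) :* (v3 :* (v6 :* v10 :* (v7 :* v11)))))
   l2 : ∀ N T t e1 e2 w1 w2 -> N * T * (N * (N * N) * (t * (e1 * e2 * (w1 * w2)))) ≡ N ^ 4 * T * t * (e1 * e2) * (w1 * w2)
   l2 N T t e1 e2 w1 w2 = go N T t e1 e2 w1 w2
    where go = r7 (v0 :* v1 :* (v0 :* (v0 :* v0) :* (v2 :* (v3 :* v4 :* (v5 :* v6))))) (v0 :* (v0 :* (v0 :* (v0 :* :1))) :* v1 :* v2 :* (v3 :* v4) :* (v5 :* v6))
   W≡ : W1 * W2 ≡ w2P (k , k') c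
   W≡ = sym (pV sb (\ i -> lookup c i) (w2 (k , k')) >> ap₂ _*_ (ap₂ (\ x y -> x ^ a * y ^ b) refl (one* (C1.vv n1 * C1.vv n1) (ig (C1.qq n1)))) (ap₂ (\ x y -> x ^ a' * y ^ b') refl (one* (C2.vv n2 * C2.vv n2) (ig (C2.qq n2)))))
    where one* = r2 (v0 :* :1 :* v1) (v0 :* v1)

 good : Ix -> Vec Bool n -> Bool
 good κ c = ⌊ Ac c * Ac c ℚ.≤? C0 * w2P κ c ⌋

 good-use : ∀ κ c -> Id κ -> Ac c * Ac c * 𝟙 (good κ c) ≤ C0 * w2P κ c
 good-use κ c g = go (Ac c * Ac c ℚ.≤? C0 * w2P κ c)
  where
  go : (D : Dec (Ac c * Ac c ≤ C0 * w2P κ c)) -> Ac c * Ac c * 𝟙 ⌊ D ⌋ ≤ C0 * w2P κ c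
  go (yes p) = EQ (*-1ʳ (Ac c * Ac c)) ~ p
  go (no _) = EQ (*-0ʳ (Ac c * Ac c)) ~ nc C0-nn (pH (\ i -> nc (nc (sn (wt κ (sb i) (lookup c i))) (en-nn (sb i) (lookup c i))) (iq-nn κ (sb i))))

 good-yes : ∀ κ c -> Ac c * Ac c ≤ C0 * w2P κ c -> 𝟙 (good κ c) ≡ 1q
 good-yes κ c h = go (Ac c * Ac c ℚ.≤? C0 * w2P κ c)
  where
  go : (D : Dec (Ac c * Ac c ≤ C0 * w2P κ c)) -> 𝟙 ⌊ D ⌋ ≡ 1q
  go (yes p) = refl
  go (no q) = ⊥-elim (q h)

 gP : ∀ {m} -> Vec Ix m -> Vec (Vec Bool n) m -> ℚ
 gP [] [] = 1q
 gP (κ ∷ sa) (c ∷ cs) = 𝟙 (good κ c) * gP sa cs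
 bP : ∀ {m} -> Vec Ix m -> Vec (Vec Bool n) m -> ℚ
 bP [] [] = 1q
 bP (κ ∷ sa) (c ∷ cs) = wP κ c * bP sa cs
 enP : ∀ {m} -> Vec (Vec Bool n) m -> ℚ
 enP [] = 1q
 enP (c ∷ cs) = eP c * enP cs
 iqP : ∀ {m} -> Vec Ix m -> ℚ
 iqP [] = 1q
 iqP (κ ∷ sa) = iP κ * iqP sa
 AI : ∀ {m} -> Vec Ix m -> Set
 AI [] = ⊤
 AI (κ ∷ sa) = Id κ × AI sa

 ∈-AllIn : ∀ m (sa : Vec Ix m) -> sa ∈ vecsOver GP m -> AI sa
 ∈-AllIn zero [] p = tt
 ∈-AllIn (suc m) sa p with co (\ x -> map (x ∷_) (vecsOver GP m)) GP p
 ... | (κ , a , b) with ∈P.∈-map⁻ (κ ∷_) b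
 ... | (κs' , q , refl) = GP⁻ κ a , ∈-AllIn m κs' q

 gn : ∀ {m} (sa : Vec Ix m) cs -> 0q ≤ gP sa cs
 gn [] [] = ze
 gn (κ ∷ sa) (c ∷ cs) = nc (nk (good κ c)) (gn sa cs)
 goodP≤1 : ∀ {m} (sa : Vec Ix m) cs -> gP sa cs ≤ 1q
 goodP≤1 [] [] = ≤-refl
 goodP≤1 (κ ∷ sa) (c ∷ cs) = ma (nk (good κ c)) (gn sa cs) (zG (good κ c)) (goodP≤1 sa cs) ~ EQ (*-1ˡ 1q)
 bP-nn : ∀ {m} (sa : Vec Ix m) cs -> AI sa -> 0q ≤ bP sa cs
 bP-nn [] [] a = ze
 bP-nn (κ ∷ sa) (c ∷ cs) (g , a) = nc (pH (\ i -> wt-nn κ g (sb i) (lookup c i))) (bP-nn sa cs a)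
 enP-nn : ∀ {m} (cs : Vec (Vec Bool n) m) -> 0q ≤ enP cs
 enP-nn [] = ze
 enP-nn (c ∷ cs) = nc (pH (\ i -> en-nn (sb i) (lookup c i))) (enP-nn cs)
 iqP-nn : ∀ {m} (sa : Vec Ix m) -> 0q ≤ iqP sa
 iqP-nn [] = ze
 iqP-nn (κ ∷ sa) = nc (pH (\ i -> iq-nn κ (sb i))) (iqP-nn sa)

 -- A column may be dominated by several grid points; counting it for each of them is harmless in an
 -- upper bound. Grouping by grid points therefore costs only their number, which does not depend on
 -- n.
 goodP-sum : ∀ {m} (cs : Vec (Vec Bool n) m) -> 1q ≤ S (\ sa -> gP sa cs) (vecsOver GP m)
 goodP-sum [] = EQ (sym (+-0ʳ 1q))
 goodP-sum {suc m} (c ∷ cs) = fin (pattern-grid c)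
  where
  fin : ∃[ κ ] (Id κ × Ac c * Ac c ≤ C0 * w2P κ c) -> 1q ≤ S (\ sa -> gP sa (c ∷ cs)) (vecsOver GP (suc m))
  fin (κ , g , h) = goodP-sum cs ~ EQ (Sc (vecsOver GP m) (\ sa _ -> trans (sym (*-1ˡ (gP sa cs))) (ap (_* gP sa cs) (sym (good-yes κ c h)))) >> refl)
   ~ S-term {f = \ κ -> S (\ sa -> 𝟙 (good κ c) * gP sa cs) (vecsOver GP m)} GP (GP⁺ κ g) (\ κ -> S-nn (vecsOver GP m) (\ sa -> nc (nk (good κ c)) (gn sa cs))) ~ EQ (sym (Sg GP m (\ sa -> gP sa (c ∷ cs))))

 prodA-sq : ∀ {m} (sa : Vec Ix m) cs -> AI sa -> pl cs * pl cs * gP sa cs ≤ C0 ^ m * (bP sa cs * bP sa cs * enP cs * iqP sa)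
 prodA-sq [] [] a = EQ refl
 prodA-sq {suc m} (κ ∷ sa) (c ∷ cs) (g , a) = EQ (l1 (Ac c) (pl cs) (𝟙 (good κ c)) (gP sa cs)) ~ ma (nc (nc (An c) (An c)) (nk (good κ c))) (nc (nc (pI cs) (pI cs)) (gn sa cs)) (good-use κ c g ~ EQ (ap (C0 *_) (w2P≡ κ c))) (prodA-sq sa cs a)
  ~ EQ (l2 C0 (C0 ^ m) (wP κ c) (eP c) (iP κ) (bP sa cs) (enP cs) (iqP sa))
  where
  l1 = r4 (v0 :* v1 :* (v0 :* v1) :* (v2 :* v3)) (v0 :* v0 :* v2 :* (v1 :* v1 :* v3))
  l2 = r8 (v0 :* (v2 :* v2 :* v3 :* v4) :* (v1 :* (v5 :* v5 :* v6 :* v7))) (v0 :* v1 :* (v2 :* v5 :* (v2 :* v5) :* (v3 :* v6) :* (v4 :* v7)))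

 -- thresholds lowered by the labels already seen
 rw : ∀ {m} -> (Fin n -> ℕ) -> Vec (Vec Bool n) m -> ℚ
 rw t [] = pF (\ i -> ro [] (t i))
 rw t (c ∷ cs) = rw (\ i -> if lookup c i then ℕ.pred (t i) else t i) cs

 colc : ∀ {m} -> Fin n -> Vec (Vec Bool n) m -> ℕ
 colc i [] = 0
 colc i (c ∷ cs) = (if lookup c i then 1 else 0) +' colc i cs

 rowsOK-nn : ∀ {m} t (cs : Vec (Vec Bool n) m) -> 0q ≤ rw t cs
 rowsOK-nn t [] = pH (\ i -> g (t i))
  where
  g : ∀ T -> 0q ≤ ro [] T
  g zero = ze
  g (suc T) = ≤-refl
 rowsOK-nn t (c ∷ cs) = rowsOK-nn _ cs

 rn : ∀ {m} t (cs : Vec (Vec Bool n) m) -> (∀ i -> t i <= colc i cs) -> rw t cs ≡ 1q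
 rn t [] h = trans (pG (\ i -> ap (ro []) (ℕP.n≤0⇒n≡0 (h i)))) (one n)
  where
  one : ∀ k -> pF {k} (\ _ -> 1q) ≡ 1q
  one zero = refl
  one (suc k) = trans (*-1ˡ (pF {k} (\ _ -> 1q))) (one k)
 rn t (c ∷ cs) h = rn _ cs (\ i -> go i (lookup c i) (h i))
  where
  go : ∀ i b -> t i <= (if b then 1 else 0) +' colc i cs -> (if b then ℕ.pred (t i) else t i) <= colc i cs
  go i true p = ℕP.pred-mono-≤ p
  go i false p = p

 idx1 idx2 : ∀ {m} -> Vec Ix m -> List ℕ
 idx1 [] = []
 idx1 (κ ∷ sa) = d *' fst κ ∷ idx1 sa
 idx2 [] = []
 idx2 (κ ∷ sa) = d *' snd κ ∷ idx2 sa

 RLs : ∀ {m} -> Vec Ix m -> Bool -> ℕ -> ℚ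
 RLs sa true T = G1.RL (idx1 sa) T
 RLs sa false T = G2.RL (idx2 sa) T

 RLs-nil : ∀ b T -> RLs [] b T ≡ ro [] T
 RLs-nil true T = refl
 RLs-nil false T = refl

 RLs-cons : ∀ {m} κ (sa : Vec Ix m) b T -> RLs (κ ∷ sa) b T ≡ wt κ b true * RLs sa b (ℕ.pred T) + wt κ b false * RLs sa b T
 RLs-cons κ sa true T = +-cm (wt κ true false * RLs sa true T) (wt κ true true * RLs sa true (ℕ.pred T))
 RLs-cons κ sa false T = +-cm (wt κ false false * RLs sa false T) (wt κ false true * RLs sa false (ℕ.pred T))

 -- This is where vertices decouple: with the grid points fixed the weight of a matrix is a product
 -- over its entries, so the sum over matrices meeting all thresholds factors into one tail per row.
 row-sum : ∀ {m} (sa : Vec Ix m) t -> S (\ cs -> bP sa cs * rw t cs) (vecsOver AC m) ≡ pF (\ i -> RLs sa (sb i) (t i))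
 row-sum [] t = trans (+-0ʳ (1q * rw t [])) (*-1ˡ (rw t []) >> pG (\ i -> sym (RLs-nil (sb i) (t i))))
 row-sum {suc m} (κ ∷ sa) t = trans (Sg AC m (\ cs -> bP (κ ∷ sa) cs * rw t cs)) (trans (Sc AC (\ c _ -> trans (Sc (vecsOver AC m) (\ cs _ -> *-as (wP κ c) (bP sa cs) (rw (t' c) cs))) (Sa (wP κ c) (\ cs -> bP sa cs * rw (t' c) cs) (vecsOver AC m) >> ap (wP κ c *_) (row-sum sa (t' c)) >> sym (pP (\ i -> wt κ (sb i) (lookup c i)) (\ i -> RLs sa (sb i) (t' c i))) >> pG (\ i -> bb' i (lookup c i)))))
  (p7 n (\ i b -> wt κ (sb i) b * RLs sa (sb i) (if b then ℕ.pred (t i) else t i)) >> pG (\ i -> sym (RLs-cons κ sa (sb i) (t i)))))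
  where
  t' : Vec Bool n -> Fin n -> ℕ
  t' c i = if lookup c i then ℕ.pred (t i) else t i
  bb' : ∀ i b -> wt κ (sb i) b * RLs sa (sb i) (if b then ℕ.pred (t i) else t i) ≡ wt κ (sb i) b * RLs sa (sb i) (if b then ℕ.pred (t i) else t i)
  bb' i b = refl

 qP : ∀ {m} -> Vec Ix m -> Bool -> ℚ
 qP [] b = 1q
 qP (κ ∷ sa) b = qn κ b * qP sa b
 jP : ∀ {m} -> Vec Ix m -> Bool -> ℚ
 jP [] b = 1q
 jP (κ ∷ sa) b = iq κ b * jP sa b
 qjP : ∀ {m} (sa : Vec Ix m) b -> qP sa b * jP sa b ≡ 1q
 qjP [] b = refl
 qjP (κ ∷ sa) b = trans (l (qn κ b) (qP sa b) (iq κ b) (jP sa b)) (ap₂ _*_ (q*iq κ b) (qjP sa b) >> refl)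
  where l = r4 (v0 :* v1 :* (v2 :* v3)) (v0 :* v2 :* (v1 :* v3))
 jP-nn : ∀ {m} (sa : Vec Ix m) b -> 0q ≤ jP sa b
 jP-nn [] b = ze
 jP-nn (κ ∷ sa) b = nc (iq-nn κ b) (jP-nn sa b)
 iqP≡ : ∀ {m} (sa : Vec Ix m) -> iqP sa ≡ pF (\ i -> jP sa (sb i))
 iqP≡ [] = sym (one n)
  where
  one : ∀ k -> pF {k} (\ _ -> 1q) ≡ 1q
  one zero = refl
  one (suc k) = trans (*-1ˡ (pF {k} (\ _ -> 1q))) (one k)
 iqP≡ (κ ∷ sa) = trans (ap (iP κ *_) (iqP≡ sa)) (sym (pP (\ i -> iq κ (sb i)) (\ i -> jP sa (sb i))))

 module Event (Ev : Vec (Vec Bool n) d -> Bool) (Tt : Bool -> ℕ) (BE : ℚ) (pBE : 0q ≤ BE) (R : Bool -> ℚ) (pR : ∀ b -> 0q ≤ R b)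
  (hrow : ∀ cs -> Ev cs ≡ true -> ∀ i -> Tt (sb i) <= colc i cs)
  (hen : ∀ cs -> Ev cs ≡ true -> enP cs ≤ BE)
  (hR : ∀ (sa : Vec Ix d) -> AI sa -> ∀ b -> RLs sa b (Tt b) * RLs sa b (Tt b) ≤ R b * qP sa b) where

  events : ℚ
  events = S (\ ms -> 𝟙 (Ev (lg ms))) (vecsOver PM d)

  MM : ℚ
  MM = C0 ^ d * BE * (R true ^ s * R false ^ s')

  private
   a : Vec Ix d -> Vec (Vec Bool n) d -> ℚ
   a sa cs = pl cs * 𝟙 (Ev cs) * gP sa cs
   a-nn : ∀ sa cs -> 0q ≤ a sa cs
   a-nn sa cs = nc (nc (pI cs) (nk (Ev cs))) (gn sa cs)
   t0 : Fin n -> ℕ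
   t0 i = Tt (sb i)
   σ : Vec Ix d -> ℚ
   σ sa = C0 ^ d * BE * iqP sa
   σ-nn : ∀ sa -> 0q ≤ σ sa
   σ-nn sa = nc (nc (ng d C0-nn) pBE) (iqP-nn sa)
   asq : ∀ sa -> AI sa -> ∀ cs -> a sa cs * a sa cs ≤ σ sa * (bP sa cs * rw t0 cs * (bP sa cs * rw t0 cs))
   asq sa ai cs = go (Ev cs) refl
    where
    go : ∀ b -> Ev cs ≡ b -> a sa cs * a sa cs ≤ σ sa * (bP sa cs * rw t0 cs * (bP sa cs * rw t0 cs))
    go false e = EQ (ap (\ z -> pl cs * 𝟙 z * gP sa cs * (pl cs * 𝟙 z * gP sa cs)) e >> l (pl cs) (gP sa cs)) ~ nc (σ-nn sa) (sn (bP sa cs * rw t0 cs))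
     where l = r2 (v0 :* :0 :* v1 :* (v0 :* :0 :* v1)) :0
    go true e = EQ (ap (\ z -> pl cs * 𝟙 z * gP sa cs * (pl cs * 𝟙 z * gP sa cs)) e >> l (pl cs) (gP sa cs)) ~ za (nc (nc (pI cs) (pI cs)) (gn sa cs)) (goodP≤1 sa cs) ~ EQ (*-1ʳ (pl cs * pl cs * gP sa cs))
     ~ prodA-sq sa cs ai ~ za (ng d C0-nn) (zb (iqP-nn sa) (za (sn (bP sa cs)) (hen cs e)))
     ~ EQ (l2 (C0 ^ d) (bP sa cs) BE (iqP sa) >> ap (\ z -> σ sa * (bP sa cs * z * (bP sa cs * z))) (sym (rn t0 cs (hrow cs e))))
     where
     l = r2 (v0 :* :1 :* v1 :* (v0 :* :1 :* v1)) (v0 :* v0 :* v1 :* v1)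
     l2 = r4 (v0 :* (v1 :* v1 :* v2 :* v3)) (v0 :* v2 :* v3 :* (v1 :* :1 :* (v1 :* :1)))
   Agrp : Vec Ix d -> ℚ
   Agrp sa = S (a sa) (vecsOver AC d)
   grp : ∀ sa -> AI sa -> Agrp sa * Agrp sa ≤ MM * (1q * 1q)
   grp sa ai = sq-sum (vecsOver AC d) (σ-nn sa) (a-nn sa) (\ cs -> nc (bP-nn sa cs ai) (rowsOK-nn t0 cs)) (\ cs _ -> asq sa ai cs)
    ~ EQ (ap (\ z -> σ sa * (z * z)) (row-sum sa t0) >> l1 (C0 ^ d * BE) (iqP sa) (pF (\ i -> RLs sa (sb i) (t0 i))) >> ap (C0 ^ d * BE *_) (ap₂ _*_ (sym (pP (\ i -> RLs sa (sb i) (t0 i)) (\ i -> RLs sa (sb i) (t0 i)))) (iqP≡ sa) >> sym (pP (\ i -> RLs sa (sb i) (t0 i) * RLs sa (sb i) (t0 i)) (\ i -> jP sa (sb i)))))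
    ~ za (nc (ng d C0-nn) pBE) (p5 (\ i -> nc (sn (RLs sa (sb i) (t0 i))) (jP-nn sa (sb i))) (\ i -> zb (jP-nn sa (sb i)) (hR sa ai (sb i)) ~ EQ (*-as (R (sb i)) (qP sa (sb i)) (jP sa (sb i)) >> ap (R (sb i) *_) (qjP sa (sb i)) >> *-1ʳ (R (sb i)))))
    ~ EQ (ap (C0 ^ d * BE *_) (pJ sb R) >> l3 MM)
    where
    l1 = r3 (v0 :* v1 :* (v2 :* v2)) (v0 :* (v2 :* v2 :* v1))
    l3 = r1 v0 (v0 :* (:1 :* :1))
   MM-nn : 0q ≤ MM
   MM-nn = nc (nc (ng d C0-nn) pBE) (nc (ng s (pR true)) (ng s' (pR false)))
   events≤ : events ≤ S Agrp (vecsOver GP d)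
   events≤ = EQ (bp d (\ cs -> 𝟙 (Ev cs))) ~ Sm (vecsOver AC d) (\ cs _ -> EQ (sym (*-1ʳ (pl cs * 𝟙 (Ev cs)))) ~ za (nc (pI cs) (nk (Ev cs))) (goodP-sum cs) ~ EQ (sym (Sa (pl cs * 𝟙 (Ev cs)) (\ sa -> gP sa cs) (vecsOver GP d)))) ~ EQ (Ss (\ cs sa -> a sa cs) (vecsOver AC d) (vecsOver GP d))
   events-nn : 0q ≤ events
   events-nn = S-nn (vecsOver PM d) (\ ms -> nk (Ev (lg ms)))

  -- `sq-sum` is used twice: inside one choice of grid points, where `asq` bounds the squared matrix
  -- weights, and over all choices, each of which contributes at most √`MM`.
  master : events * events ≤ MM * (ι (length (vecsOver GP d)) * ι (length (vecsOver GP d)))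
  master = ma events-nn events-nn events≤ events≤ ~ sq-sum (vecsOver GP d) MM-nn (\ sa -> S-nn (vecsOver AC d) (a-nn sa)) (\ _ -> ze) (\ sa p -> grp sa (∈-AllIn d sa p)) ~ EQ (ap (\ z -> MM * (z * z)) (Sn 1q (vecsOver GP d) >> *-1ʳ (ι (length (vecsOver GP d)))))

-- Row estimates at grid points.

ellipse-bound : ∀ v U {Y} -> 0q < Y -> (v + U) * (v + U) ≤ (1q + Y) * (v * v + U * U * ig Y)
ellipse-bound v U {Y} Y+ = ba (nc (sn (U - Y * v)) (ie Y+)) (l v U Y (ig Y) >> ap (\ t -> (v + U) * (v + U) + (U - Y * v) * (U - Y * v) * ig Y + (t - 1q) * (U * U + v * U + v * U - Y * v * v)) (ic Y+) >> l2 v U Y (ig Y))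
 where
 l = r4 ((:1 :+ v2) :* (v0 :* v0 :+ v1 :* v1 :* v3)) ((v0 :+ v1) :* (v0 :+ v1) :+ (v1 :- v2 :* v0) :* (v1 :- v2 :* v0) :* v3 :+ (v2 :* v3 :- :1) :* (v1 :* v1 :+ v0 :* v1 :+ v0 :* v1 :- v2 :* v0 :* v0))
 l2 = r4 ((v0 :+ v1) :* (v0 :+ v1) :+ (v1 :- v2 :* v0) :* (v1 :- v2 :* v0) :* v3 :+ (:1 :- :1) :* (v1 :* v1 :+ v0 :* v1 :+ v0 :* v1 :- v2 :* v0 :* v0)) ((v0 :+ v1) :* (v0 :+ v1) :+ (v1 :- v2 :* v0) :* (v1 :- v2 :* v0) :* v3)

module GridRows (Y δ : ℚ) (Y+ : 0q < Y) (zB : 0q < δ) (F d' : ℕ) (E : Cover.End Y δ Y+ zB F) (η : ℚ) (η1 : η ≤ 1q)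
 (ht : (40 // 1) * (ι (suc d') * ι (suc d') * (δ * δ) * Y) ≤ η) where
 open Cover Y δ Y+ zB
 open Grid F d' E η η1 ht
 w : ℚ
 w = 1q + δ * δ * Y

 dm : List ℕ -> List ℕ
 dm [] = []
 dm (k ∷ ks) = d *' k ∷ dm ks

 qs : List ℕ -> ℚ
 qs [] = 1q
 qs (k ∷ ks) = qq (d *' k) * qs ks

 AllK : List ℕ -> Set
 AllK [] = ⊤
 AllK (k ∷ ks) = k <= K × AllK ks

 sumK : List ℕ -> ℕ
 sumK [] = 0
 sumK (k ∷ ks) = k +' sumK ks

 -- Squared radii are powers of 1 + δ²Y, so their product depends on the sum of the indices alone
 -- and is not affected by balancing.
 qs≡ : ∀ ks -> qs ks ≡ qq (sumK ks) ^ d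
 qs≡ ks = trans (go ks) (ap (_^ d) (sym (qo (sumK ks))))
  where
  go : ∀ ks -> qs ks ≡ (w ^ sumK ks) ^ d
  go [] = sym (zC d)
  go (k ∷ ks) = trans (ap₂ _*_ (qo (d *' k) >> ap (w ^_) (*-cmℕ d k) >> zp w k d) (go ks))
   (sym (zi (w ^ k) (w ^ sumK ks) d) >> ap (_^ d) (sym (zr w k (sumK ks))))

 dm-All : ∀ ks -> AllK ks -> Al (dm ks)
 dm-All [] a = tt
 dm-All (k ∷ ks) (p , a) = dK≤ k p , dm-All ks a

 dm-sum : ∀ ks -> sL (dm ks) ≡ sumK ks *' d
 dm-sum [] = refl
 dm-sum (k ∷ ks) = trans (ap₂ ℕ._+_ (*-cmℕ d k) (dm-sum ks)) (sym (ℕP.*-distribʳ-+ d k (sumK ks)))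

 dm-len : ∀ ks -> length (dm ks) ≡ length ks
 dm-len [] = refl
 dm-len (k ∷ ks) = ap suc (dm-len ks)

 sumL≤ : ∀ l -> Al l -> sL l <= length l *' J
 sumL≤ [] a = ℕ.z≤n
 sumL≤ (j ∷ l) (p , a) = ℕP.+-mono-≤ p (sumL≤ l a)

 fo : ∀ ks -> RL (dm ks) 0 * RL (dm ks) 0 ≤ (1q + Y) ^ length ks * qs ks
 fo [] = EQ refl
 fo (k ∷ ks) = EQ (l (vv (d *' k)) (UU (d *' k)) (RL (dm ks) 0)) ~ ma (sn (vv (d *' k) + UU (d *' k))) (sn (RL (dm ks) 0)) (ellipse-bound (vv (d *' k)) (UU (d *' k)) Y+) (fo ks)
  ~ EQ (l2 (1q + Y) (qq (d *' k)) ((1q + Y) ^ length ks) (qs ks))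
  where
  l = r3 ((v0 :* v2 :+ v1 :* v2) :* (v0 :* v2 :+ v1 :* v2)) ((v0 :+ v1) :* (v0 :+ v1) :* (v2 :* v2))
  l2 = r4 (v0 :* v1 :* (v2 :* v3)) (v0 :* v2 :* (v1 :* v3))

 private
  ra : ∀ m T -> ro (rep m (1q , 0q)) (suc T) ≡ 0q
  ra zero T = refl
  ra (suc m) T = trans (ap (\ z -> 1q * z + 0q * ro (rep m (1q , 0q)) T) (ra m T)) (l (ro (rep m (1q , 0q)) T))
   where l = r1 (:1 :* :0 :+ :0 :* v0) :0
  map-rep : ∀ m a -> map vU (rep m a) ≡ rep m (vU a)
  map-rep zero a = refl
  map-rep (suc m) a = ap (vU a ∷_) (map-rep m a)

 tl : ∀ T -> (∀ v U -> 0q < v -> 0q < U -> ro (rep d (v , U)) (suc T) * ro (rep d (v , U)) (suc T) * (10000 // 1) ≤ (8464 // 1) * ((1q + Y) * (v * v + U * U * ig Y)) ^ d) ->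
  ∀ ks -> length ks ≡ d -> AllK ks -> RL (dm ks) (suc T) * RL (dm ks) (suc T) ≤ (8464 // 10000) * (1q + Y) ^ d * qs ks
 tl T rb ks len ak = ma nn nn bal bal ~ go (a ℕ.≟ 0)
  where
  a = sumK ks
  al = dm-All ks ak
  a≤J : a <= J
  a≤J = ℕP.*-cancelʳ-≤ a J d (≤≤ (≤≡ (sym (dm-sum ks))) (≤≤ (sumL≤ (dm ks) al) (≤≡ (ap (ℕ._* J) (dm-len ks >> len) >> *-cmℕ d J))))
  nn : 0q ≤ RL (dm ks) (suc T)
  nn = RL-nn (dm ks) (suc T) al
  Z = ro (rep d (vU a)) (suc T)
  bal : RL (dm ks) (suc T) ≤ Z
  bal = balance d a (dm ks) (dm-len ks >> len) a≤J al (dm-sum ks) (suc T) ~ EQ (ap (\ z -> ro z (suc T)) (map-rep d a))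
  qnn : 0q ≤ (8464 // 10000) * (1q + Y) ^ d * qs ks
  qnn = nc (nc {8464 // 10000} by (ng d (nh ze (qa Y+)))) (subst (0q ≤_) (sym (qs≡ ks)) (ng d (qa (qq+ a))))
  go : Dec (a ≡ 0) -> Z * Z ≤ (8464 // 10000) * (1q + Y) ^ d * qs ks
  -- Index 0 is the point (1, 0), at which no label can be present: a positive threshold has tail 0,
  -- whereas the row estimate assumes U > 0.
  go (yes e) = EQ (ap (\ z -> z * z) (ap (\ k -> ro (rep d (vU k)) (suc T)) e >> ra d T) >> refl) ~ qnn
  go (no ne) = ca {Z * Z} {(8464 // 10000) * (1q + Y) ^ d * qs ks} {10000 // 1} (>0 (10000 // 1)) (rb (vv a) (UU a) (vpos a a≤J) (U+ a (ℕP.n≢0⇒n>0 ne) a≤J)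
   ~ EQ (ap ((8464 // 1) *_) (zi (1q + Y) (qq a) d >> ap ((1q + Y) ^ d *_) (sym (qs≡ ks))) >> l ((1q + Y) ^ d) (qs ks)))
   where l = r2 ((8464 :/ 1) :* (v0 :* v1)) ((8464 :/ 10000) :* v0 :* v1 :* (10000 :/ 1))

kn : ∀ {k} (s c : Fin k -> Bool) a b -> kF s (\ i -> not (c i)) a b ≡ kF s c a (not b)
kn {zero} s c a b = refl
kn {suc k} s c a b = ap₂ (\ z w -> (if ea (s fz) a ∧ z then 1 else 0) +' w) (e (c fz) b) (kn (\ i -> s (fs i)) (\ i -> c (fs i)) a b)
 where
 e : ∀ x b -> ea (not x) b ≡ ea x (not b)
 e true b = refl
 e false true = refl
 e false false = refl

kc : ∀ {k} {s c c' : Fin k -> Bool} a b -> (∀ i -> c i ≡ c' i) -> kF s c a b ≡ kF s c' a b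
kc {zero} a b e = refl
kc {suc k} {s} a b e = ap₂ (\ z w -> (if ea (s fz) a ∧ ea z b then 1 else 0) +' w) (e fz) (kc a b (\ i -> e (fs i)))

ι-inj : ∀ {m n} -> ι m ≡ ι n -> m ≡ n
ι-inj e = ℕP.≤-antisym (cf (EQ e)) (cf (EQ (sym e)))

ι-if : ∀ b -> ι (if b then 1 else 0) ≡ 𝟙 b
ι-if true = ι1
ι-if false = ι0

kF-S : ∀ {k n} (h : Fin k -> Fin n) (s c : Fin n -> Bool) a b -> ι (kF (s ∘ h) (c ∘ h) a b) ≡ S (\ i -> 𝟙 (ea (s i) a ∧ ea (c i) b)) (tabulate h)
kF-S {zero} h s c a b = ι0
kF-S {suc k} h s c a b = trans (zq (if ea (s (h fz)) a ∧ ea (c (h fz)) b then 1 else 0) _) (ap₂ _+_ (ι-if (ea (s (h fz)) a ∧ ea (c (h fz)) b)) (kF-S (h ∘ fs) s c a b))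

S-involution : ∀ {n} (m : Fin n -> Fin n) -> (∀ i -> m (m i) ≡ i) -> (g : Fin n -> ℚ) -> (∀ i -> 0q ≤ g i) -> S (g ∘ m) (allFin n) ≡ S g (allFin n)
S-involution {n} m mm g nn = ℚP.≤-antisym (half g nn) (EQ (Sc (allFin n) (\ i _ -> ap g (sym (mm i)))) ~ half (g ∘ m) (\ i -> nn (m i)))
 where
 half : ∀ g -> (∀ i -> 0q ≤ g i) -> S (g ∘ m) (allFin n) ≤ S g (allFin n)
 half g nn = EQ (sym (S-map g m (allFin n))) ~ S-⊆ (map m (allFin n)) (allFin n) (UniqueP.map⁺ (\ {i} {j} e -> trans (sym (mm i)) (ap m e >> mm j)) (UniqueP.allFin⁺ n)) (\ i _ -> ∈P.∈-allFin i) nn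

-- A matching carries the crossing vertices of one side bijectively to those of the other.
cy : ∀ {n} (s : Fin n -> Bool) (m : Fin n -> Fin n) -> (∀ i -> m (m i) ≡ i) -> kF s (\ i -> xo (s i) (s (m i))) true true ≡ kF s (\ i -> xo (s i) (s (m i))) false true
cy {n} s m mm = ι-inj (trans (kF-S (\ i -> i) s (\ i -> xo (s i) (s (m i))) true true) (trans (sym (S-involution m mm (\ i -> 𝟙 (ea (s i) true ∧ ea (xo (s i) (s (m i))) true)) (\ i -> nk (ea (s i) true ∧ ea (xo (s i) (s (m i))) true))))
 (Sc (allFin n) (\ i _ -> ap 𝟙 (ap (\ j -> ea (s (m i)) true ∧ ea (xo (s (m i)) (s j)) true) (mm i) >> tbl (s (m i)) (s i))) >> sym (kF-S (\ i -> i) s (\ i -> xo (s i) (s (m i))) false true))))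
 where
 tbl : ∀ a b -> (ea a true ∧ ea (xo a b) true) ≡ (ea b false ∧ ea (xo b a) true)
 tbl true true = refl
 tbl true false = refl
 tbl false true = refl
 tbl false false = refl

AV : ∀ {A : Set} {k} -> (A -> Set) -> Vec A k -> Set
AV P [] = ⊤
AV P (x ∷ xs) = P x × AV P xs

Ae : ∀ {A : Set} {P : A -> Set} (xs : List A) k (v : Vec A k) -> v ∈ vecsOver xs k -> (∀ x -> x ∈ xs -> P x) -> AV P v
Ae xs zero [] p h = tt
Ae xs (suc k) v p h with co (\ x -> map (x ∷_) (vecsOver xs k)) xs p
... | (x , a , b) with ∈P.∈-map⁻ (x ∷_) b
... | (v' , c , refl) = h x a , Ae xs k v' c h

lh : ∀ {A : Set} (xs : List A) k -> ι (length (vecsOver xs k)) ≡ ι (length xs) ^ k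
lh xs zero = ι1
lh xs (suc k) = trans (sym (o (vecsOver xs (suc k)))) (Sg xs k (\ _ -> 1q) >> Sc xs (\ x _ -> trans (o (vecsOver xs k)) (lh xs k)) >> Sn (ι (length xs) ^ k) xs)
 where
 o : ∀ {A : Set} (ys : List A) -> S (\ _ -> 1q) ys ≡ ι (length ys)
 o ys = trans (Sn 1q ys) (*-1ʳ (ι (length ys)))

PM-IsPM : ∀ n m -> m ∈ perfectMatchings n -> Is m
PM-IsPM n m p = isPM-sound m (snd (fi isPerfectMatching (vecsOver (allFin n) n) p))

-- Label totals and exponential tilting.

module Labels (f : ℕ) (Sb : Vec Bool (f +' f)) (up : Bool) where
 open Pattern f Sb up public
 s s' : ℕ
 s = cn sb true
 s' = cn sb false
 θ zm : ℚ
 θ = ι s * ig (ι n)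
 zm = ι s' * ig (ι n)

 cr : Vec (Fin n) n -> Fin n -> Bool
 cr m i = xo (sb i) (sb (lookup m i))

 XX : ∀ {k} -> Vec (Vec (Fin n) n) k -> ℕ
 XX [] = 0
 XX (m ∷ ms) = kF sb (cr m) true true +' XX ms

 LL : ∀ {k} -> Bool -> Vec (Vec Bool n) k -> ℕ
 LL b [] = 0
 LL b (c ∷ cs) = kF sb (lookup c) b true +' LL b cs

 rowc : ∀ {k} -> Fin n -> Vec (Vec Bool n) k -> ℕ
 rowc i [] = 0
 rowc i (c ∷ cs) = (if lookup c i then 1 else 0) +' rowc i cs

 private
  lab-k : ∀ m a -> kF sb (lookup (lab m)) a true ≡ kF sb (bit m) a true
  lab-k m a = kc {s = sb} a true (\ i -> VecP.lookup∘tabulate (bit m) i)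

 LL-up : up ≡ true -> ∀ {k} (ms : Vec (Vec (Fin n) n) k) -> AV Is ms -> ∀ b -> LL b (lg ms) ≡ XX ms
 LL-up e [] a b = refl
 LL-up e (m ∷ ms) (pm , a) b = ap₂ ℕ._+_ (lab-k m b >> kc {s = sb} b true (\ i -> ap (\ u -> ea u (cr m i)) e) >> go b) (LL-up e ms a b)
  where
  go : ∀ b -> kF sb (cr m) b true ≡ kF sb (cr m) true true
  go true = refl
  go false = sym (cy sb (lookup m) (fst pm))

 LL-low : up ≡ false -> ∀ {k} (ms : Vec (Vec (Fin n) n) k) -> AV Is ms -> ∀ b -> LL b (lg ms) +' XX ms ≡ cn sb b *' k
 LL-low e [] a b = sym (ℕP.*-zeroʳ (cn sb b))
 LL-low e {suc k} (m ∷ ms) (pm , a) b = trans (sh (kF sb (lookup (lab m)) b true) (LL b (lg ms)) (kF sb (cr m) true true) (XX ms)) (ap₂ ℕ._+_ one (LL-low e ms a b) >> sym (ℕP.*-suc (cn sb b) k))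
  where
  open import Data.Nat.Tactic.RingSolver using () renaming (solve-∀ to solveℕ)
  sh : ∀ a b c e -> a +' b +' (c +' e) ≡ (a +' c) +' (b +' e)
  sh = solveℕ
  go : ∀ b -> kF sb (cr m) true true ≡ kF sb (cr m) b true
  go true = refl
  go false = cy sb (lookup m) (fst pm)
  one : kF sb (lookup (lab m)) b true +' kF sb (cr m) true true ≡ cn sb b
  one = trans (ap₂ ℕ._+_ (lab-k m b >> kc {s = sb} b true (\ i -> ap (\ u -> ea u (cr m i)) e) >> kn sb (cr m) b true) (go b)) (+-cmℕ (kF sb (cr m) b false) (kF sb (cr m) b true) >> km sb (cr m) b)

pj : {A : Set} -> Bool -> A -> A -> A
pj true x y = x
pj false x y = y

-- p is the mean frequency of the label on the side `true` and q that on the other side: the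
-- fraction of the opposite side when crossing is favoured, of the own side otherwise. Tilting by u
-- turns the odds p/q into Y.
module TiltBase (f : ℕ) (Sb : Vec Bool (f +' f)) (up : Bool)
 (sc : 1 <= cn (lookup Sb) true) (sd : 1 <= cn (lookup Sb) false) (u u' : ℚ) (u+ : 0q < u) (u'+ : 0q < u') where
 open Labels f Sb up public
 n≡ : s +' s' ≡ n
 n≡ = cu sb
 n+ : 0q < ι n
 n+ = <-≤ (zj 0) (mn (≤≤ sc (≤≤ (m≤m+n s s') (≤≡ n≡))))
 θ+ : 0q < θ
 θ+ = pos-* (<-≤ (zj 0) (mn sc)) (io n+)
 zD : 0q < zm
 zD = pos-* (<-≤ (zj 0) (mn sd)) (io n+)
 p q : ℚ
 p = pj up zm θ
 q = pj up θ zm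
 p+ : 0q < p
 p+ = go up
  where
  go : ∀ b -> 0q < pj b zm θ
  go true = zD
  go false = θ+
 q+ : 0q < q
 q+ = go up
  where
  go : ∀ b -> 0q < pj b θ zm
  go true = θ+
  go false = zD
 Y Y' : ℚ
 Y = p * u * ig q
 Y' = q * u' * ig p
 Y+ : 0q < Y
 Y+ = pos-* (pos-* p+ u+) (io q+)
 Y'+ : 0q < Y'
 Y'+ = pos-* (pos-* q+ u'+) (io p+)
 fc : θ + zm ≡ 1q
 fc = trans (sym (ℚP.*-distribʳ-+ (ig (ι n)) (ι s) (ι s'))) (ap (_* ig (ι n)) (sym (zq s s') >> ap ι n≡) >> ic n+)
 p+q : p + q ≡ 1q
 p+q = go up
  where
  go : ∀ b -> pj b zm θ + pj b θ zm ≡ 1q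
  go true = trans (+-cm zm θ) fc
  go false = fc
 pW : p * q ≡ θ * zm
 pW = go up
  where
  go : ∀ b -> pj b zm θ * pj b θ zm ≡ θ * zm
  go true = *-cm zm θ
  go false = refl

module Tilt (f : ℕ) (Sb : Vec Bool (f +' f)) (up : Bool)
 (sc : 1 <= cn (lookup Sb) true) (sd : 1 <= cn (lookup Sb) false) (d' F : ℕ) (η : ℚ) (η1 : η ≤ 1q) (δ : ℚ) (zB : 0q < δ) (u u' : ℚ) (u+ : 0q < u) (u'+ : 0q < u') where
 open TiltBase f Sb up sc sd u u' u+ u'+
 d = suc d'

 module Bounded (ht : (40 // 1) * (ι d * ι d * (δ * δ) * Y) ≤ η) (ht' : (40 // 1) * (ι d * ι d * (δ * δ) * Y') ≤ η)
  (hF : 1q ≤ ι F * (δ * δ * Y)) (hF' : 1q ≤ ι F * (δ * δ * Y')) where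
  E = Cover.ed Y δ Y+ zB F hF
  E' = Cover.ed Y' δ Y'+ zB F hF'
  module R1 = GridRows Y δ Y+ zB (suc F) d' E η η1 ht
  module R2 = GridRows Y' δ Y'+ zB (suc F) d' E' η η1 ht'
  module Ma = Master f Sb up sc sd d' (suc F) η η1 Y δ Y' δ Y+ zB Y'+ zB E E' ht ht'

  Ro : ℚ -> (Bool -> ℕ) -> Bool -> Set
  Ro zE Tt true = ∀ ks -> length ks ≡ d -> R1.AllK ks -> Ma.G1.RL (R1.dm ks) (Tt true) * Ma.G1.RL (R1.dm ks) (Tt true) ≤ zE * (1q + Y) ^ d * R1.qs ks
  Ro zE Tt false = ∀ ks -> length ks ≡ d -> R2.AllK ks -> Ma.G2.RL (R2.dm ks) (Tt false) * Ma.G2.RL (R2.dm ks) (Tt false) ≤ zE * (1q + Y') ^ d * R2.qs ks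

  private
   ks1 ks2 : ∀ {m} -> Vec (ℕ × ℕ) m -> List ℕ
   ks1 [] = []
   ks1 (κ ∷ sa) = fst κ ∷ ks1 sa
   ks2 [] = []
   ks2 (κ ∷ sa) = snd κ ∷ ks2 sa
   len1 : ∀ {m} (sa : Vec (ℕ × ℕ) m) -> length (ks1 sa) ≡ m
   len1 [] = refl
   len1 (κ ∷ sa) = ap suc (len1 sa)
   len2 : ∀ {m} (sa : Vec (ℕ × ℕ) m) -> length (ks2 sa) ≡ m
   len2 [] = refl
   len2 (κ ∷ sa) = ap suc (len2 sa)
   all1 : ∀ {m} (sa : Vec (ℕ × ℕ) m) -> Ma.AI sa -> R1.AllK (ks1 sa)
   all1 [] a = tt
   all1 (κ ∷ sa) ((x , y) , a) = x , all1 sa a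
   all2 : ∀ {m} (sa : Vec (ℕ × ℕ) m) -> Ma.AI sa -> R2.AllK (ks2 sa)
   all2 [] a = tt
   all2 (κ ∷ sa) ((x , y) , a) = y , all2 sa a
   dm1 : ∀ {m} (sa : Vec (ℕ × ℕ) m) -> Ma.idx1 sa ≡ R1.dm (ks1 sa)
   dm1 [] = refl
   dm1 (κ ∷ sa) = ap (d *' fst κ ∷_) (dm1 sa)
   dm2 : ∀ {m} (sa : Vec (ℕ × ℕ) m) -> Ma.idx2 sa ≡ R2.dm (ks2 sa)
   dm2 [] = refl
   dm2 (κ ∷ sa) = ap (d *' snd κ ∷_) (dm2 sa)
   qs1 : ∀ {m} (sa : Vec (ℕ × ℕ) m) -> Ma.qP sa true ≡ R1.qs (ks1 sa)
   qs1 [] = refl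
   qs1 (κ ∷ sa) = ap (Ma.qn κ true *_) (qs1 sa)
   qs2 : ∀ {m} (sa : Vec (ℕ × ℕ) m) -> Ma.qP sa false ≡ R2.qs (ks2 sa)
   qs2 [] = refl
   qs2 (κ ∷ sa) = ap (Ma.qn κ false *_) (qs2 sa)

  c1 c2 : ℚ
  c1 = q + p * u
  c2 = p + q * u'
  private
   one-plus : ∀ p q u -> 0q < q -> 1q + p * u * ig q ≡ (q + p * u) * ig q
   one-plus p q u q+ = trans (ap (_+ p * u * ig q) (sym (ic q+))) (l q (ig q) (p * u))
    where l = r3 (v0 :* v1 :+ v2 :* v1) ((v0 :+ v2) :* v1)
   u-iY : ∀ p q u -> 0q < p -> 0q < q -> (Y+ : 0q < p * u * ig q) -> ig (p * u * ig q) * u ≡ q * ig p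
   u-iY p q u p+ q+ Y+ = trans (ap (ig (p * u * ig q) *_) ue) (l (ig (p * u * ig q)) (q * ig p) (p * u * ig q) >> ap ((q * ig p) *_) (ic Y+) >> *-1ʳ (q * ig p))
    where
    l = r3 (v0 :* (v1 :* v2)) (v1 :* (v2 :* v0))
    l2 = r5 (v0 :* v1 :* (v2 :* v3 :* v4)) ((v0 :* v4) :* (v2 :* v1) :* v3)
    ue : u ≡ q * ig p * (p * u * ig q)
    ue = sym (l2 q (ig p) p u (ig q) >> ap₂ (\ a b -> a * b * u) (ic q+) (ic p+) >> ap (_* u) (*-1ˡ 1q) >> *-1ˡ u)
   iY iY' x y Θ K0 B0 : ℚ
   iY = ig Y
   iY' = ig Y'
   x = q * ig p
   y = p * ig q
   Θ = θ ^ s * zm ^ s'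
   Θ+ : 0q < Θ
   Θ+ = pos-* (po s θ+) (po s' zD)
   K0 = q ^ s * p ^ s'
   B0 = (K0 * ig Θ) ^ d
   K0+ : 0q < K0
   K0+ = pos-* (po s q+) (po s' p+)
   B0+ : 0q < B0
   B0+ = po d (pos-* K0+ (io Θ+))
   xy : x * y ≡ 1q
   xy = trans (l q (ig p) p (ig q)) (ap₂ _*_ (ic q+) (ic p+))
    where l = r4 (v0 :* v1 :* (v2 :* v3)) (v0 :* v3 :* (v2 :* v1))
   xyk : ∀ k -> x ^ k * y ^ k ≡ 1q
   xyk k = trans (sym (zi x y k)) (ap (_^ k) xy >> zC k)

   -- Once the tilt is removed from the factors 1/Y and 1/Y', the odds (q/p)^L (p/q)^L' remain. They
   -- are the same for all matchings: L = L' if crossing is favoured, and otherwise L - L' = d(s -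
   -- s').
   balU : ∀ (ms : Vec (Vec (Fin n) n) d) -> AV Is ms -> ∀ b -> up ≡ b -> x ^ LL true (lg ms) * y ^ LL false (lg ms) ≡ B0
   balU ms a true e = trans (ap₂ (\ i j -> x ^ i * y ^ j) (LL-up e ms a true) (LL-up e ms a false)) (xyk (XX ms) >> sym (ap (_^ d) (ap (_* ig Θ) ke >> ic Θ+) >> zC d))
    where
    ke : K0 ≡ Θ
    ke = ap (\ b -> pj b θ zm ^ s * pj b zm θ ^ s') e
   balU ms a false e = trans main (sym B0e)
    where
    L = LL true (lg ms)
    L' = LL false (lg ms)
    Te : Θ ≡ p ^ s * q ^ s'
    Te = ap (\ b -> pj b zm θ ^ s * pj b θ zm ^ s') (sym e)
    Ke : K0 ≡ x ^ s * y ^ s' * Θ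
    Ke = sym (ap (x ^ s * y ^ s' *_) Te >> l (x ^ s) (y ^ s') (p ^ s) (q ^ s') >> ap₂ _*_ (sym (zi x p s) >> ap (_^ s) (xp q p p+)) (sym (zi y q s') >> ap (_^ s') (xp p q q+)))
     where
     l = r4 (v0 :* v1 :* (v2 :* v3)) (v0 :* v2 :* (v1 :* v3))
     l3 = r3 (v0 :* v1 :* v2) (v0 :* (v2 :* v1))
     xp : ∀ q p -> 0q < p -> q * ig p * p ≡ q
     xp q p p+ = trans (l3 q (ig p) p) (ap (q *_) (ic p+) >> *-1ʳ q)
    B0e : B0 ≡ (x ^ s * y ^ s') ^ d
    B0e = ap (_^ d) (ap (_* ig Θ) Ke >> *-as (x ^ s * y ^ s') Θ (ig Θ) >> ap (x ^ s * y ^ s' *_) (ic Θ+) >> *-1ʳ (x ^ s * y ^ s'))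
    bal : L +' s' *' d ≡ L' +' s *' d
    bal = trans (ap (L ℕ.+_) (sym (LL-low e ms a false))) (sh L L' (XX ms) >> ap (L' ℕ.+_) (LL-low e ms a true))
     where
     open import Data.Nat.Tactic.RingSolver using () renaming (solve-∀ to solveℕ)
     sh : ∀ a b c -> a +' (b +' c) ≡ b +' (a +' c)
     sh = solveℕ
    main : x ^ L * y ^ L' ≡ (x ^ s * y ^ s') ^ d
    main = trans (sym (*-1ʳ (x ^ L * y ^ L')) >> ap (x ^ L * y ^ L' *_) (sym (xyk (s' *' d))) >> l (x ^ L) (y ^ L') (x ^ (s' *' d)) (y ^ (s' *' d)))
     (trans (ap (\ z -> z * y ^ L' * y ^ (s' *' d)) (sym (zr x L (s' *' d)) >> ap (x ^_) bal >> zr x L' (s *' d)))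
     (l2 (x ^ L') (x ^ (s *' d)) (y ^ L') (y ^ (s' *' d)) >> ap (_* (x ^ (s *' d) * y ^ (s' *' d))) (xyk L') >> *-1ˡ (x ^ (s *' d) * y ^ (s' *' d)) >> ap₂ _*_ (zp x s d) (zp y s' d) >> sym (zi (x ^ s) (y ^ s') d)))
     where
     l = r4 (v0 :* v1 :* (v2 :* v3)) (v0 :* v2 :* v1 :* v3)
     l2 = r4 (v0 :* v1 :* v2 :* v3) (v0 :* v2 :* (v1 :* v3))

   enP≡ : ∀ {k} (cs : Vec (Vec Bool n) k) -> Ma.enP cs ≡ iY ^ LL true cs * iY' ^ LL false cs
   enP≡ [] = refl
   enP≡ (c ∷ cs) = trans (ap₂ _*_ (pV sb (lookup c) Ma.en >> ap₂ (\ a b -> iY ^ kF sb (lookup c) true true * a * (iY' ^ kF sb (lookup c) false true * b)) (zC (kF sb (lookup c) true false)) (zC (kF sb (lookup c) false false))) (enP≡ cs))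
    (l (iY ^ kF sb (lookup c) true true) (iY' ^ kF sb (lookup c) false true) (iY ^ LL true cs) (iY' ^ LL false cs) >> ap₂ _*_ (sym (zr iY (kF sb (lookup c) true true) (LL true cs))) (sym (zr iY' (kF sb (lookup c) false true) (LL false cs))))
    where l = r4 (v0 :* :1 :* (v1 :* :1) :* (v2 :* v3)) (v0 :* v2 :* (v1 :* v3))

   colc≡ : ∀ {k} i (cs : Vec (Vec Bool n) k) -> Ma.colc i cs ≡ rowc i cs
   colc≡ i [] = refl
   colc≡ i (c ∷ cs) = ap ((if lookup c i then 1 else 0) ℕ.+_) (colc≡ i cs)

  Gc : ℚ
  Gc = (ι (suc n) ^ 4) ^ d * ((ι (suc (suc F)) * ι (suc (suc F))) ^ d * (ι (suc (suc F)) * ι (suc (suc F))) ^ d)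

  module Conclude (zE : ℚ) (pκ : 0q ≤ zE) (Tt : Bool -> ℕ) (rows : ∀ b -> Ro zE Tt b) (W : ℚ) (W+ : 0q < W)
   (P : Vec (Vec (Fin n) n) d -> Bool)
   (hrow : ∀ ms -> AV Is ms -> P ms ≡ true -> ∀ i -> Tt (sb i) <= rowc i (lg ms))
   (hen : ∀ ms -> AV Is ms -> P ms ≡ true -> W ≤ u ^ LL true (lg ms) * u' ^ LL false (lg ms)) where
   bh : ℚ
   bh = S (\ ms -> 𝟙 (P ms)) (vecsOver PM d)
   private
    BE : ℚ
    BE = B0 * ig W
    pBE : 0q ≤ BE
    pBE = nc (qa B0+) (ie W+)
    R : Bool -> ℚ
    R true = zE * (1q + Y) ^ d
    R false = zE * (1q + Y') ^ d
    pR : ∀ b -> 0q ≤ R b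
    pR true = nc pκ (ng d (nh ze (qa Y+)))
    pR false = nc pκ (ng d (nh ze (qa Y'+)))
    rowsB : Vec (Vec Bool n) d -> Bool
    rowsB cs = allB (\ i -> ⌊ Tt (sb i) ℕ.≤? Ma.colc i cs ⌋) (allFin n)
    Ev : Vec (Vec Bool n) d -> Bool
    Ev cs = rowsB cs ∧ ⌊ Ma.enP cs ℚ.≤? BE ⌋
    ∧-l : ∀ {a b} -> (a ∧ b) ≡ true -> a ≡ true
    ∧-l {true} e = refl
    ∧-r : ∀ {a b} -> (a ∧ b) ≡ true -> b ≡ true
    ∧-r {true} e = e
    tg : ∀ {A : Set} (x : Dec A) -> ⌊ x ⌋ ≡ true -> A
    tg (yes a) e = a
    tc : ∀ {A : Set} (x : Dec A) -> A -> ⌊ x ⌋ ≡ true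
    tc (yes a) _ = refl
    tc (no na) a = ⊥-elim (na a)
    hR : ∀ (sa : Vec Ma.Ix d) -> Ma.AI sa -> ∀ b -> Ma.RLs sa b (Tt b) * Ma.RLs sa b (Tt b) ≤ R b * Ma.qP sa b
    hR sa a true = EQ (ap (\ l -> Ma.G1.RL l (Tt true) * Ma.G1.RL l (Tt true)) (dm1 sa)) ~ rows true (ks1 sa) (len1 sa) (all1 sa a) ~ EQ (ap (R true *_) (sym (qs1 sa)))
    hR sa a false = EQ (ap (\ l -> Ma.G2.RL l (Tt false) * Ma.G2.RL l (Tt false)) (dm2 sa)) ~ rows false (ks2 sa) (len2 sa) (all2 sa a) ~ EQ (ap (R false *_) (sym (qs2 sa)))
    module Evt = Ma.Event Ev Tt BE pBE R pR
     (\ cs e i -> tg (Tt (sb i) ℕ.≤? Ma.colc i cs) (ao (\ i -> ⌊ Tt (sb i) ℕ.≤? Ma.colc i cs ⌋) (allFin n) (∧-l e) i (∈P.∈-allFin i)))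
     (\ cs e -> tg (Ma.enP cs ℚ.≤? BE) (∧-r {rowsB cs} e)) hR
    en-ok : ∀ ms -> AV Is ms -> P ms ≡ true -> Ma.enP (lg ms) ≤ BE
    en-ok ms a e = ≤-div W+ (EQ (ap (_* W) (enP≡ (lg ms))) ~ za (nc (ng L (ie Y+)) (ng L' (ie Y'+))) (hen ms a e)
     ~ EQ (l (iY ^ L) (iY' ^ L') (u ^ L) (u' ^ L') >> ap₂ _*_ (sym (zi iY u L) >> ap (_^ L) (u-iY p q u p+ q+ Y+)) (sym (zi iY' u' L') >> ap (_^ L') (u-iY q p u' q+ p+ Y'+)) >> balU ms a up refl))
     where
     L = LL true (lg ms)
     L' = LL false (lg ms)
     l = r4 (v0 :* v1 :* (v2 :* v3)) (v0 :* v2 :* (v1 :* v3))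
    ev-ok : ∀ ms -> ms ∈ vecsOver PM d -> ∀ b -> P ms ≡ b -> 𝟙 b ≤ 𝟙 (Ev (lg ms))
    ev-ok ms q false e = nk (Ev (lg ms))
    ev-ok ms q true e = EQ (ap 𝟙 (sym (ap₂ _∧_ (ac (\ i -> ⌊ Tt (sb i) ℕ.≤? Ma.colc i (lg ms) ⌋) (allFin n) (\ i _ -> tc (Tt (sb i) ℕ.≤? Ma.colc i (lg ms)) (subst (Tt (sb i) ℕ.≤_) (sym (colc≡ i (lg ms))) (hrow ms a e i)))) (tc (Ma.enP (lg ms) ℚ.≤? BE) (en-ok ms a e)))))
     where a = Ae PM d ms q (\ m r -> PM-IsPM n m r)
    bad≤ : bh ≤ Evt.events
    bad≤ = Sm (vecsOver PM d) (\ ms q -> ev-ok ms q (P ms) refl)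
    bm : 0q ≤ bh
    bm = S-nn (vecsOver PM d) (\ ms -> nk (P ms))
    K2 : ℚ
    K2 = ι (suc (suc F)) * ι (suc (suc F))
    GPlen : ι (length Ma.GP) ≤ K2
    GPlen = EQ (sym (o Ma.GP) >> So (\ _ -> 1q) (\ k -> map (k ,_) (upTo (suc Ma.G2.K))) (upTo (suc Ma.G1.K)) >> Sc (upTo (suc Ma.G1.K)) (\ k _ -> trans (S-map (\ _ -> 1q) (k ,_) (upTo (suc Ma.G2.K))) (o (upTo (suc Ma.G2.K)) >> ap ι (LP.length-upTo (suc Ma.G2.K)))) >> Sn (ι (suc Ma.G2.K)) (upTo (suc Ma.G1.K)) >> ap (\ k -> ι k * ι (suc Ma.G2.K)) (LP.length-upTo (suc Ma.G1.K)))
     ~ ma (zd (suc Ma.G1.K)) (zd (suc Ma.G2.K)) (mn (ℕ.s≤s (≤≤ (ℕD.m/n≤m Ma.G1.J d) Ma.G1.J≤))) (mn (ℕ.s≤s (≤≤ (ℕD.m/n≤m Ma.G2.J d) Ma.G2.J≤)))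
     where
     o : ∀ {A : Set} (ys : List A) -> S (\ _ -> 1q) ys ≡ ι (length ys)
     o ys = trans (Sn 1q ys) (*-1ʳ (ι (length ys)))
    Glen : ι (length (vecsOver Ma.GP d)) ≤ K2 ^ d
    Glen = EQ (lh Ma.GP d) ~ mc d (zd (length Ma.GP)) GPlen
    MM-nn : 0q ≤ Evt.MM
    MM-nn = nc (nc (ng d Ma.C0-nn) pBE) (nc (ng s (pR true)) (ng s' (pR false)))
    Rt : R true ^ s ≡ zE ^ s * (c1 ^ (d *' s) * ig q ^ (d *' s))
    Rt = trans (zi zE ((1q + Y) ^ d) s) (ap (zE ^ s *_) (sym (zp (1q + Y) d s) >> ap (_^ (d *' s)) (one-plus p q u q+) >> zi c1 (ig q) (d *' s)))
    Rf : R false ^ s' ≡ zE ^ s' * (c2 ^ (d *' s') * ig p ^ (d *' s'))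
    Rf = trans (zi zE ((1q + Y') ^ d) s') (ap (zE ^ s' *_) (sym (zp (1q + Y') d s') >> ap (_^ (d *' s')) (one-plus q p u' p+) >> zi c2 (ig p) (d *' s')))
    K0c : K0 ^ d * (ig q ^ (d *' s) * ig p ^ (d *' s')) ≡ 1q
    K0c = trans (ap (_* (ig q ^ (d *' s) * ig p ^ (d *' s'))) (zi (q ^ s) (p ^ s') d >> ap₂ _*_ (sym (zp q s d) >> ap (q ^_) (*-cmℕ s d)) (sym (zp p s' d) >> ap (p ^_) (*-cmℕ s' d))))
     (l (q ^ (d *' s)) (p ^ (d *' s')) (ig q ^ (d *' s)) (ig p ^ (d *' s')) >> ap₂ _*_ (z (d *' s) q q+) (z (d *' s') p p+))
     where
     l = r4 (v0 :* v1 :* (v2 :* v3)) (v0 :* v2 :* (v1 :* v3))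
     z : ∀ k q -> 0q < q -> q ^ k * ig q ^ k ≡ 1q
     z k q q+ = trans (sym (zi q (ig q) k)) (ap (_^ k) (ic q+) >> zC k)
    N4 tt' e1 : ℚ
    N4 = ι (suc n) ^ 4
    tt' = tot * tot
    e1 = (1q + η) ^ n
    C0d : Ma.C0 ^ d * B0 ≡ N4 ^ d * (tot ^ d * tot ^ d) * ((1q + η) ^ d) ^ n * K0 ^ d
    C0d = trans (sym (zi Ma.C0 (K0 * ig Θ) d)) (trans (ap (_^ d) (l N4 tt' Θ e1 K0 (ig Θ) >> ap (N4 * tt' * e1 * K0 *_) (ic Θ+) >> *-1ʳ (N4 * tt' * e1 * K0)))
     (zi (N4 * tt' * e1) K0 d >> ap (_* K0 ^ d) (zi (N4 * tt') e1 d >> ap₂ _*_ (zi N4 tt' d >> ap (N4 ^ d *_) (zi tot tot d)) (sym (zp (1q + η) n d) >> ap ((1q + η) ^_) (*-cmℕ n d) >> zp (1q + η) d n))))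
     where l = r6 (v0 :* v1 :* v2 :* v3 :* (v4 :* v5)) (v0 :* v1 :* v3 :* v4 :* (v2 :* v5))

   -- Markov's inequality for the tilted measure: W is the least tilt on the event, `c1` and `c2`
   -- are the moment generating functions of a single label on either side, and `zE` is what the
   -- thresholds gain per row. The square of the event matches the fact that L and L' count each
   -- favoured edge at both of its ends.
   tilted-bound : bh * bh * W ≤ Gc * (tot ^ d * tot ^ d) * (zE * (1q + η) ^ d) ^ n * (c1 ^ (d *' s) * c2 ^ (d *' s'))
   tilted-bound = zb (qa W+) (ma bm bm bad≤ bad≤ ~ Evt.master ~ za MM-nn (ma (zd (length (vecsOver Ma.GP d))) (zd (length (vecsOver Ma.GP d))) Glen Glen))
    ~ EQ (trans (ap₂ (\ a b -> Ma.C0 ^ d * (B0 * ig W) * (a * b) * (K2 ^ d * K2 ^ d) * W) Rt Rf)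
     (trans (l (Ma.C0 ^ d) B0 (ig W) (zE ^ s) (c1 ^ (d *' s)) (ig q ^ (d *' s)) (zE ^ s') (c2 ^ (d *' s')) (ig p ^ (d *' s')) (K2 ^ d * K2 ^ d) W)
     (trans (ap₂ (\ a b -> a * b * (zE ^ s * zE ^ s') * (ig q ^ (d *' s) * ig p ^ (d *' s')) * (c1 ^ (d *' s) * c2 ^ (d *' s')) * (K2 ^ d * K2 ^ d)) C0d (ic W+))
     (trans (l2 (N4 ^ d) (tot ^ d * tot ^ d) (((1q + η) ^ d) ^ n) (K0 ^ d) (zE ^ s * zE ^ s') (ig q ^ (d *' s) * ig p ^ (d *' s')) (c1 ^ (d *' s) * c2 ^ (d *' s')) (K2 ^ d * K2 ^ d))
     (trans (ap₂ (\ a b -> N4 ^ d * (K2 ^ d * K2 ^ d) * (tot ^ d * tot ^ d) * (a * ((1q + η) ^ d) ^ n) * (c1 ^ (d *' s) * c2 ^ (d *' s')) * b) (sym (zr zE s s') >> ap (zE ^_) n≡) K0c)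
     (trans (*-1ʳ (N4 ^ d * (K2 ^ d * K2 ^ d) * (tot ^ d * tot ^ d) * (zE ^ n * ((1q + η) ^ d) ^ n) * (c1 ^ (d *' s) * c2 ^ (d *' s'))))
      (ap (\ z -> Gc * (tot ^ d * tot ^ d) * z * (c1 ^ (d *' s) * c2 ^ (d *' s'))) (sym (zi zE ((1q + η) ^ d) n)))))))))
    where
    l = r11 (v0 :* (v1 :* v2) :* (v3 :* (v4 :* v5) :* (v6 :* (v7 :* v8))) :* v9 :* v10) ((v0 :* v1) :* (v10 :* v2) :* (v3 :* v6) :* (v5 :* v8) :* (v4 :* v7) :* v9)
    l2 = r8 (v0 :* v1 :* v2 :* v3 :* :1 :* v4 :* v5 :* v6 :* v7) (v0 :* v7 :* v1 :* (v4 :* v2) :* v6 :* (v3 :* v5))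

-- Integer rounding and a discrete exponential scale.

zA : ∀ y -> y ≤ ι ℤ.∣ ↥ y ∣
zA y@(ℚ.mkℚ _ _ _) = ℚP.toℚᵘ-cancel-≤ (ℚᵘP.≤-respʳ-≃ (ℚᵘP.≃-sym (ta ℤ.∣ ↥ y ∣)) (ℚᵘ.*≤* (subst₂ ℤ._≤_ (sym (ℤP.*-identityʳ (↥ y))) refl (ℤP.≤-trans (ix (↥ y)) (subst (ℤ.+ ℤ.∣ ↥ y ∣ ℤ.≤_) (ℤP.pos-* ℤ.∣ ↥ y ∣ (ℚ.denominatorℕ y)) (ℤ.+≤+ (ℕP.m≤m*n ℤ.∣ ↥ y ∣ (ℚ.denominatorℕ y))))))))
 where
 ix : ∀ i -> i ℤ.≤ ℤ.+ ℤ.∣ i ∣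
 ix (ℤ.+ n) = ℤP.≤-refl
 ix (ℤ.-[1+ n ]) = ℤ.-≤+

ceil : ∀ y -> 0q ≤ y -> ∃[ B ] (y ≤ ι B × ι B ≤ y + 1q)
ceil y py = go ℤ.∣ ↥ y ∣ (zA y)
 where
 go : ∀ N -> y ≤ ι N -> ∃[ B ] (y ≤ ι B × ι B ≤ y + 1q)
 go zero h = 0 , h , (EQ ι0 ~ nh py ze)
 go (suc N) h = ga (y ℚ.≤? ι N)
  where
  ga : Dec (y ≤ ι N) -> ∃[ B ] (y ≤ ι B × ι B ≤ y + 1q)
  ga (yes h') = go N h'
  ga (no h') = suc N , h , (EQ (su N >> +-cm 1q (ι N)) ~ +-≤ˡ 1q (qa (≰⇒> h')))

floor : ∀ y -> 0q ≤ y -> ∃[ B ] (ι B ≤ y × y ≤ ι B + 1q)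
floor y py = go ℤ.∣ ↥ y ∣ (zA y ~ ba ze refl)
 where
 go : ∀ N -> y ≤ ι N + 1q -> ∃[ B ] (ι B ≤ y × y ≤ ι B + 1q)
 go zero h = 0 , (EQ ι0 ~ py) , h
 go (suc N) h = ga (ι (suc N) ℚ.≤? y)
  where
  ga : Dec (ι (suc N) ≤ y) -> ∃[ B ] (ι B ≤ y × y ≤ ι B + 1q)
  ga (yes h') = suc N , h' , h
  ga (no h') = go N (qa (≰⇒> h') ~ EQ (su N >> +-cm 1q (ι N)))

-- Serves as integer square root and integer logarithm: applied to a monotone P it locates the last
-- index that satisfies it.
lr : (P : ℕ -> Set) -> (∀ k -> Dec (P k)) -> P 0 -> ∀ N -> ¬ P N -> ∃[ k ] (P k × ¬ P (suc k) × k ≺ N)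
lr P dec p0 zero np = ⊥-elim (np p0)
lr P dec p0 (suc N) np = go (dec N)
 where
 go : Dec (P N) -> ∃[ k ] (P k × ¬ P (suc k) × k ≺ suc N)
 go (yes p) = N , p , np , ≤r
 go (no p) = let (k , a , b , c) = lr P dec p0 N p in k , a , b , ≤⇒≤s c

-- a consequence of ln (1 + x) ≤ x and w / (1 + w) ≤ ln (1 + w)
p8 : ∀ {x w} A B -> 0q ≤ x -> 0q ≤ w -> ι A * x * (1q + w) ≤ ι B * w -> (1q + x) ^ A ≤ (1q + w) ^ B
p8 {x} {w} zero B px pw h = zt B (ba pw refl)
p8 {x} {w} A@(suc A') B px pw h = ca {(1q + x) ^ A} {(1q + w) ^ B} {k ^ B} (po B (io w+)) (ca {(1q + x) ^ A * k ^ B} {(1q + w) ^ B * k ^ B} {ι S' ^ S'} (po S' (zj (A' +' B)))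
 (amgm {1q + x} {k} A B (nh ze px) (ie w+) M+ ~ mc S' (qa M+) Mle ~ EQ (sym (*-1ˡ (ι S' ^ S')) >> ap (_* ι S' ^ S') (sym (sym (zi (1q + w) k B) >> ap (_^ B) (ic w+) >> zC B)))))
 where
 w+ : 0q < 1q + w
 w+ = <-≤ (>0 1q) (ba pw refl)
 k = ig (1q + w)
 S' = A +' B
 M = ι A * (1q + x) + ι B * k
 M+ : 0q < M
 M+ = <-≤ (zj A') (ba (nh (nc (zd A) px) (nc (zd B) (ie w+))) (l (ι A) x (ι B * k)))
  where l = r3 (v0 :* (:1 :+ v1) :+ v2) (v0 :+ (v0 :* v1 :+ v2))
 Axk : ι A * x ≤ ι B * w * k
 Axk = ≤-div w+ h
 Mle : M ≤ ι S'
 Mle = EQ (l (ι A) x (ι B * k)) ~ +-≤ʳ (ι A) (+-≤ˡ (ι B * k) Axk) ~ EQ (ap (ι A +_) (l2 (ι B) w k >> ap (ι B *_) (ic w+) >> *-1ʳ (ι B)) >> sym (zq A B))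
  where
  l = r3 (v0 :* (:1 :+ v1) :+ v2) (v0 :+ (v0 :* v1 :+ v2))
  l2 = r3 (v0 :* v1 :* v2 :+ v0 :* v2) (v0 :* ((:1 :+ v1) :* v2))

-- g stands for exp(1/M). All tilts and exponents are powers of g, so comparing exponentials comes
-- down to comparing natural numbers.
module Lattice (M' : ℕ) where
 M : ℕ
 M = suc M'
 x g : ℚ
 x = ig (ι M)
 g = 1q + x
 x+ : 0q < x
 x+ = io (zj M')
 px : 0q ≤ x
 px = qa x+
 x≤1 : x ≤ 1q
 x≤1 = EQ (sym (*-1ˡ x)) ~ zb px (zx M') ~ EQ (ic (zj M'))
 1≤g : 1q ≤ g
 1≤g = ba px refl
 g+ : 0q < g
 g+ = <-≤ (>0 1q) 1≤g
 pg : 0q ≤ g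
 pg = qa g+

 g-lower : ∀ j -> 1q + ι j * x ≤ g ^ j
 g-lower j = bo j pg

 g-upper : ∀ j -> g ^ j * (1q - ι j * x) ≤ 1q
 g-upper j = za (ng j pg) (EQ (l (ι j) x) ~ bo j (df x≤1)) ~ EQ (sym (zi g (1q + - x) j)) ~ zy j (nc pg (df x≤1)) (ba (nc px px) (l2 x))
  where
  l = r2 (:1 :- v0 :* v1) (:1 :+ v0 :* (:- v1))
  l2 = r1 :1 ((:1 :+ v0) :* (:1 :+ :- v0) :+ v0 :* v0)

 z-bound : ∀ j {c t} -> ι j * x ≤ t -> t < 1q -> 0q ≤ c -> 1q ≤ c * (1q - t) -> g ^ j ≤ 1q + c * (ι j * x)
 z-bound j {c} {t} jt t1 pc hc = ca {g ^ j} {1q + c * y} {1q - y} y+ (g-upper j ~ ba (nc (nc (zd j) px) (df (hc ~ za pc (+-≤ʳ 1q (neg≤ jt))))) (l c y))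
  where
  y = ι j * x
  y+ : 0q < 1q - y
  y+ = <-≤ (subst (_< 1q - t) (+-inv t) (ℚP.+-monoˡ-< (- t) t1)) (+-≤ʳ 1q (neg≤ jt))
  l = r2 ((:1 :+ v0 :* v1) :* (:1 :- v1)) (:1 :+ v1 :* (v0 :* (:1 :- v1) :- :1))

 -- the discrete cumulant bound  ln (q + p eᵗ) ≤ p t + p q c t² / 2
 module Cumulant (p q : ℚ) (pp : 0q ≤ p) (pq' : 0q ≤ q) (p+q : p + q ≡ 1q) (c : ℚ) (pc : 0q ≤ c) where
  zF : ℚ
  zF = (1 // 2) * (p * q * c) * (x * x)
  pβ : 0q ≤ zF
  pβ = nc (nc {1 // 2} by (nc (nc pp pq') pc)) (nc px px)
  h : ℕ -> ℚ
  h j = 1q + p * x + zF * ι j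
  h+ : ∀ j -> 1q ≤ h j
  h+ j = ba (nh (nc pp px) (nc pβ (zd j))) (+-as 1q (p * x) (zF * ι j))

  cA : ∀ k -> (∀ j -> j <= k -> g ^ j ≤ 1q + c * (ι j * x)) -> q + p * g ^ k ≤ h k ^ k
  cA zero hz = EQ (l p q >> p+q)
   where l = r2 (v1 :+ v0 :* :1) (v0 :+ v1)
  cA (suc j) hz = step1 ~ ma (nh pq' (nc pp (ng j pg))) (ze ~ B1) (cA j (\ i le -> hz i (≤⇒≤s le))) (≤-refl {B}) ~ step2
   where
   z = g ^ j - 1q
   B = 1q + p * x + (zF + zF) * ι j
   B1 : 1q ≤ B
   B1 = ba (nh (nc pp px) (nc (nh pβ pβ) (zd j))) (+-as 1q (p * x) ((zF + zF) * ι j))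
   zc : z ≤ c * (ι j * x)
   zc = +-≤ˡ (- 1q) (hz j (n≤sn j)) ~ EQ (l (c * (ι j * x)))
    where l = r1 (:1 :+ v0 :- :1) v0
   qe : q ≡ 1q - p
   qe = pT (+-cm q p >> p+q)
   F-nn : 0q ≤ q + p * g ^ j
   F-nn = nh pq' (nc pp (ng j pg))
   -- Discrete derivative of ln(q + p eᵗ): with z = eᵗ - 1 the tilted probability p(1 + z)/(1 + pz)
   -- is at most p + pqz, the difference being p²qz² over 1 + pz.
   mid : q + p * g ^ suc j ≤ (q + p * g ^ j) * (1q + x * (p + p * q * z))
   mid = ba (nc px (nc (nc (nc pp pp) pq') (sn z))) (ap (\ q -> (q + p * g ^ j) * (1q + x * (p + p * q * z))) qe >> l p (g ^ j) x >> ap (\ q -> q + p * ((1q + x) * g ^ j) + x * (p * p * q * (z * z))) (sym qe))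
    where l = r3 ((:1 :- v0 :+ v0 :* v1) :* (:1 :+ v2 :* (v0 :+ v0 :* (:1 :- v0) :* (v1 :- :1)))) (:1 :- v0 :+ v0 :* ((:1 :+ v2) :* v1) :+ v2 :* (v0 :* v0 :* (:1 :- v0) :* ((v1 :- :1) :* (v1 :- :1))))
   step1 : q + p * g ^ suc j ≤ (q + p * g ^ j) * B
   step1 = mid ~ za F-nn (+-≤ʳ 1q (za px (+-≤ʳ p (za (nc pp pq') zc))) ~ EQ (l p q c x (ι j)))
    where l = r5 (:1 :+ v3 :* (v0 :+ v0 :* v1 :* (v2 :* (v4 :* v3)))) (:1 :+ v0 :* v3 :+ (:½ :* (v0 :* v1 :* v2) :* (v3 :* v3) :+ :½ :* (v0 :* v1 :* v2) :* (v3 :* v3)) :* v4)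
   jM : ι j * h j + ι 1 * B ≤ ι (suc j) * h (suc j)
   jM = ba pβ (ap (\ i -> i * (1q + p * x + zF * i)) (su j) >> l (ι j) (1q + p * x) zF >> ap (\ i -> ι j * (1q + p * x + zF * ι j) + i * (1q + p * x + (zF + zF) * ι j) + zF) (sym ι1))
    where l = r3 ((:1 :+ v0) :* (v1 :+ v2 :* (:1 :+ v0))) (v0 :* (v1 :+ v2 :* v0) :+ :1 :* (v1 :+ (v2 :+ v2) :* v0) :+ v2)
   jM+ : 0q < ι j * h j + ι 1 * B
   jM+ = <-≤ (>0 1q) (B1 ~ ba (nc (zd j) (ze ~ h+ j)) (ap (\ i -> ι j * h j + i * B) ι1 >> l (ι j * h j) B))
    where l = r2 (v0 :+ :1 :* v1) (v1 :+ v0)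
   -- AM-GM merges j equal factors and the new factor B into `suc j` equal ones; `h` is chosen as
   -- their mean, rounded up by `zF`/(j + 1).
   step2 : h j ^ j * B ≤ h (suc j) ^ suc j
   step2 = ca {h j ^ j * B} {h (suc j) ^ suc j} {ι (suc j) ^ suc j} (po (suc j) (zj j))
    (EQ (ap₂ _*_ (ap (h j ^ j *_) (sym (*-1ʳ B))) (ap (\ i -> ι i ^ i) (+-cmℕ 1 j)))
     ~ amgm {h j} {B} j 1 (ze ~ h+ j) (ze ~ B1) jM+ ~ mc (j +' 1) (qa jM+) jM ~ EQ (ap ((ι (suc j) * h (suc j)) ^_) (+-cmℕ j 1) >> zi (ι (suc j)) (h (suc j)) (suc j) >> *-cm (ι (suc j) ^ suc j) (h (suc j) ^ suc j)))

  cw : ∀ k A B -> (∀ j -> j <= k -> g ^ j ≤ 1q + c * (ι j * x)) -> ι k * ι A * (p + (1 // 2) * (p * q * c) * (ι k * x)) * (1q + x) ≤ ι B -> (q + p * g ^ k) ^ A ≤ g ^ B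
  cw k A B hz hB = mc A (nh pq' (nc pp (ng k pg))) (cA k hz) ~ EQ (sym (zp (h k) k A) >> ap (_^ (k *' A)) (+-as 1q (p * x) (zF * ι k)))
   ~ p8 (k *' A) B (nh (nc pp px) (nc pβ (zd k))) px (EQ (ap (\ i -> i * (p * x + zF * ι k) * (1q + x)) (zn k A) >> l (ι k) (ι A) p q c x) ~ zb px hB)
   where l = r6 (v0 :* v1 :* (v2 :* v5 :+ :½ :* (v2 :* v3 :* v4) :* (v5 :* v5) :* v0) :* (:1 :+ v5)) (v0 :* v1 :* (v2 :+ :½ :* (v2 :* v3 :* v4) :* (v0 :* v5)) :* (:1 :+ v5) :* v5)

module Fractions (s s' n : ℕ) (sc : 1 <= s) (n≡ : s +' s' ≡ n) where
 n+ : 0q < ι n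
 n+ = <-≤ (zj 0) (mn (≤≤ sc (≤≤ (m≤m+n s s') (≤≡ n≡))))
 fc : ι s * ig (ι n) + ι s' * ig (ι n) ≡ 1q
 fc = trans (sym (ℚP.*-distribʳ-+ (ig (ι n)) (ι s) (ι s'))) (ap (_* ig (ι n)) (sym (zq s s') >> ap ι n≡) >> ic n+)
 fn : ∀ k -> ι k ≡ ι k * ig (ι n) * ι n
 fn k = sym (l (ι k) (ig (ι n)) (ι n) >> ap (ι k *_) (ic n+) >> *-1ʳ (ι k))
  where l = r3 (v0 :* v1 :* v2) (v0 :* (v2 :* v1))

pE : ∀ {a b} -> 0q ≤ b -> a + b ≡ 1q -> a ≤ 1q
pE pb e = ba pb (sym e)

1≤inv : ∀ {x} -> 0q < x -> x ≤ 1q -> 1q ≤ ig x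
1≤inv {x} x+ x1 = EQ (sym (ic x+)) ~ zb (ie x+) x1 ~ EQ (*-1ˡ (ig x))

il : ∀ {x N} -> 0q < x -> 1q ≤ N * x -> ig x ≤ N
il {x} {N} x+ h = EQ (sym (*-1ˡ (ig x))) ~ di x+ h

odds-bounds : ∀ {p q u N} -> 0q < p -> 0q < q -> p + q ≡ 1q -> 1q ≤ u -> u ≤ 4 // 1 -> 1q ≤ N * p -> 1q ≤ N * q -> p * u * ig q ≤ (4 // 1) * N × 1q ≤ N * (p * u * ig q)
odds-bounds {p} {q} {u} {N} p+ q+ e u1 u4 hp hq =
 (ma (nc (qa p+) (ze ~ u1)) (ie q+) (ma (qa p+) (ze ~ u1) (pE (qa q+) e) u4) (il {q} {N} q+ hq) ~ EQ (ap (_* N) (*-1ˡ (4 // 1))))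
 , (hp ~ EQ (l (N * p)) ~ ma (nc (ze ~ hp) ze) ze (za (ze ~ hp) u1) (1≤inv q+ (pE (qa p+) (+-cm q p >> e))) ~ EQ (l2 N p u (ig q)))
 where
 l = r1 v0 (v0 :* :1 :* :1)
 l2 = r4 (v0 :* v1 :* v2 :* v3) (v0 :* (v1 :* v2 :* v3))

module Region (f : ℕ) (Sb : Vec Bool (f +' f)) (up : Bool)
 (sc : 1 <= cn (lookup Sb) true) (sd : 1 <= cn (lookup Sb) false) (d' F : ℕ) (η : ℚ) (η1 : η ≤ 1q) (δ : ℚ) (zB : 0q < δ) (M' k k' : ℕ) where
 open Lattice M' public
 open TiltBase f Sb up sc sd (g ^ k) (g ^ k') (po k g+) (po k' g+) public
 open Fractions s s' n sc n≡ using (fn)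
 d : ℕ
 d = suc d'
 t t' zo : ℚ
 t = ι k * x
 t' = ι k' * x
 zo = θ * zm

 module _ (N0 : ℚ) (hθ : 1q ≤ N0 * θ) (hθ' : 1q ≤ N0 * zm) (u4 : g ^ k ≤ 4 // 1) (u'4 : g ^ k' ≤ 4 // 1)
  (hδ : (160 // 1) * (ι d * ι d * (δ * δ) * N0) ≤ η) (hF : N0 ≤ ι F * (δ * δ)) where
  private
   hp : ∀ b -> 1q ≤ N0 * pj b zm θ × 1q ≤ N0 * pj b θ zm
   hp true = hθ' , hθ
   hp false = hθ , hθ'
   ob = odds-bounds {p} {q} {g ^ k} {N0} p+ q+ p+q (zt k 1≤g) u4 (fst (hp up)) (snd (hp up))
   ob' = odds-bounds {q} {p} {g ^ k'} {N0} q+ p+ (+-cm q p >> p+q) (zt k' 1≤g) u'4 (snd (hp up)) (fst (hp up))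
   D2 : ℚ
   D2 = ι d * ι d * (δ * δ)
   D2nn : 0q ≤ D2
   D2nn = nc (nc (zd d) (zd d)) (nc (qa zB) (qa zB))
   mkt : ∀ y -> y ≤ (4 // 1) * N0 -> (40 // 1) * (D2 * y) ≤ η
   mkt y h = za {c = 40 // 1} by (za D2nn h) ~ EQ (l D2 N0) ~ hδ
    where l = r2 ((40 :/ 1) :* (v0 :* (:4 :* v1))) ((160 :/ 1) :* (v0 :* v1))
   mkF : ∀ y -> 0q ≤ y -> 1q ≤ N0 * y -> 1q ≤ ι F * (δ * δ * y)
   mkF y py h = h ~ zb py hF ~ EQ (*-as (ι F) (δ * δ) y)
   h1 = mkt Y (fst ob)
   h1' = mkt Y' (fst ob')
   h2 = mkF Y (qa Y+) (snd ob)
   h2' = mkF Y' (qa Y'+) (snd ob')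
  Ro : ℚ -> (Bool -> ℕ) -> Bool -> Set
  Ro = Tilt.Bounded.Ro f Sb up sc sd d' F η η1 δ zB (g ^ k) (g ^ k') (po k g+) (po k' g+) h1 h1' h2 h2'
  Ra : ℚ -> ℕ -> Set
  Ra y T = ∀ v U -> 0q < v -> 0q < U -> ro (rep d (v , U)) T * ro (rep d (v , U)) T * (10000 // 1) ≤ (8464 // 1) * ((1q + y) * (v * v + U * U * ig y)) ^ d
  tl : ∀ (Ta : Bool -> ℕ) -> Ra Y (suc (Ta true)) -> Ra Y' (suc (Ta false)) -> ∀ b -> Ro (8464 // 10000) (\ b -> suc (Ta b)) b
  tl Ta rb rb' true = GridRows.tl Y δ Y+ zB (suc F) d' (Cover.ed Y δ Y+ zB F h2) η η1 h1 (Ta true) rb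
  tl Ta rb rb' false = GridRows.tl Y' δ Y'+ zB (suc F) d' (Cover.ed Y' δ Y'+ zB F h2') η η1 h1' (Ta false) rb'
  fo : ∀ b -> Ro 1q (\ _ -> 0) b
  fo true ks len a = GridRows.fo Y δ Y+ zB (suc F) d' (Cover.ed Y δ Y+ zB F h2) η η1 h1 ks ~ EQ (ap (_* GridRows.qs Y δ Y+ zB (suc F) d' (Cover.ed Y δ Y+ zB F h2) η η1 h1 ks) (ap ((1q + Y) ^_) len >> sym (*-1ˡ ((1q + Y) ^ d))))
  fo false ks len a = GridRows.fo Y' δ Y'+ zB (suc F) d' (Cover.ed Y' δ Y'+ zB F h2') η η1 h1' ks ~ EQ (ap (_* GridRows.qs Y' δ Y'+ zB (suc F) d' (Cover.ed Y' δ Y'+ zB F h2') η η1 h1' ks) (ap ((1q + Y') ^_) len >> sym (*-1ˡ ((1q + Y') ^ d))))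
  Gc : ℚ
  Gc = (ι (suc n) ^ 4) ^ d * ((ι (suc (suc F)) * ι (suc (suc F))) ^ d * (ι (suc (suc F)) * ι (suc (suc F))) ^ d)

  module Exponent (c : ℚ) (pc : 0q ≤ c) (kM : k <= M) (k'M : k' <= M)
   (hz : ∀ j -> j <= k -> g ^ j ≤ 1q + c * (ι j * x)) (hz' : ∀ j -> j <= k' -> g ^ j ≤ 1q + c * (ι j * x))
   (ct : c * t ≤ 2 // 1) (ct' : c * t' ≤ 2 // 1) (an : ℕ) (e : ℚ)
   (star : ι an * x + ι n * ((1 // 2) * (ι d * c * zo) * (θ * (t * t) + zm * (t' * t')) + (2 // 1) * (x * ι d) * (t + t')) ≤ ι n * (ι d * (e * zo) * (t + t')))
   (zE : ℚ) (pκ : 0q ≤ zE) (Tt : Bool -> ℕ) (rows : ∀ b -> Ro zE Tt b)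
   (P : Vec (Vec (Fin n) n) d -> Bool)
   (hrow : ∀ ms -> AV Is ms -> P ms ≡ true -> ∀ i -> Tt (sb i) <= rowc i (lg ms))
   (hL : ∀ ms -> AV Is ms -> P ms ≡ true -> ι d * (ι s * p + e * zo * ι n) - ι d ≤ ι (LL true (lg ms)))
   (hL' : ∀ ms -> AV Is ms -> P ms ≡ true -> ι d * (ι s' * q + e * zo * ι n) - ι d ≤ ι (LL false (lg ms))) where
   private
    -- 2 for the two ceilings B and B', and d · M for either label total, which may fall short of
    -- its target by d while its tilt is at most M lattice steps.
    c0 : ℕ
    c0 = 2 +' (d *' M +' d *' M)
    pp = qa p+
    pq = qa q+
    q+p = trans (+-cm q p) p+q
    c1 c2 : ℚ
    c1 = q + p * g ^ k
    c2 = p + q * g ^ k'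
    E1 E2 : ℚ
    E1 = ι k * ι (d *' s) * (p + (1 // 2) * (p * q * c) * t) * (1q + x)
    E2 = ι k' * ι (d *' s') * (q + (1 // 2) * (q * p * c) * t') * (1q + x)
    pt : 0q ≤ t
    pt = nc (zd k) px
    pt' : 0q ≤ t'
    pt' = nc (zd k') px
    Enn : ∀ k A p q t -> 0q ≤ p -> 0q ≤ q -> 0q ≤ t -> 0q ≤ ι k * ι A * (p + (1 // 2) * (p * q * c) * t) * (1q + x)
    Enn k A p q t pp pq pt = nc (nc (nc (zd k) (zd A)) (nh pp (nc (nc {1 // 2} by (nc (nc pp pq) pc)) pt))) pg
    C1 = ceil E1 (Enn k (d *' s) p q t pp pq pt)
    C2 = ceil E2 (Enn k' (d *' s') q p t' pq pp pt')
    B B' : ℕ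
    B = fst C1
    B' = fst C2
    cp1 : c1 ^ (d *' s) ≤ g ^ B
    cp1 = Cumulant.cw p q pp pq p+q c pc k (d *' s) B hz (fst (snd C1))
    cp2 : c2 ^ (d *' s') ≤ g ^ B'
    cp2 = Cumulant.cw q p pq pp q+p c pc k' (d *' s') B' hz' (fst (snd C2))
    V W : ℚ
    V = c1 ^ (d *' s) * c2 ^ (d *' s')
    V+ : 0q < V
    V+ = pos-* (po (d *' s) (<-≤ q+ (ba (nc pp (ng k pg)) refl))) (po (d *' s') (<-≤ p+ (ba (nc pq (ng k' pg)) refl)))
    W = g ^ an * V * ig (g ^ c0)
    W+ : 0q < W
    W+ = pos-* (pos-* (po an g+) V+) (io (po c0 g+))
    D = ι d
    N = ι n
    pD = zd d
    pN = zd n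
    side : ∀ k S θ p q t -> t ≡ ι k * x -> ι S ≡ θ * N -> 0q ≤ θ -> θ ≤ 1q -> 0q ≤ p -> p ≤ 1q -> 0q ≤ q -> q ≤ 1q -> p * q ≡ zo -> 0q ≤ t -> c * t ≤ 2 // 1 ->
     ι k * ι (d *' S) * (p + (1 // 2) * (p * q * c) * t) * (1q + x) * x ≤ t * (D * (ι S * p)) + N * ((1 // 2) * (D * c * zo) * (θ * (t * t)) + (2 // 1) * (x * D) * t)
    side k S θ p q t te Se pθ θ1 pp p1 pq q1 e pt ct = EQ (ap₂ (\ a b -> ι k * a * (p + (1 // 2) * (b * c) * t) * (1q + x) * x) (zn d S >> ap (D *_) Se) e >> l1 (ι k) (D * (θ * N)) p zo c t x >> ap (\ z -> z * (D * (θ * N)) * (p + (1 // 2) * (zo * c) * t) * (1q + x)) (sym te))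
     ~ EQ (l2 t D θ N p zo c x) ~ +-≤ʳ (t * (D * (θ * N * p)) + N * ((1 // 2) * (D * c * zo) * (θ * (t * t)))) big ~ EQ (l3 t D θ N p zo c x >> ap (\ z -> t * (D * (z * p)) + N * ((1 // 2) * (D * c * zo) * (θ * (t * t)) + (2 // 1) * (x * D) * t)) (sym Se))
     where
     l1 = r7 (v0 :* v1 :* (v2 :+ :½ :* (v3 :* v4) :* v5) :* (:1 :+ v6) :* v6) ((v0 :* v6) :* v1 :* (v2 :+ :½ :* (v3 :* v4) :* v5) :* (:1 :+ v6))
     l2 = r8 (v0 :* (v1 :* (v2 :* v3)) :* (v4 :+ :½ :* (v5 :* v6) :* v0) :* (:1 :+ v7)) (v0 :* (v1 :* (v2 :* v3 :* v4)) :+ v3 :* (:½ :* (v1 :* v6 :* v5) :* (v2 :* (v0 :* v0))) :+ (v4 :+ :½ :* (v5 :* (v6 :* v0))) :* v2 :* (v0 :* v1 :* v3 :* v7))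
     l3 = r8 (v0 :* (v1 :* (v2 :* v3 :* v4)) :+ v3 :* (:½ :* (v1 :* v6 :* v5) :* (v2 :* (v0 :* v0))) :+ :2 :* :1 :* (v0 :* v1 :* v3 :* v7)) (v0 :* (v1 :* (v2 :* v3 :* v4)) :+ v3 :* (:½ :* (v1 :* v6 :* v5) :* (v2 :* (v0 :* v0)) :+ :2 :* (v7 :* v1) :* v0))
     σnn : 0q ≤ zo
     σnn = nc (qa θ+) (qa zD)
     σ1 : zo ≤ 1q
     σ1 = EQ (sym e) ~ ma pp pq p1 q1
     P2 : p + (1 // 2) * (zo * (c * t)) ≤ 2 // 1
     P2 = mb p1 (za {c = 1 // 2} by (ma σnn (nc pc pt) σ1 ct)) ~ by {1q + (1 // 2) * (1q * (2 // 1))} {2 // 1}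
     big : (p + (1 // 2) * (zo * (c * t))) * θ * (t * D * N * x) ≤ (2 // 1) * 1q * (t * D * N * x)
     big = zb (nc (nc (nc pt pD) pN) px) (ma (nh pp (nc {1 // 2} by (nc σnn (nc pc pt)))) pθ P2 θ1)
    θ1 : θ ≤ 1q
    θ1 = pE (qa zD) fc
    θ'1 : zm ≤ 1q
    θ'1 = pE (qa θ+) (+-cm zm θ >> fc)
    p1 : p ≤ 1q
    p1 = pE pq p+q
    q1 : q ≤ 1q
    q1 = pE pp q+p
    t≤1 : ∀ k -> k <= M -> ι k * x ≤ 1q
    t≤1 k h = zb px (mn h) ~ EQ (ic (zj M'))
    exps : ∀ L L' -> D * (ι s * p + e * zo * N) - D ≤ ι L -> D * (ι s' * q + e * zo * N) - D ≤ ι L' -> an +' (B +' B') <= k *' L +' k' *' L' +' c0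
    exps L L' h h' = cf (ca {ι (an +' (B +' B'))} {ι (k *' L +' k' *' L' +' c0)} {x} x+
     (EQ (ap (_* x) (zq an (B +' B') >> ap (ι an +_) (zq B B')))
      ~ zb px (+-≤ʳ (ι an) (mb (snd (snd C1)) (snd (snd C2))))
      ~ EQ (l1 (ι an) E1 E2 x)
      ~ +-≤ʳ (ι an * x + (2 // 1) * x) (mb (side k s θ p q t refl (fn s) (qa θ+) θ1 pp p1 pq q1 pW pt ct) (side k' s' zm q p t' refl (fn s') (qa zD) θ'1 pq q1 pp p1 (*-cm q p >> pW) pt' ct'))
      ~ EQ (l2 (ι an * x) N x (t * (D * (ι s * p))) (t' * (D * (ι s' * q))) ((1 // 2) * (D * c * zo)) (θ * (t * t)) (zm * (t' * t')) ((2 // 1) * (x * D)) t t')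
      ~ +-≤ʳ ((2 // 1) * x + (t * (D * (ι s * p)) + t' * (D * (ι s' * q)))) star
      ~ EQ (l3 x t t' D (ι s * p) (ι s' * q) (e * zo) N)
      ~ +-≤ʳ ((2 // 1) * x) (mb (mb (za pt h) (za pt' h')) (mb (zb pD (t≤1 k kM)) (zb pD (t≤1 k' k'M))))
      ~ EQ (sym rhs)))
     where
     l1 = r4 ((v0 :+ (v1 :+ :1 :+ (v2 :+ :1))) :* v3) (v0 :* v3 :+ :2 :* v3 :+ (v1 :* v3 :+ v2 :* v3))
     l2 = r11 (v0 :+ :2 :* v2 :+ (v3 :+ v1 :* (v5 :* v6 :+ v8 :* v9) :+ (v4 :+ v1 :* (v5 :* v7 :+ v8 :* v10)))) (:2 :* v2 :+ (v3 :+ v4) :+ (v0 :+ v1 :* (v5 :* (v6 :+ v7) :+ v8 :* (v9 :+ v10))))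
     l3 = r8 (:2 :* v0 :+ (v1 :* (v3 :* v4) :+ v2 :* (v3 :* v5)) :+ v7 :* (v3 :* v6 :* (v1 :+ v2))) (:2 :* v0 :+ (v1 :* (v3 :* (v4 :+ v6 :* v7) :- v3) :+ v2 :* (v3 :* (v5 :+ v6 :* v7) :- v3) :+ (v1 :* v3 :+ v2 :* v3)))
     rhs : ι (k *' L +' k' *' L' +' c0) * x ≡ (2 // 1) * x + (t * ι L + t' * ι L' + (1q * D + 1q * D))
     rhs = trans (ap (_* x) (zq (k *' L +' k' *' L') c0 >> ap₂ _+_ (zq (k *' L) (k' *' L') >> ap₂ _+_ (zn k L) (zn k' L')) (zq 2 (d *' M +' d *' M) >> ap₂ _+_ (li 2) (zq (d *' M) (d *' M) >> ap₂ _+_ (zn d M) (zn d M)))))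
      (l (ι k) (ι L) (ι k') (ι L') D (ι M) x >> ap (\ z -> (2 // 1) * x + (t * ι L + t' * ι L' + (z * D + z * D))) (ic (zj M')))
      where l = r7 ((v0 :* v1 :+ v2 :* v3 :+ (:2 :+ (v4 :* v5 :+ v4 :* v5))) :* v6) (:2 :* v6 :+ (v0 :* v6 :* v1 :+ v2 :* v6 :* v3 :+ (v5 :* v6 :* v4 :+ v5 :* v6 :* v4)))
    hen : ∀ ms -> AV Is ms -> P ms ≡ true -> W ≤ (g ^ k) ^ LL true (lg ms) * (g ^ k') ^ LL false (lg ms)
    hen ms al pt = di (po c0 g+) (za (ng an pg) (ma (qa (po (d *' s) (<-≤ q+ (ba (nc pp (ng k pg)) refl)))) (qa (po (d *' s') (<-≤ p+ (ba (nc pq (ng k' pg)) refl)))) cp1 cp2)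
     ~ EQ (ap (g ^ an *_) (sym (zr g B B')) >> sym (zr g an (B +' B'))) ~ em 1≤g (exps L L' (hL ms al pt) (hL' ms al pt))
     ~ EQ (zr g (k *' L +' k' *' L') c0 >> ap (_* g ^ c0) (zr g (k *' L) (k' *' L') >> ap₂ _*_ (zp g k L) (zp g k' L'))))
     where
     L = LL true (lg ms)
     L' = LL false (lg ms)
    bh : ℚ
    bh = S (\ ms -> 𝟙 (P ms)) (vecsOver PM d)

   rg : bh * bh * g ^ an ≤ g ^ c0 * Gc * (tot ^ d * tot ^ d) * (zE * (1q + η) ^ d) ^ n
   rg = ca {bh * bh * g ^ an} {g ^ c0 * Gc * (tot ^ d * tot ^ d) * (zE * (1q + η) ^ d) ^ n} {V} V+
    (EQ (sym (*-1ʳ (bh * bh * g ^ an * V)) >> ap (bh * bh * g ^ an * V *_) (sym (ic (po c0 g+))) >> l1 (bh * bh) (g ^ an) V (g ^ c0) (ig (g ^ c0)))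
     ~ za (ng c0 pg) (Tilt.Bounded.Conclude.tilted-bound f Sb up sc sd d' F η η1 δ zB (g ^ k) (g ^ k') (po k g+) (po k' g+) h1 h1' h2 h2' zE pκ Tt rows W W+ P hrow hen) ~ EQ (l2 (g ^ c0) Gc (tot ^ d * tot ^ d) ((zE * (1q + η) ^ d) ^ n) V))
    where
    l1 = r5 (v0 :* v1 :* v2 :* (v3 :* v4)) (v3 :* (v0 :* (v1 :* v2 :* v4)))
    l2 = r5 (v0 :* (v1 :* v2 :* v3 :* v4)) (v0 :* v1 :* v2 :* v3 :* v4)

-- The exponent at central densities.

by< : ∀ {p q : ℚ} {t : True (p ℚ.<? q)} -> p < q
by< {t = t} = toWitness t

-- 1.595 lies just below 2√(2/π) = 1.59576.... The excess of `cg` over 1 pays for higher-order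
-- terms, and `ti` bounds quantities that vanish as d grows.
zf cg ti : ℚ
zf = 319 // 200
cg = 1000000001 // 1000000000
ti = 1 // 100000000000000000000

nm : ∀ {a b} -> a ≤ b -> - b ≤ - a
nm = neg≤

shift : ∀ {a b c} -> a + c ≤ b + c -> a ≤ b
shift {a} {b} {c} h = nj (df h ~ EQ (l a b c))
 where l = r3 (v1 :+ v2 :- (v0 :+ v2)) (v1 :- v0)

-- Unequal sides shift the row thresholds by about ± D e xc = ± D zo b. Tilting one side by a0 + b
-- and the other by a0 - b follows this shift, so that in every row the threshold lies about 1.3
-- standard deviations below the tilted mean. `Ch` bounds C = r `zk`/2, which is about 1/(2√(θ zm)).
module CentralScalars (D r Λ zk θ zm : ℚ) (θ+ : 0q < θ) (zD : 0q < zm) (sum1 : θ + zm ≡ 1q) (zw : θ ≤ zm)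
 (big : 1000000000000000000000000000000 // 1 ≤ r) (Dr : D ≤ r * r) (rD : (r - 1q) * (r - 1q) ≤ D)
 (λ+ : 0q < zk) (λΛ : zk * Λ ≡ 1q) (pΛ : 0q ≤ Λ) (Λlo : Λ * Λ ≤ D * (θ * zm)) (Λhi : D * (θ * zm) ≤ (Λ + (128 // 1)) * (Λ + (128 // 1)))
 (Ch : ℚ) (Chi≤ : Ch ≤ 13 // 10) (pChi : 0q ≤ Ch)
 (ww : (1000001 // 1000000) * (1000001 // 1000000) ≤ (2 // 1) * Ch * ((2 // 1) * Ch) * (θ * zm)) (σ-low : 2 // 13 ≤ θ * zm) where
 zo xc iσ ir e b a0 τ τ' : ℚ
 zo = θ * zm
 xc = (1 // 2) * (zm - θ)
 σ+ : 0q < zo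
 σ+ = pos-* θ+ zD
 iσ = ig zo
 ir = ig r
 e = zf * ir
 b = e * xc * iσ
 a0 = zg * zk
 τ = a0 + b
 τ' = a0 - b
 p6 = qa λ+
 r+ : 0q < r
 r+ = <-≤ (>0 (1000000000000000000000000000000 // 1)) big
 pr = qa r+
 pir = ie r+
 piσ = ie σ+
 pσ = qa σ+
 px̄ : 0q ≤ xc
 px̄ = nc {1 // 2} by (df zw)
 pe : 0q ≤ e
 pe = nc {zf} by pir
 pb : 0q ≤ b
 pb = nc (nc pe px̄) piσ
 pa0 : 0q ≤ a0
 pa0 = nc {zg} by p6
 x̄σ : xc * xc + zo ≡ 1 // 4
 x̄σ = trans (l θ zm) (ap (\ z -> (1 // 4) * (z * z)) sum1 >> refl)
  where l = r2 (:½ :* (v1 :- v0) :* (:½ :* (v1 :- v0)) :+ v0 :* v1) ((1 :/ 4) :* ((v0 :+ v1) :* (v0 :+ v1)))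
 x̄² : xc * xc ≡ (1 // 4) - zo
 x̄² = trans (l (xc * xc) zo) (ap (_- zo) x̄σ)
  where l = r2 v0 (v0 :+ v1 :- v1)
 pD : 0q ≤ D
 pD = sn (r - 1q) ~ rD
 r≥1 : 1q ≤ r
 r≥1 = by {1q} {1000000000000000000000000000000 // 1} ~ big
 σ≤¼ : zo ≤ 1 // 4
 σ≤¼ = ba (sn xc) (sym x̄σ >> +-cm (xc * xc) zo)
 σ≤1 : zo ≤ 1q
 σ≤1 = σ≤¼ ~ by
 iσ≤ : iσ ≤ 13 // 2
 iσ≤ = il {zo} {13 // 2} σ+ (by {1q} {(13 // 2) * (2 // 13)} ~ za {c = 13 // 2} by σ-low)

 rΛ : r ≤ (2 // 1) * Λ * Ch
 rΛ = shift {r} {(2 // 1) * Λ * Ch} {(1 // 1000000) * r} (nj (nh (df lin) (df slack) ~ EQ (l r Λ Ch)))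
  where
  μ = 1000001 // 1000000
  lin : (r - 1q) * μ ≤ (2 // 1) * Ch * (Λ + (128 // 1))
  lin = sr (nc (nc {2 // 1} by pChi) (nh pΛ (by {0q} {128 // 1}))) (EQ (l1 (r - 1q) μ) ~ za (sn (r - 1q)) ww ~ EQ (l2 (r - 1q) ((2 // 1) * Ch) zo) ~ za (sn ((2 // 1) * Ch)) (zb pσ rD ~ Λhi) ~ EQ (l3 ((2 // 1) * Ch) (Λ + (128 // 1))))
   where
   l1 = r2 (v0 :* v1 :* (v0 :* v1)) (v0 :* v0 :* (v1 :* v1))
   l2 = r3 (v0 :* v0 :* (v1 :* v1 :* v2)) (v1 :* v1 :* (v0 :* v0 :* v2))
   l3 = r2 (v0 :* v0 :* (v1 :* v1)) (v0 :* v1 :* (v0 :* v1))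
  slack : (256 // 1) * Ch + μ ≤ (1 // 1000000) * r
  slack = +-≤ˡ μ (za {c = 256 // 1} by Chi≤) ~ by {(256 // 1) * (13 // 10) + (1000001 // 1000000)} {(1 // 1000000) * (1000000000000000000000000000000 // 1)} ~ za {c = 1 // 1000000} by big
  l = r3 ((:2 :* v2 :* (v1 :+ (128 :/ 1)) :- (v0 :- :1) :* (1000001 :/ 1000000)) :+ ((1 :/ 1000000) :* v0 :- ((256 :/ 1) :* v2 :+ (1000001 :/ 1000000)))) ((:2 :* v1 :* v2 :+ (1 :/ 1000000) :* v0) :- (v0 :+ (1 :/ 1000000) :* v0))

 ir≤ : ir ≤ 1 // 1000000000000000000000000000000
 ir≤ = il {r} {1 // 1000000000000000000000000000000} r+ (by {1q} {(1 // 1000000000000000000000000000000) * (1000000000000000000000000000000 // 1)} ~ za {c = 1 // 1000000000000000000000000000000} by big)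
 e≤ : e ≤ ti
 e≤ = za {c = zf} by ir≤ ~ by {zf * (1 // 1000000000000000000000000000000)} {ti}
 rλ : r * zk ≤ 26 // 10
 rλ = zb p6 rΛ ~ EQ (l Λ Ch zk >> ap ((2 // 1) * Ch *_) λΛ >> *-1ʳ ((2 // 1) * Ch)) ~ za {c = 2 // 1} by Chi≤ ~ by {(2 // 1) * (13 // 10)} {26 // 10}
  where l = r3 (:2 :* v0 :* v1 :* v2) (:2 :* v1 :* (v2 :* v0))
 λ≤ : zk ≤ ti
 λ≤ = ca {zk} {ti} {r} r+ (EQ (*-cm zk r) ~ rλ ~ by {26 // 10} {ti * (1000000000000000000000000000000 // 1)} ~ za {c = ti} by big)

 Dσλ : D * zo * (zk * zk) ≤ (1q + (128 // 1) * zk) * (1q + (128 // 1) * zk)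
 Dσλ = zb (nc p6 p6) Λhi ~ EQ (l Λ zk >> ap (\ z -> (z + (128 // 1) * zk) * (z + (128 // 1) * zk)) λΛ)
  where l = r2 ((v0 :+ (128 :/ 1)) :* (v0 :+ (128 :/ 1)) :* (v1 :* v1)) ((v1 :* v0 :+ (128 :/ 1) :* v1) :* (v1 :* v0 :+ (128 :/ 1) :* v1))
 K≤ : (1q + (128 // 1) * zk) * (1q + (128 // 1) * zk) ≤ cg
 K≤ = ma nn nn h h ~ by {(1q + (128 // 1) * ti) * (1q + (128 // 1) * ti)} {cg}
  where
  h : 1q + (128 // 1) * zk ≤ 1q + (128 // 1) * ti
  h = +-≤ʳ 1q (za {c = 128 // 1} by λ≤)
  nn : 0q ≤ 1q + (128 // 1) * zk
  nn = nh ze (nc {128 // 1} by p6)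
 C : ℚ
 C = (1 // 2) * r * zk
 pC : 0q ≤ C
 pC = nc (nc {1 // 2} by pr) p6
 iσC : iσ ≤ r * r * (zk * zk)
 iσC = il {zo} {r * r * (zk * zk)} σ+ (EQ (sym (l zk Λ >> ap (\ z -> z * z) λΛ)) ~ zb (nc p6 p6) (Λlo ~ zb pσ Dr) ~ EQ (l2 (r * r) zo (zk * zk)))
  where
  l = r2 (v1 :* v1 :* (v0 :* v0)) (v0 :* v1 :* (v0 :* v1))
  l2 = r3 (v0 :* v1 :* v2) (v0 :* v2 :* v1)
 iC : (1 // 4) * iσ ≤ C * C
 iC = za {c = 1 // 4} by iσC ~ EQ (l r zk)
  where l = r2 ((1 :/ 4) :* (v0 :* v0 :* (v1 :* v1))) (:½ :* v0 :* v1 :* (:½ :* v0 :* v1))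
 1≤¼iσ : 1q ≤ (1 // 4) * iσ
 1≤¼iσ = EQ (sym (ic σ+)) ~ zb piσ σ≤¼
 1≤C : 1q ≤ C
 1≤C = sr {1q} {C} pC (1≤¼iσ ~ iC)
 C≤Chi : C ≤ Ch
 C≤Chi = zb p6 (za {c = 1 // 2} by rΛ) ~ EQ (l Λ Ch zk >> ap (Ch *_) λΛ >> *-1ʳ Ch)
  where l = r3 (:½ :* (:2 :* v0 :* v1) :* v2) (v1 :* (v2 :* v0))
 x̄²iσ : xc * xc * iσ ≡ (1 // 4) * iσ - 1q
 x̄²iσ = trans (ap (_* iσ) x̄²) (l zo iσ >> ap (\ z -> (1 // 4) * iσ - z) (ic σ+))
  where l = r2 (((1 :/ 4) :- v0) :* v1) ((1 :/ 4) :* v1 :- v0 :* v1)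
 r-ir : r * ir ≡ 1q
 r-ir = ic r+

 -- Keeps the smaller tilt nonnegative. It rests on θ zm ≥ 2/13, by way of 1.595² (13/8 - 1) ≤ 1.3².
 b≤a0 : b ≤ a0
 b≤a0 = sr pa0 (EQ (l1 zf ir xc iσ >> ap (\ z -> zf * zf * z * (ir * ir * iσ)) x̄²iσ)
  ~ ma (nc (sn zf) (df 1≤¼iσ)) (nc (nc pir pir) piσ) h1 h2 ~ EQ (l3 zg zk))
  where
  h1 : zf * zf * ((1 // 4) * iσ - 1q) ≤ zg * zg
  h1 = za (sn zf) (+-≤ˡ (- 1q) (za {c = 1 // 4} by iσ≤)) ~ by {zf * zf * ((1 // 4) * (13 // 2) - 1q)} {zg * zg}
  h2 : ir * ir * iσ ≤ zk * zk
  h2 = za (nc pir pir) iσC ~ EQ (l2 ir r (zk * zk) >> ap (\ z -> z * z * (zk * zk)) r-ir >> l4 (zk * zk))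
   where
   l2 = r3 (v0 :* v0 :* (v1 :* v1 :* v2)) (v1 :* v0 :* (v1 :* v0) :* v2)
   l4 = r1 (:1 :* :1 :* v0) v0
  l1 = r4 (v0 :* v1 :* v2 :* v3 :* (v0 :* v1 :* v2 :* v3)) (v0 :* v0 :* (v2 :* v2 :* v3) :* (v1 :* v1 :* v3))
  l3 = r2 (v0 :* v0 :* (v1 :* v1)) (v0 :* v1 :* (v0 :* v1))
 pτ' : 0q ≤ τ'
 pτ' = df b≤a0
 pτ : 0q ≤ τ
 pτ = nh pa0 pb
 af : τ ≤ a0 + a0
 af = +-≤ʳ a0 b≤a0
 ae : τ' ≤ a0 + a0
 ae = ba (nh pa0 pb) (l a0 b)
  where l = r2 (v0 :+ v0) (v0 :- v1 :+ (v0 :+ v1))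
 2a0≤ : a0 + a0 ≤ 1 // 1000000000000
 2a0≤ = mb h h ~ by {zg * ti + zg * ti} {1 // 1000000000000}
  where h = za {c = zg} by λ≤
 σb : zo * b ≡ e * xc
 σb = trans (l zo (e * xc) iσ) (ap (e * xc *_) (ic σ+) >> *-1ʳ (e * xc))
  where l = r3 (v0 :* (v1 :* v2)) (v1 :* (v0 :* v2))

 -- Up to small errors gain minus cost is 1.3 · 1.595 C - (1.3² + 1.595² (C² - 1))/2: the mixed term
 -- of the cost is brought to the gain side, where xc² + zo = 1/4 makes the coefficients combine.
 -- `closed` asks for this at `Ch` with 10⁻⁹ set aside for the errors.
 module Star (x t t' A : ℚ) (px : 0q ≤ x) (xD : x * D ≤ ti) (pt : 0q ≤ t) (pt' : 0q ≤ t') (t≤ : t ≤ τ) (t'≤ : t' ≤ τ')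
  (≤t : τ - τ * τ - x ≤ t) (≤t' : τ' - τ' * τ' - x ≤ t')
  (closed : A + (1 // 2) * cg * (zg * zg * cg + zf * zf * (Ch * Ch - 1q)) + (1 // 1000000000) ≤ zg * zf * Ch) where
  private
   pc : 0q ≤ cg
   pc = by
   sq-sum-τ : θ * (τ * τ) + zm * (τ' * τ') ≡ a0 * a0 + b * b - (4 // 1) * (a0 * b * xc)
   sq-sum-τ = trans (l θ zm a0 b) (ap (\ z -> z * (a0 * a0 + b * b) - (4 // 1) * (a0 * b * xc)) sum1 >> ap (_- (4 // 1) * (a0 * b * xc)) (*-1ˡ (a0 * a0 + b * b)))
    where l = r4 (v0 :* ((v2 :+ v3) :* (v2 :+ v3)) :+ v1 :* ((v2 :- v3) :* (v2 :- v3))) ((v0 :+ v1) :* (v2 :* v2 :+ v3 :* v3) :- :4 :* (v2 :* v3 :* (:½ :* (v1 :- v0))))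
   De² : D * (e * e) ≤ zf * zf
   De² = zb (sn e) Dr ~ EQ (l r zf ir >> ap (\ z -> zf * zf * (z * z)) r-ir >> refl)
    where l = r3 (v0 :* v0 :* (v1 :* v2 :* (v1 :* v2))) (v1 :* v1 :* (v0 :* v2 :* (v0 :* v2)))
   Q : D * zo * (a0 * a0 + b * b) ≤ zg * zg * cg + zf * zf * (C * C - 1q)
   Q = EQ (l1 D zo zg zk b >> ap (\ z -> zg * zg * (D * zo * (zk * zk)) + D * z * b) σb) ~ mb (za (sn zg) (Dσλ ~ K≤)) (EQ (l2 D e xc iσ >> ap (D * (e * e) *_) x̄²iσ) ~ ma (nc pD (sn e)) (df 1≤¼iσ) De² (+-≤ˡ (- 1q) iC))
    where
    l1 = r5 (v0 :* v1 :* (v2 :* v3 :* (v2 :* v3) :+ v4 :* v4)) (v2 :* v2 :* (v0 :* v1 :* (v3 :* v3)) :+ v0 :* (v1 :* v4) :* v4)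
    l2 = r4 (v0 :* (v1 :* v2) :* (v1 :* v2 :* v3)) (v0 :* (v1 :* v1) :* (v2 :* v2 :* v3))
   gain : zg * zf * C - zg * zf * zk ≤ D * e * a0 * (1 // 2)
   gain = EQ (l1 r zk) ~ za {c = zg * zf * (1 // 2)} by (zb p6 Dir) ~ EQ (l2 D ir zk)
    where
    Dir : r - (2 // 1) ≤ D * ir
    Dir = EQ (sym (l3 (r - (2 // 1)) r ir >> ap ((r - (2 // 1)) *_) r-ir >> *-1ʳ (r - (2 // 1)))) ~ zb {(r - (2 // 1)) * r} {D} {ir} pir (ba {(r - (2 // 1)) * r} {(r - 1q) * (r - 1q)} {1q} ze (l4 r) ~ rD)
     where
     l3 = r3 (v0 :* v1 :* v2) (v0 :* (v1 :* v2))
     l4 = r1 ((v0 :- :1) :* (v0 :- :1)) ((v0 :- :2) :* v0 :+ :1)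
    l1 = r2 ((13 :/ 10) :* (319 :/ 200) :* (:½ :* v0 :* v1) :- (13 :/ 10) :* (319 :/ 200) :* v1) ((13 :/ 10) :* (319 :/ 200) :* :½ :* ((v0 :- :2) :* v1))
    l2 = r3 ((13 :/ 10) :* (319 :/ 200) :* :½ :* (v0 :* v1 :* v2)) (v0 :* ((319 :/ 200) :* v1) :* ((13 :/ 10) :* v2) :* :½)
   -- For C ≥ 1 the quadratic cost grows faster than the linear gain, since 1.3 < 1.595; the
   -- exponent is therefore smallest at the upper bound `Ch`.
   mono : (1 // 2) * cg * (zf * zf * (C * C - 1q)) + zg * zf * Ch ≤ (1 // 2) * cg * (zf * zf * (Ch * Ch - 1q)) + zg * zf * C
   mono = ba (nc (df C≤Chi) (df slope)) (l C Ch)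
    where
    slope : zg * zf ≤ (1 // 2) * cg * (zf * zf) * (Ch + C)
    slope = by {zg * zf} {(1 // 2) * cg * (zf * zf) * (1q + 1q)} ~ za {c = (1 // 2) * cg * (zf * zf)} by (mb (1≤C ~ C≤Chi) 1≤C)
    l = r2 (:½ :* (1000000001 :/ 1000000000) :* ((319 :/ 200) :* (319 :/ 200) :* (v1 :* v1 :- :1)) :+ (13 :/ 10) :* (319 :/ 200) :* v0) (:½ :* (1000000001 :/ 1000000000) :* ((319 :/ 200) :* (319 :/ 200) :* (v0 :* v0 :- :1)) :+ (13 :/ 10) :* (319 :/ 200) :* v1 :+ (v1 :- v0) :* (:½ :* (1000000001 :/ 1000000000) :* ((319 :/ 200) :* (319 :/ 200)) :* (v1 :+ v0) :- (13 :/ 10) :* (319 :/ 200)))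
   τ² : ∀ {y} -> 0q ≤ y -> y ≤ a0 + a0 -> D * e * zo * (y * y) ≤ (8 // 1) * ti
   τ² {y} py h = za (nc (nc pD pe) pσ) (ma py py h h) ~ EQ (l D e zo zk) ~ za {c = (676 // 100)} by (ma pe (nc (nc pD pσ) (nc p6 p6)) e≤ (Dσλ ~ K≤)) ~ by {(676 // 100) * (ti * cg)} {(8 // 1) * ti}
    where l = r4 (v0 :* v1 :* v2 :* (((13 :/ 10) :* v3 :+ (13 :/ 10) :* v3) :* ((13 :/ 10) :* v3 :+ (13 :/ 10) :* v3))) ((676 :/ 100) :* (v1 :* (v0 :* v2 :* (v3 :* v3))))
   t≤1 : ∀ {y} -> y ≤ a0 + a0 -> y ≤ 1q
   t≤1 h = h ~ 2a0≤ ~ by {1 // 1000000000000} {1q}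
   err1 : (2 // 1) * (x * D) * (t + t') ≤ (4 // 1) * ti
   err1 = ma (nc {2 // 1} by (nc px pD)) (nh pt pt') (za {c = 2 // 1} by xD) (mb (t≤1 (t≤ ~ af)) (t≤1 (t'≤ ~ ae))) ~ by {(2 // 1) * ti * (1q + 1q)} {(4 // 1) * ti}
   err2 : D * e * zo * (x + x) ≤ ti
   err2 = EQ (l D e zo x) ~ ma (nc (nc {2 // 1} by pe) pσ) (nc px pD) (ma (nc {2 // 1} by pe) pσ (za {c = 2 // 1} by e≤) σ≤1) xD ~ by {(2 // 1) * ti * 1q * ti} {ti}
    where l = r4 (v0 :* v1 :* v2 :* (v3 :+ v3)) (:2 :* v1 :* v2 :* (v3 :* v0))
   err3 : zg * zf * zk ≤ (3 // 1) * ti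
   err3 = za {c = zg * zf} by λ≤ ~ by {zg * zf * ti} {(3 // 1) * ti}

  star : A + (1 // 2) * (D * cg * zo) * (θ * (t * t) + zm * (t' * t')) + (2 // 1) * (x * D) * (t + t') ≤ D * (e * zo) * (t + t')
  star = mb (+-≤ʳ A (za {c = (1 // 2) * (D * cg * zo)} (nc {1 // 2} by (nc (nc pD pc) pσ)) (mb (za (qa θ+) (ma pt pt t≤ t≤)) (za (qa zD) (ma pt' pt' t'≤ t'≤))) ~ EQ (ap ((1 // 2) * (D * cg * zo) *_) sq-sum-τ >> l1 D cg zo a0 b xc >> ap (\ z -> (1 // 2) * cg * (D * zo * (a0 * a0 + b * b)) - (2 // 1) * cg * (a0 * D * z * xc)) σb)
   ~ mb (za {c = (1 // 2) * cg} by Q) (nm {(2 // 1) * (a0 * D * (e * xc) * xc)} {(2 // 1) * cg * (a0 * D * (e * xc) * xc)} (zb (nc (nc (nc pa0 pD) (nc pe px̄)) px̄) (by {2 // 1} {(2 // 1) * cg})))))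
   err1
   ~ EQ (l2 A (zg * zg * cg) (zf * zf * (C * C - 1q)) (a0 * D) e xc) ~ core ~ +-mono-rhs
   where
   l1 = r6 (:½ :* (v0 :* v1 :* v2) :* (v3 :* v3 :+ v4 :* v4 :- :4 :* (v3 :* v4 :* v5))) (:½ :* v1 :* (v0 :* v2 :* (v3 :* v3 :+ v4 :* v4)) :- :2 :* v1 :* (v3 :* v0 :* (v2 :* v4) :* v5))
   l2 = r6 (v0 :+ (:½ :* (1000000001 :/ 1000000000) :* (v1 :+ v2) :- :2 :* (v3 :* (v4 :* v5) :* v5)) :+ :4 :* (1 :/ 100000000000000000000)) ((v0 :+ :½ :* (1000000001 :/ 1000000000) :* (v1 :+ v2) :+ :4 :* (1 :/ 100000000000000000000)) :- :2 :* (v3 :* v4 :* (v5 :* v5)))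
   core : (A + (1 // 2) * cg * (zg * zg * cg + zf * zf * (C * C - 1q)) + (4 // 1) * ti) - (2 // 1) * (a0 * D * e * (xc * xc)) ≤ (D * e * a0 * (1 // 2) - (17 // 1) * ti) - (2 // 1) * (a0 * D * e * (xc * xc))
   core = +-≤ˡ (- ((2 // 1) * (a0 * D * e * (xc * xc)))) (nj {A + (1 // 2) * cg * (zg * zg * cg + zf * zf * (C * C - 1q)) + (4 // 1) * ti} {D * e * a0 * (1 // 2) - (17 // 1) * ti} (nh (nh (nh (df closed) (df mono)) (nh (df gain) (df err3))) (by {0q} {(1 // 1000000000) - (24 // 1) * ti}) ~ EQ (l3 A (zg * zg * cg) (zf * zf * (C * C - 1q)) (zf * zf * (Ch * Ch - 1q)) (zg * zf * Ch) (zg * zf * C) (zg * zf * zk) (D * e * a0 * (1 // 2)))))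
    where l3 = r8 ((v4 :- (v0 :+ :½ :* (1000000001 :/ 1000000000) :* (v1 :+ v3) :+ (1 :/ 1000000000))) :+ (:½ :* (1000000001 :/ 1000000000) :* v3 :+ v5 :- (:½ :* (1000000001 :/ 1000000000) :* v2 :+ v4)) :+ ((v7 :- (v5 :- v6)) :+ (:3 :* (1 :/ 100000000000000000000) :- v6)) :+ ((1 :/ 1000000000) :- (24 :/ 1) :* (1 :/ 100000000000000000000))) ((v7 :- (17 :/ 1) :* (1 :/ 100000000000000000000)) :- (v0 :+ :½ :* (1000000001 :/ 1000000000) :* (v1 :+ v2) :+ :4 :* (1 :/ 100000000000000000000)))
   +-mono-rhs : (D * e * a0 * (1 // 2) - (17 // 1) * ti) - (2 // 1) * (a0 * D * e * (xc * xc)) ≤ D * (e * zo) * (t + t')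
   +-mono-rhs = nj (nh (nh (nc (nc pD (nc pe pσ)) (nh (df ≤t) (df ≤t'))) (nh (df (τ² pτ af)) (df (τ² pτ' ae)))) (df err2)
    ~ EQ (l4 D e zo t t' a0 b x >> ap (\ z -> D * (e * zo) * (t + t') - (a0 * D * e * z * (2 // 1) - (17 // 1) * ti)) σe >> l5 D e zo t t' a0 (xc * xc)))
    where
    σe : zo ≡ (1 // 4) - xc * xc
    σe = trans (l (xc * xc) zo) (ap (_- xc * xc) x̄σ)
     where l = r2 v1 (v0 :+ v1 :- v0)
    l4 = r8 (v0 :* (v1 :* v2) :* ((v3 :- ((v5 :+ v6) :- (v5 :+ v6) :* (v5 :+ v6) :- v7)) :+ (v4 :- ((v5 :- v6) :- (v5 :- v6) :* (v5 :- v6) :- v7))) :+ ((:8 :* (1 :/ 100000000000000000000) :- v0 :* v1 :* v2 :* ((v5 :+ v6) :* (v5 :+ v6))) :+ (:8 :* (1 :/ 100000000000000000000) :- v0 :* v1 :* v2 :* ((v5 :- v6) :* (v5 :- v6)))) :+ ((1 :/ 100000000000000000000) :- v0 :* v1 :* v2 :* (v7 :+ v7))) (v0 :* (v1 :* v2) :* (v3 :+ v4) :- (v5 :* v0 :* v1 :* v2 :* :2 :- (17 :/ 1) :* (1 :/ 100000000000000000000)))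
    l5 = r7 (v0 :* (v1 :* v2) :* (v3 :+ v4) :- (v5 :* v0 :* v1 :* ((1 :/ 4) :- v6) :* :2 :- (17 :/ 1) :* (1 :/ 100000000000000000000))) (v0 :* (v1 :* v2) :* (v3 :+ v4) :- ((v0 :* v1 :* v5 :* :½ :- (17 :/ 1) :* (1 :/ 100000000000000000000)) :- :2 :* (v5 :* v0 :* v1 :* v6)))

module Rounding (M' : ℕ) where
 open Lattice M'
 module _ (τ : ℚ) (pτ : 0q ≤ τ) (τ<1 : τ < 1q) where
  private
   fd = lr (\ k -> g ^ k ≤ 1q + τ) (\ k -> g ^ k ℚ.≤? 1q + τ) (ba pτ refl) M
    (\ h -> <⇒≱ (ℚP.+-monoʳ-< 1q τ<1) (+-≤ʳ 1q (EQ (sym (ic (zj M')))) ~ g-lower M ~ h))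
  sv : ℕ
  sv = fst fd
  g-steps : g ^ sv ≤ 1q + τ
  g-steps = fst (snd fd)
  steps<M : sv ≺ M
  steps<M = snd (snd (snd fd))
  sj : ι sv * x ≤ τ
  sj = nj (df (g-lower sv ~ g-steps) ~ EQ (l (ι sv * x) τ))
   where l = r2 (:1 :+ v1 :- (:1 :+ v0)) (v1 :- v0)
  sD : τ - τ * τ - x ≤ ι sv * x
  sD = nj (nh (df prod) (nc pτ (df sj)) ~ EQ (l τ (ι sv * x) x))
   where
   t1 : 0q ≤ 1q - ι sv * x
   t1 = df (sj ~ qa τ<1)
   prod : (1q + τ) * (1q - ι sv * x) ≤ 1q + x
   prod = zb t1 (qa (≰⇒> (fst (snd (snd fd))))) ~ EQ (*-as g (g ^ sv) (1q - ι sv * x)) ~ za pg (g-upper sv) ~ EQ (*-1ʳ g)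
   l = r3 ((:1 :+ v2 :- (:1 :+ v0) :* (:1 :- v1)) :+ v0 :* (v0 :- v1)) (v1 :- (v0 :- v0 :* v0 :- v2))

-- Opaque wrappers, so that the large numerals in these conditions stay folded inside the fields of
-- `Setup`.
opaque
 Large : ℕ -> Set
 Large R = 1000000000000000000000000000000 // 1 ≤ ι R
 large⁻ : ∀ {R} -> Large R -> 1000000000000000000000000000000 // 1 ≤ ι R
 large⁻ h = h
 large⁺ : ∀ {R} -> 1000000000000000000000000000000 // 1 ≤ ι R -> Large R
 large⁺ h = h
 Fa : ℕ -> ℕ -> Set
 Fa M' d' = ι (suc M') ≡ (10000 // 1) * (ι (suc d') * ι (suc d') * (ι (suc d') * ι (suc d')))
 fine⁻ : ∀ {M' d'} -> Fa M' d' -> ι (suc M') ≡ (10000 // 1) * (ι (suc d') * ι (suc d') * (ι (suc d') * ι (suc d')))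
 fine⁻ h = h
 fine⁺ : ∀ {M' d'} -> ι (suc M') ≡ (10000 // 1) * (ι (suc d') * ι (suc d') * (ι (suc d') * ι (suc d'))) -> Fa M' d'
 fine⁺ h = h
 FineGrid : ℕ -> ℚ -> ℚ -> ℚ -> Set
 FineGrid d' δ N0 η = (160 // 1) * (ι (suc d') * ι (suc d') * (δ * δ) * N0) ≤ η
 grid⁻ : ∀ {d' δ N0 η} -> FineGrid d' δ N0 η -> (160 // 1) * (ι (suc d') * ι (suc d') * (δ * δ) * N0) ≤ η
 grid⁻ h = h
 grid⁺ : ∀ {d' δ N0 η} -> (160 // 1) * (ι (suc d') * ι (suc d') * (δ * δ) * N0) ≤ η -> FineGrid d' δ N0 η
 grid⁺ h = h

-- R rounds √d up. M is 10⁴d⁴, which makes exponents with four decimals whole numbers of lattice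
-- steps and keeps d/M below `ti`.
record Setup : Set where
 field
  d' R M' F : ℕ
  N0 η δ : ℚ
  zB : 0q < δ
  η1 : η ≤ 1q
  big' : Large R
  Dr : ι (suc d') ≤ ι R * ι R
  rD : (ι R - 1q) * (ι R - 1q) ≤ ι (suc d')
  Me' : Fa M' d'
  hδ' : FineGrid d' δ N0 η
  hF : N0 ≤ ι F * (δ * δ)
 big : 1000000000000000000000000000000 // 1 ≤ ι R
 big = large⁻ big'
 Me : ι (suc M') ≡ (10000 // 1) * (ι (suc d') * ι (suc d') * (ι (suc d') * ι (suc d')))
 Me = fine⁻ Me'
 hδ : (160 // 1) * (ι (suc d') * ι (suc d') * (δ * δ) * N0) ≤ η
 hδ = grid⁻ hδ'
 d : ℕ
 d = suc d'
 r D : ℚ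
 r = ι R
 D = ι d
 rD' : (1000 // 1) * (r - 1q) ≤ D
 rD' = zb (df (by {1q} {1000000000000000000000000000000 // 1} ~ big)) (by {1000 // 1} {(1000000000000000000000000000000 // 1) - 1q} ~ +-≤ˡ (- 1q) big) ~ rD
 D-big : 100000000000000000000 // 1 ≤ D
 D-big = by {100000000000000000000 // 1} {(1000 // 1) * ((1000000000000000000000000000000 // 1) - 1q)} ~ za {c = 1000 // 1} by (+-≤ˡ (- 1q) big) ~ rD'
 open Lattice M' public using (x; g; g+; pg; 1≤g; px; x+)
 Da : 1q ≤ D
 Da = zx d'
 xD⁴ : x * ((10000 // 1) * (D * D * (D * D))) ≡ 1q
 xD⁴ = trans (ap (x *_) (sym Me)) (*-cm x (ι (suc M')) >> ic (zj M'))
 xD : x * D ≤ ti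
 xD = ca {x * D} {ti} {(10000 // 1) * (D * (D * D))} (pos-* (>0 (10000 // 1)) (pos-* (zj d') (pos-* (zj d') (zj d'))))
  (EQ (l x D >> xD⁴) ~ by {1q} {ti * ((10000 // 1) * ((100000000000000000000 // 1) * (1q * 1q)))} ~ za {c = ti} by (za {c = 10000 // 1} by (ma (by {0q} {100000000000000000000 // 1}) (nc ze ze) D-big (ma ze ze Da Da))))
  where l = r2 (v0 :* v1 :* ((10000 :/ 1) :* (v1 :* (v1 :* v1)))) (v0 :* ((10000 :/ 1) :* (v1 :* v1 :* (v1 :* v1))))
 da : ℕ
 da = d *' d *' (d *' d)
 -- exponents a/10000 are exact multiples of the lattice step
 ge : ∀ a -> ι (a *' da) * x ≡ ι a * (1 // 10000)
 ge a = trans (ap (_* x) (zn a da >> ap (ι a *_) (zn (d *' d) (d *' d) >> ap₂ _*_ (zn d d) (zn d d)))) (l (ι a) (D * D * (D * D)) x >> ap (\ z -> ι a * ((1 // 10000) * z)) xD⁴ >> ap (ι a *_) (*-1ʳ (1 // 10000)))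
  where l = r3 (v0 :* v1 :* v2) (v0 :* ((1 :/ 10000) :* (v2 :* ((10000 :/ 1) :* v1))))

fractions : ∀ (f : ℕ) (Sb : Vec Bool (f +' f)) -> 1 <= cn (lookup Sb) true -> Labels.θ f Sb true + Labels.zm f Sb true ≡ 1q
fractions f Sb sc = Fractions.fc (cn (lookup Sb) true) (cn (lookup Sb) false) (f +' f) sc (cu (lookup Sb))

module Central (Se : Setup) (f : ℕ) (Sb : Vec Bool (f +' f)) (up : Bool)
 (sc : 1 <= cn (lookup Sb) true) (sd : 1 <= cn (lookup Sb) false)
 (θ+ : 0q < Labels.θ f Sb up) (zD : 0q < Labels.zm f Sb up) (zw : Labels.θ f Sb up ≤ Labels.zm f Sb up)
 (hθ : 1q ≤ Setup.N0 Se * Labels.θ f Sb up) (hθ' : 1q ≤ Setup.N0 Se * Labels.zm f Sb up)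
 (Ch : ℚ) (Chi≤ : Ch ≤ 13 // 10) (pChi : 0q ≤ Ch)
 (ww : (1000001 // 1000000) * (1000001 // 1000000) ≤ (2 // 1) * Ch * ((2 // 1) * Ch) * (Labels.θ f Sb up * Labels.zm f Sb up))
 (σ-low : 2 // 13 ≤ Labels.θ f Sb up * Labels.zm f Sb up)
 (a : ℕ) (closed : ι a * (1 // 10000) + (1 // 2) * cg * (zg * zg * cg + zf * zf * (Ch * Ch - 1q)) + (1 // 1000000000) ≤ zg * zf * Ch) where
 open Setup Se
 private
  module La = Labels f Sb up
  σ0 = La.θ * La.zm
  σ0+ : 0q < σ0
  σ0+ = pos-* θ+ zD
  sum1 : La.θ + La.zm ≡ 1q
  sum1 = fractions f Sb sc
  Λof : ℕ -> ℚ
  Λof j = (128 // 1) * ι (suc j)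
  Λ-mono : ∀ j -> ι j ≤ Λof j
  Λ-mono j = mn (n≤sn j) ~ EQ (sym (*-1ˡ (ι (suc j)))) ~ zb (zd (suc j)) (by {1q} {128 // 1})
  -- ℓ = `suc zh` is the integer part of √(d σ0)/128, so Λ = 128ℓ misses √(d σ0) by at most 128.
  foundℓ = lr (\ j -> Λof j * Λof j ≤ D * σ0) (\ j -> Λof j * Λof j ℚ.≤? D * σ0)
   (EQ (ap (\ z -> (128 // 1) * z * ((128 // 1) * z)) ι1) ~ by {(128 // 1) * 1q * ((128 // 1) * 1q)} {(100000000000000000000 // 1) * (2 // 13)} ~ ma (by {0q} {100000000000000000000 // 1}) (by {0q} {2 // 13}) D-big σ-low) R
   (\ h -> <⇒≱ (<-≤ (ℚP.*-monoʳ-<-pos (D) {{positive (zj d')}} (σ<1)) (EQ (*-1ʳ D) ~ Dr ~ ma (zd R) (zd R) (Λ-mono R) (Λ-mono R))) h)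
   where
   σ<1 : σ0 < 1q
   σ<1 = ℚP.≤-<-trans (za (qa θ+) (pE (qa θ+) (+-cm La.zm La.θ >> sum1)) ~ EQ (*-1ʳ La.θ)) (<-≤ (subst (_< La.θ + La.zm) (+-0ʳ La.θ) (ℚP.+-monoʳ-< La.θ zD)) (EQ sum1))
  zh = fst foundℓ
  Λ = (128 // 1) * ι (suc zh)
  zk = (1 // 128) * ig (ι (suc zh))
  λ+ : 0q < zk
  λ+ = pos-* (>0 (1 // 128)) (io (zj zh))
  λΛ : zk * Λ ≡ 1q
  λΛ = trans (l (ig (ι (suc zh))) (ι (suc zh))) (ic (zj zh))
   where l = r2 ((1 :/ 128) :* v0 :* ((128 :/ 1) :* v1)) (v1 :* v0)
  pΛ : 0q ≤ Λ
  pΛ = nc {128 // 1} by (zd (suc zh))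
  Λlo : Λ * Λ ≤ D * σ0
  Λlo = fst (snd foundℓ)
  Λhi : D * σ0 ≤ (Λ + (128 // 1)) * (Λ + (128 // 1))
  Λhi = qa (≰⇒> (fst (snd (snd foundℓ)))) ~ EQ (ap (\ z -> z * z) (ap ((128 // 1) *_) (su (suc zh)) >> l (ι (suc zh))))
   where l = r1 ((128 :/ 1) :* (:1 :+ v0)) ((128 :/ 1) :* v0 :+ (128 :/ 1))
  module CS = CentralScalars D r Λ zk La.θ La.zm θ+ zD sum1 zw big Dr rD λ+ λΛ pΛ Λlo Λhi Ch Chi≤ pChi ww σ-low
  e12 = 1 // 1000000000000
  lt1 : ∀ {y} -> y ≤ CS.a0 + CS.a0 -> y < 1q
  lt1 h = ℚP.≤-<-trans (h ~ CS.2a0≤) (by< {1 // 1000000000000} {1q})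
  module RS = Rounding M'
  k = RS.sv CS.τ CS.pτ (lt1 CS.af)
  k' = RS.sv CS.τ' CS.pτ' (lt1 CS.ae)
  t = ι k * x
  t' = ι k' * x
  gk : g ^ k ≤ 1q + CS.τ
  gk = RS.g-steps CS.τ CS.pτ (lt1 CS.af)
  gk' : g ^ k' ≤ 1q + CS.τ'
  gk' = RS.g-steps CS.τ' CS.pτ' (lt1 CS.ae)
  t≤ : t ≤ CS.τ
  t≤ = RS.sj CS.τ CS.pτ (lt1 CS.af)
  t'≤ : t' ≤ CS.τ'
  t'≤ = RS.sj CS.τ' CS.pτ' (lt1 CS.ae)
  pt : 0q ≤ t
  pt = nc (zd k) px
  pt' : 0q ≤ t'
  pt' = nc (zd k') px
  u4 : ∀ {y τ} -> τ ≤ CS.a0 + CS.a0 -> y ≤ 1q + τ -> y ≤ 4 // 1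
  u4 h h' = h' ~ +-≤ʳ 1q (h ~ CS.2a0≤) ~ by {1q + (1 // 1000000000000)} {4 // 1}
  module Re = Region f Sb up sc sd d' F η η1 δ zB M' k k'
  a4 = u4 CS.af gk
  a4' = u4 CS.ae gk'

 e xc : ℚ
 e = zf * ig r
 xc = (1 // 2) * (La.zm - La.θ)
 thr : Bool -> ℚ
 thr true = D * Re.p + D * (e * xc)
 thr false = D * Re.q - D * (e * xc)

 private
  pD = zd d
  ex : e * xc ≤ ti
  ex = ma CS.pe CS.px̄ CS.e≤ x1 ~ EQ (*-1ʳ ti)
   where
   x1 : xc ≤ 1q
   x1 = za {La.zm - La.θ} {1q} {1 // 2} by (ba {La.zm - La.θ} {1q} (nh (qa θ+) (qa θ+)) (sym sum1 >> l La.θ La.zm)) ~ by {(1 // 2) * 1q} {1q}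
    where l = r2 (v0 :+ v1) (v1 :- v0 :+ (v0 :+ v0))
  exnn : 0q ≤ e * xc
  exnn = nc CS.pe CS.px̄
  p-low : ∀ {p q} -> 0q ≤ p -> q ≤ 1q -> p * q ≡ σ0 -> 2 // 13 ≤ p
  p-low {p} {q} pp q1 e = σ-low ~ EQ (sym e) ~ za pp q1 ~ EQ (*-1ʳ p)
  q+p = trans (+-cm Re.q Re.p) Re.p+q
  qpσ = trans (*-cm Re.q Re.p) Re.pW
  p≥ : 2 // 13 ≤ Re.p
  p≥ = p-low (qa Re.p+) (pE (qa Re.p+) q+p) Re.pW
  q≥ : 2 // 13 ≤ Re.q
  q≥ = p-low (qa Re.q+) (pE (qa Re.q+) Re.p+q) qpσ
  thr-low : ∀ b -> (1 // 10) * D ≤ thr b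
  thr-low true = zb pD (by {1 // 10} {2 // 13} ~ p≥) ~ EQ (*-cm Re.p D) ~ ba (nc pD exnn) refl
  thr-low false = zb pD (by {1 // 10} {(2 // 13) - ti} ~ mb q≥ (nm ex)) ~ EQ (l Re.q (e * xc) D)
   where l = r3 ((v0 :- v1) :* v2) (v2 :* v0 :- v2 :* v1)
  p≤ : ∀ {p q} -> p + q ≡ 1q -> 2 // 13 ≤ q -> p ≤ 11 // 13
  p≤ {p} {q} e h = nj (df h ~ EQ (l p q >> ap (\ z -> z - (2 // 13) - p) e))
   where l = r2 (v1 :- (2 :/ 13)) (v0 :+ v1 :- (2 :/ 13) :- v0)
  thr-high : ∀ b -> thr b ≤ D
  thr-high true = EQ (sym (ℚP.*-distribˡ-+ D Re.p (e * xc))) ~ za {Re.p + e * xc} {1q} {D} pD (mb {Re.p} {11 // 13} {e * xc} {ti} (p≤ Re.p+q q≥) ex ~ by {(11 // 13) + ti} {1q}) ~ EQ (*-1ʳ D)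
  thr-high false = ba (nc pD exnn) (l (D * Re.q) (D * (e * xc))) ~ za pD (pE (qa Re.p+) q+p) ~ EQ (*-1ʳ D)
   where l = r2 v0 (v0 :- v1 :+ v1)
  fl : ∀ b -> ∃[ B ] (ι B ≤ thr b - (3 // 1) × thr b - (3 // 1) ≤ ι B + 1q)
  fl b = floor (thr b - (3 // 1)) (df (by {3 // 1} {(1 // 10) * (100000000000000000000 // 1)} ~ za {c = 1 // 10} by D-big ~ thr-low b))
  -- `Tt` = `Ta` + 1 stays at most thr - 2, which absorbs the additive 2 in `hrow`, and at least thr
  -- - 3, the loss that `Window` allows for.
  Ta : Bool -> ℕ
  Ta b = fst (fl b)
  Tt : Bool -> ℕ
  Tt b = suc (Ta b)
  Tt-up : ∀ b -> thr b ≤ ι (Tt b) + (3 // 1)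
  Tt-up b = shift {thr b} {ι (Tt b) + (3 // 1)} { - (3 // 1)} (snd (snd (fl b)) ~ EQ (l (ι (Ta b)) >> ap (\ z -> z + (3 // 1) + - (3 // 1)) (sym (su (Ta b)))))
   where l = r1 (v0 :+ :1) (:1 :+ v0 :+ :3 :+ :- :3)
  Tt-low : ∀ b -> ι (Tt b) ≤ thr b - (2 // 1)
  Tt-low b = EQ (su (Ta b)) ~ +-≤ʳ 1q (fst (snd (fl b))) ~ EQ (l (thr b))
   where l = r1 (:1 :+ (v0 :- :3)) (v0 :- :2)
  Tt≤d : ∀ b -> Tt b <= d
  Tt≤d b = cf (Tt-low b ~ ba {thr b - (2 // 1)} {thr b} {2 // 1} by (l (thr b)) ~ thr-high b)
   where l = r1 v0 (v0 :- :2 :+ :2)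
  Λ≤r : Λ ≤ r
  Λ≤r = sr CS.pr (Λlo ~ za pD CS.σ≤1 ~ EQ (*-1ʳ D) ~ Dr)
  fit : ∀ b -> suc (512 *' suc zh) <= Tt b
  fit b = ℕ.s≤s (cf (EQ (zn 512 (suc zh) >> ap (_* ι (suc zh)) (li 512) >> l (ι (suc zh))) ~ za {c = 4 // 1} by Λ≤r ~ nj (nh (nc {1 // 10} by (df rD')) (nc {96 // 1} by (df (by {104 // 96} {1000000000000000000000000000000 // 1} ~ big))) ~ EQ (l2 r D)) ~ low))
   where
   l = r1 ((512 :/ 1) :* v0) (:4 :* ((128 :/ 1) :* v0))
   l2 = r2 ((1 :/ 10) :* (v1 :- (1000 :/ 1) :* (v0 :- :1)) :+ (96 :/ 1) :* (v0 :- (104 :/ 96))) (((1 :/ 10) :* v1 :- :4) :- :4 :* v0)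
   low : (1 // 10) * D - (4 // 1) ≤ ι (Ta b)
   low = shift {(1 // 10) * D - (4 // 1)} {ι (Ta b)} {1q} (EQ (l3 ((1 // 10) * D)) ~ +-≤ˡ (- (3 // 1)) (thr-low b) ~ snd (snd (fl b)))
    where l3 = r1 (v0 :- :4 :+ :1) (v0 :- :3)
  small : (2000000 // 1) * zk ≤ 1q
  small = za {c = 2000000 // 1} by CS.λ≤ ~ by {(2000000 // 1) * ti} {1q}
  rowK : ∀ p q -> 0q < p -> 0q < q -> p + q ≡ 1q -> p * q ≡ σ0 -> ∀ j b̃ -> b̃ ≤ CS.a0 -> g ^ j ≤ 1q + (CS.a0 + b̃) -> ∀ T -> T <= d -> suc (512 *' suc zh) <= T -> D * p + D * (σ0 * b̃) ≤ ι T + (3 // 1) ->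
   ∀ Y -> 0q < Y -> Y * q ≡ p * g ^ j -> ∀ v U -> 0q < v -> 0q < U -> ro (rep d (v , U)) T * ro (rep d (v , U)) T * (10000 // 1) ≤ (8464 // 1) * ((1q + Y) * (v * v + U * U * ig Y)) ^ d
  rowK p q p+ q+ e1 e2 j b̃ b̃≤ gj T T≤d fitT hT Y Y+ hY = Kappa.row-bound p q p+ q+ e1 d' T zh ρ ρ0 ρ2 small (Λlo ~ EQ (ap (D *_) (sym e2))) (EQ (ap (D *_) e2) ~ Λhi) hT' T≤d fitT Y Y+ hY'
   where
   φ = g ^ j - 1q
   φ≤ : φ ≤ CS.a0 + b̃
   φ≤ = +-≤ˡ (- 1q) gj ~ EQ (l (CS.a0 + b̃))
    where l = r1 (:1 :+ v0 :- :1) v0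
   -- Defined from the lattice tilt g^j actually in use rather than from its target, so that `hY'`
   -- holds exactly; the rounding of the tilt then enters only through the inequality `hT'`.
   ρ = φ * Λ - zg
   ρλ : ρ * zk ≡ φ - CS.a0
   ρλ = trans (l φ Λ zg zk) (ap (\ z -> φ * z - zg * zk) λΛ >> ap (_- zg * zk) (*-1ʳ φ))
    where l = r4 ((v0 :* v1 :- v2) :* v3) (v0 :* (v3 :* v1) :- v2 :* v3)
   ρ0 : 0q ≤ zg + ρ
   ρ0 = nc (df (zt j 1≤g)) pΛ ~ EQ (l (φ * Λ) zg)
    where l = r2 v0 (v1 :+ (v0 :- v1))
   ρ2 : ρ ≤ 4 // 1
   ρ2 = +-≤ˡ (- zg) (zb pΛ (φ≤ ~ +-≤ʳ CS.a0 b̃≤) ~ EQ (l zg zk Λ >> ap (\ z -> (zg + zg) * z) λΛ)) ~ by {(zg + zg) * 1q + - zg} {4 // 1}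
    where l = r3 ((v0 :* v1 :+ v0 :* v1) :* v2) ((v0 :+ v0) :* (v1 :* v2))
   hT' : D * p + ρ * zk * (D * (p * q)) ≤ ι T + (3 // 1)
   hT' = +-≤ʳ (D * p) (EQ (ap₂ (\ a b -> a * (D * b)) ρλ e2) ~ zb (nc pD CS.pσ) (+-≤ˡ (- CS.a0) φ≤ ~ EQ (l CS.a0 b̃)) ~ EQ (l2 b̃ D σ0)) ~ hT
    where
    l = r2 (v0 :+ v1 :- v0) v1
    l2 = r3 (v0 :* (v1 :* v2)) (v1 :* (v2 :* v0))
   hY' : Y * q ≡ p * (1q + (zg * zk + ρ * zk))
   hY' = trans hY (ap (p *_) (l (g ^ j) CS.a0 >> ap (\ z -> 1q + (zg * zk + z)) (sym ρλ)))
    where l = r2 v0 (:1 :+ (v1 :+ (v0 :- :1 :- v1)))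
  Yq : ∀ p q u -> 0q < q -> p * u * ig q * q ≡ p * u
  Yq p q u q+ = trans (l (p * u) (ig q) q) (ap (p * u *_) (ic q+) >> *-1ʳ (p * u))
   where l = r3 (v0 :* v1 :* v2) (v0 :* (v2 :* v1))
  rows : ∀ b -> Re.Ro N0 hθ hθ' a4 a4' hδ hF (8464 // 10000) (\ b -> suc (Ta b)) b
  rows = Re.tl N0 hθ hθ' a4 a4' hδ hF Ta (rowK Re.p Re.q Re.p+ Re.q+ Re.p+q Re.pW k CS.b CS.b≤a0 gk (Tt true) (Tt≤d true) (fit true) (EQ (ap (\ z -> D * Re.p + D * z) CS.σb) ~ Tt-up true) Re.Y Re.Y+ (Yq Re.p Re.q (g ^ k) Re.q+)) (rowK Re.q Re.p Re.q+ Re.p+ q+p qpσ k' (- CS.b) (neg-b ~ CS.pa0) gk' (Tt false) (Tt≤d false) (fit false) (EQ (l D Re.q σ0 CS.b >> ap (\ z -> D * Re.q - D * z) CS.σb) ~ Tt-up false) Re.Y' Re.Y'+ (Yq Re.q Re.p (g ^ k') Re.p+))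
   where
   neg-b : - CS.b ≤ 0q
   neg-b = nm CS.pb
   l = r4 (v0 :* v1 :+ v0 :* (v2 :* :- v3)) (v0 :* v1 :- v0 :* (v2 :* v3))
  t0≤ : ∀ {y} -> y ≤ CS.a0 + CS.a0 -> y ≤ e12
  t0≤ h = h ~ CS.2a0≤
  hz : ∀ k τ -> τ ≤ CS.a0 + CS.a0 -> ι k * x ≤ τ -> ∀ j -> j <= k -> g ^ j ≤ 1q + cg * (ι j * x)
  hz k τ h h' j le = Lattice.z-bound M' j {cg} {e12} (zb px (mn le) ~ h' ~ t0≤ h) (lt1' ) by (by {1q} {cg * (1q - (1 // 1000000000000))})
   where
   lt1' : e12 < 1q
   lt1' = by< {1 // 1000000000000} {1q}
  ct2 : ∀ {y} -> y ≤ CS.a0 + CS.a0 -> cg * y ≤ 2 // 1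
  ct2 h = za {c = cg} by (t0≤ h) ~ by {cg * (1 // 1000000000000)} {2 // 1}
  open CS.Star x t t' (ι (a *' da) * x) px xD pt pt' t≤ t'≤ (RS.sD CS.τ CS.pτ (lt1 CS.af)) (RS.sD CS.τ' CS.pτ' (lt1 CS.ae))
   (EQ (ap (\ z -> z + (1 // 2) * cg * (zg * zg * cg + zf * zf * (Ch * Ch - 1q)) + (1 // 1000000000)) (ge a)) ~ closed) using (star)

 module _ (P : Vec (Vec (Fin (f +' f)) (f +' f)) d -> Bool)
  (hrow : ∀ ms -> AV Is ms -> P ms ≡ true -> ∀ i -> thr (lookup Sb i) ≤ ι (La.rowc i (La.lg ms)) + (2 // 1))
  (hL : ∀ ms -> AV Is ms -> P ms ≡ true -> D * (ι La.s * Re.p + e * (La.θ * La.zm) * ι (f +' f)) - D ≤ ι (La.LL true (La.lg ms)))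
  (hL' : ∀ ms -> AV Is ms -> P ms ≡ true -> D * (ι La.s' * Re.q + e * (La.θ * La.zm) * ι (f +' f)) - D ≤ ι (La.LL false (La.lg ms))) where
  private
   star' : ι (a *' da *' (f +' f)) * x + ι (f +' f) * ((1 // 2) * (D * cg * σ0) * (La.θ * (t * t) + La.zm * (t' * t')) + (2 // 1) * (x * D) * (t + t')) ≤ ι (f +' f) * (D * (e * σ0) * (t + t'))
   star' = EQ (ap (\ z -> z * x + N * (H + K)) (zn (a *' da) (f +' f)) >> l (ι (a *' da)) N x H K) ~ za (zd (f +' f)) star
    where
    N = ι (f +' f)
    H = (1 // 2) * (D * cg * σ0) * (La.θ * (t * t) + La.zm * (t' * t'))
    K = (2 // 1) * (x * D) * (t + t')
    l = r5 (v0 :* v1 :* v2 :+ v1 :* (v3 :+ v4)) (v1 :* (v0 :* v2 :+ v3 :+ v4))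
   add2 = r1 (v0 :+ :2 :+ :- :2) v0
  central-bound : S (\ ms -> 𝟙 (P ms)) (vecsOver La.PM d) * S (\ ms -> 𝟙 (P ms)) (vecsOver La.PM d) * (g ^ (a *' da)) ^ (f +' f)
   ≤ g ^ (2 +' (d *' suc M' +' d *' suc M')) * ((ι (suc (f +' f)) ^ 4) ^ d * ((ι (suc (suc F)) * ι (suc (suc F))) ^ d * (ι (suc (suc F)) * ι (suc (suc F))) ^ d)) * (La.tot ^ d * La.tot ^ d) * ((8464 // 10000) * (1q + η) ^ d) ^ (f +' f)
  central-bound = EQ (ap (\ z -> S (\ ms -> 𝟙 (P ms)) (vecsOver La.PM d) * S (\ ms -> 𝟙 (P ms)) (vecsOver La.PM d) * z) (sym (zp g (a *' da) (f +' f)))) ~ Re.Exponent.rg N0 hθ hθ' a4 a4' hδ hF cg by (<≤ (RS.steps<M CS.τ CS.pτ (lt1 CS.af))) (<≤ (RS.steps<M CS.τ' CS.pτ' (lt1 CS.ae))) (hz k CS.τ CS.af t≤) (hz k' CS.τ' CS.ae t'≤) (ct2 (t≤ ~ CS.af)) (ct2 (t'≤ ~ CS.ae)) (a *' da *' (f +' f)) e star' (8464 // 10000) by Tt rows P (\ ms al h i -> cf (Tt-low (lookup Sb i) ~ +-≤ˡ (- (2 // 1)) (hrow ms al h i) ~ EQ (add2 (ι (La.rowc i (La.lg ms)))))) hL hL'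

-- Sparse sets and very small sets.

module Peripheral (Se : Setup) (f : ℕ) (Sb : Vec Bool (f +' f)) (up : Bool)
 (sc : 1 <= cn (lookup Sb) true) (sd : 1 <= cn (lookup Sb) false)
 (hθ : 1q ≤ Setup.N0 Se * Labels.θ f Sb up) (hθ' : 1q ≤ Setup.N0 Se * Labels.zm f Sb up)
 (e τ : ℚ) (pe : 0q ≤ e) (pτ : 0q ≤ τ) (τ≤ : τ ≤ 1 // 1000) (θτ : Labels.θ f Sb up * τ ≤ e)
 (xτ : Setup.x Se ≤ (1 // 1000) * τ) (xe : (2 // 1) * Setup.x Se ≤ (1 // 1000) * (e * (Labels.θ f Sb up * Labels.zm f Sb up)))
 (an : ℕ) (hA : ι an * Setup.x Se ≤ ι (f +' f) * ((497 // 1000) * (Setup.D Se * (e * (Labels.θ f Sb up * Labels.zm f Sb up)) * τ))) where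
 open Setup Se
 private
  module La = Labels f Sb up
  c : ℚ
  c = 1002 // 1000
  τ<1 : τ < 1q
  τ<1 = ℚP.≤-<-trans τ≤ (by< {1 // 1000} {1q})
  module RS = Rounding M'
  k = RS.sv τ pτ τ<1
  t = ι k * x
  t≤ : t ≤ τ
  t≤ = RS.sj τ pτ τ<1
  pt : 0q ≤ t
  pt = nc (zd k) px
  t≥ : (998 // 1000) * τ ≤ t
  t≥ = nj (nh (nh (df (RS.sD τ pτ τ<1)) (df xτ)) (nc pτ (df τ≤)) ~ EQ (l τ t x))
   where l = r3 ((v1 :- (v0 :- v0 :* v0 :- v2)) :+ ((1 :/ 1000) :* v0 :- v2) :+ v0 :* ((1 :/ 1000) :- v0)) (v1 :- (998 :/ 1000) :* v0)
  u4 : g ^ k ≤ 4 // 1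
  u4 = RS.g-steps τ pτ τ<1 ~ +-≤ʳ 1q τ≤ ~ by {1q + (1 // 1000)} {4 // 1}
  module Re = Region f Sb up sc sd d' F η η1 δ zB M' k 0
  u'4 : g ^ 0 ≤ 4 // 1
  u'4 = by {1q} {4 // 1}
  hz : ∀ k' -> ι k' * x ≤ 1 // 1000 -> ∀ j -> j <= k' -> g ^ j ≤ 1q + c * (ι j * x)
  hz k' h j le = Lattice.z-bound M' j {c} {1 // 1000} (zb px (mn le) ~ h) (by< {1 // 1000} {1q}) by (by {1q} {c * (1q - (1 // 1000))})
  t'0 : ι 0 * x ≡ 0q
  t'0 = trans (ap (_* x) ι0) (*-0ˡ x)
  σ0 = La.θ * La.zm
  pσ : 0q ≤ σ0
  pσ = nc (qa Re.θ+) (qa Re.zD)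
  pD = zd d
  N = ι (f +' f)
  star : ι an * x + N * ((1 // 2) * (D * c * σ0) * (La.θ * (t * t) + La.zm * (ι 0 * x * (ι 0 * x))) + (2 // 1) * (x * D) * (t + ι 0 * x)) ≤ N * (D * (e * σ0) * (t + ι 0 * x))
  star = EQ (ap (\ z -> ι an * x + N * ((1 // 2) * (D * c * σ0) * (La.θ * (t * t) + La.zm * (z * z)) + (2 // 1) * (x * D) * (t + z))) t'0)
   ~ nj (nh (df hA) (nc (zd (f +' f)) (nh (nc (nc pD (nc pe pσ)) (df lower)) (nh (nc {501 // 1000} by (nc (nc pD pσ) (nc pt (df (za (qa Re.θ+) t≤ ~ θτ))))) (nc (nc pD pt) (df xe)))))
    ~ EQ (l (ι an * x) N D e σ0 La.θ La.zm t τ x)) ~ EQ (ap (\ z -> N * (D * (e * σ0) * (t + z))) (sym t'0))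
   where
   -- Of the linear gain the quadratic cost consumes 501/1000, by θt ≤ e, and rounding 1/1000. The
   -- remaining 498/1000 is multiplied by t ≥ 0.998 τ.
   lower : (497 // 1000) * τ ≤ (498 // 1000) * t
   lower = zb pτ (by {497 // 1000} {(498 // 1000) * (998 // 1000)}) ~ EQ (*-as (498 // 1000) (998 // 1000) τ) ~ za {c = 498 // 1000} by t≥
   l = r10 ((v1 :* ((497 :/ 1000) :* (v2 :* (v3 :* v4) :* v8)) :- v0) :+ v1 :* (v2 :* (v3 :* v4) :* ((498 :/ 1000) :* v7 :- (497 :/ 1000) :* v8) :+ ((501 :/ 1000) :* (v2 :* v4 :* (v7 :* (v3 :- v5 :* v7))) :+ v2 :* v7 :* ((1 :/ 1000) :* (v3 :* v4) :- :2 :* v9)))) (v1 :* (v2 :* (v3 :* v4) :* (v7 :+ :0)) :- (v0 :+ v1 :* (:½ :* (v2 :* (1002 :/ 1000) :* v4) :* (v5 :* (v7 :* v7) :+ v6 :* (:0 :* :0)) :+ :2 :* (v9 :* v2) :* (v7 :+ :0))))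

 module _ (P : Vec (Vec (Fin (f +' f)) (f +' f)) d -> Bool)
  (hL : ∀ ms -> AV Is ms -> P ms ≡ true -> D * (ι La.s * Re.p + e * (La.θ * La.zm) * ι (f +' f)) - D ≤ ι (La.LL true (La.lg ms)))
  (hL' : ∀ ms -> AV Is ms -> P ms ≡ true -> D * (ι La.s' * Re.q + e * (La.θ * La.zm) * ι (f +' f)) - D ≤ ι (La.LL false (La.lg ms))) where
  -- Only the side `true` is tilted and all row thresholds are 0: away from central densities the
  -- exponential gain beats the number of sets without the rows.
  pO : S (\ ms -> 𝟙 (P ms)) (vecsOver La.PM d) * S (\ ms -> 𝟙 (P ms)) (vecsOver La.PM d) * g ^ an
   ≤ g ^ (2 +' (d *' suc M' +' d *' suc M')) * ((ι (suc (f +' f)) ^ 4) ^ d * ((ι (suc (suc F)) * ι (suc (suc F))) ^ d * (ι (suc (suc F)) * ι (suc (suc F))) ^ d)) * (La.tot ^ d * La.tot ^ d) * (1q * (1q + η) ^ d) ^ (f +' f)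
  pO = Re.Exponent.rg N0 hθ hθ' u4 u'4 hδ hF c by (<≤ (RS.steps<M τ pτ τ<1)) ℕ.z≤n (hz k (t≤ ~ τ≤)) (hz 0 (EQ t'0 ~ by {0q} {1 // 1000})) (za {c = c} by (t≤ ~ τ≤) ~ by {c * (1 // 1000)} {2 // 1}) (za {c = c} by (EQ t'0) ~ by {c * 0q} {2 // 1}) an e star 1q ze (\ _ -> 0) (Re.fo N0 hθ hθ' u4 u'4 hδ hF) P (\ ms al h i -> ℕ.z≤n) hL hL'

Sp : ∀ {A : Set} (xs : List A) d (φ : A -> ℕ) y -> (L : ∀ {k} -> Vec A k -> ℕ) -> L [] ≡ 0 -> (∀ {k} x (v : Vec A k) -> L (x ∷ v) ≡ φ x +' L v) -> S (\ v -> y ^ L v) (vecsOver xs d) ≡ S (\ x -> y ^ φ x) xs ^ d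
Sp xs zero φ y L l0 ls = trans (+-0ʳ (y ^ L [])) (ap (y ^_) l0)
Sp xs (suc d) φ y L l0 ls = trans (Sg xs d (\ v -> y ^ L v)) (trans (Sc xs (\ x _ -> trans (Sc (vecsOver xs d) (\ v _ -> trans (ap (y ^_) (ls x v)) (zr y (φ x) (L v)))) (Sa (y ^ φ x) (\ v -> y ^ L v) (vecsOver xs d) >> ap (y ^ φ x *_) (Sp xs d φ y L l0 ls) >> *-cm (y ^ φ x) (S (\ x -> y ^ φ x) xs ^ d))))
 (Sa (S (\ x -> y ^ φ x) xs ^ d) (\ x -> y ^ φ x) xs >> *-cm (S (\ x -> y ^ φ x) xs ^ d) (S (\ x -> y ^ φ x) xs)))

-- The matching is exposed starting from the vertices of the set, so that the number of
-- available partners stays close to n until the whole set has been matched.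
module InternalEdges (f : ℕ) (Sb : Vec Bool (f +' f)) where
 n = f +' f
 sb : Fin n -> Bool
 sb i = lookup Sb i

 inb : Vec (Fin n) n -> Fin n -> Bool
 inb m i = sb i ∧ sb (lookup m i)

 nL : List (Fin n) -> Vec (Fin n) n -> ℕ
 nL [] m = 0
 nL (i ∷ is) m = (if inb m i then 1 else 0) +' nL is m

 cL : List (Fin n) -> ℕ
 cL [] = 0
 cL (i ∷ is) = (if sb i then 1 else 0) +' cL is

 nL-S : ∀ is m -> ι (nL is m) ≡ S (\ i -> 𝟙 (inb m i)) is
 nL-S [] m = ι0
 nL-S (i ∷ is) m = trans (zq (if inb m i then 1 else 0) (nL is m)) (ap₂ _+_ (ι-if (inb m i)) (nL-S is m))
 cL-S : ∀ is -> ι (cL is) ≡ S (\ i -> 𝟙 (sb i)) is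
 cL-S [] = ι0
 cL-S (i ∷ is) = trans (zq (if sb i then 1 else 0) (cL is)) (ap₂ _+_ (ι-if (sb i)) (cL-S is))

 data SF : List (Fin n) -> Set where
  none : ∀ {vs} -> (∀ i -> i ∈ vs -> sb i ≡ false) -> SF vs
  cons : ∀ {v vs} -> sb v ≡ true -> SF vs -> SF (v ∷ vs)

 Si : ∀ {vs w ws} -> SF vs -> (w , ws) ∈ pi vs -> SF ws
 Si {vs} (none h) p = none (\ i q -> h i (fst (snd (pf vs p)) i q))
 Si (cons h sf) (here refl) = sf
 Si {v ∷ vs} (cons h sf) (there p) with ∈P.∈-map⁻ (\ wy -> fst wy , v ∷ snd wy) p
 ... | ((w , ws) , q , refl) = cons h (Si sf q)

 picks-nL : ∀ vs {w ws} m -> (w , ws) ∈ pi vs -> nL vs m ≡ (if inb m w then 1 else 0) +' nL ws m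
 picks-nL (v ∷ vs) m (here refl) = refl
 picks-nL (v ∷ vs) m (there p) with ∈P.∈-map⁻ (\ wy -> fst wy , v ∷ snd wy) p
 ... | ((w , ws) , q , refl) = trans (ap ((if inb m v then 1 else 0) ℕ.+_) (picks-nL vs m q)) (x+y+z (if inb m v then 1 else 0) (if inb m w then 1 else 0) (nL ws m))
  where
  x+y+z : ∀ a b c -> a +' (b +' c) ≡ b +' (a +' c)
  x+y+z a b c = trans (sym (ℕP.+-assoc a b c)) (ap (ℕ._+ c) (+-cmℕ a b) >> ℕP.+-assoc b a c)

 picks-cL : ∀ vs {w ws} -> (w , ws) ∈ pi vs -> cL vs ≡ (if sb w then 1 else 0) +' cL ws
 picks-cL (v ∷ vs) (here refl) = refl
 picks-cL (v ∷ vs) (there p) with ∈P.∈-map⁻ (\ wy -> fst wy , v ∷ snd wy) p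
 ... | ((w , ws) , q , refl) = trans (ap ((if sb v then 1 else 0) ℕ.+_) (picks-cL vs q)) (x+y+z (if sb v then 1 else 0) (if sb w then 1 else 0) (cL ws))
  where
  x+y+z : ∀ a b c -> a +' (b +' c) ≡ b +' (a +' c)
  x+y+z a b c = trans (sym (ℕP.+-assoc a b c)) (ap (ℕ._+ c) (+-cmℕ a b) >> ℕP.+-assoc b a c)

 nL-none : ∀ vs m -> (∀ i -> i ∈ vs -> sb i ≡ false) -> nL vs m ≡ 0
 nL-none [] m h = refl
 nL-none (v ∷ vs) m h rewrite h v (here refl) = nL-none vs m (\ i p -> h i (there p))

 module MGF (y μ : ℚ) (y1 : 1q ≤ y) (pμ : 0q ≤ μ) (K s0 : ℕ) (hK : ι s0 ≤ μ * ι (suc K)) where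
  py = ze ~ y1
  Pm : ℚ
  Pm = 1q + y * y * μ
  1≤Pm : 1q ≤ Pm
  1≤Pm = ba (nc (nc py py) pμ) refl
  pPm = ze ~ 1≤Pm

  -- When a vertex of the set is exposed, at most s0 of at least `suc K` candidates lie in the set,
  -- a proportion of at most μ. An inner partner contributes y², one factor for either end, and
  -- hence every exposed vertex costs at most `Pm`.
  mgf : ∀ g re bc -> Unique re -> length re ≡ g +' g -> SF re -> K +' (cL re +' cL re) <= g +' g -> cL re <= s0 ->
   S (\ m -> y ^ nL re m) (PL g re bc) ≤ ι (dd g) * Pm ^ cL re
  mgf g re bc u len (none h) hr hs = EQ (Sc (PL g re bc) (\ m _ -> ap (y ^_) (nL-none re m h)) >> Pn g re bc len) ~ EQ (sym (*-1ʳ (ι (dd g)))) ~ za (zd (dd g)) (zt (cL re) 1≤Pm)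
  mgf zero (v ∷ vs) bc u () (cons h sf) hr hs
  mgf (suc g) (v ∷ vs) bc u@(nv ∷ uv) len (cons h sf) hr hs = EQ (S-PL (\ m -> y ^ nL (v ∷ vs) m) g v vs bc) ~ Sm (pi vs) term
   ~ EQ (Sa C (\ wy -> y * y * 𝟙 (sb (fst wy)) + 1q) (pi vs) >> ap (C *_) (sym (S-map (\ w -> y * y * 𝟙 (sb w) + 1q) fst (pi vs)) >> ap (S (\ w -> y * y * 𝟙 (sb w) + 1q)) (pL vs) >> S-+ (\ w -> y * y * 𝟙 (sb w)) (\ _ -> 1q) vs >> ap₂ _+_ (Sa (y * y) (\ w -> 𝟙 (sb w)) vs >> ap (y * y *_) (sym (cL-S vs))) (Sn 1q vs >> *-1ʳ (ι (length vs)))))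
   ~ za (nc (zd (dd g)) (ng c pPm)) (+-≤ˡ (ι (length vs)) (za (nc py py) c≤))
   ~ EQ (ap (\ z -> C * (y * y * (μ * z) + z)) (ap ι lenvs) >> l (ι (dd g)) (Pm ^ c) (y * y) μ (ι (suc (g +' g))) >> ap₂ (\ a b -> a * Pm ^ b) (sym (zn (suc (g +' g)) (dd g))) (sym cv))
   where
   c = cL vs
   C = ι (dd g) * Pm ^ c
   cv : cL (v ∷ vs) ≡ suc c
   cv = ap (\ b -> (if b then 1 else 0) +' c) h
   lenvs : length vs ≡ suc (g +' g)
   lenvs = trans (suc-inj len) (+-suc g g)
   l = r5 (v0 :* v1 :* (v2 :* (v3 :* v4) :+ v4)) (v4 :* v0 :* ((:1 :+ v2 :* v3) :* v1))
   hr' : K +' (c +' c) <= g +' g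
   hr' = ≤-pred (≤-pred (≤≤ (≤≡ (sh K c)) (≤≤ (subst (\ z -> K +' (z +' z) <= suc g +' suc g) cv hr) (≤≡ (ap suc (+-suc g g))))))
    where
    open import Data.Nat.Tactic.RingSolver using () renaming (solve-∀ to solveℕ)
    sh : ∀ K c -> suc (suc (K +' (c +' c))) ≡ K +' (suc c +' suc c)
    sh = solveℕ
   hs' : c <= s0
   hs' = ≤≤ (n≤sn c) (subst (ℕ._≤ s0) cv hs)
   c≤ : ι c ≤ μ * ι (length vs)
   c≤ = mn hs' ~ hK ~ za pμ (mn (≤≤ (ℕ.s≤s (≤≤ (m≤m+n K (c +' c)) hr')) (≤≡ (sym lenvs))))
   term : ∀ wy -> wy ∈ pi vs -> S (\ m -> y ^ nL (v ∷ vs) m) (PL g (snd wy) (upd bc v (fst wy))) ≤ C * (y * y * 𝟙 (sb (fst wy)) + 1q)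
   term (w , ws) p = go (sb w) refl
    where
    pk = pf vs p
    uw = snd (pn vs uv p)
    lenw : length ws ≡ g +' g
    lenw = suc-inj (sym (snd (snd (snd pk))) >> lenvs)
    cw≤ : cL ws <= c
    cw≤ = ≤≤ (m≤n+m (cL ws) (if sb w then 1 else 0)) (≤≡ (sym (picks-cL vs p)))
    rec : S (\ m -> y ^ nL ws m) (PL g ws (upd bc v w)) ≤ C
    rec = mgf g ws (upd bc v w) uw lenw (Si sf p) (≤≤ (+-≤ℕ K (ℕP.+-mono-≤ cw≤ cw≤)) hr') (≤≤ cw≤ hs') ~ za (zd (dd g)) (em 1≤Pm cw≤)
    exp : ∀ b -> sb w ≡ b -> ∀ m -> m ∈ PL g ws (upd bc v w) -> y ^ nL (v ∷ vs) m ≡ y ^ (if b then 2 else 0) * y ^ nL ws m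
    exp b eb m q = trans (ap (y ^_) (ap₂ (\ a z -> (if a then 1 else 0) +' z) (ap₂ (\ a z -> a ∧ sb z) h (fst hd) >> eb) (picks-nL vs m p >> ap (\ a -> (if a then 1 else 0) +' nL ws m) (ap₂ (\ a z -> a ∧ sb z) eb (snd hd) >> ap (b ∧_) h >> ∧t b)) >> two b (nL ws m))) (zr y (if b then 2 else 0) (nL ws m))
     where
     hd = PL-head g v vs bc u p q
     ∧t : ∀ b -> (b ∧ true) ≡ b
     ∧t true = refl
     ∧t false = refl
     two : ∀ b k -> (if b then 1 else 0) +' ((if b then 1 else 0) +' k) ≡ (if b then 2 else 0) +' k
     two true k = refl
     two false k = refl
    go : ∀ b -> sb w ≡ b -> S (\ m -> y ^ nL (v ∷ vs) m) (PL g ws (upd bc v w)) ≤ C * (y * y * 𝟙 (sb w) + 1q)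
    go b eb = EQ (Sc (PL g ws (upd bc v w)) (exp b eb) >> Sa (y ^ (if b then 2 else 0)) (\ m -> y ^ nL ws m) (PL g ws (upd bc v w))) ~ za (ng (if b then 2 else 0) py) rec ~ EQ (*-cm (y ^ (if b then 2 else 0)) C) ~ za (nc (zd (dd g)) (ng c pPm)) (fac b) ~ EQ (ap (\ z -> C * (y * y * 𝟙 z + 1q)) (sym eb))
     where
     fac : ∀ b -> y ^ (if b then 2 else 0) ≤ y * y * 𝟙 b + 1q
     fac true = ba ze (l' y)
      where l' = r1 (v0 :* v0 :* :1 :+ :1) (v0 :* (v0 :* :1) :+ :1)
     fac false = EQ (l' y)
      where l' = r1 :1 (v0 :* v0 :* :0 :+ :1)

 rs : List (Fin n)
 rs = filterᵇ sb (allFin n) ++ filterᵇ (\ i -> not (sb i)) (allFin n)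

 private
  SF-app : ∀ A B -> (∀ i -> i ∈ A -> sb i ≡ true) -> (∀ i -> i ∈ B -> sb i ≡ false) -> SF (A ++ B)
  SF-app [] B h h' = none h'
  SF-app (v ∷ A) B h h' = cons (h v (here refl)) (SF-app A B (\ i p -> h i (there p)) h')
  not-true : ∀ {b} -> not b ≡ true -> b ≡ false
  not-true {false} e = refl
  len-split : ∀ (xs : List (Fin n)) -> length (filterᵇ sb xs ++ filterᵇ (\ i -> not (sb i)) xs) ≡ length xs
  len-split xs = trans (LP.length-++ (filterᵇ sb xs)) (go xs)
   where
   go : ∀ (xs : List (Fin n)) -> length (filterᵇ sb xs) +' length (filterᵇ (\ i -> not (sb i)) xs) ≡ length xs
   go [] = refl
   go (x ∷ xs) with sb x
   ... | true = ap suc (go xs)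
   ... | false = trans (+-suc _ _) (ap suc (go xs))

 rest₀-SF : SF rs
 rest₀-SF = SF-app (filterᵇ sb (allFin n)) (filterᵇ (\ i -> not (sb i)) (allFin n)) (\ i p -> snd (fi sb (allFin n) p)) (\ i p -> not-true (snd (fi (\ i -> not (sb i)) (allFin n) p)))
 rt : length rs ≡ n
 rt = trans (len-split (allFin n)) (lF n)
 rl : ∀ i -> i ∈ rs
 rl i = go (sb i) refl
  where
  go : ∀ b -> sb i ≡ b -> i ∈ rs
  go true e = ∈P.∈-++⁺ˡ (fr sb (allFin n) (∈P.∈-allFin i) e)
  go false e = ∈P.∈-++⁺ʳ (filterᵇ sb (allFin n)) (fr (\ i -> not (sb i)) (allFin n) (∈P.∈-allFin i) (ap not e))
 ri : Unique rs
 ri = UniqueP.++⁺ (uf sb (UniqueP.allFin⁺ n)) (uf (\ i -> not (sb i)) (UniqueP.allFin⁺ n))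
  (\ {i} (p , q) -> contra (snd (fi sb (allFin n) p)) (not-true (snd (fi (\ i -> not (sb i)) (allFin n) q))))
  where
  contra : ∀ {b} -> b ≡ true -> b ≡ false -> ⊥
  contra refl ()

 S-rest₀ : ∀ g -> (∀ i -> 0q ≤ g i) -> S g rs ≡ S g (allFin n)
 S-rest₀ g nn = ℚP.≤-antisym (S-⊆ rs (allFin n) ri (\ i _ -> ∈P.∈-allFin i) nn) (S-⊆ (allFin n) rs (UniqueP.allFin⁺ n) (\ i _ -> rl i) nn)

 s : ℕ
 s = cn sb true
 cnt-S : ∀ {k} (h : Fin k -> Fin n) -> ι (cn (sb ∘ h) true) ≡ S (\ i -> 𝟙 (sb i)) (tabulate h)
 cnt-S {zero} h = ι0
 cnt-S {suc k} h = trans (zq (if ea (sb (h fz)) true then 1 else 0) _) (ap₂ _+_ (ι-if (ea (sb (h fz)) true) >> ap 𝟙 (eqt (sb (h fz)))) (cnt-S (h ∘ fs)))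
  where
  eqt : ∀ b -> ea b true ≡ b
  eqt true = refl
  eqt false = refl
 cq : cL rs ≡ s
 cq = ι-inj (cL-S rs >> S-rest₀ (\ i -> 𝟙 (sb i)) (\ i -> nk (sb i)) >> sym (cnt-S (\ i -> i)))

 module La = Labels f Sb false
 nL-LL : ∀ m -> nL rs m ≡ kF sb (lookup (La.lab m)) true true
 nL-LL m = trans (ι-inj (nL-S rs m >> S-rest₀ (\ i -> 𝟙 (inb m i)) (\ i -> nk (inb m i)) >> Sc (allFin n) (\ i _ -> ap 𝟙 (tbl (sb i) (sb (lookup m i)))) >> sym (kF-S (\ i -> i) sb (La.bit m) true true))) (kc {s = sb} true true (\ i -> sym (VecP.lookup∘tabulate (La.bit m) i)))
  where
  tbl : ∀ a b -> (a ∧ b) ≡ (ea a true ∧ ea (ea false (xo a b)) true)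
  tbl true true = refl
  tbl true false = refl
  tbl false true = refl
  tbl false false = refl

 module _ (y μ : ℚ) (y1 : 1q ≤ y) (pμ : 0q ≤ μ) (K : ℕ) (hK : ι s ≤ μ * ι (suc K)) (Ks : K +' (s +' s) <= n) where
  private
   module Mg = MGF y μ y1 pμ K s hK
  iu : ∀ d -> S (\ ms -> y ^ La.LL true (La.lg ms)) (vecsOver (perfectMatchings n) d) ≤ La.tot ^ d * ((1q + y * y * μ) ^ s) ^ d
  iu d = EQ (Sp (perfectMatchings n) d (\ m -> kF sb (lookup (La.lab m)) true true) y (\ ms -> La.LL true (La.lg ms)) refl (\ _ _ -> refl))
   ~ mc d (S-nn (perfectMatchings n) (\ m -> ng (kF sb (lookup (La.lab m)) true true) Mg.py)) one ~ EQ (zi La.tot ((1q + y * y * μ) ^ s) d)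
   where
   one : S (\ m -> y ^ kF sb (lookup (La.lab m)) true true) (perfectMatchings n) ≤ La.tot * (1q + y * y * μ) ^ s
   one = EQ (Sc (perfectMatchings n) (\ m _ -> ap (y ^_) (sym (nL-LL m))))
    ~ S-⊆ (perfectMatchings n) (PL f rs (bk n)) (PM-unique n) (\ m p -> Pc f rs (bk n) m (PM-IsPM n m p) ri (≤≡ rt) (\ i ni -> ⊥-elim (ni (rl i))) (\ i _ -> rl (lookup m i))) (\ m -> ng (nL rs m) Mg.py)
    ~ Mg.mgf f rs (bk n) ri rt rest₀-SF (subst (\ c -> K +' (c +' c) <= n) (sym cq) Ks) (≤≡ cq)
    ~ EQ (ap (\ c -> ι (dd f) * (1q + y * y * μ) ^ c) cq) ~ zb (ng s Mg.pPm) (Pl f)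

pow≤2 : ∀ {z} d -> 0q ≤ z -> z ≤ 1q -> ι d * z ≤ 1 // 2 -> (1q + z) ^ d ≤ 2 // 1
pow≤2 {z} d pz z1 h = ca {(1q + z) ^ d} {2 // 1} {1 // 2} (>0 (1 // 2)) (za (ng d (nh ze pz)) half
 ~ za (ng d (nh ze pz)) (EQ (l (ι d) z) ~ bo d (df z1)) ~ EQ (sym (zi (1q + z) (1q + - z) d)) ~ zy d (nc (nh ze pz) (df z1)) (ba (nc pz pz) (l2 z)) ~ by {1q} {(2 // 1) * (1 // 2)})
 where
 half : 1 // 2 ≤ 1q - ι d * z
 half = by {1 // 2} {1q - (1 // 2)} ~ +-≤ʳ 1q (nm h)
 l = r2 (:1 :- v0 :* v1) (:1 :+ v0 :* (:- v1))
 l2 = r1 :1 ((:1 :+ v0) :* (:1 :+ :- v0) :+ v0 :* v0)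

module SmallSets (Se : Setup) (f : ℕ) (Sb : Vec Bool (f +' f)) (sc : 1 <= cn (lookup Sb) true)
 (tiny-θ : Setup.D Se * (Setup.D Se * Setup.D Se) * Labels.θ f Sb false ≤ 1q) where
 open Setup Se
 open InternalEdges f Sb using (module La; iu)
 private
  n = f +' f
  s = cn (lookup Sb) true
  θ = La.θ
  module Fr = Fractions s (cn (lookup Sb) false) n sc (cu (lookup Sb))
  θ+ : 0q < θ
  θ+ = pos-* (<-≤ (zj 0) (mn sc)) (io Fr.n+)
  pθ = qa θ+
  pD = zd d
  D+ : 0q < D
  D+ = zj d'
  h : ℚ
  h = (16 // 1) * (D * θ)
  hnn : 0q ≤ h
  hnn = nc {16 // 1} by (nc pD pθ)
  hD : h * D ≤ 1 // 100
  hD = ca {h * D} {1 // 100} {D} D+ (EQ (l D θ) ~ za {c = 16 // 1} by tiny-θ ~ by {(16 // 1) * 1q} {(1 // 100) * (100000000000000000000 // 1)} ~ za {c = 1 // 100} by D-big)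
   where l = r2 (:16 :* (v0 :* v1) :* v0 :* v0) (:16 :* (v0 :* (v0 :* v0) :* v1))
  h1 : h ≤ 1 // 100
  h1 = EQ (sym (*-1ʳ h)) ~ za hnn Da ~ hD
  θ≤ : θ ≤ 1 // 100
  θ≤ = EQ (sym (*-1ˡ θ)) ~ zb pθ (by {1q} {(16 // 1) * 1q} ~ za {c = 16 // 1} by Da) ~ EQ (*-as (16 // 1) D θ) ~ h1
  s-θ : ι s ≡ θ * ι n
  s-θ = Fr.fn s
  1≤nθ : 1q ≤ ι n * θ
  1≤nθ = EQ (sym ι1) ~ mn sc ~ EQ (s-θ >> *-cm θ (ι n))
  sq : ℕ -> ℚ
  sq j = ι (suc j) * ι (suc j) * ((4 // 1) * (D * θ))
  fd = lr (\ j -> sq j ≤ 1q) (\ j -> sq j ℚ.≤? 1q)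
   (EQ (ap (\ z -> z * z * ((4 // 1) * (D * θ))) ι1 >> l (D * θ)) ~ za {c = 1 // 4} by h1 ~ by {(1 // 4) * (1 // 100)} {1q}) n
   (\ q -> <⇒≱ (by< {1q} {4 // 1}) (by {4 // 1} {1q * ((4 // 1) * (1q * 1q))} ~ ma ze (by {0q} {(4 // 1) * (1q * 1q)}) (zx n) (za {c = 4 // 1} by (ma ze ze Da (1≤nθ ~ zb pθ (mn (n≤sn n))))) ~ EQ (l2 (ι (suc n)) D θ) ~ q))
   where
   l = r1 (:1 :* :1 :* (:4 :* v0)) ((1 :/ 4) :* (:16 :* v0))
   l2 = r3 (v0 :* (:4 :* (v1 :* (v0 :* v2)))) (v0 :* v0 :* (:4 :* (v1 :* v2)))
  j = fst fd
  -- About (4dθ)^(-1/2), the largest integer for which the moment (1 + 2y²θ)^d is certain to stay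
  -- below 2.
  y : ℚ
  y = ι (suc j)
  y1 : 1q ≤ y
  y1 = zx j
  py = ze ~ y1
  y-up : y * y * ((4 // 1) * (D * θ)) ≤ 1q
  y-up = fst (snd fd)
  y-low : 1q ≤ y * y * h
  y-low = qa (≰⇒> (fst (snd (snd fd)))) ~ zb (nc {4 // 1} by (nc pD pθ)) (ma (zd (suc (suc j))) (zd (suc (suc j))) y2 y2) ~ EQ (l y (D * θ))
   where
   y2 : ι (suc (suc j)) ≤ y + y
   y2 = EQ (su (suc j)) ~ +-≤ˡ y y1
   l = r2 ((v0 :+ v0) :* (v0 :+ v0) :* (:4 :* v1)) (v0 :* v0 :* (:16 :* v1))
  μ : ℚ
  μ = (2 // 1) * θ
  s4≤n : s +' s +' (s +' s) <= n
  s4≤n = cf (EQ (zq (s +' s) (s +' s) >> ap (\ z -> z + z) (zq s s >> ap (\ z -> z + z) s-θ)) ~ EQ (l θ (ι n)) ~ zb (zd n) (za {c = 4 // 1} by θ≤ ~ by {(4 // 1) * (1 // 100)} {1q}) ~ EQ (*-1ˡ (ι n)))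
   where l = r2 (v0 :* v1 :+ v0 :* v1 :+ (v0 :* v1 :+ v0 :* v1)) (:4 :* v0 :* v1)
  K : ℕ
  K = n ℕ.∸ (s +' s)
  2s≤n : s +' s <= n
  2s≤n = ≤≤ (m≤m+n (s +' s) (s +' s)) s4≤n
  Ke : K +' (s +' s) ≡ n
  Ke = ℕP.m∸n+n≡m 2s≤n
  hK : ι s ≤ μ * ι (suc K)
  hK = EQ s-θ ~ ca {θ * ι n} {μ * ι (suc K)} {2 // 1} (>0 (2 // 1)) (nj (nc (nc {4 // 1} by pθ) (df n≤2K) ~ EQ (l θ (ι n) (ι (suc K)))))
   where
   l = r3 (:4 :* v0 :* (v2 :- :½ :* v1)) (:2 :* v0 :* v2 :* :2 :- v0 :* v1 :* :2)
   n≤2K : (1 // 2) * ι n ≤ ι (suc K)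
   n≤2K = za {c = 1 // 2} by (mn nK ~ EQ (zq K K)) ~ EQ (l' (ι K)) ~ mn (n≤sn K)
    where
    l' = r1 (:½ :* (v0 :+ v0)) v0
    nK : n <= K +' K
    nK = ≤≤ (≤≡ (sym Ke)) (+-≤ℕ K (ℕP.+-cancelʳ-≤ (s +' s) (s +' s) K (≤≤ s4≤n (≤≡ (sym Ke)))))
  Pm : ℚ
  Pm = 1q + y * y * μ
  z≤ : y * y * μ ≤ 1q
  z≤ = za (nc py py) (zb pθ (by {2 // 1} {(4 // 1) * 1q} ~ za {c = 4 // 1} by Da) ~ EQ (*-as (4 // 1) D θ)) ~ y-up
  Pm2 : Pm ^ d ≤ 2 // 1
  Pm2 = pow≤2 d (nc (nc py py) (nc {2 // 1} by pθ)) z≤ (EQ (l D y θ) ~ za {c = 1 // 2} by y-up ~ by {(1 // 2) * 1q} {1 // 2})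
   where l = r3 (v0 :* (v1 :* v1 :* (:2 :* v2))) (:½ :* (v1 :* v1 :* (:4 :* (v0 :* v2))))
  e : ℚ
  e = zf * ig r
  r+ : 0q < r
  r+ = <-≤ (by< {0q} {1000000000000000000000000000000 // 1}) big
  eD : 24 // 1 ≤ e * D
  eD = ca {24 // 1} {e * D} {r} r+ (nj (nh (nh (df (za {c = zf} by rD')) (nc {(1595 // 1) - (24 // 1)} by (df big))) (by {0q} {((1595 // 1) - (24 // 1)) * (1000000000000000000000000000000 // 1) - (1595 // 1)}) ~ EQ (l r D >> ap (\ z -> zf * z * D - (24 // 1) * r) (sym (ic r+))) ~ EQ (l2 (ig r) D r)))
   where
   l = r2 (((319 :/ 200) :* v1 :- (319 :/ 200) :* ((1000 :/ 1) :* (v0 :- :1))) :+ ((1595 :/ 1) :- (24 :/ 1)) :* (v0 :- (1000000000000000000000000000000 :/ 1)) :+ (((1595 :/ 1) :- (24 :/ 1)) :* (1000000000000000000000000000000 :/ 1) :- (1595 :/ 1))) ((319 :/ 200) :* :1 :* v1 :- (24 :/ 1) :* v0)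
   l2 = r3 ((319 :/ 200) :* (v2 :* v0) :* v1 :- (24 :/ 1) :* v2) ((319 :/ 200) :* v0 :* v1 :* v2 :- (24 :/ 1) :* v2)
  -- The set has at least 24 inner labels per vertex by `eD`, so the tail costs y^(-24) ≤ h^12 per
  -- vertex. Two of the twelve factors h provide θ², two more pay for the resulting D² by h D ≤
  -- 1/100.
  h12 : (2 // 1) * h ^ 12 ≤ (1 // 8) * (θ * θ)
  h12 = EQ (l D θ) ~ za (nc {512 // 1} by (nc pθ pθ)) (ma (sn (h * D)) (ng 8 hnn) (ma (nc hnn pD) (nc hnn pD) hD hD) (zy 8 hnn (h1 ~ by {1 // 100} {1q}))) ~ EQ (l2 (θ * θ)) ~ zb (nc pθ pθ) (by {(512 // 1) * ((1 // 100) * (1 // 100))} {1 // 8})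
   where
   l' = r3 (:2 :* (:16 :* (v0 :* v1) :* (:16 :* (v0 :* v1) :* ((:16 :* (v0 :* v1)) :* (:16 :* (v0 :* v1) :* v2))))) ((512 :/ 1) :* (v1 :* v1) :* (:16 :* (v0 :* v1) :* v0 :* (:16 :* (v0 :* v1) :* v0) :* v2))
   l : ∀ D θ -> (2 // 1) * ((16 // 1) * (D * θ)) ^ 12 ≡ (512 // 1) * (θ * θ) * ((16 // 1) * (D * θ) * D * ((16 // 1) * (D * θ) * D) * ((16 // 1) * (D * θ)) ^ 8)
   l D θ = l' D θ (((16 // 1) * (D * θ)) ^ 8)
   l2 = r1 ((512 :/ 1) :* v0 :* ((1 :/ 100) :* (1 :/ 100) :* :1)) ((512 :/ 1) :* ((1 :/ 100) :* (1 :/ 100)) :* v0)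

 module _ (P : Vec (Vec (Fin (f +' f)) (f +' f)) d -> Bool)
  (hL : ∀ ms -> AV Is ms -> P ms ≡ true -> zf * ig r * D * ι (cn (lookup Sb) true) ≤ ι (La.LL true (La.lg ms))) where
  private
   bh : ℚ
   bh = S (\ ms -> 𝟙 (P ms)) (vecsOver (perfectMatchings n) d)
   bm : 0q ≤ bh
   bm = S-nn (vecsOver (perfectMatchings n) d) (\ ms -> nk (P ms))
   pw : ∀ ms -> ms ∈ vecsOver (perfectMatchings n) d -> ∀ b -> P ms ≡ b -> y ^ (24 *' s) * 𝟙 b ≤ y ^ La.LL true (La.lg ms)
   pw ms q true e' = EQ (*-1ʳ (y ^ (24 *' s))) ~ em y1 (cf (EQ (zn 24 s >> ap (_* ι s) (li 24)) ~ zb (zd s) eD ~ hL ms (Ae (perfectMatchings n) d ms q (\ m r -> PM-IsPM n m r)) e'))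
   pw ms q false e' = EQ (*-0ʳ (y ^ (24 *' s))) ~ ng (La.LL true (La.lg ms)) py
   sC : y ^ (24 *' s) * bh ≤ La.tot ^ d * (2 // 1) ^ s
   sC = EQ (sym (Sa (y ^ (24 *' s)) (\ ms -> 𝟙 (P ms)) (vecsOver (perfectMatchings n) d))) ~ Sm (vecsOver (perfectMatchings n) d) (\ ms q -> pw ms q (P ms) refl)
    ~ iu y μ y1 (nc {2 // 1} by pθ) K hK (≤≡ Ke) d
    ~ za (ng d (zd (length (perfectMatchings n)))) (EQ (sym (zp Pm s d) >> ap (Pm ^_) (*-cmℕ s d) >> zp Pm d s) ~ mc s (ng d (nh ze (nc (nc py py) (nc {2 // 1} by pθ)))) Pm2)
   y24 : y ^ (24 *' s) * (h ^ 12) ^ s ≡ ((y * y * h) ^ 12) ^ s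
   y24 = trans (ap (_* (h ^ 12) ^ s) (zp y 24 s)) (sym (zi (y ^ 24) (h ^ 12) s) >> ap (_^ s) (ap (_* h ^ 12) (zr y 12 12 >> sym (zi y y 12)) >> sym (zi (y * y) h 12)))
  small-bound : bh ≤ La.tot ^ d * ((1 // 8) * (θ * θ)) ^ s
  small-bound = EQ (sym (*-1ˡ bh)) ~ zb bm (zt s (zt 12 y-low) ~ EQ (sym y24)) ~ EQ (l (y ^ (24 *' s)) ((h ^ 12) ^ s) bh) ~ zb (ng s (ng 12 hnn)) sC
   ~ EQ (*-as (La.tot ^ d) ((2 // 1) ^ s) ((h ^ 12) ^ s) >> ap (La.tot ^ d *_) (sym (zi (2 // 1) (h ^ 12) s))) ~ za (ng d (zd (length (perfectMatchings n)))) (mc s (nc {2 // 1} by (ng 12 hnn)) h12)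
   where l = r3 (v0 :* v1 :* v2) (v0 :* v2 :* v1)

-- Cut sizes, and their change when one vertex moves.

Sl : ∀ {k n} (g : Fin n -> ℚ) (h : Fin (suc k) -> Fin n) -> S g (tabulate h) ≡ g (h fz) + S (\ i -> g (h (fs i))) (allFin k)
Sl {k} g h = ap (g (h fz) +_) (ap (S g) (sym (LP.map-tabulate (\ i -> i) (\ i -> h (fs i)))) >> S-map g (\ i -> h (fs i)) (allFin k))

sS : ∀ {A : Set} (g : A -> ℚ) xs -> sumℚ (map g xs) ≡ S g xs
sS g [] = refl
sS g (x ∷ xs) = ap (g x +_) (sS g xs)

im : ∀ b -> indℚ b ≡ 𝟙 b
im true = refl
im false = refl

cx : ∀ {n} (s : Fin n -> Bool) a -> ι (cn s a) ≡ S (\ i -> 𝟙 (ea (s i) a)) (allFin n)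
cx {zero} s a = ι0
cx {suc n} s a = trans (zq (if ea (s fz) a then 1 else 0) _) (ap₂ _+_ (ι-if (ea (s fz) a)) (cx (\ i -> s (fs i)) a) >> sym (Sl {n} {suc n} (\ i -> 𝟙 (ea (s i) a)) (\ i -> i)))

S-delta : ∀ {n} (i : Fin n) -> S (\ j -> 𝟙 ⌊ j Fin.≟ i ⌋) (allFin n) ≡ 1q
S-delta {suc n} fz = trans (Sl {n} {suc n} (\ j -> 𝟙 ⌊ j Fin.≟ fz ⌋) (\ j -> j)) (ap (1q +_) (S-zero (allFin n)) >> +-0ʳ 1q)
S-delta {suc n} (fs i) = trans (Sl {n} {suc n} (\ j -> 𝟙 ⌊ j Fin.≟ fs i ⌋) (\ j -> j)) ((+-0ˡ _) >> Sc (allFin n) (\ j _ -> ap 𝟙 (e j)) >> S-delta i)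
 where
 e : ∀ j -> ⌊ fs j Fin.≟ fs i ⌋ ≡ ⌊ j Fin.≟ i ⌋
 e j with j Fin.≟ i
 ... | yes _ = refl
 ... | no _ = refl

nt : ∀ b -> 𝟙 (not b) ≡ 1q - 𝟙 b
nt true = refl
nt false = refl

module Cuts {n : ℕ} where
 Mt : Set
 Mt = Vec (Fin n) n

 xi : Vec Bool n -> Mt -> Fin n -> Bool
 xi T m i = xo (lookup T i) (lookup T (lookup m i))

 xS : Vec Bool n -> Mt -> ℕ
 xS T m = kF (lookup T) (xi T m) true true

 XS : ∀ {k} -> Vec Bool n -> Vec Mt k -> ℕ
 XS T [] = 0
 XS T (m ∷ ms) = xS T m +' XS T ms

 cS : ∀ {k} -> Vec Bool n -> Fin n -> Vec Mt k -> ℕ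
 cS T i [] = 0
 cS T i (m ∷ ms) = (if xi T m i then 1 else 0) +' cS T i ms

 sz : Vec Bool n -> Bool -> ℕ
 sz T a = cn (lookup T) a

 private
  eqBt : ∀ a -> ea a true ≡ a
  eqBt true = refl
  eqBt false = refl
  eqBf : ∀ a -> ea a false ≡ not a
  eqBf true = refl
  eqBf false = refl

 cutK≡ : ∀ T -> cutK n T ≡ ι (sz T true) * ι (sz T false)
 cutK≡ T = trans (sS _ (allFin n)) (trans (Sc (allFin n) (\ i _ -> trans (sS _ (allFin n)) (Sc (allFin n) (\ j _ -> trans (im (crosses T i j)) (sp (lookup T i) (lookup T j))) >> Sa (𝟙 (ea (lookup T i) true)) (\ j -> 𝟙 (ea (lookup T j) false)) (allFin n) >> ap (𝟙 (ea (lookup T i) true) *_) (sym (cx (lookup T) false)) >> *-cm (𝟙 (ea (lookup T i) true)) (ι (sz T false)))))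
  (Sa (ι (sz T false)) (\ i -> 𝟙 (ea (lookup T i) true)) (allFin n) >> ap (ι (sz T false) *_) (sym (cx (lookup T) true)) >> *-cm (ι (sz T false)) (ι (sz T true))))
  where
  sp : ∀ a b -> 𝟙 (a ∧ not b) ≡ 𝟙 (ea a true) * 𝟙 (ea b false)
  sp true true = refl
  sp true false = refl
  sp false true = refl
  sp false false = refl

 xS-S : ∀ T m -> ι (xS T m) ≡ S (\ i -> 𝟙 (crosses T i (lookup m i))) (allFin n)
 xS-S T m = trans (kF-S (\ i -> i) (lookup T) (xi T m) true true) (Sc (allFin n) (\ i _ -> ap 𝟙 (sp (lookup T i) (lookup T (lookup m i)))))
  where
  sp : ∀ a b -> (ea a true ∧ ea (xo a b) true) ≡ (a ∧ not b)
  sp true true = refl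
  sp true false = refl
  sp false true = refl
  sp false false = refl

 cutH≡ : ∀ {d} w (ms : Vec Mt d) T -> cutH w ms T ≡ w * ι (XS T ms)
 cutH≡ {d} w ms T = ap (w *_) (sS _ (allFin d) >> Sc (allFin d) (\ k _ -> trans (sS _ (allFin n)) (Sc (allFin n) (\ i _ -> im (crosses T i (lookup (lookup ms k) i))) >> sym (xS-S T (lookup ms k)))) >> go ms)
  where
  go : ∀ {d} (ms : Vec Mt d) -> S (\ k -> ι (xS T (lookup ms k))) (allFin d) ≡ ι (XS T ms)
  go [] = sym ι0
  go {suc d} (m ∷ ms) = trans (Sl {d} {suc d} (\ k -> ι (xS T (lookup (m ∷ ms) k))) (\ k -> k)) (ap (ι (xS T m) +_) (go ms) >> sym (zq (xS T m) (XS T ms)))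

 double-xS : ∀ T m -> Is m -> ι (xS T m) + ι (xS T m) ≡ S (\ i -> 𝟙 (xi T m i)) (allFin n)
 double-xS T m pm = trans (ap₂ _+_ (kF-S (\ i -> i) (lookup T) (xi T m) true true) (ap ι (cy (lookup T) (lookup m) (fst pm)) >> kF-S (\ i -> i) (lookup T) (xi T m) false true)) (sym (S-+ (\ i -> 𝟙 (ea (lookup T i) true ∧ ea (xi T m i) true)) (\ i -> 𝟙 (ea (lookup T i) false ∧ ea (xi T m i) true)) (allFin n)) >> Sc (allFin n) (\ i _ -> sp (lookup T i) (xi T m i)))
  where
  sp : ∀ a b -> 𝟙 (ea a true ∧ ea b true) + 𝟙 (ea a false ∧ ea b true) ≡ 𝟙 b
  sp true true = refl
  sp true false = refl
  sp false true = refl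
  sp false false = refl

 fp : Vec Bool n -> Fin n -> Vec Bool n
 fp T i = Vec.updateAt T i not

 private
  fl-i : ∀ T i -> lookup (fp T i) i ≡ not (lookup T i)
  fl-i T i = VecP.lookup∘updateAt i T
  fl-o : ∀ T i j -> j ≢ i -> lookup (fp T i) j ≡ lookup T j
  fl-o T i j ne = VecP.lookup∘updateAt′ j i ne T
  xn : ∀ a b -> xo (not a) b ≡ not (xo a b)
  xn true true = refl
  xn true false = refl
  xn false true = refl
  xn false false = refl
  xr : ∀ a b -> xo a (not b) ≡ not (xo b a)
  xr true true = refl
  xr true false = refl
  xr false true = refl
  xr false false = refl
  xm : ∀ a b -> xo a b ≡ xo b a
  xm true true = refl
  xm true false = refl
  xm false true = refl
  xm false false = refl

 -- Summed over all vertices, each crossing edge is counted twice. Moving i negates the crossing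
 -- bits of i and of its partner and no others, and both bits were equal before.
 flip-xS : ∀ T i m -> Is m -> ι (xS (fp T i) m) ≡ ι (xS T m) + (1q - (𝟙 (xi T m i) + 𝟙 (xi T m i)))
 flip-xS T i m pm = half _ _ (double-xS (fp T i) m pm >> Sc (allFin n) (\ j _ -> pt j) >> S-+ (\ j -> 𝟙 (xi T m j)) (\ j -> c * (𝟙 ⌊ j Fin.≟ i ⌋ + 𝟙 ⌊ j Fin.≟ i' ⌋)) (allFin n) >> ap₂ _+_ (sym (double-xS T m pm)) (Sa c (\ j -> 𝟙 ⌊ j Fin.≟ i ⌋ + 𝟙 ⌊ j Fin.≟ i' ⌋) (allFin n) >> ap (c *_) (S-+ (\ j -> 𝟙 ⌊ j Fin.≟ i ⌋) (\ j -> 𝟙 ⌊ j Fin.≟ i' ⌋) (allFin n) >> ap₂ _+_ (S-delta i) (S-delta i'))) >> l (ι (xS T m)) c)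
  where
  i' = lookup m i
  b = 𝟙 (xi T m i)
  c = 1q - (b + b)
  l = r2 (v0 :+ v0 :+ v1 :* (:1 :+ :1)) ((v0 :+ v1) :+ (v0 :+ v1))
  half : ∀ a b -> a + a ≡ b + b -> a ≡ b
  half a b e = trans (l2 a) (ap ((1 // 2) *_) e >> sym (l2 b))
   where l2 = r1 v0 (:½ :* (v0 :+ v0))
  ii : i' ≢ i
  ii = snd pm i
  pt : ∀ j -> 𝟙 (xi (fp T i) m j) ≡ 𝟙 (xi T m j) + c * (𝟙 ⌊ j Fin.≟ i ⌋ + 𝟙 ⌊ j Fin.≟ i' ⌋)
  pt j with j Fin.≟ i | j Fin.≟ i'
  ... | yes refl | yes e = ⊥-elim (ii (sym e))
  ... | yes refl | no _ = trans (ap 𝟙 (ap₂ xo (fl-i T i) (fl-o T i i' ii) >> xn (lookup T i) (lookup T i'))) (nt (xi T m i) >> l3 b)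
   where l3 = r1 (:1 :- v0) (v0 :+ (:1 :- (v0 :+ v0)) :* (:1 :+ :0))
  ... | no ne | yes refl = trans (ap 𝟙 (ap₂ xo (fl-o T i i' ii) (ap (lookup (fp T i)) (fst pm i) >> fl-i T i) >> xr (lookup T i') (lookup T i))) (nt (xi T m i) >> l3 b >> ap (\ z -> 𝟙 z + c * (0q + 1q)) (xm (lookup T i) (lookup T i') >> ap (\ z -> xo (lookup T i') (lookup T z)) (sym (fst pm i))))
   where l3 = r1 (:1 :- v0) (v0 :+ (:1 :- (v0 :+ v0)) :* (:0 :+ :1))
  ... | no ne | no ne' = trans (ap 𝟙 (ap₂ xo (fl-o T i j ne) (fl-o T i (lookup m j) (\ e -> ne' (sym (fst pm j) >> ap (lookup m) e))))) (l3 (𝟙 (xi T m j)) c)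
   where l3 = r2 v0 (v0 :+ v1 :* (:0 :+ :0))

 flip-XS : ∀ T i {k} (ms : Vec Mt k) -> AV Is ms -> ι (XS (fp T i) ms) ≡ ι (XS T ms) + (ι k - (ι (cS T i ms) + ι (cS T i ms)))
 flip-XS T i [] a = trans (l (ι 0)) (ap (\ z -> ι 0 + (z - (z + z))) (sym ι0))
  where l = r1 v0 (v0 :+ (:0 :- (:0 :+ :0)))
 flip-XS T i {suc k} (m ∷ ms) (pm , a) = trans (zq (xS (fp T i) m) (XS (fp T i) ms)) (ap₂ _+_ (flip-xS T i m pm) (flip-XS T i ms a) >> l (ι (xS T m)) (𝟙 (xi T m i)) (ι (XS T ms)) (ι k) (ι (cS T i ms)) >> ap₂ _+_ (sym (zq (xS T m) (XS T ms))) (ap₂ (\ u v -> u - (v + v)) (sym (su k)) (ap (_+ ι (cS T i ms)) (sym (ι-if (xi T m i))) >> sym (zq (if xi T m i then 1 else 0) (cS T i ms)))))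
  where l = r5 (v0 :+ (:1 :- (v1 :+ v1)) :+ (v2 :+ (v3 :- (v4 :+ v4)))) ((v0 :+ v2) :+ ((:1 :+ v3) :- ((v1 :+ v4) :+ (v1 :+ v4))))

 dir : Vec Bool n -> Fin n -> ℚ
 dir T i = 1q - (𝟙 (lookup T i) + 𝟙 (lookup T i))

 flip-sz : ∀ T i -> ι (sz (fp T i) true) ≡ ι (sz T true) + dir T i
 flip-sz T i = trans (cx (lookup (fp T i)) true) (Sc (allFin n) (\ j _ -> pt j) >> S-+ (\ j -> 𝟙 (ea (lookup T j) true)) (\ j -> dir T i * 𝟙 ⌊ j Fin.≟ i ⌋) (allFin n) >> ap₂ _+_ (sym (cx (lookup T) true)) (Sa (dir T i) (\ j -> 𝟙 ⌊ j Fin.≟ i ⌋) (allFin n) >> ap (dir T i *_) (S-delta i) >> *-1ʳ (dir T i)))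
  where
  pt : ∀ j -> 𝟙 (ea (lookup (fp T i) j) true) ≡ 𝟙 (ea (lookup T j) true) + dir T i * 𝟙 ⌊ j Fin.≟ i ⌋
  pt j with j Fin.≟ i
  ... | yes refl = trans (ap 𝟙 (eqBt (lookup (fp T i) i) >> fl-i T i)) (nt (lookup T i) >> l (𝟙 (lookup T i)) >> ap (\ z -> 𝟙 z + dir T i * 1q) (sym (eqBt (lookup T i))))
   where l = r1 (:1 :- v0) (v0 :+ (:1 :- (v0 :+ v0)) :* :1)
  ... | no ne = trans (ap (\ z -> 𝟙 (ea z true)) (fl-o T i j ne)) (l (𝟙 (ea (lookup T j) true)) (dir T i))
   where l = r2 v0 (v0 :+ v1 :* :0)

 sz-sum : ∀ T -> ι (sz T true) + ι (sz T false) ≡ ι n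
 sz-sum T = trans (sym (zq (sz T true) (sz T false))) (ap ι (cu (lookup T)))

 flip-sz' : ∀ T i -> ι (sz (fp T i) false) ≡ ι (sz T false) - dir T i
 flip-sz' T i = trans (l (ι (sz (fp T i) true)) (ι (sz (fp T i) false))) (ap₂ _-_ (sz-sum (fp T i) >> sym (sz-sum T)) (flip-sz T i) >> l2 (ι (sz T true)) (ι (sz T false)) (dir T i))
  where
  l = r2 v1 (v0 :+ v1 :- v0)
  l2 = r3 (v0 :+ v1 :- (v0 :+ v2)) (v1 :- v2)

 compl : Vec Bool n -> Vec Bool n
 compl T = Vec.map not T

 cC : ∀ T a -> sz (compl T) a ≡ sz T (not a)
 cC T a = ι-inj (cx (lookup (compl T)) a >> Sc (allFin n) (\ i _ -> ap 𝟙 (ap (\ z -> ea z a) (VecP.lookup-map i not T) >> sp (lookup T i) a)) >> sym (cx (lookup T) (not a)))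
  where
  sp : ∀ b a -> ea (not b) a ≡ ea b (not a)
  sp true true = refl
  sp true false = refl
  sp false true = refl
  sp false false = refl

 compl-xS : ∀ T m -> Is m -> xS (compl T) m ≡ xS T m
 compl-xS T m pm = trans (ι-inj (kF-S (\ i -> i) (lookup (compl T)) (xi (compl T) m) true true >> Sc (allFin n) (\ i _ -> ap 𝟙 (ap₂ (\ a b -> ea a true ∧ ea (xo a b) true) (VecP.lookup-map i not T) (VecP.lookup-map (lookup m i) not T) >> sp (lookup T i) (lookup T (lookup m i)))) >> sym (kF-S (\ i -> i) (lookup T) (xi T m) false true))) (sym (cy (lookup T) (lookup m) (fst pm)))
  where
  sp : ∀ a b -> (ea (not a) true ∧ ea (xo (not a) (not b)) true) ≡ (ea a false ∧ ea (xo a b) true)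
  sp true true = refl
  sp true false = refl
  sp false true = refl
  sp false false = refl

 compl-XS : ∀ T {k} (ms : Vec Mt k) -> AV Is ms -> XS (compl T) ms ≡ XS T ms
 compl-XS T [] a = refl
 compl-XS T (m ∷ ms) (pm , a) = ap₂ ℕ._+_ (compl-xS T m pm) (compl-XS T ms a)

aS : ∀ {n} (T : Vec Bool n) -> T ∈ allSubsets n
aS T = vc (true ∷ false ∷ []) T (\ i -> mem (lookup T i))
 where
 mem : ∀ b -> b ∈ (true ∷ false ∷ [])
 mem true = here refl
 mem false = there (here refl)

argmax : ∀ {A : Set} (V : A -> ℚ) (x : A) xs -> ∃[ y ] (∀ z -> z ∈ (x ∷ xs) -> V z ≤ V y)
argmax V x [] = x , (\ { z (here refl) -> ≤-refl })
argmax V x (x' ∷ xs) = go (argmax V x' xs)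
 where
 go : ∃[ y ] (∀ z -> z ∈ (x' ∷ xs) -> V z ≤ V y) -> ∃[ y ] (∀ z -> z ∈ (x ∷ x' ∷ xs) -> V z ≤ V y)
 go (y , h) = ga (≤-tot (V x) (V y))
  where
  ga : V x ≤ V y ⊎ V y ≤ V x -> ∃[ y ] (∀ z -> z ∈ (x ∷ x' ∷ xs) -> V z ≤ V y)
  ga (inj₁ p) = y , (\ { z (here refl) -> p ; z (there q) -> h z q })
  ga (inj₂ p) = x , (\ { z (here refl) -> ≤-refl ; z (there q) -> h z q ~ p })

dv : ∀ a d' -> (ℤ.+ a) / suc d' * ι (suc d') ≡ ι a
dv a d' = ℚP.toℚᵘ-injective (ℚᵘP.≃-trans (ℚP.toℚᵘ-homo-* ((ℤ.+ a) / suc d') (ι (suc d'))) (ℚᵘP.≃-trans (ℚᵘP.*-cong (ℚP.toℚᵘ-fromℚᵘ (ℚᵘ.mkℚᵘ (ℤ.+ a) d')) (ta (suc d'))) (ℚᵘP.≃-trans (ℚᵘ.*≡* (ℤP.*-assoc (ℤ.+ a) (ℤ.+ suc d') (ℤ.+ 1) >> ap (ℤ.+ a ℤ.*_) (ℤP.*-identityʳ (ℤ.+ suc d') >> ap (\ k -> ℤ.+ suc k) (sym (ℕP.*-identityʳ d'))))) (ℚᵘP.≃-sym (ta a)))))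

sgn : Bool -> ℚ
sgn true = 1q
sgn false = - 1q

module Excess {n d : ℕ} (w e : ℚ) where
 open Cuts {n}
 KK : Vec Bool n -> ℚ
 KK T = ι (sz T true) * ι (sz T false)
 -- The deviation of the sampled cut from the complete cut, in the direction `up`, minus what is
 -- tolerated. The sparsifier property with error e says that it is positive for no set and neither
 -- direction.
 V : Bool -> Vec (Vec (Fin n) n) d -> Vec Bool n -> ℚ
 V up ms T = sgn up * (w * ι (XS T ms) - KK T) - e * KK T

module EventFacts (f d' : ℕ) (Sb : Vec Bool (f +' f)) (up : Bool) (w e : ℚ) (pe : 0q ≤ e) (e1 : e ≤ 1q)
 (sc : 1 <= cn (lookup Sb) true) (sd : 1 <= cn (lookup Sb) false)
 (wD : w * ι (suc d') ≡ ι (f +' f) - 1q) (nD : ι (suc d') ≤ ι (f +' f) - 1q)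
 (ms : Vec (Vec (Fin (f +' f)) (f +' f)) (suc d')) (pm : AV Is ms)
 (pos : 0q ≤ Excess.V {f +' f} {suc d'} w e up ms Sb) where
 open Labels f Sb up
 open Cuts {n}
 open Excess {n} {suc d'} w e
 private
  d = suc d'
  D N N1 iN Sd Sf X K : ℚ
  D = ι d
  N = ι n
  N1 = N - 1q
  iN = ig N
  Sd = ι s
  Sf = ι s'
  X = ι (XS Sb ms)
  K = Sd * Sf
  module Fr = Fractions s s' n sc (cu sb)
  pD = zd d
  pN = zd n
  p1 = zd s
  p2 = zd s'
  pX = zd (XS Sb ms)
  pK : 0q ≤ K
  pK = nc p1 p2
  piN = ie Fr.n+
  N-iN : N * iN ≡ 1q
  N-iN = ic Fr.n+
  sN : Sd + Sf ≡ N
  sN = sz-sum Sb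
  N1+ : 0q < N1
  N1+ = <-≤ (zj d') nD
  pN1 = qa N1+
  S₂≤N1 : Sf ≤ N1
  S₂≤N1 = ba (df (subst (_≤ Sd) ι1 (mn sc))) (ap (_- 1q) (sym sN) >> l Sd Sf)
   where l = r2 (v0 :+ v1 :- :1) (v1 :+ (v0 :- :1))
  S₁≤N : Sd ≤ N
  S₁≤N = ba p2 (sym sN)
  XX≡ : ∀ {k} (ms : Vec (Vec (Fin n) n) k) -> XX ms ≡ XS Sb ms
  XX≡ [] = refl
  XX≡ (m ∷ ms) = ap (xS Sb m ℕ.+_) (XX≡ ms)
  θ≡ : θ + zm ≡ 1q
  θ≡ = Fr.fc

  -- positivity of the excess, multiplied by d
  raw : ∀ ς -> 0q ≤ ς * (w * X - K) - e * K -> 0q ≤ ς * (N1 * X - D * K) - e * (D * K)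
  raw ς h = nc h pD ~ EQ (l ς w X K e D >> ap (\ z -> ς * (z * X - D * K) - e * (D * K)) wD)
   where l = r6 ((v0 :* (v1 :* v2 :- v3) :- v4 :* v3) :* v5) (v0 :* (v1 :* v5 :* v2 :- v5 :* v3) :- v4 :* (v5 :* v3))
  up-raw : up ≡ true -> (1q + e) * (D * K) ≤ N1 * X
  up-raw refl = nj (raw 1q pos ~ EQ (l (N1 * X) (D * K) e))
   where l = r3 (:1 :* (v0 :- v1) :- v2 :* v1) (v0 :- (:1 :+ v2) :* v1)
  low-raw : up ≡ false -> N1 * X ≤ (1q - e) * (D * K)
  low-raw refl = nj (raw (- 1q) pos ~ EQ (l (N1 * X) (D * K) e))
   where l = r3 (:- :1 :* (v0 :- v1) :- v2 :* v1) ((:1 :- v2) :* v1 :- v0)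

  up-X : up ≡ true -> (1q + e) * (D * K) * iN ≤ X
  up-X u = di Fr.n+ (up-raw u ~ zb pX (ba {N1} {N} {1q} ze (l N)) ~ EQ (*-cm N X))
   where l = r1 v0 (v0 :- :1 :+ :1)
  low-X : up ≡ false -> X ≤ (1q - e) * (D * K) * iN + D
  low-X u = ca {X} {a + D} {N1} N1+ (EQ (*-cm X N1) ~ low-raw u ~ nj (df a≤ ~ EQ (l a D N >> ap (\ z -> (a + D) * N1 - z) aN)))
   where
   a = (1q - e) * (D * K) * iN
   aN : a * N ≡ (1q - e) * (D * K)
   aN = trans (l' ((1q - e) * (D * K)) iN N) (ap ((1q - e) * (D * K) *_) N-iN >> *-1ʳ ((1q - e) * (D * K)))
    where l' = r3 (v0 :* v1 :* v2) (v0 :* (v2 :* v1))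
   a≤ : a ≤ D * N1
   a≤ = zb piN (ma (df e1) (nc pD pK) (ba {1q - e} {1q} pe (lz e)) (za pD (ma p1 p2 S₁≤N S₂≤N1))) ~ EQ (l' D N N1 iN >> ap (D * N1 *_) N-iN >> *-1ʳ (D * N1))
    where
    lz = r1 :1 (:1 :- v0 :+ v0)
    l' = r4 (:1 :* (v0 :* (v1 :* v2)) :* v3) (v0 :* v2 :* (v1 :* v3))
   l = r3 (v1 :* (v2 :- :1) :- v0) ((v0 :+ v1) :* (v2 :- :1) :- v0 :* v2)

  θθ'N : θ * zm * N ≡ K * iN
  θθ'N = trans (l Sd Sf iN N) (ap (K * iN *_) N-iN >> *-1ʳ (K * iN))
   where l = r4 (v0 :* v2 :* (v1 :* v2) :* v3) (v0 :* v1 :* v2 :* (v3 :* v2))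
  -- For an excess, replacing n - 1 by n only helps. For a deficit it may cost up to d crossing
  -- edges, which explains the subtracted D.
  LL-gen : ∀ b z -> (up ≡ true -> z ≡ K * iN) -> (up ≡ false -> z ≡ ι (cn sb b) - K * iN) -> D * (z + e * (θ * zm) * N) - D ≤ ι (LL b (lg ms))
  LL-gen b z zu zl = go up refl
   where
   go : ∀ u -> up ≡ u -> D * (z + e * (θ * zm) * N) - D ≤ ι (LL b (lg ms))
   go true u = EQ (ap₂ (\ a c -> D * (a + c) - D) (zu u) (*-as e (θ * zm) N >> ap (e *_) θθ'N)) ~ ba {D * (K * iN + e * (K * iN)) - D} {(1q + e) * (D * K) * iN} pD (l D K iN e) ~ up-X u ~ EQ (ap ι (sym (LL-up u ms pm b >> XX≡ ms)))
    where l = r4 ((:1 :+ v3) :* (v0 :* v1) :* v2) (v0 :* (v1 :* v2 :+ v3 :* (v1 :* v2)) :- v0 :+ v0)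
   go false u = EQ (ap₂ (\ a c -> D * (a + c) - D) (zl u) (*-as e (θ * zm) N >> ap (e *_) θθ'N)) ~ nj (df (low-X u) ~ EQ (l D K iN e (ι (cn sb b)) X >> ap (_- (D * (ι (cn sb b) - K * iN + e * (K * iN)) - D)) (sym Le)))
    where
    l = r6 ((:1 :- v3) :* (v0 :* v1) :* v2 :+ v0 :- v5) ((v4 :* v0 :- v5) :- (v0 :* (v4 :- v1 :* v2 :+ v3 :* (v1 :* v2)) :- v0))
    Le : ι (LL b (lg ms)) ≡ ι (cn sb b) * D - X
    Le = trans (l2 (ι (LL b (lg ms))) X) (ap (_- X) (ap (ι (LL b (lg ms)) +_) (ap ι (sym (XX≡ ms))) >> sym (zq (LL b (lg ms)) (XX ms)) >> ap ι (LL-low u ms pm b) >> zn (cn sb b) d))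
     where l2 = r2 v0 (v0 :+ v1 :- v1)
  part : ∀ a b -> a + b ≡ N -> a * (a * iN) ≡ a - a * b * iN
  part a b ab = trans (l a b iN) (ap (\ z -> a * (z * iN) - a * b * iN) ab >> ap (\ z -> a * z - a * b * iN) N-iN >> ap (_- a * b * iN) (*-1ʳ a))
   where l = r3 (v0 :* (v0 :* v2)) (v0 :* ((v0 :+ v1) :* v2) :- v0 :* v1 :* v2)

 LL-true : ι (suc d') * (ι s * pj up zm θ + e * (θ * zm) * ι n) - ι (suc d') ≤ ι (LL true (lg ms))
 LL-true = LL-gen true (Sd * pj up zm θ) (\ u -> trans (ap (\ b -> Sd * pj b zm θ) u) (sym (*-as Sd Sf iN))) (\ u -> trans (ap (\ b -> Sd * pj b zm θ) u) (part Sd Sf sN))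
 LL-false : ι (suc d') * (ι s' * pj up θ zm + e * (θ * zm) * ι n) - ι (suc d') ≤ ι (LL false (lg ms))
 LL-false = LL-gen false (Sf * pj up θ zm) (\ u -> trans (ap (\ b -> Sf * pj b θ zm) u) (l Sf Sd iN)) (\ u -> trans (ap (\ b -> Sf * pj b θ zm) u) (part Sf Sd (+-cm Sf Sd >> sN) >> ap (\ z -> Sf - z * iN) (*-cm Sf Sd)))
  where l = r3 (v0 :* (v1 :* v2)) (v1 :* v0 :* v2)

 internal≥ : up ≡ false -> e * ι (suc d') * ι s ≤ ι (LL true (lg ms))
 internal≥ u = nj (df X≤ ~ EQ (l e D Sd X >> ap (_- e * D * Sd) (sym Le)))
  where
  X≤ : X ≤ (1q - e) * (D * Sd)
  X≤ = ca {X} {(1q - e) * (D * Sd)} {N1} N1+ (EQ (*-cm X N1) ~ low-raw u ~ za {c = 1q - e} (df e1) (za pD (za p1 S₂≤N1)) ~ EQ (l' (1q - e) D Sd N1))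
   where l' = r4 (v0 :* (v1 :* (v2 :* v3))) (v0 :* (v1 :* v2) :* v3)
  l = r4 ((:1 :- v0) :* (v1 :* v2) :- v3) ((v2 :* v1 :- v3) :- v0 :* v1 :* v2)
  Le : ι (LL true (lg ms)) ≡ Sd * D - X
  Le = trans (l2 (ι (LL true (lg ms))) X) (ap (_- X) (ap (ι (LL true (lg ms)) +_) (ap ι (sym (XX≡ ms))) >> sym (zq (LL true (lg ms)) (XX ms)) >> ap ι (LL-low u ms pm true) >> zn s d))
   where l2 = r2 v0 (v0 :+ v1 :- v1)

 -- Even if all ds edge ends at the set cross, the excess over the complete cut is limited: (1 +
 -- e)(1 - θ) ≤ 1. An excess is thus impossible for very small sets.
 dense : up ≡ true -> e ≤ θ + θ
 dense u = shift {e} {θ + θ} {1q - θ - e * θ} (EQ (l e θ) ~ h ~ ba {1q} {θ + θ + (1q - θ - e * θ)} (nc (df e1) (nc p1 piN)) (l2 e θ))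
  where
  l = r2 (v0 :+ (:1 :- v1 :- v0 :* v1)) ((:1 :+ v0) :* (:1 :- v1))
  l2 = r2 (v1 :+ v1 :+ (:1 :- v1 :- v0 :* v1)) (:1 :+ (:1 :- v0) :* v1)
  XS≤ : ∀ {k} (ms : Vec (Vec (Fin n) n) k) -> XS Sb ms <= s *' k
  XS≤ [] = ℕ.z≤n
  XS≤ {suc k} (m ∷ ms) = ≤≤ (ℕP.+-mono-≤ (≤≤ (m≤m+n (xS Sb m) (kF sb (xi Sb m) true false)) (≤≡ (km sb (xi Sb m) true))) (XS≤ ms)) (≤≡ (sym (ℕP.*-suc s k)))
  S₁+ : 0q < Sd
  S₁+ = <-≤ (zj 0) (mn sc)
  h1 : (1q + e) * Sf ≤ N1
  h1 = ca {(1q + e) * Sf} {N1} {Sd * D} (pos-* S₁+ (zj d')) (EQ (l' e D Sd Sf) ~ up-raw u ~ za pN1 (mn (XS≤ ms) ~ EQ (zn s d)))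
   where l' = r4 ((:1 :+ v0) :* v3 :* (v2 :* v1)) ((:1 :+ v0) :* (v1 :* (v2 :* v3)))
  h : (1q + e) * (1q - θ) ≤ 1q
  h = EQ (ap (\ z -> (1q + e) * (z - θ)) (sym θ≡) >> l' e Sd Sf iN) ~ di {1q} {(1q + e) * Sf} Fr.n+ (h1 ~ ba {N1} {1q * N} {1q} ze (l'' N))
   where
   l' = r4 ((:1 :+ v0) :* (v1 :* v3 :+ v2 :* v3 :- v1 :* v3)) ((:1 :+ v0) :* v2 :* v3)
   l'' = r1 (:1 :* v0) (v0 :- :1 :+ :1)

 -- Moving i changes the sampled cut by w(d - 2c), with c the number of crossing edges at i, and the
 -- complete cut by ±(s' - s) - 1. Maximality bounds c on one side by the mean plus a shift
 -- proportional to the imbalance, and the additive 2 absorbs the terms of lower order.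
 row-threshold : ∀ i -> V up ms (fp Sb i) ≤ V up ms Sb -> sz Sb true <= sz Sb false -> ∀ b -> lookup Sb i ≡ b ->
  pj b (ι (suc d') * pj up zm θ + ι (suc d') * (e * ((1 // 2) * (zm - θ)))) (ι (suc d') * pj up θ zm - ι (suc d') * (e * ((1 // 2) * (zm - θ)))) ≤ ι (rowc i (lg ms)) + (2 // 1)
 row-threshold i opt ss b eb = ca {y} {R + (2 // 1)} {2 // 1} (>0 (2 // 1)) (EQ (l0 y >> two-y up b) ~ shift {D + κ * D * (h * Δ)} {(R + (2 // 1)) * (2 // 1)} { - D} (EQ (l9 D (κ * D * (h * Δ))) ~ core ~ EQ (l10 R D)))
  where
  c = ι (cS Sb i ms)
  R = ι (rowc i (lg ms))
  y = pj b (D * pj up zm θ + D * (e * ((1 // 2) * (zm - θ)))) (D * pj up θ zm - D * (e * ((1 // 2) * (zm - θ))))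
  ς = sgn up
  κ = 1q + ς * e
  dr : Bool -> ℚ
  dr b = 1q - (𝟙 b + 𝟙 b)
  h = - (ς * dr b)
  Δ = zm - θ
  l0 = r1 (v0 :* :2) (v0 :+ v0)
  l9 = r2 (v0 :+ v1 :+ :- v0) v1
  l10 = r2 ((v0 :+ v0 :- v1) :+ :4) ((v0 :+ :2) :* :2 :+ :- v1)
  two-y : ∀ up b -> pj b (D * pj up zm θ + D * (e * ((1 // 2) * (zm - θ)))) (D * pj up θ zm - D * (e * ((1 // 2) * (zm - θ)))) + pj b (D * pj up zm θ + D * (e * ((1 // 2) * (zm - θ)))) (D * pj up θ zm - D * (e * ((1 // 2) * (zm - θ))))
   ≡ D + (1q + sgn up * e) * D * (- (sgn up * dr b) * (zm - θ))
  two-y true true = trans (l D θ zm e) (ap (\ z -> D * z + (1q + 1q * e) * D * (- (1q * (1q - (1q + 1q))) * (zm - θ))) θ≡) >> ap (_+ (1q + 1q * e) * D * (- (1q * (1q - (1q + 1q))) * (zm - θ))) (*-1ʳ D)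
   where l = r4 ((v0 :* v2 :+ v0 :* (v3 :* (:½ :* (v2 :- v1)))) :+ (v0 :* v2 :+ v0 :* (v3 :* (:½ :* (v2 :- v1))))) (v0 :* (v1 :+ v2) :+ (:1 :+ :1 :* v3) :* v0 :* (:- (:1 :* (:1 :- (:1 :+ :1))) :* (v2 :- v1)))
  two-y true false = trans (l D θ zm e) (ap (\ z -> D * z + (1q + 1q * e) * D * (- (1q * (1q - (0q + 0q))) * (zm - θ))) θ≡) >> ap (_+ (1q + 1q * e) * D * (- (1q * (1q - (0q + 0q))) * (zm - θ))) (*-1ʳ D)
   where l = r4 ((v0 :* v1 :- v0 :* (v3 :* (:½ :* (v2 :- v1)))) :+ (v0 :* v1 :- v0 :* (v3 :* (:½ :* (v2 :- v1))))) (v0 :* (v1 :+ v2) :+ (:1 :+ :1 :* v3) :* v0 :* (:- (:1 :* (:1 :- (:0 :+ :0))) :* (v2 :- v1)))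
  two-y false true = trans (l D θ zm e) (ap (\ z -> D * z + (1q + - 1q * e) * D * (- (- 1q * (1q - (1q + 1q))) * (zm - θ))) θ≡) >> ap (_+ (1q + - 1q * e) * D * (- (- 1q * (1q - (1q + 1q))) * (zm - θ))) (*-1ʳ D)
   where l = r4 ((v0 :* v1 :+ v0 :* (v3 :* (:½ :* (v2 :- v1)))) :+ (v0 :* v1 :+ v0 :* (v3 :* (:½ :* (v2 :- v1))))) (v0 :* (v1 :+ v2) :+ (:1 :+ :- :1 :* v3) :* v0 :* (:- (:- :1 :* (:1 :- (:1 :+ :1))) :* (v2 :- v1)))
  two-y false false = trans (l D θ zm e) (ap (\ z -> D * z + (1q + - 1q * e) * D * (- (- 1q * (1q - (0q + 0q))) * (zm - θ))) θ≡) >> ap (_+ (1q + - 1q * e) * D * (- (- 1q * (1q - (0q + 0q))) * (zm - θ))) (*-1ʳ D)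
   where l = r4 ((v0 :* v2 :- v0 :* (v3 :* (:½ :* (v2 :- v1)))) :+ (v0 :* v2 :- v0 :* (v3 :* (:½ :* (v2 :- v1))))) (v0 :* (v1 :+ v2) :+ (:1 :+ :- :1 :* v3) :* v0 :* (:- (:- :1 :* (:1 :- (:0 :+ :0))) :* (v2 :- v1)))
  dr² : ∀ b -> dr b * dr b ≡ 1q
  dr² true = refl
  dr² false = refl
  ς² : ∀ u -> sgn u * sgn u ≡ 1q
  ς² true = refl
  ς² false = refl
  κ0 : ∀ u -> 0q ≤ 1q + sgn u * e
  κ0 true = nh ze (nc ze pe)
  κ0 false = df e1 ~ EQ (l e)
   where l = r1 (:1 :- v0) (:1 :+ :- :1 :* v0)
  zE : ∀ u -> 1q + sgn u * e ≤ 2 // 1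
  zE true = +-≤ʳ 1q (EQ (*-1ˡ e) ~ e1)
  zE false = ba {1q + - 1q * e} {2 // 1} (nh ze pe) (l e)
   where l = r1 (:2) (:1 :+ :- :1 :* v0 :+ (:1 :+ v0))
  pm1 : ∀ u b {z} -> 0q ≤ z -> z ≤ 1q -> - 1q ≤ - (sgn u * dr b) * z
  pm1 true true {z} pz z1 = by { - 1q} {0q} ~ pz ~ EQ (sym (*-1ˡ z))
  pm1 true false {z} pz z1 = nm z1 ~ EQ (l z)
   where l = r1 (:- v0) (:- (:1 :* (:1 :- (:0 :+ :0))) :* v0)
  pm1 false true {z} pz z1 = nm z1 ~ EQ (l z)
   where l = r1 (:- v0) (:- (:- :1 :* (:1 :- (:1 :+ :1))) :* v0)
  pm1 false false {z} pz z1 = by { - 1q} {0q} ~ pz ~ EQ (sym (*-1ˡ z))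
  ςm : ∀ u -> - 1q ≤ sgn u
  ςm true = by { - 1q} {1q}
  ςm false = ≤-refl
  Re : ∀ u -> up ≡ u -> R + R - D ≡ sgn u * (c + c - D)
  Re true u = trans (ap (\ z -> ι z + ι z - D) (go u ms)) (sym (*-1ˡ (c + c - D)))
   where
   go : up ≡ true -> ∀ {k} (ms : Vec (Vec (Fin n) n) k) -> rowc i (lg ms) ≡ cS Sb i ms
   go u [] = refl
   go u (m ∷ ms) = ap₂ (\ a z -> (if a then 1 else 0) +' z) (VecP.lookup∘tabulate (bit m) i >> ap (\ v -> ea v (cr m i)) u) (go u ms)
  Re false u = trans (l R D) (ap (\ z -> D - (z - R + (z - R))) (sym (sym (zq (rowc i (lg ms)) (cS Sb i ms)) >> ap ι (go u ms))) >> l2 R c D)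
   where
   go : up ≡ false -> ∀ {k} (ms : Vec (Vec (Fin n) n) k) -> rowc i (lg ms) +' cS Sb i ms ≡ k
   go u [] = refl
   go u {suc k} (m ∷ ms) = trans (ap (\ z -> (if z then 1 else 0) +' rowc i (lg ms) +' cS Sb i (m ∷ ms)) (VecP.lookup∘tabulate (bit m) i >> ap (\ v -> ea v (cr m i)) u)) (two (cr m i) (rowc i (lg ms)) (cS Sb i ms) (go u ms))
    where
    two : ∀ b a c -> a +' c ≡ k -> (if not b then 1 else 0) +' a +' ((if b then 1 else 0) +' c) ≡ suc k
    two true a c e = trans (+-suc a c) (ap suc e)
    two false a c e = ap suc e
   l = r2 (v0 :+ v0 :- v1) (v1 :- (v1 :- v0 :+ (v1 :- v0)))
   l2 = r3 (v2 :- (v0 :+ v1 :- v0 :+ (v0 :+ v1 :- v0))) (:- :1 :* (v1 :+ v1 :- v2))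
  -- the change of the excess under the flip, multiplied by d
  opt' : ς * (N1 * (D - (c + c)) - D * (dr b * (Sf - Sd) - 1q)) - e * (D * (dr b * (Sf - Sd) - 1q)) ≤ 0q
  opt' = EQ (ap (\ z -> ς * (z * (D - (c + c)) - D * dK) - e * (D * dK)) (sym wD) >> l ς w D c dK e X K >> ap₂ (\ a b -> D * ((ς * (w * a - b) - e * b) - (ς * (w * X - K) - e * K))) (sym (flip-XS Sb i ms pm)) (sym KT)) ~ za pD (+-≤ˡ (- V up ms Sb) opt ~ EQ (+-inv (V up ms Sb))) ~ EQ (*-0ʳ D)
   where
   dK = dr b * (Sf - Sd) - 1q
   l = r8 (v0 :* (v1 :* v2 :* (v2 :- (v3 :+ v3)) :- v2 :* v4) :- v5 :* (v2 :* v4)) (v2 :* ((v0 :* (v1 :* (v6 :+ (v2 :- (v3 :+ v3))) :- (v7 :+ v4)) :- v5 :* (v7 :+ v4)) :- (v0 :* (v1 :* v6 :- v7) :- v5 :* v7)))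
   KT : KK (fp Sb i) ≡ K + dK
   KT = trans (ap₂ _*_ (flip-sz Sb i) (flip-sz' Sb i)) (ap (\ z -> (Sd + dr z) * (Sf - dr z)) eb >> l2 Sd Sf (dr b) >> ap (\ z -> K + (dr b * (Sf - Sd) - z)) (dr² b))
    where l2 = r3 ((v0 :+ v2) :* (v1 :- v2)) (v0 :* v1 :+ (v2 :* (v1 :- v0) :- v2 :* v2))
  big1 : κ * D * (h * (Sf - Sd)) + ς * κ * D ≤ N1 * (R + R - D)
  big1 = nj (df opt' ~ EQ (l ς N1 D c (dr b) (Sf - Sd) e >> ap (\ z -> N1 * (ς * (c + c - D)) - ((1q + ς * e) * D * (- (ς * dr b) * (Sf - Sd)) + ς * (1q + ς * e) * D) + (1q - z) * (e * (D * (dr b * (Sf - Sd) - 1q)))) (ς² up) >> l2 (N1 * (ς * (c + c - D)) - ((1q + ς * e) * D * (- (ς * dr b) * (Sf - Sd)) + ς * (1q + ς * e) * D)) (e * (D * (dr b * (Sf - Sd) - 1q))) >> ap (\ z -> N1 * z - (κ * D * (h * (Sf - Sd)) + ς * κ * D)) (sym (Re up refl))))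
   where
   l = r7 (:0 :- (v0 :* (v1 :* (v2 :- (v3 :+ v3)) :- v2 :* (v4 :* v5 :- :1)) :- v6 :* (v2 :* (v4 :* v5 :- :1)))) (v1 :* (v0 :* (v3 :+ v3 :- v2)) :- ((:1 :+ v0 :* v6) :* v2 :* (:- (v0 :* v4) :* v5) :+ v0 :* (:1 :+ v0 :* v6) :* v2) :+ (:1 :- v0 :* v0) :* (v6 :* (v2 :* (v4 :* v5 :- :1))))
   l2 = r2 (v0 :+ (:1 :- :1) :* v1) v0
  pκ = κ0 up
  Δnn : 0q ≤ Δ
  Δnn = df (zb piN (mn ss))
  Δ1 : Δ ≤ 1q
  Δ1 = ba {Δ} {1q} (nh (nc p1 piN) (nc p1 piN)) (sym θ≡ >> l θ zm)
   where l = r2 (v0 :+ v1) (v1 :- v0 :+ (v0 :+ v0))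
  ΔN : Sf - Sd ≡ N * Δ
  ΔN = trans (ap₂ _-_ (Fr.fn s') (Fr.fn s) >> l θ zm N) refl
   where l = r3 (v1 :* v2 :- v0 :* v2) (v2 :* (v1 :- v0))
  core : κ * D * (h * Δ) ≤ (R + R - D) + (4 // 1)
  core = ca {κ * D * (h * Δ)} {(R + R - D) + (4 // 1)} {N1} N1+ (nj (nh (nh (df big1') (nc (nc pκ pD) (nh (df (pm1 up b Δnn Δ1)) (df (ςm up))))) (nh (nc {2 // 1} by (nc pD (df (zE up)))) (nc {4 // 1} by (df nD))) ~ EQ (l κ D h Δ N (R + R - D) ς)))
   where
   big1' : κ * D * (h * (N * Δ)) + ς * κ * D ≤ N1 * (R + R - D)
   big1' = EQ (ap (\ z -> κ * D * (h * z) + ς * κ * D) (sym ΔN)) ~ big1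
   l = r7 (((v4 :- :1) :* v5 :- (v0 :* v1 :* (v2 :* (v4 :* v3)) :+ v6 :* v0 :* v1)) :+ v0 :* v1 :* ((v2 :* v3 :- :- :1) :+ (v6 :- :- :1)) :+ (:2 :* (v1 :* (:2 :- v0)) :+ :4 :* ((v4 :- :1) :- v1))) ((v5 :+ :4) :* (v4 :- :1) :- v0 :* v1 :* (v2 :* v3) :* (v4 :- :1))

-- First moment over all sets.

ds : ℕ -> List ℕ
ds zero = []
ds (suc n) = n ∷ ds n

∈-downs : ∀ {k} n -> k ≺ n -> k ∈ ds n
∈-downs {k} (suc n) p = go (ℕP.m≤n⇒m<n∨m≡n (≤-pred p))
 where
 go : k ≺ n ⊎ k ≡ n -> k ∈ ds (suc n)
 go (inj₁ q) = there (∈-downs n q)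
 go (inj₂ refl) = here refl

<-downs : ∀ {k} n -> k ∈ ds n -> k ≺ n
<-downs (suc n) (here refl) = ≤r
<-downs (suc n) (there p) = ≤⇒≤s (<-downs n p)

gc : ∀ n -> S (\ j -> (1 // 2) ^ suc j * ι (suc j)) (ds n) + ι (suc (suc n)) * (1 // 2) ^ n ≡ 2 // 1
gc zero = trans (ap (\ z -> 0q + z * 1q) (li 2)) refl
gc (suc n) = trans (ap₂ (\ a b -> ((1 // 2) ^ suc n * a + Σn) + b * (1 // 2) ^ suc n) (su n) (su (suc (suc n)) >> ap (1q +_) (su (suc n) >> ap (1q +_) (su n)))) (l ((1 // 2) ^ n) (ι n) Σn >> ap (\ z -> Σn + z * (1 // 2) ^ n) (sym (su (suc n) >> ap (1q +_) (su n))) >> gc n)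
 where
 Σn = S (\ j -> (1 // 2) ^ suc j * ι (suc j)) (ds n)
 l = r3 ((:½ :* v0 :* (:1 :+ v1) :+ v2) :+ (:1 :+ (:1 :+ (:1 :+ v1))) :* (:½ :* v0)) (v2 :+ (:1 :+ (:1 :+ v1)) :* v0)

sA : ∀ n α -> S (\ Sb -> α ^ cn (lookup Sb) true) (allSubsets n) ≡ (1q + α) ^ n
sA n α = trans (Sc (allSubsets n) (\ Sb _ -> sym (pJ (lookup Sb) wt >> ap (α ^ cn (lookup Sb) true *_) (zC (cn (lookup Sb) false)) >> *-1ʳ (α ^ cn (lookup Sb) true)))) (p7 n (\ _ b -> wt b) >> pZ n)
 where
 wt : Bool -> ℚ
 wt true = α
 wt false = 1q
 pZ : ∀ n -> pF {n} (\ _ -> α + 1q) ≡ (1q + α) ^ n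
 pZ zero = refl
 pZ (suc n) = ap₂ _*_ (+-cm α 1q) (pZ n)

-- first moment over the small sets: there are at most (4n/k)^k sets of size k
sG : ∀ n' -> let n = suc n' in S (\ Sb -> S (\ j -> 𝟙 ⌊ cn (lookup Sb) true ℕ.≟ suc j ⌋ * ((1 // 8) * (ι (suc j) * ig (ι n) * (ι (suc j) * ig (ι n)))) ^ suc j) (ds n)) (allSubsets n) ≤ (2 // 1) * ig (ι n)
sG n' = EQ (Ss (\ Sb j -> 𝟙 ⌊ sz Sb ℕ.≟ suc j ⌋ * q j) (allSubsets n) (ds n)) ~ Sm (ds n) (\ j p -> EQ (Sc (allSubsets n) (\ Sb _ -> *-cm (𝟙 ⌊ sz Sb ℕ.≟ suc j ⌋) (q j)) >> Sa (q j) (\ Sb -> 𝟙 ⌊ sz Sb ℕ.≟ suc j ⌋) (allSubsets n)) ~ term j (<-downs n p))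
 ~ EQ (Sa iN (\ j -> (1 // 2) ^ suc j * ι (suc j)) (ds n)) ~ za piN (ba {b = 2 // 1} (nc (zd (suc (suc n))) (ng n (by {0q} {1 // 2}))) (sym (gc n))) ~ EQ (*-cm iN (2 // 1))
 where
 n = suc n'
 sz : Vec Bool n -> ℕ
 sz Sb = cn (lookup Sb) true
 iN = ig (ι n)
 piN = ie (zj n')
 q : ℕ -> ℚ
 q j = ((1 // 8) * (ι (suc j) * iN * (ι (suc j) * iN))) ^ suc j
 term : ∀ j -> j ≺ n -> q j * S (\ Sb -> 𝟙 ⌊ sz Sb ℕ.≟ suc j ⌋) (allSubsets n) ≤ iN * ((1 // 2) ^ suc j * ι (suc j))
 term j j<n = za (ng k q-nn) (Sm (allSubsets n) (\ Sb _ -> ind Sb (sz Sb ℕ.≟ k)) ~ EQ (Sa (ig α ^ k) (\ Sb -> α ^ sz Sb) (allSubsets n) >> ap (ig α ^ k *_) (sA n α)) ~ za (ng k (ie α+)) four)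
  ~ EQ (sym (*-as (q j) (ig α ^ k) ((4 // 1) ^ k)) >> ap (_* (4 // 1) ^ k) (sym (zi ((1 // 8) * (α * α)) (ig α) k)) >> sym (zi ((1 // 8) * (α * α) * ig α) (4 // 1) k) >> ap (_^ k) half-α >> zi (1 // 2) α k)
  ~ za (ng k (by {0q} {1 // 2})) (za pα (zy j pα α1) ~ EQ (*-1ʳ α)) ~ EQ (l ((1 // 2) ^ k) (ι k) iN)
  where
  k = suc j
  α = ι k * iN
  α+ : 0q < α
  α+ = pos-* (zj j) (io (zj n'))
  pα = qa α+
  α1 : α ≤ 1q
  α1 = zb piN (mn j<n) ~ EQ (ic (zj n'))
  q-nn : 0q ≤ (1 // 8) * (α * α)
  q-nn = nc {1 // 8} by (nc pα pα)
  l = r3 (v0 :* (v1 :* v2)) (v2 :* (v0 :* v1))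
  half-α : (1 // 8) * (α * α) * ig α * (4 // 1) ≡ (1 // 2) * α
  half-α = trans (l' α (ig α)) (ap ((1 // 2) * α *_) (ic α+) >> *-1ʳ ((1 // 2) * α))
   where l' = r2 ((1 :/ 8) :* (v0 :* v0) :* v1 :* :4) (:½ :* v0 :* (v0 :* v1))
  ind : ∀ Sb (x : Dec (sz Sb ≡ k)) -> 𝟙 ⌊ x ⌋ ≤ ig α ^ k * α ^ sz Sb
  ind Sb (no _) = nc (ng k (ie α+)) (ng (sz Sb) pα)
  ind Sb (yes e) = EQ (sym (ap (\ z -> ig α ^ k * α ^ z) e >> sym (zi (ig α) α k) >> ap (_^ k) (*-cm (ig α) α >> ic α+) >> zC k))
  -- Bernoulli gives 1 + k/n ≤ (1 + 1/n)^k, and (1 + 1/n)^n ≤ 4 takes the role of the bound by e.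
  four : (1q + α) ^ n ≤ (4 // 1) ^ k
  four = mc n (nh ze pα) (bo k (nh ze piN)) ~ EQ (sym (zp (1q + iN) k n) >> ap ((1q + iN) ^_) (*-cmℕ k n) >> zp (1q + iN) n k)
   ~ mc k (ng n (nh ze piN)) (mc n (nh ze piN) (ba (nc {1 // 4} by (nc piN piN)) (l' iN)) ~ EQ (zi (1q + (1 // 2) * iN) (1q + (1 // 2) * iN) n) ~ ma nn nn two two ~ by {(2 // 1) * (2 // 1)} {4 // 1})
   where
   l' = r1 ((:1 :+ :½ :* v0) :* (:1 :+ :½ :* v0)) (:1 :+ v0 :+ (1 :/ 4) :* (v0 :* v0))
   ph = nc {1 // 2} by piN
   nn = ng n (nh ze ph)
   iN1 : iN ≤ 1q
   iN1 = EQ (sym (*-1ˡ iN)) ~ zb piN (zx n') ~ EQ (ic (zj n'))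
   two : (1q + (1 // 2) * iN) ^ n ≤ 2 // 1
   two = pow≤2 n ph (za {c = 1 // 2} by iN1 ~ by {(1 // 2) * 1q} {1q}) (EQ (l'' (ι n) iN >> ap ((1 // 2) *_) (ic (zj n')) >> *-1ʳ (1 // 2)))
    where l'' = r2 (v0 :* (:½ :* v1)) (:½ :* (v0 :* v1))

↑-anti : ∀ {y m n} -> 0q ≤ y -> y ≤ 1q -> m <= n -> y ^ n ≤ y ^ m
↑-anti {y} {m} {n} py y1 le = subst (\ k -> y ^ k ≤ y ^ m) (m+[n∸m] le) (EQ (zr y m (n ℕ.∸ m)) ~ za (ng m py) (zy (n ℕ.∸ m) py y1) ~ EQ (*-1ʳ (y ^ m)))

-- Bernoulli with the quadratic term. `g-power` approximates exp(a'/500) by a twentieth power, and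
-- at that coarseness the first-order bound would lose more than the margin at densities near one
-- half.
bu : ∀ {x} j -> 0q ≤ x -> 1q + ι j * x + (1 // 2) * (ι j * x * (ι j * x - x)) ≤ (1q + x) ^ j
bu {x} zero px = EQ (ap (\ z -> 1q + z * x + (1 // 2) * (z * x * (z * x - x))) ι0 >> l x)
 where l = r1 (:1 :+ :0 :* v0 :+ :½ :* (:0 :* v0 :* (:0 :* v0 :- v0))) :1
bu {x} (suc j) px = EQ (ap (\ z -> 1q + z * x + (1 // 2) * (z * x * (z * x - x))) (su j)) ~ ba (nc (nc {1 // 2} by (nc px (nc px px))) (jj j)) (l (ι j) x) ~ za (nh ze px) (bu j px)
 where
 l = r2 ((:1 :+ v1) :* (:1 :+ v0 :* v1 :+ :½ :* (v0 :* v1 :* (v0 :* v1 :- v1)))) (:1 :+ (:1 :+ v0) :* v1 :+ :½ :* ((:1 :+ v0) :* v1 :* ((:1 :+ v0) :* v1 :- v1)) :+ :½ :* (v1 :* (v1 :* v1)) :* (v0 :* (v0 :- :1)))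
 jj : ∀ j -> 0q ≤ ι j * (ι j - 1q)
 jj zero = EQ (sym (ap (\ z -> z * (z - 1q)) ι0 >> refl))
 jj (suc j) = nc (zd (suc j)) (df (zx j))

tj : ∀ {a b} -> (a ∧ b) ≡ true -> a ≡ true × b ≡ true
tj {true} {true} e = refl , refl

de : ∀ {A : Set} (x : Dec A) -> ⌊ x ⌋ ≡ true -> A
de (yes a) e = a

tu : ∀ {A : Set} (x : Dec A) -> A -> ⌊ x ⌋ ≡ true
tu (yes a) _ = refl
tu (no na) a = ⊥-elim (na a)

XS≤ : ∀ {n k} (Sb : Vec Bool n) (ms : Vec (Vec (Fin n) n) k) -> Cuts.XS Sb ms <= cn (lookup Sb) true *' k
XS≤ Sb [] = ℕ.z≤n
XS≤ {n} {suc k} Sb (m ∷ ms) = ≤≤ (ℕP.+-mono-≤ (≤≤ (m≤m+n (Cuts.xS Sb m) (kF (lookup Sb) (Cuts.xi Sb m) true false)) (≤≡ (km (lookup Sb) (Cuts.xi Sb m) true))) (XS≤ Sb ms)) (≤≡ (sym (ℕP.*-suc (cn (lookup Sb) true) k)))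

-- Density classes and their numerical certificates.

module Classes (Se : Setup) (m : ℕ) (hm : ι m * (4000 // 1) ≤ Setup.r Se) (Nn : ℕ) (N0≡ : Setup.N0 Se ≡ ι Nn) (N0D : ι Nn ≡ Setup.D Se * (Setup.D Se * Setup.D Se))
 (h2m : (256 // 1) * (ι Nn * ι Nn) ≤ (2 // 1) ^ m) (hη : (1q + Setup.η Se) ^ Setup.d Se ≤ 1q + ig (ι Nn))
 (f : ℕ) (w : ℚ) (wD : w * Setup.D Se ≡ ι (f +' f) - 1q) (nD : Setup.D Se ≤ ι (f +' f) - 1q) where
 open Setup Se
 n = f +' f
 e : ℚ
 e = zf * ig r
 open Excess {n} {d} w e
 open Cuts {n}
 PMs : List (Vec (Vec (Fin n) n) d)
 PMs = vecsOver (perfectMatchings n) d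
 tot : ℚ
 tot = ι (length (perfectMatchings n))
 Pr : Vec Bool n -> Bool -> Vec (Vec (Fin n) n) d -> Bool
 Pr Sb up ms = ⌊ 0q ℚ.<? V up ms Sb ⌋ ∧ allB (\ U -> ⌊ V up ms U ℚ.≤? V up ms Sb ⌋) (allSubsets n)
 bh : Vec Bool n -> Bool -> ℚ
 bh Sb up = S (\ ms -> 𝟙 (Pr Sb up ms)) PMs
 bm : ∀ Sb up -> 0q ≤ bh Sb up
 bm Sb up = S-nn PMs (\ ms -> nk (Pr Sb up ms))
 M0 : ℚ
 M0 = g ^ (2 +' (d *' suc M' +' d *' suc M')) * ((ι (suc n) ^ 4) ^ d * ((ι (suc (suc F)) * ι (suc (suc F))) ^ d * (ι (suc (suc F)) * ι (suc (suc F))) ^ d)) * (tot ^ d * tot ^ d)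
 -- ρ = 1/(1 + d⁻³) is the decay per vertex that each class has to reach; any fixed ratio below 1
 -- defeats the polynomial factors. `h`, the loss due to the grid, is at most 1 + d⁻³.
 ik ρ h : ℚ
 ik = ig (ι Nn)
 ρ = ig (1q + ik)
 h = (1q + η) ^ d

 private
  pD = zd d
  r+ : 0q < r
  r+ = <-≤ (by< {0q} {1000000000000000000000000000000 // 1}) big
  pir = ie r+
  pe : 0q ≤ e
  pe = nc {zf} by pir
  ir≤ : ig r ≤ 1 // 1000000000000000000000000000000
  ir≤ = il {r} {1 // 1000000000000000000000000000000} r+ (by {1q} {(1 // 1000000000000000000000000000000) * (1000000000000000000000000000000 // 1)} ~ za {c = 1 // 1000000000000000000000000000000} by big)
  e≤ : e ≤ ti
  e≤ = za {c = zf} by ir≤ ~ by {zf * (1 // 1000000000000000000000000000000)} {ti}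
  e1 : e ≤ 1q
  e1 = e≤ ~ by {ti} {1q}
  er : e * r ≡ zf
  er = trans (l zf (ig r) r) (ap (zf *_) (ic r+) >> *-1ʳ zf)
   where l = r3 (v0 :* v1 :* v2) (v0 :* (v2 :* v1))
  r≤D : r ≤ D
  r≤D = nj (nh (nh (df rD') (nc {999 // 1} by (df big))) (by {0q} {(999 // 1) * (1000000000000000000000000000000 // 1) - (1000 // 1)}) ~ EQ (l r D))
   where l = r2 ((v1 :- (1000 :/ 1) :* (v0 :- :1)) :+ (999 :/ 1) :* (v0 :- (1000000000000000000000000000000 :/ 1)) :+ ((999 :/ 1) :* (1000000000000000000000000000000 :/ 1) :- (1000 :/ 1))) (v1 :- v0)
  x≤tiny : x ≤ ti
  x≤tiny = EQ (sym (*-1ʳ x)) ~ za px Da ~ xD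
  N0-big : 100000000000000000000 // 1 ≤ ι Nn
  N0-big = D-big ~ EQ (l D) ~ za pD (ma ze ze Da Da) ~ EQ (sym N0D)
   where l = r1 v0 (v0 :* (:1 :* :1))
  N0+ : 0q < ι Nn
  N0+ = <-≤ (by< {0q} {100000000000000000000 // 1}) N0-big
  iN0+ : 0q < ik
  iN0+ = io N0+
  piN0 = qa iN0+
  iN0≤ : ik ≤ ti
  iN0≤ = il {ι Nn} {ti} N0+ (by {1q} {ti * (100000000000000000000 // 1)} ~ za {c = ti} by N0-big)
  1N0+ : 0q < 1q + ik
  1N0+ = <-≤ (>0 1q) (ba piN0 refl)
 ρ+ : 0q < ρ
 ρ+ = io 1N0+
 ρ<1 : ρ < 1q
 ρ<1 = ≰⇒> \ q -> <⇒≱ (subst (_< 1q + ik) (+-0ʳ 1q) (ℚP.+-monoʳ-< 1q iN0+)) (EQ (sym (*-1ʳ (1q + ik))) ~ za (qa 1N0+) q ~ EQ (ic 1N0+))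
 pρ : 0q ≤ ρ
 pρ = qa ρ+
 ρ≥ : 999 // 1000 ≤ ρ
 ρ≥ = ca {999 // 1000} {ρ} {1q + ik} 1N0+ (za {c = 999 // 1000} by (+-≤ʳ 1q iN0≤) ~ by {(999 // 1000) * (1q + ti)} {1q} ~ EQ (sym (ic 1N0+) >> *-cm (1q + ik) ρ))
 iN0-nn : 0q ≤ ik
 iN0-nn = piN0
 sparse-total : h * (ρ * ρ * (ρ * ρ)) * ((1q + ik) * (1q + ik)) ≤ ρ
 sparse-total = EQ (l h ρ (1q + ik) >> ap (\ z -> h * (ρ * ρ) * (z * z)) (ic 1N0+) >> l2 h ρ) ~ zb (nc pρ pρ) hη ~ EQ (l3 (1q + ik) ρ >> ap (_* ρ) (ic 1N0+) >> *-1ˡ ρ)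
  where
  l = r3 (v0 :* (v1 :* v1 :* (v1 :* v1)) :* (v2 :* v2)) (v0 :* (v1 :* v1) :* (v2 :* v1 :* (v2 :* v1)))
  l2 = r2 (v0 :* (v1 :* v1) :* (:1 :* :1)) (v0 :* (v1 :* v1))
  l3 = r2 (v0 :* (v1 :* v1)) (v0 :* v1 :* v1)
 M0-nn : 0q ≤ M0
 M0-nn = nc (nc (ng (2 +' (d *' suc M' +' d *' suc M')) pg) (nc (ng d (ng 4 (zd (suc n)))) (nc (ng d q) (ng d q)))) (nc (ng d (zd (length (perfectMatchings n)))) (ng d (zd (length (perfectMatchings n)))))
  where q = nc (zd (suc (suc F))) (zd (suc (suc F)))
 private
  h₀ : ℚ
  h₀ = 1000001 // 1000000
  h≤ : h ≤ h₀
  h≤ = hη ~ +-≤ʳ 1q iN0≤ ~ by {1q + ti} {1000001 // 1000000}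
  pη : 0q ≤ η
  pη = nc {160 // 1} by (nc (nc (nc pD pD) (nc (qa zB) (qa zB))) (subst (0q ≤_) (sym N0≡) (qa N0+))) ~ hδ
 h-nn : 0q ≤ h
 h-nn = ng d (nh ze pη)
 private
  -- lower bound for g^(20 a' d⁴) ≈ exp (20 a'/10000)
  Eof : ℕ -> ℚ
  Eof a' = (1q + (a' // 10000) + (1 // 2) * ((a' // 10000) * ((a' // 10000) - ti))) ^ 20
  g-power : ∀ a' -> 0q ≤ (1q + (a' // 10000) + (1 // 2) * ((a' // 10000) * ((a' // 10000) - ti))) -> Eof a' ≤ g ^ (20 *' a' *' da)
  g-power a' nn = mc 20 nn (+-≤ʳ (1q + v) (za {c = 1 // 2} by (za pv (+-≤ʳ v (nm x≤tiny)))) ~ EQ (ap (\ z -> 1q + z + (1 // 2) * (z * (z - x))) ve) ~ bu (a' *' da) px)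
   ~ EQ (sym (zp g (a' *' da) 20) >> ap (g ^_) (*-cmℕ (a' *' da) 20 >> sym (ℕP.*-assoc 20 a' da)))
   where
   v = a' // 10000
   ve : v ≡ ι (a' *' da) * x
   ve = sym (ge a' >> ap (_* (1 // 10000)) (sym (dv a' 9999)) >> *-as (a' // 10000) (ι 10000) (1 // 10000) >> ap (\ z -> (a' // 10000) * (z * (1 // 10000))) (li 10000) >> *-1ʳ (a' // 10000))
   pv : 0q ≤ v
   pv = nc (zd (a' *' da)) px ~ EQ (sym ve)

 -- Density at most j/m' converts the spare factor y^(2jn) into α^(2s). Sets are then summed with
 -- weight α^s, giving (1 + α)^n instead of 2^n, which exploits that sparser classes have fewer
 -- members.
 reweigh : ∀ {B G k σ α y} s j m' -> 0q < G -> 0q ≤ k -> 0q ≤ σ -> 0q ≤ y -> y ≤ 1q -> α ≡ y ^ m' -> m' *' s <= j *' n -> k ≤ σ * (y ^ j * y ^ j) * G -> B * G ^ n ≤ M0 * k ^ n -> B ≤ M0 * (σ ^ n * (α ^ s * α ^ s))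
 reweigh {B} {G} {k} {σ} {α} {y} s j m' G+ pk pσ py y1 αe le kk hb = ca {B} {M0 * (σ ^ n * (α ^ s * α ^ s))} {G ^ n} (po n G+) (hb ~ za M0-nn (mc n pk kk ~ EQ (zi (σ * (y ^ j * y ^ j)) G n >> ap (_* G ^ n) (zi σ (y ^ j * y ^ j) n >> ap (σ ^ n *_) (zi (y ^ j) (y ^ j) n >> ap (\ z -> z * z) (sym (zp y j n)))))
  ~ zb (ng n (qa G+)) (za (ng n pσ) (ma (ng (j *' n) py) (ng (j *' n) py) ys ys))) ~ EQ (sym (*-as M0 (σ ^ n * (α ^ s * α ^ s)) (G ^ n))))
  where
  ys : y ^ (j *' n) ≤ α ^ s
  ys = ↑-anti py y1 le ~ EQ (zp y m' s >> ap (_^ s) (sym αe))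

 module OneSet (Sb : Vec Bool n) (up : Bool) (sc : 1 <= cn (lookup Sb) true) (ss : cn (lookup Sb) true <= cn (lookup Sb) false) where
  open Labels f Sb up using (s; s'; θ; zm; rowc; lg; LL)
  private
   sd : 1 <= s'
   sd = ≤≤ sc ss
   module Fr = Fractions s s' n sc (cu (lookup Sb))
   piN = ie Fr.n+
   θ+ : 0q < θ
   θ+ = pos-* (<-≤ (zj 0) (mn sc)) (io Fr.n+)
   zD : 0q < zm
   zD = pos-* (<-≤ (zj 0) (mn sd)) (io Fr.n+)
   pθ = qa θ+
   zw : θ ≤ zm
   zw = zb piN (mn ss)
   sum1 : θ + zm ≡ 1q
   sum1 = Fr.fc
   θ'≥½ : 1 // 2 ≤ zm
   θ'≥½ = nj (nc {1 // 2} by (df zw) ~ EQ (l θ zm >> ap (\ z -> zm - (1 // 2) * z) sum1))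
    where l = r2 (:½ :* (v1 :- v0)) (v1 :- :½ :* (v0 :+ v1))
   θ≤½ : θ ≤ 1 // 2
   θ≤½ = nj (nc {1 // 2} by (df zw) ~ EQ (l θ zm >> ap (\ z -> (1 // 2) * z - θ) sum1))
    where l = r2 (:½ :* (v1 :- v0)) (:½ :* (v0 :+ v1) :- v0)
   eo : ∀ ms -> Pr Sb up ms ≡ true -> 0q ≤ V up ms Sb
   eo ms p = qa (de (0q ℚ.<? V up ms Sb) (fst (tj p)))
   ev-opt : ∀ ms -> Pr Sb up ms ≡ true -> ∀ U -> V up ms U ≤ V up ms Sb
   ev-opt ms p U = de (V up ms U ℚ.≤? V up ms Sb) (ao (\ U -> ⌊ V up ms U ℚ.≤? V up ms Sb ⌋) (allSubsets n) (snd (tj p)) U (aS U))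

  small-class : D * (D * D) * θ ≤ 1q -> bh Sb up ≤ tot ^ d * ((1 // 8) * (θ * θ)) ^ s
  small-class tθ = go up refl
   where
   go : ∀ u -> up ≡ u -> bh Sb up ≤ tot ^ d * ((1 // 8) * (θ * θ)) ^ s
   go false refl = SmallSets.small-bound Se f Sb sc tθ (Pr Sb false) (\ ms pm p -> EventFacts.internal≥ f d' Sb false w e pe e1 sc sd wD nD ms pm (eo ms p) refl)
   -- At this density an excess contradicts `dense`, so the event is empty.
   go true u = EQ (Sc PMs (\ ms q -> ap 𝟙 (never ms (Ae (perfectMatchings n) d ms q (\ m r -> PM-IsPM n m r)))) >> S-zero PMs) ~ nc (ng d (zd (length (perfectMatchings n)))) (ng s (nc {1 // 8} by (nc pθ pθ)))
    where
    absurd : ¬ (e ≤ θ + θ)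
    absurd q = <⇒≱ (by< {1q} {zf}) (EQ (sym er) ~ zb (qa r+) q ~ EQ (l θ r) ~ za pθ rr ~ EQ (*-cm θ (D * (D * D))) ~ tθ)
     where
     l = r2 ((v0 :+ v0) :* v1) (v0 :* (v1 :+ v1))
     rr : r + r ≤ D * (D * D)
     rr = mb r≤D r≤D ~ EQ (l2 D) ~ za pD (by {2 // 1} {(100000000000000000000 // 1) * 1q} ~ ma (by {0q} {100000000000000000000 // 1}) ze D-big Da)
      where l2 = r1 (v0 :+ v0) (v0 :* :2)
    never : ∀ ms -> AV Is ms -> Pr Sb up ms ≡ false
    never ms pm = ga (Pr Sb up ms) refl
     where
     ga : ∀ b -> Pr Sb up ms ≡ b -> b ≡ false
     ga false _ = refl
     ga true p = ⊥-elim (absurd (EventFacts.dense f d' Sb up w e pe e1 sc sd wD nD ms pm (eo ms p) u))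

  module Dense (hθ₀ : 1q ≤ D * (D * D) * θ) where
   private
    hθ : 1q ≤ N0 * θ
    hθ = hθ₀ ~ EQ (ap (_* θ) (sym (N0≡ >> N0D)))
    hθ' : 1q ≤ N0 * zm
    hθ' = hθ ~ za (subst (0q ≤_) (sym N0≡) (qa N0+)) zw
    zo = θ * zm
    N = ι n
    s-θ : ι s ≡ θ * N
    s-θ = Fr.fn s

   -- Everything is tested at the left end θa of a window: θ zm is smallest there, so a `Ch` that is
   -- valid at θa is valid throughout. The last hypothesis weighs the row factor 0.8464 against the
   -- exponential gain.
   cj : ∀ θa Ch a' σ y α j m' -> 0q ≤ Ch -> Ch ≤ 13 // 10 -> 0q ≤ θa -> θa ≤ 1 // 2 -> θa ≤ θ ->
    (1000001 // 1000000) * (1000001 // 1000000) ≤ (2 // 1) * Ch * ((2 // 1) * Ch) * (θa * (1q - θa)) -> 2 // 13 ≤ θa * (1q - θa) ->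
    (20 *' a') // 1 * (1 // 10000) + (1 // 2) * cg * (zg * zg * cg + zf * zf * (Ch * Ch - 1q)) + (1 // 1000000000) ≤ zg * zf * Ch ->
    0q ≤ (1q + (a' // 10000) + (1 // 2) * ((a' // 10000) * ((a' // 10000) - ti))) -> 0q ≤ σ -> 0q ≤ y -> y ≤ 1q -> α ≡ y ^ m' -> m' *' s <= j *' n ->
    (8464 // 10000) * h₀ ≤ σ * (y ^ j * y ^ j) * Eof a' -> bh Sb up * bh Sb up ≤ M0 * (σ ^ n * (α ^ s * α ^ s))
   cj θa Ch a' σ y α j m' pChi Chi≤ pθa θa½ θaθ win slow closed nnE pσ py y1 αe le final =
    reweigh {bh Sb up * bh Sb up} {g ^ (20 *' a' *' da)} {(8464 // 10000) * h} {σ} {α} {y} s j m' (po (20 *' a' *' da) g+) (nc {8464 // 10000} by h-nn) pσ py y1 αe le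
     (za {c = 8464 // 10000} by h≤ ~ final ~ za (nc pσ (nc (ng j py) (ng j py))) (g-power a' nnE))
     (Central.central-bound Se f Sb up sc sd θ+ zD zw hθ hθ' Ch Chi≤ pChi win' slow' (20 *' a') closed' (Pr Sb up) (\ ms pm p i -> EQ (conv (lookup Sb i)) ~ EventFacts.row-threshold f d' Sb up w e pe e1 sc sd wD nD ms pm (eo ms p) i (ev-opt ms p (fp Sb i)) ss (lookup Sb i) refl) (\ ms pm p -> EventFacts.LL-true f d' Sb up w e pe e1 sc sd wD nD ms pm (eo ms p)) (\ ms pm p -> EventFacts.LL-false f d' Sb up w e pe e1 sc sd wD nD ms pm (eo ms p)))
    where
    σa : θa * (1q - θa) ≤ zo
    σa = nj (nc (df θaθ) (nh (df (θa½ ~ by {1 // 2} {1 // 2})) (df θ≤½)) ~ EQ (trans (l θ θa) (ap (\ z -> θ * (z - θ) - θa * (1q - θa)) (sym sum1)) >> l2 θ zm (θa * (1q - θa))))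
     where
     l = r2 ((v0 :- v1) :* ((:½ :- v1) :+ (:½ :- v0))) (v0 :* (:1 :- v0) :- v1 :* (:1 :- v1))
     l2 = r3 (v0 :* (v0 :+ v1 :- v0) :- v2) (v0 :* v1 :- v2)
    win' = win ~ za (sn ((2 // 1) * Ch)) σa
    slow' = slow ~ σa
    closed' : ι (20 *' a') * (1 // 10000) + (1 // 2) * cg * (zg * zg * cg + zf * zf * (Ch * Ch - 1q)) + (1 // 1000000000) ≤ zg * zf * Ch
    closed' = EQ (ap (\ z -> z * (1 // 10000) + (1 // 2) * cg * (zg * zg * cg + zf * zf * (Ch * Ch - 1q)) + (1 // 1000000000)) (li (20 *' a'))) ~ closed
    conv : ∀ b -> Central.thr Se f Sb up sc sd θ+ zD zw hθ hθ' Ch Chi≤ pChi win' slow' (20 *' a') closed' b ≡ pj b (D * pj up zm θ + D * (e * ((1 // 2) * (zm - θ)))) (D * pj up θ zm - D * (e * ((1 // 2) * (zm - θ))))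
    conv true = refl
    conv false = refl

   private
    xe : (2 // 1) * x ≤ (1 // 1000) * (e * zo)
    xe = ca {(2 // 1) * x} {(1 // 1000) * (e * zo)} {D * (D * D) * r} (pos-* (pos-* (zj d') (pos-* (zj d') (zj d'))) r+)
     (EQ (l x (D * (D * D)) r) ~ za (nc {2 // 1} by (nc px (nc pD (nc pD pD)))) r≤D ~ EQ (l2 x D >> ap ((2 // 10000) *_) xD⁴) ~ by {(2 // 10000) * 1q} {(1 // 1000) * (zf * (1q * (1 // 2)))} ~ za {c = 1 // 1000} by (za {c = zf} by (ma ze (by {0q} {1 // 2}) hθ₀ θ'≥½)) ~ EQ (ap (\ z -> (1 // 1000) * (z * (D * (D * D) * θ * zm))) (sym er) >> l3 e r (D * (D * D)) θ zm))
     where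
     l = r3 (:2 :* v0 :* (v1 :* v2)) (:2 :* (v0 :* v1) :* v2)
     l2 = r2 (:2 :* (v0 :* (v1 :* (v1 :* v1))) :* v1) ((2 :/ 10000) :* (v0 :* ((10000 :/ 1) :* (v1 :* v1 :* (v1 :* v1)))))
     l3 = r5 ((1 :/ 1000) :* (v0 :* v1 :* (v2 :* v3 :* v4))) ((1 :/ 1000) :* (v0 :* (v3 :* v4)) :* (v2 :* v1))
    De : zf * (r - (2 // 1)) ≤ D * e
    De = ca {zf * (r - (2 // 1))} {D * e} {r} r+ (EQ (*-as zf (r - (2 // 1)) r) ~ za {c = zf} by (ba {(r - (2 // 1)) * r} {(r - 1q) * (r - 1q)} {1q} ze (l r) ~ rD) ~ EQ (ap (_* D) (sym er) >> l2 e r D))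
     where
     l = r1 ((v0 :- :1) :* (v0 :- :1)) ((v0 :- :2) :* v0 :+ :1)
     l2 = r3 (v0 :* v1 :* v2) (v2 :* v0 :* v1)
    De≥ : (3 // 2) * r ≤ D * e
    De≥ = nj (nh (nc {zf - (3 // 2)} by (df big)) (by {0q} {(zf - (3 // 2)) * (1000000000000000000000000000000 // 1) - zf * (2 // 1)}) ~ EQ (l r)) ~ De
     where l = r1 (((319 :/ 200) :- (3 :/ 2)) :* (v0 :- (1000000000000000000000000000000 :/ 1)) :+ (((319 :/ 200) :- (3 :/ 2)) :* (1000000000000000000000000000000 :/ 1) :- (319 :/ 200) :* :2)) ((319 :/ 200) :* (v0 :- :2) :- (3 :/ 2) :* v0)

   -- The tilt is fixed at 1/1000 and gains at least 2^m ≥ 256 `Nn`² per vertex of the set. `Nn`²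
   -- pays for the weight `ik`² per vertex; 256 = 4⁴ pays for ρ^(4n), because n ≤ `Nn` s gives (1 +
   -- 1/`Nn`)^n ≤ 4^s.
   sparse-class : θ ≤ (1000 // 1) * e -> bh Sb up * bh Sb up ≤ M0 * ((h * (ρ * ρ * (ρ * ρ))) ^ n * (ik ^ s * ik ^ s))
   sparse-class θe = ca {bh Sb up * bh Sb up} {M0 * ((h * (ρ * ρ * (ρ * ρ))) ^ n * (ik ^ s * ik ^ s))} {Z ^ s} (po s Z+)
    (za (nc (bm Sb up) (bm Sb up)) Zg ~ Peripheral.pO Se f Sb up sc sd hθ hθ' e (1 // 1000) pe by ≤-refl (zb {c = 1 // 1000} by θe ~ EQ (lth e)) (x≤tiny ~ by {ti} {(1 // 1000) * (1 // 1000)}) xe an hA (Pr Sb up) (\ ms pm p -> EventFacts.LL-true f d' Sb up w e pe e1 sc sd wD nD ms pm (eo ms p)) (\ ms pm p -> EventFacts.LL-false f d' Sb up w e pe e1 sc sd wD nD ms pm (eo ms p))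
     ~ za M0-nn (EQ (ap (_^ n) (*-1ˡ h)) ~ fin) ~ EQ (sym (*-as M0 ((h * (ρ * ρ * (ρ * ρ))) ^ n * (ik ^ s * ik ^ s)) (Z ^ s))))
    where
    Z = (256 // 1) * (ι Nn * ι Nn)
    Z+ : 0q < Z
    Z+ = pos-* (by< {0q} {256 // 1}) (pos-* N0+ N0+)
    an = m *' suc M' *' s
    anx : ι an * x ≡ ι m * ι s
    anx = trans (ap (_* x) (zn (m *' suc M') s >> ap (_* ι s) (zn m (suc M')))) (l (ι m) (ι (suc M')) (ι s) x >> ap (ι m * ι s *_) (ic (zj M')) >> *-1ʳ (ι m * ι s))
     where l = r4 (v0 :* v1 :* v2 :* v3) (v0 :* v2 :* (v1 :* v3))
    Zg : Z ^ s ≤ g ^ an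
    Zg = mc s (qa Z+) (h2m ~ mc m (by {0q} {2 // 1}) (EQ (sym (ap (1q +_) (ic (zj M')) >> refl)) ~ Lattice.g-lower M' (suc M')) ~ EQ (sym (zp g (suc M') m) >> ap (g ^_) (*-cmℕ (suc M') m))) ~ EQ (sym (zp g (m *' suc M') s))
    hA : ι an * x ≤ N * ((497 // 1000) * (D * (e * zo) * (1 // 1000)))
    hA = EQ anx ~ nj (nh (nc (zd s) (nh (nc {497 // 1000000} by (nh (nc {1 // 2} by (df De≥)) (nc (nc pD pe) (df θ'≥½)))) (nh (nc {1 // 4000} by (df hm)) (nc {(497 // 1000000) * (1 // 2) * (3 // 2) - (1 // 4000)} by (qa r+))))) (≤-refl {0q}) ~ EQ (trans (l (ι s) (ι m) r D e zm) (ap (\ z -> z * ((497 // 1000) * (D * (e * zm) * (1 // 1000))) - ι m * ι s) s-θ) >> l2 θ N D e zm (ι m * ι s)))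
     where
     l = r6 (v0 :* ((497 :/ 1000000) :* (:½ :* (v3 :* v4 :- (3 :/ 2) :* v2) :+ v3 :* v4 :* (v5 :- :½)) :+ ((1 :/ 4000) :* (v2 :- v1 :* (4000 :/ 1)) :+ ((497 :/ 1000000) :* :½ :* (3 :/ 2) :- (1 :/ 4000)) :* v2)) :+ :0) (v0 :* ((497 :/ 1000) :* (v3 :* (v4 :* v5) :* (1 :/ 1000))) :- v1 :* v0)
     l2 = r6 (v0 :* v1 :* ((497 :/ 1000) :* (v2 :* (v3 :* v4) :* (1 :/ 1000))) :- v5) (v1 :* ((497 :/ 1000) :* (v2 :* (v3 :* (v0 :* v4)) :* (1 :/ 1000))) :- v5)
    lth = r1 ((1000 :/ 1) :* v0 :* (1 :/ 1000)) v0
    four : (1q + ik) ^ n ≤ (4 // 1) ^ s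
    four = em (ba piN0 refl) nle ~ EQ (zp (1q + ik) Nn s) ~ mc s (ng Nn (qa 1N0+)) (mc Nn (qa 1N0+) (ba (nc {1 // 4} by (nc piN0 piN0)) (l ik)) ~ EQ (zi (1q + (1 // 2) * ik) (1q + (1 // 2) * ik) Nn) ~ ma nn nn two two ~ by {(2 // 1) * (2 // 1)} {4 // 1})
     where
     nle : n <= Nn *' s
     nle = cf (EQ (sym (*-1ˡ N)) ~ zb (zd n) hθ ~ EQ (ap (\ z -> z * θ * N) N0≡ >> *-as (ι Nn) θ N >> ap (ι Nn *_) (sym s-θ) >> sym (zn Nn s)))
     l = r1 ((:1 :+ :½ :* v0) :* (:1 :+ :½ :* v0)) (:1 :+ v0 :+ (1 :/ 4) :* (v0 :* v0))
     ph = nc {1 // 2} by piN0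
     nn = ng Nn (nh ze ph)
     two : (1q + (1 // 2) * ik) ^ Nn ≤ 2 // 1
     two = pow≤2 Nn ph (za {c = 1 // 2} by iN0≤ ~ by {(1 // 2) * ti} {1q}) (EQ (l' (ι Nn) ik >> ap ((1 // 2) *_) (ic N0+) >> *-1ʳ (1 // 2)))
      where l' = r2 (v0 :* (:½ :* v1)) (:½ :* (v0 :* v1))
    ρ4 : 1q ≤ ρ ^ n * (4 // 1) ^ s
    ρ4 = EQ (sym (sym (zi ρ (1q + ik) n) >> ap (_^ n) (*-cm ρ (1q + ik) >> ic 1N0+) >> zC n)) ~ za (ng n pρ) four
    iN-s : ι Nn ^ s * ik ^ s ≡ 1q
    iN-s = trans (sym (zi (ι Nn) ik s)) (ap (_^ s) (ic N0+) >> zC s)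
    fin : h ^ n ≤ (h * (ρ * ρ * (ρ * ρ))) ^ n * (ik ^ s * ik ^ s) * Z ^ s
    fin = EQ (sym (l1 (h ^ n))) ~ za (ng n h-nn) (ma ze (nc ze (nc ze ze)) ρ4 (ma ze (nc ze ze) ρ4 (ma ze ze ρ4 ρ4)))
     ~ EQ (l2 (h ^ n) (ρ ^ n) ((4 // 1) ^ s) >> ap₂ _*_ (sym hρ) (sym q4) >> l3 ((h * (ρ * ρ * (ρ * ρ))) ^ n) ((256 // 1) ^ s) (ι Nn ^ s) (ik ^ s) iN-s >> ap ((h * (ρ * ρ * (ρ * ρ))) ^ n * (ik ^ s * ik ^ s) *_) (sym (zi (256 // 1) (ι Nn * ι Nn) s >> ap ((256 // 1) ^ s *_) (zi (ι Nn) (ι Nn) s))))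
     where
     l1 = r1 (v0 :* (:1 :* (:1 :* (:1 :* :1)))) v0
     l2 = r3 (v0 :* (v1 :* v2 :* (v1 :* v2 :* (v1 :* v2 :* (v1 :* v2))))) (v0 :* (v1 :* v1 :* (v1 :* v1)) :* (v2 :* v2 :* (v2 :* v2)))
     hρ : (h * (ρ * ρ * (ρ * ρ))) ^ n ≡ h ^ n * (ρ ^ n * ρ ^ n * (ρ ^ n * ρ ^ n))
     hρ = trans (zi h (ρ * ρ * (ρ * ρ)) n) (ap (h ^ n *_) (zi (ρ * ρ) (ρ * ρ) n >> ap (\ z -> z * z) (zi ρ ρ n)))
     q4 : (256 // 1) ^ s ≡ (4 // 1) ^ s * (4 // 1) ^ s * ((4 // 1) ^ s * (4 // 1) ^ s)
     q4 = trans (zi (16 // 1) (16 // 1) s) (ap (\ z -> z * z) (zi (4 // 1) (4 // 1) s))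
     l3 : ∀ A B N i -> N * i ≡ 1q -> A * B ≡ A * (i * i) * (B * (N * N))
     l3 A B N i e = trans (l4 A B) (ap (\ z -> A * B * (z * z)) (sym e) >> l5 A B N i)
      where
      l4 = r2 (v0 :* v1) (v0 :* v1 :* (:1 :* :1))
      l5 = r4 (v0 :* v1 :* (v2 :* v3 :* (v2 :* v3))) (v0 :* (v3 :* v3) :* (v1 :* (v2 :* v2)))

   -- Here the tilt is e/θ, for which quadratic cost is half of the linear gain. The squared
   -- estimate then improves by about exp(d e² zm/2) per vertex.
   ml : (1000 // 1) * e ≤ θ -> ∀ σ y α -> θ ≤ 19 // 100 -> 0q ≤ σ -> 0q ≤ y -> y ≤ 1q -> α ≡ y ^ 100 -> 100 *' s <= 19 *' n -> h₀ ≤ σ * (y ^ 19 * y ^ 19) * Eof 510 -> 0q ≤ (1q + (510 // 10000) + (1 // 2) * ((510 // 10000) * ((510 // 10000) - ti))) ->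
    bh Sb up * bh Sb up ≤ M0 * (σ ^ n * (α ^ s * α ^ s))
   ml eθ σ y α θ≤ pσ py y1 αe le final nnE = reweigh {bh Sb up * bh Sb up} {g ^ (20 *' 510 *' da)} {1q * h} {σ} {α} {y} s 19 100 (po (20 *' 510 *' da) g+) (nc ze h-nn) pσ py y1 αe le
    (EQ (*-1ˡ h) ~ h≤ ~ final ~ za (nc pσ (nc (ng 19 py) (ng 19 py))) (g-power 510 nnE))
    (EQ (ap (bh Sb up * bh Sb up *_) (sym (zp g (20 *' 510 *' da) n))) ~ Peripheral.pO Se f Sb up sc sd hθ hθ' e τ pe (nc pe piθ) τ≤ (EQ θτ) xτ xe an hA  (Pr Sb up) (\ ms pm p -> EventFacts.LL-true f d' Sb up w e pe e1 sc sd wD nD ms pm (eo ms p)) (\ ms pm p -> EventFacts.LL-false f d' Sb up w e pe e1 sc sd wD nD ms pm (eo ms p)))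
    where
    iθ = ig θ
    piθ = ie θ+
    τ = e * iθ
    θτ : θ * τ ≡ e
    θτ = trans (l θ e iθ) (ap (e *_) (ic θ+) >> *-1ʳ e)
     where l = r3 (v0 :* (v1 :* v2)) (v1 :* (v0 :* v2))
    e≤τ : e ≤ τ
    e≤τ = EQ (sym (*-1ʳ e)) ~ za pe (1≤inv θ+ (θ≤½ ~ by {1 // 2} {1q}))
    τ≤ : τ ≤ 1 // 1000
    τ≤ = di θ+ (nj (nc {1 // 1000} by (df eθ) ~ EQ (l e θ)))
     where l = r2 ((1 :/ 1000) :* (v1 :- (1000 :/ 1) :* v0)) ((1 :/ 1000) :* v1 :- v0)
    xτ : x ≤ (1 // 1000) * τ
    xτ = ca {x} {(1 // 1000) * e} {r} r+ (za px r≤D ~ xD ~ by {ti} {(1 // 1000) * zf} ~ EQ (ap ((1 // 1000) *_) (sym er) >> sym (*-as (1 // 1000) e r))) ~ za {c = 1 // 1000} by e≤τ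
    θ'≥ : 81 // 100 ≤ zm
    θ'≥ = nj (df θ≤ ~ EQ (l θ zm >> ap (\ z -> zm - (z - (19 // 100))) sum1))
     where l = r2 ((19 :/ 100) :- v0) (v1 :- (v0 :+ v1 :- (19 :/ 100)))
    De²≥ : zf * (zf * (1q - (2 // 1) * ig r)) ≤ D * e * e
    De²≥ = EQ (ap (\ z -> zf * (zf * (z - (2 // 1) * ig r))) (sym (ic r+)) >> l zf r (ig r)) ~ zb pe De
     where l = r3 (v0 :* (v0 :* (v1 :* v2 :- :2 :* v2))) (v0 :* (v1 :- :2) :* (v0 :* v2))
    -- 0.497 · 1.595² · 0.81 is about 1.024, the exponent at the upper density 0.19.
    A≤ : (10200 // 10000) ≤ (497 // 1000) * (D * e * e * zm)
    A≤ = by {10200 // 10000} {(497 // 1000) * (zf * (zf * (1q - (2 // 1) * (1 // 1000000000000000000000000000000))) * (81 // 100))} ~ za {c = 497 // 1000} by (ma (by {0q} {zf * (zf * (1q - (2 // 1) * (1 // 1000000000000000000000000000000)))}) (by {0q} {81 // 100}) (za {c = zf} by (za {c = zf} by (+-≤ʳ 1q (nm (za {c = 2 // 1} by ir≤)))) ~ De²≥) θ'≥)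
    an = 20 *' 510 *' da *' n
    hA : ι an * x ≤ N * ((497 // 1000) * (D * (e * zo) * τ))
    hA = EQ (ap (_* x) (zn (20 *' 510 *' da) n) >> l (ι (20 *' 510 *' da)) N x >> ap (N *_) (ge (20 *' 510) >> ap (_* (1 // 10000)) (li 10200))) ~ za (zd n) (by {(10200 // 1) * (1 // 10000)} {10200 // 10000} ~ A≤ ~ EQ (sym (l2 D e θ zm τ >> ap (\ z -> (497 // 1000) * (D * e * z * zm)) θτ)))
     where
     l = r3 (v0 :* v1 :* v2) (v1 :* (v0 :* v2))
     l2 = r5 ((497 :/ 1000) :* (v0 :* (v1 :* (v2 :* v3)) :* v4)) ((497 :/ 1000) :* (v0 :* v1 :* (v2 :* v4) :* v3))

 -- A pair (α, σ) certifies a squared bound σ^n α^(2s), whose sum over sets decays if σ(1 + α)² ≤ ρ.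
 -- The entries follow increasing density; the last has α = 1, as no counting gain is left near one
 -- half.
 cls : List (ℚ × ℚ)
 cls = (ik , h * (ρ * ρ * (ρ * ρ))) ∷ ((137 // 139) ^ 100 , 32763 // 50000) ∷ ((39 // 40) ^ 50 , 12157 // 20000) ∷ ((26 // 27) ^ 25 , 647 // 1250)
  ∷ ((32 // 33) ^ 20 , 42101 // 100000) ∷ ((12 // 13) ^ 5 , 8953 // 25000) ∷ ((96 // 97) ^ 20 , 30399 // 100000) ∷ (1q ^ 2 , 999 // 4000) ∷ []

 Admissible : ℚ × ℚ -> Set
 Admissible (α , σ) = 0q ≤ α × 0q ≤ σ × σ * ((1q + α) * (1q + α)) ≤ ρ

 ck : ∀ c -> c ∈ cls -> Admissible c
 ck c (here refl) = iN0-nn , nc h-nn (nc (nc pρ pρ) (nc pρ pρ)) , sparse-total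
 ck c (there (here refl)) = by , by , (by {(32763 // 50000) * ((1q + (137 // 139) ^ 100) * (1q + (137 // 139) ^ 100))} {999 // 1000} ~ ρ≥)
 ck c (there (there (here refl))) = by , by , (by {(12157 // 20000) * ((1q + (39 // 40) ^ 50) * (1q + (39 // 40) ^ 50))} {999 // 1000} ~ ρ≥)
 ck c (there (there (there (here refl)))) = by , by , (by {(647 // 1250) * ((1q + (26 // 27) ^ 25) * (1q + (26 // 27) ^ 25))} {999 // 1000} ~ ρ≥)
 ck c (there (there (there (there (here refl))))) = by , by , (by {(42101 // 100000) * ((1q + (32 // 33) ^ 20) * (1q + (32 // 33) ^ 20))} {999 // 1000} ~ ρ≥)
 ck c (there (there (there (there (there (here refl)))))) = by , by , (by {(8953 // 25000) * ((1q + (12 // 13) ^ 5) * (1q + (12 // 13) ^ 5))} {999 // 1000} ~ ρ≥)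
 ck c (there (there (there (there (there (there (here refl))))))) = by , by , (by {(30399 // 100000) * ((1q + (96 // 97) ^ 20) * (1q + (96 // 97) ^ 20))} {999 // 1000} ~ ρ≥)
 ck c (there (there (there (there (there (there (there (here refl)))))))) = by , by , (by {(999 // 4000) * ((1q + 1q ^ 2) * (1q + 1q ^ 2))} {999 // 1000} ~ ρ≥)

 Gd : Vec Bool n -> Bool -> ℚ × ℚ -> Set
 Gd Sb up (α , σ) = bh Sb up * bh Sb up ≤ M0 * (σ ^ n * (α ^ cn (lookup Sb) true * α ^ cn (lookup Sb) true))

 module _ (Sb : Vec Bool n) (up : Bool) (sc : 1 <= cn (lookup Sb) true) (ss : cn (lookup Sb) true <= cn (lookup Sb) false) where
  open Labels f Sb up using (s; s'; θ; zm)
  private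
   n+ : 0q < ι n
   n+ = Fractions.n+ s s' n sc (cu (lookup Sb))
   θ-ge : ∀ j m' -> ¬ (suc m' *' s <= j *' n) -> (j // suc m') ≤ θ
   θ-ge j m' h = ≤-div n+ (ca {(j // suc m') * ι n} {ι s} {ι (suc m')} (zj m') (EQ (l (j // suc m') (ι n) (ι (suc m')) >> ap (_* ι n) (dv j m') >> sym (zn j n)) ~ mn (<≤ (ℕP.≰⇒> h)) ~ EQ (zn (suc m') s >> *-cm (ι (suc m')) (ι s))))
    where l = r3 (v0 :* v1 :* v2) (v0 :* v2 :* v1)
   θ-le : ∀ j m' -> suc m' *' s <= j *' n -> θ ≤ (j // suc m')
   θ-le j m' h = di n+ (ca {ι s} {(j // suc m') * ι n} {ι (suc m')} (zj m') (EQ (*-cm (ι s) (ι (suc m')) >> sym (zn (suc m') s)) ~ mn h ~ EQ (sym (l (j // suc m') (ι n) (ι (suc m')) >> ap (_* ι n) (dv j m') >> sym (zn j n)))))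
    where l = r3 (v0 :* v1 :* v2) (v0 :* v2 :* v1)
   half : 2 *' s <= 1 *' n
   half = ≤≤ (≤≡ (ap (s ℕ.+_) (n+0 s))) (≤≤ (+-≤ℕ s ss) (≤≡ (cu (lookup Sb) >> sym (ℕP.*-identityˡ n))))

  classify : (D * (D * D) * θ ≤ 1q) ⊎ (∃[ c ] (c ∈ cls × Gd Sb up c))
  classify = go0 (D * (D * D) * θ ℚ.≤? 1q)
   where
   go0 : Dec (D * (D * D) * θ ≤ 1q) -> (D * (D * D) * θ ≤ 1q) ⊎ (∃[ c ] (c ∈ cls × Gd Sb up c))
   go0 (yes p) = inj₁ p
   go0 (no p) = inj₂ (go1 (100 *' s ℕ.≤? 19 *' n) (50 *' s ℕ.≤? 11 *' n) (25 *' s ℕ.≤? 7 *' n) (20 *' s ℕ.≤? 7 *' n) (5 *' s ℕ.≤? 2 *' n) (20 *' s ℕ.≤? 9 *' n))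
    where
    dn = qa (≰⇒> p)
    go1 : Dec (100 *' s <= 19 *' n) -> Dec (50 *' s <= 11 *' n) -> Dec (25 *' s <= 7 *' n) -> Dec (20 *' s <= 7 *' n) -> Dec (5 *' s <= 2 *' n) -> Dec (20 *' s <= 9 *' n) -> ∃[ c ] (c ∈ cls × Gd Sb up c)
    go1 (yes a) _ _ _ _ _ = ga (θ ℚ.≤? (1000 // 1) * e)
     where
     ga : Dec (θ ≤ (1000 // 1) * e) -> ∃[ c ] (c ∈ cls × Gd Sb up c)
     ga (yes b) = _ , here refl , OneSet.Dense.sparse-class Sb up sc ss dn b
     ga (no b) = _ , there (here refl) , OneSet.Dense.ml Sb up sc ss dn (qa (≰⇒> b)) (32763 // 50000) (137 // 139) ((137 // 139) ^ 100) (θ-le 19 99 a) by by by refl a by by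
    -- Each call gives the left end θa of its window, `Ch` slightly above 1/(2√(θa(1 - θa))), the
    -- exponent a'/500 permitted by `closed`, then σ, y and α = y^m', with j/m' the right end of the
    -- window.
    go1 (no z) (yes a) _ _ _ _ = _ , there (there (here refl)) , OneSet.Dense.cj Sb up sc ss dn (19 // 100) (6373 // 5000) 501 (12157 // 20000) (39 // 40) ((39 // 40) ^ 50) 11 50 by by by by (θ-ge 19 99 z) by by by by by by by refl a by
    go1 (no _) (no z) (yes a) _ _ _ = _ , there (there (there (here refl))) , OneSet.Dense.cj Sb up sc ss dn (11 // 50) (12071 // 10000) 538 (647 // 1250) (26 // 27) ((26 // 27) ^ 25) 7 25 by by by by (θ-ge 11 49 z) by by by by by by by refl a by
    go1 (no _) (no _) (no z) (yes a) _ _ = _ , there (there (there (there (here refl)))) , OneSet.Dense.cj Sb up sc ss dn (7 // 25) (696 // 625) 579 (42101 // 100000) (32 // 33) ((32 // 33) ^ 20) 7 20 by by by by (θ-ge 7 24 z) by by by by by by by refl a by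
    go1 (no _) (no _) (no _) (no z) (yes a) _ = _ , there (there (there (there (there (here refl))))) , OneSet.Dense.cj Sb up sc ss dn (7 // 20) (10483 // 10000) 601 (8953 // 25000) (12 // 13) ((12 // 13) ^ 5) 2 5 by by by by (θ-ge 7 19 z) by by by by by by by refl a by
    go1 (no _) (no _) (no _) (no _) (no z) (yes a) = _ , there (there (there (there (there (there (here refl)))))) , OneSet.Dense.cj Sb up sc ss dn (2 // 5) (10207 // 10000) 609 (30399 // 100000) (96 // 97) ((96 // 97) ^ 20) 9 20 by by by by (θ-ge 2 4 z) by by by by by by by refl a by
    go1 (no _) (no _) (no _) (no _) (no _) (no z) = _ , there (there (there (there (there (there (there (here refl))))))) , OneSet.Dense.cj Sb up sc ss dn (9 // 20) (10051 // 10000) 613 (999 // 4000) 1q (1q ^ 2) 1 2 by by by by (θ-ge 9 19 z) by by by by by by by refl half by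

  small-case : D * (D * D) * θ ≤ 1q -> bh Sb up ≤ tot ^ d * ((1 // 8) * (θ * θ)) ^ s
  small-case = OneSet.small-class Sb up sc ss

 vd : Vec Bool n -> Bool
 vd Sb = ⌊ 1 ℕ.≤? cn (lookup Sb) true ⌋ ∧ ⌊ cn (lookup Sb) true ℕ.≤? cn (lookup Sb) false ⌋
 good? : ∀ Sb up c -> Dec (Gd Sb up c)
 good? Sb up (α , σ) = bh Sb up * bh Sb up ℚ.≤? M0 * (σ ^ n * (α ^ cn (lookup Sb) true * α ^ cn (lookup Sb) true))
 tf : Vec Bool n -> Bool -> ℚ × ℚ -> ℚ
 tf Sb up c = 𝟙 ⌊ good? Sb up c ⌋ * bh Sb up
 trunc-nn : ∀ Sb up c -> 0q ≤ tf Sb up c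
 trunc-nn Sb up c = nc (nk ⌊ good? Sb up c ⌋) (bm Sb up)

 module Sum (ζ : ℚ) (pζ : 0q ≤ ζ) (decay : M0 * ρ ^ n ≤ ζ * tot ^ d * (ζ * tot ^ d)) where
  private
   ptot = ng d (zd (length (perfectMatchings n)))
   Tc : Bool -> ℚ × ℚ -> ℚ
   Tc up c = S (\ Sb -> tf Sb up c) (allSubsets n)
   Tc≤ : ∀ up c -> c ∈ cls -> Tc up c ≤ ζ * tot ^ d
   Tc≤ up (α , σ) cc = sr (nc pζ ptot) (sq-sum {a = \ Sb -> tf Sb up (α , σ)} {b = \ Sb -> α ^ cn (lookup Sb) true} {σ = M0 * σ ^ n} (allSubsets n) (nc M0-nn (ng n pσ)) (\ Sb -> trunc-nn Sb up (α , σ)) (\ Sb -> ng (cn (lookup Sb) true) pα) (\ Sb _ -> tr Sb (good? Sb up (α , σ)))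
    ~ EQ (ap (\ z -> M0 * σ ^ n * (z * z)) (sA n α) >> *-as M0 (σ ^ n) ((1q + α) ^ n * (1q + α) ^ n) >> ap (M0 *_) (ap (σ ^ n *_) (sym (zi (1q + α) (1q + α) n)) >> sym (zi σ ((1q + α) * (1q + α)) n)))
    ~ za M0-nn (mc n (nc pσ (nc (nh ze pα) (nh ze pα))) ok) ~ decay)
    where
    ad = ck (α , σ) cc
    pα = fst ad
    pσ = fst (snd ad)
    ok = snd (snd ad)
    tr : ∀ Sb (x : Dec (Gd Sb up (α , σ))) -> 𝟙 ⌊ x ⌋ * bh Sb up * (𝟙 ⌊ x ⌋ * bh Sb up) ≤ M0 * σ ^ n * (α ^ cn (lookup Sb) true * α ^ cn (lookup Sb) true)
    tr Sb (yes gd) = EQ (l (bh Sb up)) ~ gd ~ EQ (sym (*-as M0 (σ ^ n) (α ^ cn (lookup Sb) true * α ^ cn (lookup Sb) true)))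
     where l = r1 (:1 :* v0 :* (:1 :* v0)) (v0 :* v0)
    tr Sb (no _) = EQ (l (bh Sb up)) ~ nc (nc M0-nn (ng n pσ)) (nc (ng (cn (lookup Sb) true) pα) (ng (cn (lookup Sb) true) pα))
     where l = r1 (:0 :* v0 :* (:0 :* v0)) :0
   iN = ig (ι n)
   se : Vec Bool n -> ℚ
   se Sb = S (\ j -> 𝟙 ⌊ cn (lookup Sb) true ℕ.≟ suc j ⌋ * ((1 // 8) * (ι (suc j) * iN * (ι (suc j) * iN))) ^ suc j) (ds n)
   n≥1 : 1 <= n
   n≥1 = cf (EQ ι1 ~ Da ~ nD ~ ba {ι n - 1q} {ι n} {1q} ze (l (ι n)))
    where l = r1 v0 (v0 :- :1 :+ :1)
   piN : 0q ≤ iN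
   piN = ie (<-≤ (zj 0) (mn n≥1))
   sw-nn : ∀ (Sb : Vec Bool n) j -> 0q ≤ 𝟙 ⌊ cn (lookup Sb) true ℕ.≟ suc j ⌋ * ((1 // 8) * (ι (suc j) * iN * (ι (suc j) * iN))) ^ suc j
   sw-nn Sb j = nc (nk ⌊ cn (lookup Sb) true ℕ.≟ suc j ⌋) (ng (suc j) (nc {1 // 8} by (sn (ι (suc j) * iN))))
   weight-term : ∀ (Sb : Vec Bool n) k -> cn (lookup Sb) true ≡ k -> 1 <= k -> ((1 // 8) * (ι k * iN * (ι k * iN))) ^ k ≤ se Sb
   weight-term Sb (suc j) e _ = EQ (sym (ap (\ b -> 𝟙 b * ((1 // 8) * (ι (suc j) * iN * (ι (suc j) * iN))) ^ suc j) (tu (cn (lookup Sb) true ℕ.≟ suc j) e) >> *-1ˡ (((1 // 8) * (ι (suc j) * iN * (ι (suc j) * iN))) ^ suc j)))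
    ~ S-term {f = \ j -> 𝟙 ⌊ cn (lookup Sb) true ℕ.≟ suc j ⌋ * ((1 // 8) * (ι (suc j) * iN * (ι (suc j) * iN))) ^ suc j} (ds n) (∈-downs n (≤≤ (≤≡ (sym e)) (≤≤ (m≤m+n (cn (lookup Sb) true) (cn (lookup Sb) false)) (≤≡ (cu (lookup Sb)))))) (sw-nn Sb)
   pointwise : ∀ up Sb -> 𝟙 (vd Sb) * bh Sb up ≤ tot ^ d * se Sb + S (tf Sb up) cls
   pointwise up Sb = go (vd Sb) refl
    where
    c-nn : 0q ≤ S (tf Sb up) cls
    c-nn = S-nn cls (trunc-nn Sb up)
    w-nn : 0q ≤ tot ^ d * se Sb
    w-nn = nc ptot (S-nn (ds n) (sw-nn Sb))
    go : ∀ b -> vd Sb ≡ b -> 𝟙 b * bh Sb up ≤ tot ^ d * se Sb + S (tf Sb up) cls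
    go false e = EQ (*-0ˡ (bh Sb up)) ~ nh w-nn c-nn
    go true e = EQ (*-1ˡ (bh Sb up)) ~ ga (classify Sb up sc ss)
     where
     sc = de (1 ℕ.≤? cn (lookup Sb) true) (fst (tj e))
     ss = de (cn (lookup Sb) true ℕ.≤? cn (lookup Sb) false) (snd (tj {⌊ 1 ℕ.≤? cn (lookup Sb) true ⌋} e))
     ga : (D * (D * D) * Labels.θ f Sb up ≤ 1q) ⊎ (∃[ c ] (c ∈ cls × Gd Sb up c)) -> bh Sb up ≤ tot ^ d * se Sb + S (tf Sb up) cls
     ga (inj₁ p) = small-case Sb up sc ss p ~ za ptot (weight-term Sb (cn (lookup Sb) true) refl sc) ~ ba c-nn refl
     ga (inj₂ (c , cc , gd)) = EQ (sym (ap (\ b -> 𝟙 b * bh Sb up) (tu (good? Sb up c) gd) >> *-1ˡ (bh Sb up))) ~ S-term {f = tf Sb up} cls cc (trunc-nn Sb up) ~ ba w-nn (+-cm (tot ^ d * se Sb) (S (tf Sb up) cls))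
   small-total : ∀ n -> 1 <= n -> S (\ (Sb : Vec Bool n) -> S (\ j -> 𝟙 ⌊ cn (lookup Sb) true ℕ.≟ suc j ⌋ * ((1 // 8) * (ι (suc j) * ig (ι n) * (ι (suc j) * ig (ι n)))) ^ suc j) (ds n)) (allSubsets n) ≤ (2 // 1) * ig (ι n)
   small-total (suc n') _ = sG n'

  -- 2/n comes from the very small sets, and each of the eight entries of `cls` contributes at most
  -- ζ.
  union-bound : ∀ up -> S (\ Sb -> 𝟙 (vd Sb) * bh Sb up) (allSubsets n) ≤ tot ^ d * ((2 // 1) * ig (ι n) + (8 // 1) * ζ)
  union-bound up = Sm (allSubsets n) (\ Sb _ -> pointwise up Sb) ~ EQ (S-+ (\ Sb -> tot ^ d * se Sb) (\ Sb -> S (tf Sb up) cls) (allSubsets n) >> ap₂ _+_ (Sa (tot ^ d) se (allSubsets n)) (Ss (\ Sb c -> tf Sb up c) (allSubsets n) cls))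
   ~ mb (za ptot (small-total n n≥1)) (Sm cls (\ c cc -> Tc≤ up c cc) ~ EQ (Sn (ζ * tot ^ d) cls >> ap (_* (ζ * tot ^ d)) (li 8))) ~ EQ (l (tot ^ d) ((2 // 1) * ig (ι n)) ζ)
   where l = r3 (v0 :* v1 :+ :8 :* (v2 :* v0)) (v0 :* (v1 :+ :8 :* v2))

-- From extremal cuts to the sparsifier property.

≤ᵇ-true : ∀ {a b : ℚ} -> a ≤ b -> (a ℚ.≤ᵇ b) ≡ true
≤ᵇ-true {a} {b} h = go (a ℚ.≤ᵇ b) (ℚP.≤⇒≤ᵇ h)
 where
 go : ∀ x -> T x -> x ≡ true
 go true _ = refl

module Extremal (n d : ℕ) (w e : ℚ) (ms : Vec (Vec (Fin n) n) d) (pm : AV Is ms) where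
 open Excess {n} {d} w e
 open Cuts {n}
 Pd : Vec Bool n -> Bool -> Bool
 Pd Sb up = ⌊ 0q ℚ.<? V up ms Sb ⌋ ∧ allB (\ U -> ⌊ V up ms U ℚ.≤? V up ms Sb ⌋) (allSubsets n)
 va : Vec Bool n -> Bool
 va Sb = ⌊ 1 ℕ.≤? cn (lookup Sb) true ⌋ ∧ ⌊ cn (lookup Sb) true ℕ.≤? cn (lookup Sb) false ⌋

 private
  V-compl : ∀ up U -> V up ms (compl U) ≡ V up ms U
  V-compl up U = ap₂ (\ a b -> sgn up * (w * ι a - b) - e * b) (compl-XS U ms pm) (ap₂ (\ a b -> ι a * ι b) (cC U true) (cC U false) >> *-cm (ι (sz U false)) (ι (sz U true)))
  nonempty : ∀ up U -> 0q < V up ms U -> 1 <= cn (lookup U) true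
  nonempty up U p = go (cn (lookup U) true) refl
   where
   go : ∀ k -> cn (lookup U) true ≡ k -> 1 <= k
   go zero e' = ⊥-elim (ℚP.<-irrefl refl (<-≤ p (EQ (ap₂ (\ a b -> sgn up * (w * ι a - ι b * ι (sz U false)) - e * (ι b * ι (sz U false))) X0 e' >> ap (\ z -> sgn up * (w * z - z * ι (sz U false)) - e * (z * ι (sz U false))) ι0 >> l (sgn up) w (ι (sz U false)) e))))
    where
    X0 : XS U ms ≡ 0
    X0 = ℕP.n≤0⇒n≡0 (≤≤ (XS≤ U ms) (≤≡ (ap (ℕ._* d) e')))
    l = r4 (v0 :* (v1 :* :0 :- :0 :* v2) :- v3 :* (:0 :* v2)) :0
   go (suc k) _ = ℕ.s≤s ℕ.z≤n
  fd : ∀ up U -> 0q < V up ms U -> (∀ U' -> V up ms U' ≤ V up ms U) -> cn (lookup U) true <= cn (lookup U) false -> Pd U up ≡ true × va U ≡ true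
  fd up U p h le = ap₂ _∧_ (tu (0q ℚ.<? V up ms U) p) (ac (\ U' -> ⌊ V up ms U' ℚ.≤? V up ms U ⌋) (allSubsets n) (\ U' _ -> tu (V up ms U' ℚ.≤? V up ms U) (h U')))
   , ap₂ _∧_ (tu (1 ℕ.≤? cn (lookup U) true) (nonempty up U p)) (tu (cn (lookup U) true ℕ.≤? cn (lookup U) false) le)

 -- The maximiser is taken over all sets, hence beats in particular every single move. Since the
 -- excess is the same for a set and its complement, the smaller side can be chosen.
 extremal : ∀ up -> (∀ U -> V up ms U ≤ 0q) ⊎ (∃[ U ] (Pd U up ≡ true × va U ≡ true))
 extremal up = go (0q ℚ.<? V up ms U₀) (ℕP.≤-total (cn (lookup U₀) true) (cn (lookup U₀) false))
  where
  am = argmax (V up ms) (Vec.replicate n true) (allSubsets n)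
  U₀ = fst am
  mx : ∀ U -> V up ms U ≤ V up ms U₀
  mx U = snd am U (there (aS U))
  go : Dec (0q < V up ms U₀) -> cn (lookup U₀) true <= cn (lookup U₀) false ⊎ cn (lookup U₀) false <= cn (lookup U₀) true -> (∀ U -> V up ms U ≤ 0q) ⊎ (∃[ U ] (Pd U up ≡ true × va U ≡ true))
  go (no q) _ = inj₁ (\ U -> mx U ~ ℚP.≮⇒≥ q)
  go (yes q) (inj₁ le) = inj₂ (U₀ , fd up U₀ q mx le)
  go (yes q) (inj₂ le) = inj₂ (compl U₀ , fd up (compl U₀) (subst (0q <_) (sym (V-compl up U₀)) q) (\ U -> mx U ~ EQ (sym (V-compl up U₀))) (subst₂ ℕ._≤_ (sym (cC U₀ true)) (sym (cC U₀ false)) le))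

 private
  K-nn : ∀ U -> 0q ≤ KK U
  K-nn U = nc (zd (sz U true)) (zd (sz U false))
  ok : ∀ q -> 0q ≤ e -> ι d * (e * e) ≤ q * q -> (∀ up U -> V up ms U ≤ 0q) -> ∀ U -> ι d * ((w * ι (XS U ms) - KK U) * (w * ι (XS U ms) - KK U)) ≤ q * q * (KK U * KK U)
  ok q pe hq h U = za (zd d) sq ~ EQ (l0 (ι d) e (KK U)) ~ zb (nc (K-nn U) (K-nn U)) hq
   where
   δ = w * ι (XS U ms) - KK U
   E = e * KK U
   a : δ ≤ E
   a = nj (neg≤ (h true U) ~ EQ (l δ E))
    where l = r2 (:- (:1 :* v0 :- v1)) (v1 :- v0)
   b : - δ ≤ E
   b = nj (neg≤ (h false U) ~ EQ (l δ E))
    where l = r2 (:- (:- :1 :* v0 :- v1)) (v1 :- :- v0)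
   sq : δ * δ ≤ E * E
   sq = nj (nc (df a) (df b) ~ EQ (l δ E))
    where l = r2 ((v1 :- v0) :* (v1 :- :- v0)) (v1 :* v1 :- v0 :* v0)
   l0 = r3 (v0 :* (v1 :* v2 :* (v1 :* v2))) (v0 :* (v1 :* v1) :* (v2 :* v2))

 sparsifier : ∀ .{{_ : ℕ.NonZero d}} q -> 0q ≤ e -> w ≡ edgeWeight n d -> ι d * (e * e) ≤ q * q -> (∀ up U -> V up ms U ≤ 0q) -> isSparsifierScaledB n d q ms ≡ true
 sparsifier q pe we hq h = ac _ (allSubsets n) (\ U _ -> ≤ᵇ-true (EQ (ap₂ (\ a b -> a * (b * b)) (sym (ι-def d)) (ap₂ _-_ (cutH≡ (edgeWeight n d) ms U >> ap (_* ι (XS U ms)) (sym we)) (cutK≡ U))) ~ ok q pe hq h U ~ EQ (ap (\ z -> q * q * (z * z)) (sym (cutK≡ U)))))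

 fu : ∀ .{{_ : ℕ.NonZero d}} q -> 0q ≤ e -> w ≡ edgeWeight n d -> ι d * (e * e) ≤ q * q ->
  𝟙 (not (isSparsifierScaledB n d q ms)) ≤ S (\ Sb -> 𝟙 (va Sb) * 𝟙 (Pd Sb true)) (allSubsets n) + S (\ Sb -> 𝟙 (va Sb) * 𝟙 (Pd Sb false)) (allSubsets n)
 fu q pe we hq = go (extremal true) (extremal false)
  where
  F : Bool -> Vec Bool n -> ℚ
  F up Sb = 𝟙 (va Sb) * 𝟙 (Pd Sb up)
  F-nn : ∀ up Sb -> 0q ≤ F up Sb
  F-nn up Sb = nc (nk (va Sb)) (nk (Pd Sb up))
  one : ∀ up -> (∃[ U ] (Pd U up ≡ true × va U ≡ true)) -> 1q ≤ S (F up) (allSubsets n)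
  one up (U , p , v) = EQ (sym (ap₂ (\ a b -> 𝟙 a * 𝟙 b) v p)) ~ S-term {f = F up} (allSubsets n) (aS U) (F-nn up)
  nn : ∀ up -> 0q ≤ S (F up) (allSubsets n)
  nn up = S-nn (allSubsets n) (F-nn up)
  go : (∀ U -> V true ms U ≤ 0q) ⊎ (∃[ U ] (Pd U true ≡ true × va U ≡ true)) -> (∀ U -> V false ms U ≤ 0q) ⊎ (∃[ U ] (Pd U false ≡ true × va U ≡ true)) ->
   𝟙 (not (isSparsifierScaledB n d q ms)) ≤ S (F true) (allSubsets n) + S (F false) (allSubsets n)
  go (inj₂ x) _ = zG (not (isSparsifierScaledB n d q ms)) ~ one true x ~ ba (nn false) refl
  go (inj₁ _) (inj₂ x) = zG (not (isSparsifierScaledB n d q ms)) ~ one false x ~ ba (nn true) (+-cm (S (F true) (allSubsets n)) (S (F false) (allSubsets n)))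
  go (inj₁ a) (inj₁ b) = EQ (ap (\ z -> 𝟙 (not z)) (sparsifier q pe we hq (\ { true -> a ; false -> b }))) ~ nh (nn true) (nn false)

-- Take y with (1 + y)^(m+1) ≤ 1/ρ. As n + 1 ≤ (1 + y)^n / y, the product (n + 1)^(m+1) ρ^n stays
-- bounded, and the one power of n + 1 beyond m forces the decay. `expand` finds y from the
-- convexity of (1 + y)^k on [0, 1].
poly-decay : ∀ ρ Q m ζ -> 0q < ρ -> ρ < 1q -> 0q ≤ Q -> 0q < ζ -> ∃[ N ] (∀ n -> N <= n -> Q * ι (suc n) ^ m * ρ ^ n ≤ ζ)
poly-decay ρ Q m ζ ρ+ ρ1 pQ ζ+ = fst C , bound
 where
 iρ = ig ρ
 piρ = io ρ+
 z = iρ - 1q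
 z+ : 0q < z
 z+ = subst (_< z) (+-inv 1q) (ℚP.+-monoˡ-< (- 1q) (≰⇒> (\ h -> <⇒≱ ρ1 (EQ (sym (ic ρ+)) ~ za (qa ρ+) h ~ EQ (*-1ʳ ρ)))))
 2m = (2 // 1) ^ suc m
 2m+ : 0q < 2m
 2m+ = po (suc m) (by< {0q} {2 // 1})
 y0 = ℚ._⊓_ z 1q
 y0+ : 0q < y0
 y0+ = go (≤-tot z 1q)
  where
  go : z ≤ 1q ⊎ 1q ≤ z -> 0q < y0
  go (inj₁ h) = subst (0q <_) (sym (ℚP.p≤q⇒p⊓q≡p h)) z+
  go (inj₂ h) = subst (0q <_) (sym (ℚP.p≥q⇒p⊓q≡q h)) (>0 1q)
 y = y0 * ig 2m
 y+ : 0q < y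
 y+ = pos-* y0+ (io 2m+)
 1≤2m : 1q ≤ 2m
 1≤2m = zt (suc m) (by {1q} {2 // 1})
 y1 : y ≤ 1q
 y1 = ma (qa y0+) (ie 2m+) (ℚP.p⊓q≤q z 1q) (il {2m} {1q} 2m+ (1≤2m ~ EQ (sym (*-1ˡ 2m)))) ~ EQ (*-1ˡ 1q)
 expand : ∀ k -> (1q + y) ^ k ≤ 1q + y * ((2 // 1) ^ k - 1q)
 expand zero = EQ (l y)
  where l = r1 :1 (:1 :+ v0 :* (:1 :- :1))
 expand (suc k) = za (nh ze (qa y+)) (expand k) ~ ba (nc (nc (qa y+) (df y1)) (df (zt k (by {1q} {2 // 1})))) (l y ((2 // 1) ^ k))
  where l = r2 (:1 :+ v0 :* (:2 :* v1 :- :1)) ((:1 :+ v0) :* (:1 :+ v0 :* (v1 :- :1)) :+ v0 :* (:1 :- v0) :* (v1 :- :1))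
 pw : (1q + y) ^ suc m ≤ iρ
 pw = expand (suc m) ~ +-≤ʳ 1q (za (qa y+) (ba {2m - 1q} {2m} {1q} ze (l3 2m)) ~ EQ (l y0 (ig 2m) 2m >> ap (y0 *_) (ic 2m+) >> *-1ʳ y0) ~ ℚP.p⊓q≤p z 1q) ~ EQ (l2 iρ)
  where
  l = r3 (v0 :* v1 :* v2) (v0 :* (v2 :* v1))
  l2 = r1 (:1 :+ (v0 :- :1)) v0
  l3 = r1 v0 (v0 :- :1 :+ :1)
 iy = ig y
 K : ℚ
 K = Q * iy ^ suc m
 C = ceil (K * ig ζ) (nc (nc pQ (ng (suc m) (ie y+))) (ie ζ+))
 bound : ∀ n -> fst C <= n -> Q * ι (suc n) ^ m * ρ ^ n ≤ ζ
 bound n le = ca {Q * ι (suc n) ^ m * ρ ^ n} {ζ} {ι (suc n)} (zj n) (EQ (l Q (ι (suc n) ^ m) (ρ ^ n) (ι (suc n))) ~ za pQ (zb (ng n (qa ρ+)) grow) ~ EQ (ap (Q *_) (*-as (iy ^ suc m) (iρ ^ n) (ρ ^ n) >> ap (iy ^ suc m *_) (sym (zi iρ ρ n) >> ap (_^ n) (*-cm iρ ρ >> ic ρ+) >> zC n) >> *-1ʳ (iy ^ suc m)) >> refl)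
  ~ Kn)
  where
  l = r4 (v0 :* v1 :* v2 :* v3) (v0 :* (v3 :* v1 :* v2))
  lin : ι (suc n) ≤ iy * (1q + y) ^ n
  lin = EQ (sym (l' (ι (suc n)) y iy >> ap (ι (suc n) *_) (ic y+) >> *-1ʳ (ι (suc n)))) ~ za (ie y+) (EQ (ap (_* y) (su n) >> l'' (ι n) y) ~ +-≤ˡ (ι n * y) y1 ~ bo n (nh ze (qa y+)))
   where
   l' = r3 (v2 :* (v0 :* v1)) (v0 :* (v1 :* v2))
   l'' = r2 ((:1 :+ v0) :* v1) (v1 :+ v0 :* v1)
  grow : ι (suc n) ^ suc m ≤ iy ^ suc m * iρ ^ n
  grow = mc (suc m) (zd (suc n)) lin ~ EQ (zi iy ((1q + y) ^ n) (suc m)) ~ za (ng (suc m) (ie y+)) (EQ (sym (zp (1q + y) n (suc m)) >> ap ((1q + y) ^_) (*-cmℕ n (suc m)) >> zp (1q + y) (suc m) n) ~ mc n (ng (suc m) (nh ze (qa y+))) pw)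
  Kn : K ≤ ζ * ι (suc n)
  Kn = EQ (sym (l' K (ig ζ) ζ >> ap (K *_) (ic ζ+) >> *-1ʳ K)) ~ za (qa ζ+) (fst (snd C) ~ mn (≤⇒≤s le))
   where l' = r3 (v2 :* (v0 :* v1)) (v0 :* (v2 :* v1))

-- An upper bound for π, and the constant 1.595.

leibniz-step : ∀ i -> 1 <= i -> ℕtoℚ 4 * leibnizTerm i + ig (ι (suc i) + ι (suc i)) ≤ ig (ι i + ι i)
leibniz-step i@(suc i') _ = nj (df main ~ EQ (ap₂ (\ a b -> a - b) zz uv >> l u v z z'))
 where
 I = ι i
 Z = I + I
 Z' = ι (suc i) + ι (suc i)
 Z+ : 0q < Z
 Z+ = <-≤ (zj i') (ba (zd i) refl)
 Z'+ : 0q < Z'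
 Z'+ = <-≤ (zj i) (ba (zd (suc i)) refl)
 z = ig Z
 z' = ig Z'
 u v A B : ℚ
 u = (ℤ.+ 1) / (1 +' 2 *' (2 *' i))
 v = (ℤ.+ 1) / (3 +' 2 *' (2 *' i))
 A = ι (1 +' 2 *' (2 *' i))
 B = ι (3 +' 2 *' (2 *' i))
 uA : u * A ≡ 1q
 uA = trans (dv 1 (2 *' (2 *' i))) ι1
 vB : v * B ≡ 1q
 vB = trans (dv 1 (2 +' 2 *' (2 *' i))) ι1
 ι4 : ι (2 *' (2 *' i)) ≡ (4 // 1) * I
 ι4 = trans (zn 2 (2 *' i)) (ap₂ _*_ (li 2) (zn 2 i >> ap (_* I) (li 2)) >> l0 I)
  where l0 = r1 (:2 :* (:2 :* v0)) (:4 :* v0)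
 A≡ : A ≡ 1q + (4 // 1) * I
 A≡ = trans (zq 1 (2 *' (2 *' i))) (ap₂ _+_ ι1 ι4)
 B≡ : B ≡ (3 // 1) + (4 // 1) * I
 B≡ = trans (zq 3 (2 *' (2 *' i))) (ap₂ _+_ (li 3) ι4)
 Z'≡ : Z' ≡ Z + (2 // 1)
 Z'≡ = trans (ap (\ z -> z + z) (su i)) (l0 I)
  where l0 = r1 (:1 :+ v0 :+ (:1 :+ v0)) (v0 :+ v0 :+ :2)
 zz : (2 // 1) * (z * z') ≡ z - z'
 zz = trans (l1 z z' Z) (ap (\ y -> z * (z' * y) - z' * (Z * z)) (sym Z'≡) >> ap₂ (\ a b -> z * a - z' * b) (*-cm z' Z' >> ic Z'+) (ic Z+) >> l2 z z')
  where
  l1 = r3 (:2 :* (v0 :* v1)) (v0 :* (v1 :* (v2 :+ :2)) :- v1 :* (v2 :* v0))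
  l2 = r2 (v0 :* :1 :- v1 :* :1) (v0 :- v1)
 uv : (8 // 1) * (u * v) ≡ (4 // 1) * (u - v)
 uv = sym (l1 u v >> ap₂ (\ a b -> (4 // 1) * (u * a - v * b)) (sym vB) (sym uA) >> l2 u v A B >> ap₂ (\ a b -> (4 // 1) * (u * v * (b - a))) A≡ B≡ >> l3 (u * v) I)
  where
  l1 = r2 (:4 :* (v0 :- v1)) (:4 :* (v0 :* :1 :- v1 :* :1))
  l2 = r4 (:4 :* (v0 :* (v1 :* v3) :- v1 :* (v0 :* v2))) (:4 :* (v0 :* v1 :* (v3 :- v2)))
  l3 = r2 (:4 :* (v0 :* (:3 :+ :4 :* v1 :- (:1 :+ :4 :* v1)))) (:8 :* v0)
 l = r4 ((v2 :- v3) :- :4 :* (v0 :- v1)) (v2 :- (:4 :* (v0 :- v1) :+ v3))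
 main : (8 // 1) * (u * v) ≤ (2 // 1) * (z * z')
 main = ca {(8 // 1) * (u * v)} {(2 // 1) * (z * z')} {A * B} (pos-* (zj (2 *' (2 *' i))) (zj (2 +' 2 *' (2 *' i)))) (EQ (l1 u v A B >> ap₂ (\ a b -> (8 // 1) * (a * b)) uA vB >> refl >> sym (ap₂ (\ a b -> (8 // 1) * (a * b)) (ic Z+) (ic Z'+)))
  ~ ba (nc {6 // 1} by (nc (ie Z+) (ie Z'+))) (ap₂ (\ a b -> (2 // 1) * (z * z') * (a * b)) A≡ B≡ >> l2 z z' I >> ap (\ y -> (8 // 1) * ((Z * z) * (y * z')) + (6 // 1) * (z * z')) (sym Z'≡)))
  where
  l1 = r4 (:8 :* (v0 :* v1) :* (v2 :* v3)) (:8 :* (v0 :* v2 :* (v1 :* v3)))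
  l2 = r3 (:2 :* (v0 :* v1) :* ((:1 :+ :4 :* v2) :* (:3 :+ :4 :* v2))) (:8 :* ((v2 :+ v2) :* v0 :* ((v2 :+ v2 :+ :2) :* v1)) :+ (6 :/ 1) :* (v0 :* v1))

leibniz-suc : ∀ k -> leibnizLower (suc k) ≡ leibnizLower k + ℕtoℚ 4 * leibnizTerm k
leibniz-suc k = trans (ap (ℕtoℚ 4 *_) (sS leibnizTerm (upTo (suc k)) >> ap (S leibnizTerm) (sym (LP.upTo-∷ʳ k)) >> S-++ leibnizTerm (upTo k) (k ∷ []) >> ap₂ _+_ (sym (sS leibnizTerm (upTo k))) (+-0ʳ (leibnizTerm k)))) (ℚP.*-distribˡ-+ (ℕtoℚ 4) (sumℚ (map leibnizTerm (upTo k))) (leibnizTerm k))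

-- By `leibniz-step` the partial sum plus 1/(2k) decreases in k, so its value at k = 3, about
-- 3.1427, bounds all later partial sums.
lu : ∀ k -> leibnizLower k ≤ 31446 // 10000
lu 0 = by
lu 1 = by
lu 2 = by
lu (suc (suc (suc j))) = ba (ie (pos j)) refl ~ go j
 where
 pos : ∀ j -> 0q < ι (3 +' j) + ι (3 +' j)
 pos j = <-≤ (zj (2 +' j)) (ba (zd (3 +' j)) refl)
 go : ∀ j -> leibnizLower (3 +' j) + ig (ι (3 +' j) + ι (3 +' j)) ≤ 31446 // 10000
 go zero = +-≤ʳ (leibnizLower 3) (il {N = 1 // 6} (pos 0) (by {1q} {(1 // 6) * ((3 // 1) + (3 // 1))} ~ EQ (ap (\ z -> (1 // 6) * (z + z)) (sym (li 3))))) ~ by {leibnizLower 3 + (1 // 6)} {31446 // 10000}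
 go (suc j) = EQ (ap (_+ ig (ι (4 +' j) + ι (4 +' j))) (leibniz-suc (3 +' j)) >> +-as (leibnizLower (3 +' j)) (ℕtoℚ 4 * leibnizTerm (3 +' j)) (ig (ι (4 +' j) + ι (4 +' j)))) ~ +-≤ʳ (leibnizLower (3 +' j)) (leibniz-step (3 +' j) (ℕ.s≤s ℕ.z≤n)) ~ go j

-- 1.595² · 3.1446 is still below 8, so the coarse bound on π already gives q ≥ 1.595; this is the
-- only use made of the hypothesis that q exceeds 2√(2/π).
qb : ∀ q -> 0q < q -> ∃[ k ] (ℕtoℚ 8 < q * q * leibnizLower k) -> zf ≤ q
qb q q+ (k , h) = go (≤-tot zf q)
 where
 go : zf ≤ q ⊎ q ≤ zf -> zf ≤ q
 go (inj₁ p) = p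
 go (inj₂ p) = ⊥-elim (<⇒≱ h (za (sn q) (lu k) ~ zb {c = 31446 // 10000} by (ma (qa q+) (qa q+) p p) ~ by {zf * zf * (31446 // 10000)} {ℕtoℚ 8}))

p4 : ∀ {A : Set} (p : A -> Bool) xs {η} -> 1 <= length xs -> (1q - η) * ι (length xs) ≤ ι (countB p xs) -> 1q - η ≤ probability p xs
p4 p xs {η} h1 h2 with length xs
p4 p xs {η} () h2 | zero
p4 p xs {η} h1 h2 | suc t = ca {1q - η} {(ℤ.+ countB p xs) / suc t} {ι (suc t)} (zj t) (h2 ~ EQ (sym (dv (countB p xs) t)))

-- The degree threshold is `root`² = 10⁷². Opaque, so that comparisons involving it never unfold a
-- literal of this size.
opaque
 root th : ℕ
 root = 1000000000000000000000000000000000000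
 th = 10000
 ι-root : ι root ≡ 1000000000000000000000000000000000000 // 1
 ι-root = li 1000000000000000000000000000000000000
 tn : ι th ≡ 10000 // 1
 tn = li 10000

pow-upper : ∀ {z} k -> 0q ≤ z -> z ≤ 1q -> (1q + z) ^ k * (1q - ι k * z) ≤ 1q
pow-upper {z} k pz z1 = za (ng k (nh ze pz)) (EQ (l (ι k) z) ~ bo k (df z1)) ~ EQ (sym (zi (1q + z) (1q + - z) k)) ~ zy k (nc (nh ze pz) (df z1)) (ba (nc pz pz) (l2 z))
 where
 l = r2 (:1 :- v0 :* v1) (:1 :+ v0 :* (:- v1))
 l2 = r1 :1 ((:1 :+ v0) :* (:1 :+ :- v0) :+ v0 :* v0)

predecessor : ∀ k -> 1 <= k -> ∃[ k' ] (suc k' ≡ k)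
predecessor (suc k') _ = k' , refl

-- Choice of parameters and conclusion.

module Choices (d' : ℕ) (d-large : root *' root <= suc d') where
 d = suc d'
 D = ι d
 private
  fd = lr (\ j -> j *' j <= d) (\ j -> j *' j ℕ.≤? d) ℕ.z≤n (suc d) (\ h -> ℕP.<⇒≱ (≤r {suc d}) (≤≤ (ℕP.m≤m*n (suc d) (suc d)) h))
  j = fst fd
 R : ℕ
 R = suc j
 r = ι R
 Dr : D ≤ r * r
 Dr = mn (<≤ (ℕP.≰⇒> (fst (snd (snd fd))))) ~ EQ (zn R R)
 rD : (r - 1q) * (r - 1q) ≤ D
 rD = EQ (ap (\ z -> z * z) (ap (_- 1q) (su j) >> l (ι j)) >> sym (zn j j)) ~ mn (fst (snd fd))
  where l = r1 (:1 :+ v0 :- :1) v0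
 r-large : 1000000000000000000000000000000000000 // 1 ≤ r
 r-large = EQ (sym ι-root) ~ sr (zd R) (EQ (sym (zn root root)) ~ mn d-large ~ Dr)
 pr = zd R
 D+ : 0q < D
 D+ = zj d'
 pD = qa D+
 Da : 1q ≤ D
 Da = zx d'

 Nn : ℕ
 Nn = d *' (d *' d)
 N0D : ι Nn ≡ D * (D * D)
 N0D = trans (zn d (d *' d)) (ap (D *_) (zn d d))
 N0 = ι Nn
 N0+ : 0q < N0
 N0+ = subst (0q <_) (sym N0D) (pos-* D+ (pos-* D+ D+))
 1≤N0 : 1q ≤ N0
 1≤N0 = ma ze (nc ze ze) Da (ma ze ze Da Da) ~ EQ (sym N0D)
 ik = ig N0

 -- Chosen to make dη = 1/(2 `Nn`), which keeps the accumulated loss (1 + η)^d at most 1 + 1/`Nn`.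
 η : ℚ
 η = (1 // 2) * (ik * ig D)
 η+ : 0q < η
 η+ = pos-* (by< {0q} {1 // 2}) (pos-* (io N0+) (io D+))
 Dη : D * η ≡ (1 // 2) * ik
 Dη = trans (l D ik (ig D)) (ap ((1 // 2) * ik *_) (ic D+) >> *-1ʳ ((1 // 2) * ik))
  where l = r3 (v0 :* (:½ :* (v1 :* v2))) (:½ :* v1 :* (v0 :* v2))
 iN0≤1 : ik ≤ 1q
 iN0≤1 = il {N0} {1q} N0+ (1≤N0 ~ EQ (sym (*-1ˡ N0)))
 η1 : η ≤ 1q
 η1 = EQ (sym (*-1ˡ η)) ~ zb (qa η+) Da ~ EQ Dη ~ za {c = 1 // 2} by iN0≤1 ~ by {(1 // 2) * 1q} {1q}
 hη : (1q + η) ^ d ≤ 1q + ik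
 hη = ca {(1q + η) ^ d} {1q + ik} {1q - D * η} c+ (pow-upper d (qa η+) η1 ~ ba (nc (nc {1 // 2} by piN0) (df iN0≤1)) (ap (\ z -> (1q + ik) * (1q - z)) Dη >> l ik))
  where
  piN0 = ie N0+
  c+ : 0q < 1q - D * η
  c+ = <-≤ (by< {0q} {1q - (1 // 2) * 1q}) (+-≤ʳ 1q (nm (EQ Dη ~ za {c = 1 // 2} by iN0≤1)))
  l = r1 ((:1 :+ v0) :* (:1 :- :½ :* v0)) (:1 :+ :½ :* v0 :* (:1 :- v0))

 -- The coefficient of δ² in the grid condition `hδ`. With δ = η/W and δ ≤ 1 one gets W δ² ≤ W δ =
 -- η.
 W : ℚ
 W = (160 // 1) * (D * D * N0)
 W+ : 0q < W
 W+ = pos-* (by< {0q} {160 // 1}) (pos-* (pos-* D+ D+) N0+)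
 1≤W : 1q ≤ W
 1≤W = by {1q} {(160 // 1) * (1q * 1q * 1q)} ~ za {c = 160 // 1} by (ma (nc ze ze) ze (ma ze ze Da Da) 1≤N0)
 δ : ℚ
 δ = η * ig W
 zB : 0q < δ
 zB = pos-* η+ (io W+)
 δ≤1 : δ ≤ 1q
 δ≤1 = ma (qa η+) (ie W+) η1 (il {W} {1q} W+ (1≤W ~ EQ (sym (*-1ˡ W)))) ~ EQ (*-1ˡ 1q)
 hδ : (160 // 1) * (D * D * (δ * δ) * N0) ≤ η
 hδ = EQ (l D N0 δ) ~ za (nc (qa W+) (qa zB)) δ≤1 ~ EQ (*-1ʳ (W * δ) >> l2 W η (ig W) >> ap (η *_) (ic W+) >> *-1ʳ η)
  where
  l = r3 ((160 :/ 1) :* (v0 :* v0 :* (v2 :* v2) :* v1)) ((160 :/ 1) :* (v0 :* v0 :* v1) :* v2 :* v2)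
  l2 = r3 (v0 :* (v1 :* v2)) (v1 :* (v0 :* v2))
 private
  δ²+ : 0q < δ * δ
  δ²+ = pos-* zB zB
  cF = ceil (N0 * ig (δ * δ)) (nc (qa N0+) (ie δ²+))
 F : ℕ
 F = fst cF
 hF : N0 ≤ ι F * (δ * δ)
 hF = EQ (sym (l N0 (ig (δ * δ)) (δ * δ) >> ap (N0 *_) (ic δ²+) >> *-1ʳ N0)) ~ zb (qa δ²+) (fst (snd cF))
  where l = r3 (v0 :* v1 :* v2) (v0 :* (v2 :* v1))
 private
  Mk = predecessor (th *' (d *' d *' (d *' d))) (cf (EQ ι1 ~ by {1q} {(10000 // 1) * (1q * 1q * (1q * 1q))} ~ za {c = 10000 // 1} by (ma (nc ze ze) (nc ze ze) (ma ze ze Da Da) (ma ze ze Da Da)) ~ EQ (sym M≡)))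
   where
   M≡ : ι (th *' (d *' d *' (d *' d))) ≡ (10000 // 1) * (D * D * (D * D))
   M≡ = trans (zn th (d *' d *' (d *' d))) (ap₂ _*_ tn (zn (d *' d) (d *' d) >> ap₂ _*_ (zn d d) (zn d d)))
 M' : ℕ
 M' = fst Mk
 Me : ι (suc M') ≡ (10000 // 1) * (D * D * (D * D))
 Me = trans (ap ι (snd Mk)) (zn th (d *' d *' (d *' d)) >> ap₂ _*_ tn (zn (d *' d) (d *' d) >> ap₂ _*_ (zn d d) (zn d d)))

 Se : Setup
 Se = record { d' = d' ; R = R ; M' = M' ; F = F ; N0 = N0 ; η = η ; δ = δ ; zB = zB ; η1 = η1
  ; big' = large⁺ (by {1000000000000000000000000000000 // 1} {1000000000000000000000000000000000000 // 1} ~ r-large) ; Dr = Dr ; rD = rD ; Me' = fine⁺ Me ; hδ' = grid⁺ hδ ; hF = hF }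

 private
  fk = floor (r * (1 // 60000)) (nc pr (by {0q} {1 // 60000}))
  k = fst fk
 m : ℕ
 m = k *' 14
 ιm : ι m ≡ ι k * (14 // 1)
 ιm = trans (zn k 14) (ap (ι k *_) (li 14))
 hm : ι m * (4000 // 1) ≤ r
 hm = EQ (ap (_* (4000 // 1)) ιm >> l (ι k)) ~ za {c = 56000 // 1} by (fst (snd fk)) ~ EQ (l2 r) ~ zb pr (by {(56000 // 1) * (1 // 60000)} {1q}) ~ EQ (*-1ˡ r)
  where
  l = r1 (v0 :* (14 :/ 1) :* (4000 :/ 1)) ((56000 :/ 1) :* v0)
  l2 = r1 ((56000 :/ 1) :* (v0 :* (1 :/ 60000))) ((56000 :/ 1) :* (1 :/ 60000) :* v0)
 -- 2^(14k) ≥ (1+k)^14 ≥ (r/60000)^14 ≥ 256 r^12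
 h2m : (256 // 1) * (ι Nn * ι Nn) ≤ (2 // 1) ^ m
 h2m = za {c = 256 // 1} by (ma (zd Nn) (zd Nn) N0r N0r) ~ EQ (l r) ~ zb (ng 12 pr) (by {256 // 1} {(1 // 60000) ^ 14 * ((1000000000000000000000000000000000000 // 1) * (1000000000000000000000000000000000000 // 1))} ~ za {c = (1 // 60000) ^ 14} by (ma (by {0q} {1000000000000000000000000000000000000 // 1}) (by {0q} {1000000000000000000000000000000000000 // 1}) r-large r-large))
  ~ EQ (l2 ((1 // 60000) ^ 14) r (r ^ 12) >> sym (zi (1 // 60000) r 14)) ~ mc 14 (nc {1 // 60000} by pr) (EQ (*-cm (1 // 60000) r) ~ snd (snd fk) ~ EQ (l3 (ι k)) ~ bo k (by {0q} {1q + 1q})) ~ EQ (sym (zp (2 // 1) k 14))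
  where
  N0r : ι Nn ≤ r * r * (r * r * (r * r))
  N0r = EQ N0D ~ ma pD (nc pD pD) Dr (ma pD pD Dr Dr)
  l : ∀ r -> (256 // 1) * (r * r * (r * r * (r * r)) * (r * r * (r * r * (r * r)))) ≡ (256 // 1) * r ^ 12
  l r = l' r
   where l' = r1 ((256 :/ 1) :* (v0 :* v0 :* (v0 :* v0 :* (v0 :* v0)) :* (v0 :* v0 :* (v0 :* v0 :* (v0 :* v0))))) ((256 :/ 1) :* (v0 :* (v0 :* (v0 :* (v0 :* (v0 :* (v0 :* (v0 :* (v0 :* (v0 :* (v0 :* (v0 :* (v0 :* :1)))))))))))))
  l2 = r3 (v0 :* (v1 :* v1) :* v2) (v0 :* (v1 :* (v1 :* v2)))
  l3 = r1 (v0 :+ :1) (:1 :+ v0 :* :1)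

module Final (d' : ℕ) (d-large : root *' root <= suc d') (q : ℚ) (hq : zf ≤ q) (ε : ℚ) (ε+ : 0q < ε) where
 open Choices d' d-large
 ρ ζ Q : ℚ
 ρ = ig (1q + ig (ι Nn))
 -- Two directions with eight classes each use 16ζ = ε/2; the other half of ε covers the 4/n from
 -- very small sets.
 ζ = ε * (1 // 32)
 ζ+ : 0q < ζ
 ζ+ = pos-* ε+ (by< {0q} {1 // 32})
 -- All factors of `M0` that depend on neither n nor the number of matchings; what remains is the
 -- polynomial (n + 1)^(4d).
 Q = Lattice.g M' ^ (2 +' (d *' suc M' +' d *' suc M')) * ((ι (suc (suc F)) * ι (suc (suc F))) ^ d * (ι (suc (suc F)) * ι (suc (suc F))) ^ d)
 Q-nn : 0q ≤ Q
 Q-nn = nc (ng (2 +' (d *' suc M' +' d *' suc M')) (Lattice.pg M')) (nc (ng d k) (ng d k))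
  where k = nc (zd (suc (suc F))) (zd (suc (suc F)))
 private
  1N+ : 0q < 1q + ig (ι Nn)
  1N+ = <-≤ (>0 1q) (ba (ie N0+) refl)
  ρ<1 : ρ < 1q
  ρ<1 = ≰⇒> \ p -> <⇒≱ (subst (_< 1q + ig (ι Nn)) (+-0ʳ 1q) (ℚP.+-monoʳ-< 1q (io N0+))) (EQ (sym (*-1ʳ (1q + ig (ι Nn)))) ~ za (qa 1N+) p ~ EQ (ic 1N+))
  pd = poly-decay ρ Q (4 *' d) (ζ * ζ) (io 1N+) ρ<1 Q-nn (pos-* ζ+ ζ+)
  cε = ceil ((8 // 1) * ig ε) (nc {8 // 1} by (ie ε+))
 N : ℕ
 -- The three summands make the polynomial factor negligible, ensure n > d, and make 4/n at most
 -- ε/2.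
 N = fst pd +' (suc d +' fst cε)

 module _ (f : ℕ) (n≥N : N <= f +' f) where
  n = f +' f
  w : ℚ
  w = edgeWeight n d
  private
   nd : suc d <= n
   nd = ≤≤ (≤≤ (m≤m+n (suc d) (fst cε)) (m≤n+m (suc d +' fst cε) (fst pd))) n≥N
   n1 : ι (n ℕ.∸ 1) ≡ ι n - 1q
   n1 = trans (l (ι (n ℕ.∸ 1))) (ap (_- 1q) (sym (su (n ℕ.∸ 1)) >> ap ι (m+[n∸m] (≤≤ (ℕ.s≤s ℕ.z≤n) nd))))
    where l = r1 v0 (:1 :+ v0 :- :1)
   wD : w * D ≡ ι n - 1q
   wD = trans (dv (n ℕ.∸ 1) d') n1
   nD : D ≤ ι n - 1q
   nD = mn (≤-pred (≤≤ nd (≤≡ (sym (m+[n∸m] (≤≤ (ℕ.s≤s ℕ.z≤n) nd)))))) ~ EQ n1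
   tot = ι (length (perfectMatchings n))
   td = tot ^ d
   decay : Classes.M0 Se m hm Nn refl N0D h2m hη f w wD nD * ρ ^ n ≤ ζ * td * (ζ * td)
   decay = EQ (ap (\ z -> Lattice.g M' ^ (2 +' (d *' suc M' +' d *' suc M')) * (z * ((ι (suc (suc F)) * ι (suc (suc F))) ^ d * (ι (suc (suc F)) * ι (suc (suc F))) ^ d)) * (td * td) * ρ ^ n) (sym (zp (ι (suc n)) 4 d)) >> l (Lattice.g M' ^ (2 +' (d *' suc M' +' d *' suc M'))) (ι (suc n) ^ (4 *' d)) ((ι (suc (suc F)) * ι (suc (suc F))) ^ d * (ι (suc (suc F)) * ι (suc (suc F))) ^ d) (td * td) (ρ ^ n))
    ~ zb (sn td) (snd pd n (≤≤ (m≤m+n (fst pd) (suc d +' fst cε)) n≥N)) ~ EQ (l2 ζ td)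
    where
    l = r5 (v0 :* (v1 :* v2) :* v3 :* v4) (v0 :* v2 :* v1 :* v4 :* v3)
    l2 = r2 (v0 :* v0 :* (v1 :* v1)) (v0 :* v1 :* (v0 :* v1))
   union = Classes.Sum.union-bound Se m hm Nn refl N0D h2m hη f w wD nD ζ (qa ζ+) decay
   vd = Classes.vd Se m hm Nn refl N0D h2m hη f w wD nD
   Pr = Classes.Pr Se m hm Nn refl N0D h2m hη f w wD nD
   e = zf * ig r
   r+ : 0q < r
   r+ = <-≤ (by< {0q} {1000000000000000000000000000000000000 // 1}) r-large
   De² : D * (e * e) ≤ q * q
   De² = zb (sn e) Dr ~ EQ (l r zf (ig r) >> ap (\ z -> zf * zf * (z * z)) (ic r+) >> refl) ~ ma (by {0q} {zf}) (by {0q} {zf}) hq hq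
    where l = r3 (v0 :* v0 :* (v1 :* v2 :* (v1 :* v2))) (v1 :* v1 :* (v0 :* v2 :* (v0 :* v2)))
   b : Vec (Vec (Fin n) n) d -> Bool
   b = isSparsifierScaledB n d q
   Ms = vecsOver (perfectMatchings n) d
   fail : S (\ ms -> 𝟙 (not (b ms))) Ms ≤ td * ((2 // 1) * ig (ι n) + (8 // 1) * ζ) + td * ((2 // 1) * ig (ι n) + (8 // 1) * ζ)
   fail = Sm Ms (\ ms p -> Extremal.fu n d w e ms (Ae (perfectMatchings n) d ms p (\ m' x -> PM-IsPM n m' x)) q (nc {zf} by (ie r+)) refl De²)
    ~ EQ (S-+ (Fu true) (Fu false) Ms >> ap₂ _+_ (sw true) (sw false)) ~ mb (union true) (union false)
    where
    Fu : Bool -> Vec (Vec (Fin n) n) d -> ℚ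
    Fu up ms = S (\ Sb -> 𝟙 (vd Sb) * 𝟙 (Pr Sb up ms)) (allSubsets n)
    sw : ∀ up -> S (Fu up) Ms ≡ S (\ Sb -> 𝟙 (vd Sb) * Classes.bh Se m hm Nn refl N0D h2m hη f w wD nD Sb up) (allSubsets n)
    sw up = trans (Ss (\ ms Sb -> 𝟙 (vd Sb) * 𝟙 (Pr Sb up ms)) Ms (allSubsets n)) (Sc (allSubsets n) (\ Sb _ -> Sa (𝟙 (vd Sb)) (\ ms -> 𝟙 (Pr Sb up ms)) Ms))
   n+ : 0q < ι n
   n+ = <-≤ (zj d) (mn nd)
   4/n : (4 // 1) * ig (ι n) ≤ (1 // 2) * ε
   4/n = di {(1 // 2) * ε} {4 // 1} {ι n} n+ (nj {4 // 1} {(1 // 2) * ε * ι n} (nc {1 // 2} by (df 8≤) ~ EQ (l ε (ι n))))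
    where
    l = r2 (:½ :* (v0 :* v1 :- :8)) (:½ :* v0 :* v1 :- :4)
    l' = r3 (v0 :* (v1 :* v2)) (v1 :* (v0 :* v2))
    8≤ : 8 // 1 ≤ ε * ι n
    8≤ = EQ (sym (l' ε (8 // 1) (ig ε) >> ap ((8 // 1) *_) (ic ε+) >> *-1ʳ (8 // 1))) ~ za (qa ε+) (fst (snd cε) ~ mn (≤≤ (≤≤ (m≤n+m (fst cε) (suc d)) (m≤n+m (suc d +' fst cε) (fst pd))) n≥N))
   ptd : 0q ≤ td
   ptd = ng d (zd (length (perfectMatchings n)))
   L≡ : ι (length Ms) ≡ td
   L≡ = lh (perfectMatchings n) d
   fail≤ : S (\ ms -> 𝟙 (not (b ms))) Ms ≤ ε * ι (length Ms)
   fail≤ = fail ~ EQ (l td (ig (ι n)) ε) ~ zb ptd (+-≤ˡ ((1 // 2) * ε) 4/n ~ EQ (l2 ε)) ~ EQ (ap (ε *_) (sym L≡))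
    where
    l = r3 (v0 :* (:2 :* v1 :+ :8 :* (v2 :* (1 :/ 32))) :+ v0 :* (:2 :* v1 :+ :8 :* (v2 :* (1 :/ 32)))) ((:4 :* v1 :+ :½ :* v2) :* v0)
    l2 = r1 (:½ :* v0 :+ :½ :* v0) v0
   count : ι (countB b Ms) ≡ ι (length Ms) - S (\ ms -> 𝟙 (not (b ms))) Ms
   count = trans (cB b Ms) (l (S (\ ms -> 𝟙 (b ms)) Ms) (S (\ ms -> 𝟙 (not (b ms))) Ms) >> ap (_- S (\ ms -> 𝟙 (not (b ms))) Ms) (sym (S-+ (\ ms -> 𝟙 (b ms)) (\ ms -> 𝟙 (not (b ms))) Ms) >> Sc Ms (\ ms _ -> bn (b ms)) >> Sn 1q Ms >> *-1ʳ (ι (length Ms))))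
    where
    l = r2 v0 (v0 :+ v1 :- v1)
    bn : ∀ x -> 𝟙 x + 𝟙 (not x) ≡ 1q
    bn true = refl
    bn false = refl
   dd≥1 : ∀ f -> 1 <= dd f
   dd≥1 zero = ≤r
   dd≥1 (suc f) = ≤≤ (dd≥1 f) (m≤m+n (dd f) ((f +' f) *' dd f))
   len≥1 : 1 <= length Ms
   len≥1 = cf (EQ ι1 ~ zt d (EQ (sym ι1) ~ mn (dd≥1 f) ~ Pl f) ~ EQ (sym L≡))

  si : 1q - ε ≤ probability (isSparsifierScaledB n d q) (regSamples n d)
  si = p4 b Ms {ε} len≥1 (EQ (l ε (ι (length Ms))) ~ +-≤ʳ (ι (length Ms)) (nm fail≤) ~ EQ (sym count))
   where l = r2 ((:1 :- v0) :* v1) (v1 :- v0 :* v1)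

open import Data.Nat.Divisibility using (_∣_; divides)

mainTheorem1 : (q : ℚ) -> 0ℚ < q -> (∃[ k ] ℕtoℚ 8 < q * q * leibnizLower k) ->
 ∃[ D ] ((d : ℕ) -> .{{_ : ℕ.NonZero d}} -> D ℕ.≤ d ->
  (η : ℚ) -> 0ℚ < η ->
  ∃[ N ] ((n : ℕ) -> 2 ∣ n -> N ℕ.≤ n ->
   (1ℚ - η) ≤ probability (isSparsifierScaledB n d q) (regSamples n d)))
-- The degree bound is absolute: `qb` replaces q by 1.595, so only N depends on the remaining data.
-- Divisibility supplies n as f · 2, whereas the development works with f + f.
mainTheorem1 q q+ h = root *' root , \ { (suc d') large η η+ -> Final.N d' large q (qb q q+ h) η η+ , \ { n (divides f refl) n≥N -> even d' large η η+ f n≥N } }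
 where
 even : ∀ d' (large : root *' root <= suc d') η (η+ : 0q < η) f -> Final.N d' large q (qb q q+ h) η η+ <= f *' 2 -> 1q - η ≤ probability (isSparsifierScaledB (f *' 2) (suc d') q) (regSamples (f *' 2) (suc d'))
 even d' large η η+ f = subst (\ n -> Final.N d' large q (qb q q+ h) η η+ <= n -> 1q - η ≤ probability (isSparsifierScaledB n (suc d') q) (regSamples n (suc d'))) f+f (Final.si d' large q (qb q q+ h) η η+ f)
  where
  f+f : f +' f ≡ f *' 2
  f+f = trans (ap (f ℕ.+_) (sym (n+0 f))) (*-cmℕ 2 f)
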